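{- Let $S$ be a shifted Young tableau of normal shape with entries in $\overline{X}$. Then $S^E=S^J$.
   Context: Shifted shapes: for a strict partition $\lambda$, $S(\lambda)=\{(i,j):1\le i\le\ell(\lambda),\ i\le j\le\lambda_i+i-1\}$ (matrix coordinates), main diagonal $\{(i,i)\}$, $\lambda/\mu=S(\lambda)\setminus S(\mu)$; normal shape means $\mu=\emptyset$; $\lambda/\mu$ extends $\mu/\nu$ when $\nu\subseteq\mu\subseteq\lambda$. Alphabet $\overline{X}=\{\cdots<-1'<-1<0'<0<1'<1<\cdots\}$; bold $\mathbf{k}$ means $k$ or $k'$; $|x|$ removes the prime. A shifted Young tableau (SYT) is a filling of a skew shifted shape by $\overline X$, weakly increasing along rows and columns, each column with at most one unprimed $k$, each row with at most one $k'$. $S^{(a)}$ is the subfilling of boxes with entries $a,a'$; $\min(S)$ ($\max(S)$) is the smallest (largest) integer $a$ with $S^{(a)}\neq\emptyset$. The $*$-operation: for unprimed $a\in\overline X$, $a^*=-a'$ and $(a')^*=-a$, with $-(-\mathbf{a})=\mathbf{a}$. For an SYT $T$ of shape $\lambda/\mu$, $T^*$ is the SYT with box $(\lambda_1-j+1,\lambda_1-i+1)$ filled with $(T_{i,j})^*$ for each box $(i,j)$ of $T$. Shifted jeu de taquin: given an SYT and an empty inner corner $c$ (a box of the inner shape whose removal leaves a shifted shape), slide: let $x$, $y$ be the entries of the east and south neighbors of $c$ (if present). If only one exists, move it into $c$; if both exist, move $x$ into $c$ if $|x|<|y|$ or ($|x|=|y|$ and $x$ primed), otherwise move $y$; except for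 the diagonal rule: if $c=(i,i)$, $(i,i+1)$ contains $a'$ and $(i+1,i+1)$ contains $a$, the result is $a$ at $(i,i)$ and $a$ at $(i,i+1)$ with $(i+1,i+1)$ emptied; if they contain $a'$ and $a'$, the result is $a'$ at $(i,i)$ and $a$ at $(i,i+1)$ with $(i+1,i+1)$ emptied. Repeat with the vacated box until it has no east or south neighbor in the tableau, and remove it. Iterating slides until normal shape gives the rectification $\mathrm{Rect}(T)$ (independent of choices). $T^J:=\mathrm{Rect}(T^*)$. Switching: boxes are labelled $\mathbf{a}$-boxes or $\mathbf{b}$-boxes. At an $\mathbf{a}$-box $c=(i,j)$ with entry $\alpha$, $E=(i,j+1)$, $S=(i+1,j)$: (S3) $j=i$, $E$ a $\mathbf{b}$-box with entry $b'$, $(i+1,i+1)$ a $\mathbf{b}$-box with entry $\beta$: new entries $\beta$ at $(i,i)$, $b$ at $(i,i+1)$ ($\mathbf{b}$-boxes), $\alpha$ at $(i+1,i+1)$. (S4) $j=i+1$, $\alpha=a$, $(i,i)$ an $\mathbf{a}$-box with entry $\alpha_0$, $S=(i+1,i+1)$ a $\mathbf{b}$-box with entry $\beta$, $E$ not a $\mathbf{b}$-box: new entries $\beta$ at $(i,i)$, $a'$ at $(i,i+1)$, $\alpha_0$ at $(i+1,i+1)$. (S7) as (S4) but $E$ a $\mathbf{b}$-box with entry $b$ (unchanged). (S5) $E,S$ both $\mathbf{b}$-boxes, $E$ entry $b'$: interchange $c,E$. (S6) $E,S$ both $\mathbf{b}$-boxes, $E$ entry $b$, not (S7): interchange $c,S$.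 (S1) only $E$ a $\mathbf{b}$-box, not (S3): interchange $c,E$. (S2) only $S$ a $\mathbf{b}$-box, not (S4): interchange $c,S$. A filling is fully switched if no $\mathbf{a}$-box has a $\mathbf{b}$-box as east or south neighbor; otherwise $\Box(U)$ is the easternmost $\mathbf{a}$-box with entry $a$ having a $\mathbf{b}$-box as east or south neighbor, or if none, the southernmost such with entry $a'$, and $\sigma(U)$ applies the applicable switch there. The shifted switching process applies $\sigma$ until fully switched. For SYTs $(P,Q)$ with $Q$ extending $P$: label boxes; for the letters $i$ of $P$ from largest to smallest and, for each, the letters $j$ of $Q$ from smallest to largest, apply the shifted switching process in the current filling to (current $P$-boxes with entries $\mathbf{i}$, current $Q$-boxes with entries $\mathbf{j}$). Then $P_Q$ is the final filling of $P$-labelled boxes and ${}^PQ$ of $Q$-labelled boxes. Shifted generalized evacuation $S^E$ of an SYT $S$ of normal shape: set $S^E:=\emptyset$, $m:=\max(S)$. Repeat: let $a:=\min(S)$. If $S_{1,1}=a$, replace it by $-a'$ and all other entries of $S^{(a)}$ by $-a$; if $S_{1,1}=a'$, replace it by $-a$ and all other entries of $S^{(a)}$ by $-a$; call the result $S^{(a)}$ again. If $a=m$, set $S^E:=S^{(a)}\cup S^E$ and stop. Otherwise, with $R=S^{(a+1)}\cup\cdots\cup S^{(m)}$, set $S^E:=(S^{(a)})_R\cup S^E$ and $S:={}^{S^{(a)}}R$ and repeat. -}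

module Defs where

open import Data.Bool using (Bool; true; false; _∧_; _∨_; not; if_then_else_)
open import Data.Nat as ℕ using (ℕ; zero; suc; _+_; _∸_; _≡ᵇ_; _<ᵇ_)
open import Data.Integer as ℤ using (ℤ; -_; _≤ᵇ_)
open import Data.Integer.Properties as ℤP using ()
open import Data.Nat.ListAction using (sum)
open import Data.List using (List; []; _∷_; map; length; filterᵇ; mapMaybe; upTo; _++_)
open import Data.List.Relation.Unary.All using (All)
open import Data.List.Relation.Unary.Linked using (Linked)
open import Data.List.Relation.Unary.Unique.Propositional using (Unique)
open import Data.List.Membership.Propositional using (_∈_)
open import Data.Maybe using (Maybe; just; nothing)
open import Data.Product using (_×_; _,_; proj₁; proj₂; Σ)
open import Data.Sum using (_⊎_)
open import Relation.Nullary using (does; ¬_)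
open import Relation.Binary.PropositionalEquality using (_≡_)

-- The alphabet X̄ :  ⋯ < -1' < -1 < 0' < 0 < 1' < 1 < ⋯
--   u k  is the unprimed letter k,   p k  is the primed letter k'.

data Letter : Set where
  u : ℤ → Letter
  p : ℤ → Letter

val : Letter → ℤ
val (u k) = k
val (p k) = k

primed : Letter → Bool
primed (u _) = false
primed (p _) = true

rank : Letter → ℤ
rank (u k) = k ℤ.+ k
rank (p k) = (k ℤ.+ k) ℤ.- ℤ.1ℤ

_≤L_ : Letter → Letter → Set
x ≤L y = rank x ℤ.≤ rank y

star : Letter → Letter
star (u a) = p (- a)
star (p a) = u (- a)

_==ℤ_ : ℤ → ℤ → Bool
x ==ℤ y = does (x ℤP.≟ y)

_<ℤ_ : ℤ → ℤ → Bool
x <ℤ y = does (x ℤP.<? y)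

-- Boxes (i , j) in matrix coordinates, fillings as finite lists of
-- (box , content) pairs.

Box : Set
Box = ℕ × ℕ

Fill : Set → Set
Fill A = List (Box × A)

Cells : Set
Cells = Fill Letter

module _ {A : Set} where

  at : Fill A → ℕ → ℕ → Maybe A
  at [] i j = nothing
  at (((i' , j') , x) ∷ T) i j = if (i' ≡ᵇ i) ∧ (j' ≡ᵇ j) then just x else at T i j

  del : ℕ → ℕ → Fill A → Fill A
  del i j = filterᵇ (λ c → not ((proj₁ (proj₁ c) ≡ᵇ i) ∧ (proj₂ (proj₁ c) ≡ᵇ j)))

  put : ℕ → ℕ → A → Fill A → Fill A
  put i j x T = ((i , j) , x) ∷ del i j T

_≈F_ : Cells → Cells → Set
T ≈F U = ∀ i j → at T i j ≡ at U i j

-- λ_i  (1-indexed; 0 beyond the length)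
rowLen : List ℕ → ℕ → ℕ
rowLen [] _ = 0
rowLen (x ∷ xs) zero = 0
rowLen (x ∷ xs) (suc zero) = x
rowLen (x ∷ xs) (suc (suc k)) = rowLen xs (suc k)

StrictPartition : List ℕ → Set
StrictPartition λs = Linked ℕ._>_ λs × All (0 ℕ.<_) λs

InShape : List ℕ → ℕ → ℕ → Set
InShape λs i j = (1 ℕ.≤ i) × (0 ℕ.< rowLen λs i) × (i ℕ.≤ j) × (j ℕ.< rowLen λs i + i)

inShape : List ℕ → ℕ → ℕ → Bool
inShape λs i j = (0 <ᵇ i) ∧ (0 <ᵇ rowLen λs i) ∧ ((i <ᵇ j) ∨ (i ≡ᵇ j)) ∧ (j <ᵇ rowLen λs i + i)

record IsSYTNormal (λs : List ℕ) (S : Cells) : Set where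
  field
    strict    : StrictPartition λs
    distinct  : Unique (map proj₁ S)
    shape⇒    : ∀ i j → (i , j) ∈ map proj₁ S → InShape λs i j
    shape⇐    : ∀ i j → InShape λs i j → (i , j) ∈ map proj₁ S
    rowWeak   : ∀ {i j j' x y} → ((i , j) , x) ∈ S → ((i , j') , y) ∈ S → j ℕ.≤ j' → x ≤L y
    colWeak   : ∀ {i i' j x y} → ((i , j) , x) ∈ S → ((i' , j) , y) ∈ S → i ℕ.≤ i' → x ≤L y
    colUnpr   : ∀ {i i' j k} → ((i , j) , u k) ∈ S → ((i' , j) , u k) ∈ S → i ≡ i'
    rowPrim   : ∀ {i j j' k} → ((i , j) , p k) ∈ S → ((i , j') , p k) ∈ S → j ≡ j'

starCells : List ℕ → Cells → Cells
starCells λs T = map (λ c → ((suc n ∸ proj₂ (proj₁ c) , suc n ∸ proj₁ (proj₁ c)) , star (proj₂ c))) T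
  where n = rowLen λs 1

-- inner shape ν of T*: the image of S(δ_n) ∖ S(λ) under (i,j) ↦ (n-j+1,n-i+1);
-- row r of ν = #{ c : r ≤ c ≤ n , (n-c+1 , n-r+1) ∉ S(λ) }
starInner : List ℕ → List ℕ
starInner λs = filterᵇ (λ k → 0 <ᵇ k) (map row (map suc (upTo n)))
  where
  n = rowLen λs 1
  count : List Bool → ℕ
  count [] = 0
  count (true ∷ bs) = suc (count bs)
  count (false ∷ bs) = count bs
  row : ℕ → ℕ
  row r = count (map (λ c → not (inShape λs (suc n ∸ c) (suc n ∸ r))) (map (r +_) (upTo (suc n ∸ r))))

isPrimedM : Maybe Letter → Bool
isPrimedM (just (p _)) = true
isPrimedM _ = false

-- one slide into the empty box (i , j); the fuel argument is only a
-- termination device (a slide takes at most |T| steps)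
slide : ℕ → Cells → ℕ → ℕ → Cells
slide zero T i j = T
slide (suc f) T i j = step (at T i (suc j)) (at T (suc i) j)
  where
  moveE : Cells
  moveE = slide f (Data.Maybe.maybe (λ x → put i j x (del i (suc j) T)) T (at T i (suc j))) i (suc j)
  moveS : Cells
  moveS = slide f (Data.Maybe.maybe (λ y → put i j y (del (suc i) j T)) T (at T (suc i) j)) (suc i) j
  diag : Letter → Maybe Letter → Cells
  diag (p a) (just (u b)) =
    if a ==ℤ b then slide f (put i i (u a) (put i (suc i) (u a) (del (suc i) (suc i) T))) (suc i) (suc i)
    else moveE
  diag (p a) (just (p b)) =
    if a ==ℤ b then slide f (put i i (p a) (put i (suc i) (u a) (del (suc i) (suc i) T))) (suc i) (suc i)
    else moveE
  diag _ _ = moveE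
  step : Maybe Letter → Maybe Letter → Cells
  step nothing nothing = T
  step (just x) nothing = if i ≡ᵇ j then diag x (at T (suc i) (suc i)) else moveE
  step nothing (just y) = moveS
  step (just x) (just y) =
    if (val x <ℤ val y) ∨ ((val x ==ℤ val y) ∧ primed x) then moveE else moveS

lastCorner : List ℕ → Maybe (ℕ × ℕ × List ℕ)
lastCorner [] = nothing
lastCorner (m ∷ []) = just (1 , m , (if (m ∸ 1) ≡ᵇ 0 then [] else (m ∸ 1) ∷ []))
lastCorner (x ∷ y ∷ ys) =
  Data.Maybe.map (λ t → suc (proj₁ t) , suc (proj₁ (proj₂ t)) , x ∷ proj₂ (proj₂ t)) (lastCorner (y ∷ ys))

rect : List ℕ → Cells → Cells
rect μ T = go (sum μ) μ T
  where
  go : ℕ → List ℕ → Cells → Cells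
  go zero _ T = T
  go (suc f) μ T with lastCorner μ
  ... | nothing = T
  ... | just (i , j , μ') = go f μ' (slide (suc (length T)) T i j)

tableauJ : List ℕ → Cells → Cells
tableauJ λs T = rect (starInner λs) (starCells λs T)

data Lab : Set where
  Pl Ql : Lab

LFill : Set
LFill = Fill (Letter × Lab)

isP : Lab → Bool
isP Pl = true
isP Ql = false

isQ : Lab → Bool
isQ l = not (isP l)

aBox : ℤ → LFill → ℕ → ℕ → Bool
aBox a U i j with at U i j
... | just (x , l) = isP l ∧ (val x ==ℤ a)
... | nothing = false

bBox : ℤ → LFill → ℕ → ℕ → Bool
bBox b U i j with at U i j
... | just (x , l) = isQ l ∧ (val x ==ℤ b)
... | nothing = false

entryPrimed : LFill → ℕ → ℕ → Bool
entryPrimed U i j with at U i j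
... | just (x , _) = primed x
... | nothing = false

entryUnprimed : LFill → ℕ → ℕ → Bool
entryUnprimed U i j with at U i j
... | just (x , _) = not (primed x)
... | nothing = false

pickBest : (Box → Box → Bool) → List Box → Maybe Box
pickBest better [] = nothing
pickBest better (c ∷ cs) with pickBest better cs
... | nothing = just c
... | just d = if better c d then just c else just d

switchBox : ℤ → ℤ → LFill → Maybe Box
switchBox a b U with pickBest east (cands false) | pickBest south (cands true)
  where
  hasB : Box → Bool
  hasB (i , j) = bBox b U i (suc j) ∨ bBox b U (suc i) j
  cands : Bool → List Box
  cands pr = mapMaybe (λ c → if isP (proj₂ (proj₂ c)) ∧ (val (proj₁ (proj₂ c)) ==ℤ a)
                                  ∧ (primed (proj₁ (proj₂ c)) Data.Bool.xor not pr)
                                  ∧ hasB (proj₁ c)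
                              then just (proj₁ c) else nothing) U
  -- (primed x xor not pr) is true iff primed x = pr
  east : Box → Box → Bool
  east (i , j) (i' , j') = (j' <ᵇ j) ∨ ((j ≡ᵇ j') ∧ (i' <ᵇ i))
  south : Box → Box → Bool
  south (i , j) (i' , j') = (i' <ᵇ i) ∨ ((i ≡ᵇ i') ∧ (j' <ᵇ j))
... | just c | _ = just c
... | nothing | r = r

swapBoxes : LFill → Box → Box → LFill
swapBoxes U (i , j) (k , l) with at U i j | at U k l
... | just x | just y = put i j y (put k l x U)
... | _ | _ = U

setM : ℕ → ℕ → Maybe (Letter × Lab) → LFill → LFill
setM i j (just x) U = put i j x U
setM i j nothing U = del i j U

switchAt : ℤ → ℤ → LFill → ℕ → ℕ → LFill
switchAt a b U i j =
  if s3 then s3res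
  else if eB ∧ sB then (if s47 then s4res else if entryPrimed U i (suc j) then swapE else swapS)
  else if eB then swapE
  else if s47 then s4res
  else swapS
  where
  eB = bBox b U i (suc j)
  sB = bBox b U (suc i) j
  swapE = swapBoxes U (i , j) (i , suc j)
  swapS = swapBoxes U (i , j) (suc i , j)
  s3 = (i ≡ᵇ j) ∧ eB ∧ entryPrimed U i (suc i) ∧ bBox b U (suc i) (suc i)
  s3res = setM i i (at U (suc i) (suc i))
            (put i (suc i) (u b , Ql)
              (setM (suc i) (suc i) (at U i i) U))
  -- common condition of (S4) and (S7); in (S4) E is not a 𝐛-box, in (S7) E is a 𝐛-box with unprimed entry
  s47base = (j ≡ᵇ suc i) ∧ entryUnprimed U i j ∧ aBox a U i i ∧ sB
  s47 = s47base ∧ ((not eB) ∨ (eB ∧ entryUnprimed U i (suc j)))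
  s4res = setM i i (at U (suc i) (suc i))
            (put i (suc i) (p a , Pl)
              (setM (suc i) (suc i) (at U i i) U))

-- σ(U); nothing when U is fully switched
sigma : ℤ → ℤ → LFill → Maybe LFill
sigma a b U = Data.Maybe.map (λ c → switchAt a b U (proj₁ c) (proj₂ c)) (switchBox a b U)

data SwitchProc (a b : ℤ) : LFill → LFill → Set where
  fin  : ∀ {U} → sigma a b U ≡ nothing → SwitchProc a b U U
  step : ∀ {U U' V} → sigma a b U ≡ just U' → SwitchProc a b U' V → SwitchProc a b U V

data InnerLoop (i : ℤ) : List ℤ → LFill → LFill → Set where
  done : ∀ {U} → InnerLoop i [] U U
  next : ∀ {j js U U' V} → SwitchProc i j U U' → InnerLoop i js U' V → InnerLoop i (j ∷ js) U V

data OuterLoop (js : List ℤ) : List ℤ → LFill → LFill → Set where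
  done : ∀ {U} → OuterLoop js [] U U
  next : ∀ {i is U U' V} → InnerLoop i js U U' → OuterLoop js is U' V → OuterLoop js (i ∷ is) U V

insertℤ : ℤ → List ℤ → List ℤ
insertℤ x [] = x ∷ []
insertℤ x (y ∷ ys) = if x ==ℤ y then y ∷ ys else if x <ℤ y then x ∷ y ∷ ys else y ∷ insertℤ x ys

lettersAsc : Cells → List ℤ
lettersAsc [] = []
lettersAsc (c ∷ T) = insertℤ (val (proj₂ c)) (lettersAsc T)

reverseℤ : List ℤ → List ℤ
reverseℤ = Data.List.reverse

labelWith : Lab → Cells → LFill
labelWith l = map (λ c → proj₁ c , (proj₂ c , l))

extract : Lab → LFill → Cells
extract l = mapMaybe (λ c → if isP (proj₂ (proj₂ c)) Data.Bool.xor isP l then nothing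
                            else just (proj₁ c , proj₁ (proj₂ c)))

SwitchRes : Cells → Cells → Cells → Cells → Set
SwitchRes P Q P' Q' =
  Σ LFill λ V → OuterLoop (lettersAsc Q) (reverseℤ (lettersAsc P)) (labelWith Pl P ++ labelWith Ql Q) V
               × P' ≡ extract Pl V × Q' ≡ extract Ql V

minC : Cells → Maybe ℤ
minC [] = nothing
minC (c ∷ T) with minC T
... | nothing = just (val (proj₂ c))
... | just m = just (ℤ._⊓_ (val (proj₂ c)) m)

maxC : Cells → Maybe ℤ
maxC [] = nothing
maxC (c ∷ T) with maxC T
... | nothing = just (val (proj₂ c))
... | just m = just (ℤ._⊔_ (val (proj₂ c)) m)

Corner11 : Cells → ℤ → Set
Corner11 S a = (at S 1 1 ≡ just (u a)) ⊎ (at S 1 1 ≡ just (p a))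

part : ℤ → Cells → Cells
part a = filterᵇ (λ c → val (proj₂ c) ==ℤ a)

negPart : ℤ → Cells → Cells
negPart a S = map f (part a S)
  where
  f : Box × Letter → Box × Letter
  f ((i , j) , x) = (i , j) , (if (i ≡ᵇ 1) ∧ (j ≡ᵇ 1) then star x else u (- a))

upperPart : ℤ → ℤ → Cells → Cells
upperPart a m = filterᵇ (λ c → ((a ℤ.+ ℤ.1ℤ) ≤ᵇ val (proj₂ c)) ∧ (val (proj₂ c) ≤ᵇ m))

data EvacLoop (m : ℤ) : Cells → Cells → Cells → Set where
  stop : ∀ {S acc a} → minC S ≡ just a → Corner11 S a → a ≡ m
       → EvacLoop m S acc (negPart a S ++ acc)
  step : ∀ {S acc a P' Q' res} → minC S ≡ just a → Corner11 S a → ¬ (a ≡ m)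
       → SwitchRes (negPart a S) (upperPart a m S) P' Q'
       → EvacLoop m Q' (P' ++ acc) res
       → EvacLoop m S acc res

data Evac : Cells → Cells → Set where
  evac-empty : Evac [] []
  evac-run   : ∀ {S E m} → maxC S ≡ just m → EvacLoop m S [] E → Evac S E

module Submission where

-- Record a tableau by the diagonals j − i of its boxes in the order of its
-- standardization.  Such a word determines the positions of the boxes, because
-- boxes can be counted on each diagonal, and together with the absolute values
-- and one bit for each value it determines all primes as well.  A slide moves
-- its empty box through the word by a local rule (passW, passV), including the
-- exceptional rule on the main diagonal, and the shifted switching process acts
-- on words by the same rule.  Consequently S^E has the word ev w when S has the
-- word w, and S^J has the word swT b (reverse w), where b fills the inner shape
-- of S*.  Now b followed by reverse w fills a staircase, and for staircases
-- evacuation reverses the word: this is computed for the filling by columns and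
-- carried to all others by Haiman's elementary dual equivalences.  Since ev is
-- an involution compatible with concatenation, swT b (reverse w) ≡ ev w.

open import Defs renaming (u to un; p to pr; fin to finish; step to advance; done to finished; next to andThen)
open import Data.Bool using (Bool; true; false; if_then_else_; _∧_; _∨_; not; T; _xor_)
open import Data.Bool.Properties using (∨-comm; ∨-zeroʳ; if-float; ∧-zeroʳ)
open import Data.Empty using (⊥; ⊥-elim)
open import Data.Integer as ℤ using (ℤ; -[1+_]; -<+; +<+; -<-)
open import Data.List using (List; []; _∷_; _++_; [_]; length; map; reverse; _∷ʳ_; initLast; _∷ʳ′_; downFrom; mapMaybe; filterᵇ; reverseAcc; upTo; applyUpTo)
open import Data.List.Membership.Propositional using (_∈_; _∉_)
open import Data.List.Properties using (++-assoc; ++-identityʳ; length-++; reverse-++; unfold-reverse; ∷-injective; length-reverse; reverse-involutive; map-++; length-map; map-applyUpTo; map-cong; reverse-map)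
open import Data.List.Relation.Binary.Permutation.Propositional using (↭-sym; ↭⇒↭ₛ)
open import Data.List.Relation.Binary.Permutation.Propositional.Properties using (∈-resp-↭; map⁺)
open import Data.List.Relation.Unary.All as All using (All; []; _∷_)
open import Data.List.Relation.Unary.AllPairs as AllPairs using (AllPairs; []; _∷_)
open import Data.List.Relation.Unary.Any using (here; there)
open import Data.List.Relation.Unary.Linked using (Linked; []; [-]; _∷_)
open import Data.List.Relation.Unary.Linked.Properties using (Linked⇒AllPairs)
open import Data.List.Relation.Unary.Unique.Propositional using (Unique)
open import Data.Maybe as Maybe using (Maybe; just; nothing; _<∣>_; _>>=_)
open import Data.Maybe.Properties using (just-injective)
open import Data.Nat using (ℕ; zero; suc; _+_; _∸_; _≤_; _<_; z≤n; s≤s; _≡ᵇ_; _<ᵇ_)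
open import Data.Nat.ListAction using (sum)
open import Data.Product using (_×_; _,_; proj₁; proj₂; Σ; ∃)
open import Data.Product.Relation.Binary.Lex.NonStrict using (×-decTotalOrder)
open import Data.Sum using (_⊎_; inj₁; inj₂)
open import Data.Unit using (⊤; tt)
open import Function using (_∘_; id)
open import Level using (0ℓ)
open import Relation.Binary using (tri<; tri≈; tri>)
open import Relation.Binary.Bundles using (DecTotalOrder)
open import Relation.Nullary using (¬_; yes; no; contradiction; does; Dec)
open import Relation.Nullary.Decidable using (dec-true; dec-false)
open import Data.Nat.Properties
open import Relation.Binary.PropositionalEquality hiding ([_])
open import Data.List.Membership.DecPropositional _≟_ using (_∈?_)
import Data.Integer.Properties as ℤP
import Data.List.Relation.Unary.AllPairs.Properties as AllPairsP
import Data.List.Relation.Unary.All.Properties as AllP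
import Data.List.Membership.Propositional.Properties as MP
import Data.List.Relation.Unary.Any.Properties as AnyP
import Relation.Binary.Construct.On as On
import Data.List.Relation.Binary.Permutation.Setoid.Properties as PermP
import Data.List.Sort as Sort

-- Why words suffice: evacuation and rectification both negate and reverse the values and flip the
-- bit of every value, and a word is determined by diagonals, values and bits (`coh-unique`). So the
-- theorem becomes an identity between lists of diagonals in which no letter occurs. The difficulty
-- of that identity is that the two sides start from different shapes, and an explicit evacuation is
-- known only for one particular filling of a staircase. To leave that filling one needs that
-- evacuation respects dual equivalences. A crossing only asks whether two diagonals are adjacent,
-- and a dual equivalence only compares diagonals; hence commuting a quadruple with a fifth letter
-- depends on five numbers up to shrinking their gaps, and it can be settled by a finite
-- computation. The difficulty on the side of tableaux is that a switching step chooses its box by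
-- position in the filling, not by the order of the word. Invariants of the running switch show that
-- both choices agree, and that (S4), which moves two boxes of the same letter at once, has the
-- effect of ordinary crossings on the list of diagonals.

adj : ℕ → ℕ → Bool
adj x y = (suc x ≡ᵇ y) ∨ (suc y ≡ᵇ x)

≡ᵇ-true : ∀ {m n} → (m ≡ᵇ n) ≡ true → m ≡ n
≡ᵇ-true {m} {n} e = ≡ᵇ⇒≡ m n (subst T (sym e) tt)

≡ᵇ-refl : ∀ n → (n ≡ᵇ n) ≡ true
≡ᵇ-refl zero = refl
≡ᵇ-refl (suc n) = ≡ᵇ-refl n

≡ᵇ-false : ∀ {m n} → m ≢ n → (m ≡ᵇ n) ≡ false
≡ᵇ-false {m} {n} ne with m ≡ᵇ n in e
... | true = contradiction (≡ᵇ-true e) ne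
... | false = refl

≡ᵇ-false⁻ : ∀ {m n} → (m ≡ᵇ n) ≡ false → m ≢ n
≡ᵇ-false⁻ {m} e refl with trans (sym e) (≡ᵇ-refl m)
... | ()

<ᵇ-true : ∀ {m n} → (m <ᵇ n) ≡ true → m < n
<ᵇ-true {m} {n} e = <ᵇ⇒< m n (subst T (sym e) tt)

<⇒<ᵇ-true : ∀ {m n} → m < n → (m <ᵇ n) ≡ true
<⇒<ᵇ-true {m} {n} lt with m <ᵇ n in e
... | true = refl
... | false = ⊥-elim (subst T e (<⇒<ᵇ lt))

≤⇒<ᵇ-false : ∀ {m n} → n ≤ m → (m <ᵇ n) ≡ false
≤⇒<ᵇ-false {m} {n} le with m <ᵇ n in e
... | false = refl
... | true = contradiction (<ᵇ-true e) (≤⇒≯ le)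

adj-sym : ∀ x y → adj x y ≡ adj y x
adj-sym x y = ∨-comm (suc x ≡ᵇ y) (suc y ≡ᵇ x)

data Adj : ℕ → ℕ → Set where
  up   : ∀ {k} → Adj k (suc k)
  down : ∀ {k} → Adj (suc k) k

adj-true : ∀ {x y} → adj x y ≡ true → Adj x y
adj-true {x} {y} e with suc x ≡ᵇ y in e₁
... | true with ≡ᵇ-true {suc x} {y} e₁
...   | refl = up
adj-true {x} {y} e | false with ≡ᵇ-true {suc y} {x} e
...   | refl = down

adj-up : ∀ k → adj k (suc k) ≡ true
adj-up k rewrite ≡ᵇ-refl k = refl

adj-down : ∀ k → adj (suc k) k ≡ true
adj-down k = trans (adj-sym (suc k) k) (adj-up k)

adj-far : ∀ {x y} → ¬ Adj x y → adj x y ≡ false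
adj-far {x} {y} n with adj x y in e
... | true = contradiction (adj-true e) n
... | false = refl

far-up : ∀ x y → adj x y ≡ false → y ≢ suc x
far-up x y e refl with trans (sym e) (adj-up x)
... | ()

far-down : ∀ x y → adj x y ≡ false → x ≢ suc y
far-down x y e refl with trans (sym e) (adj-down y)
... | ()

far-< : ∀ {x y} → suc x < y → adj x y ≡ false
far-< {x} {y} lt = adj-far {x} {y} λ { up → n≮n _ lt ; down → n≮n _ (<-trans lt (m<n⇒m<1+n ≤-refl)) }

-- Words of diagonals and the counts they produce.

-- A word lists the diagonals j − i of the boxes added one after the other;
-- a state counts the boxes present on each diagonal.

State : Set
State = ℕ → ℕ

West : State → ℕ → Set
West m zero = ⊤
West m (suc k) = m k ≡ suc (m (suc k))

-- The first equation says that the northern neighbour of the new box is present (unless the box is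
-- in the top row) and the eastern one absent; `West` says the same of the western and the southern
-- neighbour, and asks nothing on the main diagonal. So boxes are added exactly at the outer corners
-- of a shifted shape.
Step : State → ℕ → Set
Step m k = (m k ≡ m (suc k)) × West m k

bump : ℕ → State → State
bump k m l = if k ≡ᵇ l then suc (m l) else m l

Legal : State → List ℕ → Set
Legal m [] = ⊤
Legal m (k ∷ w) = Step m k × Legal (bump k m) w

adv : State → List ℕ → State
adv m [] = m
adv m (k ∷ w) = adv (bump k m) w

bump-same : ∀ k m → bump k m k ≡ suc (m k)
bump-same k m rewrite ≡ᵇ-refl k = refl

bump-diff : ∀ k l m → k ≢ l → bump k m l ≡ m l
bump-diff k l m ne rewrite ≡ᵇ-false ne = refl

bump-cong : ∀ k {m m' : State} → m ≗ m' → bump k m ≗ bump k m'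
bump-cong k e l with k ≡ᵇ l
... | true = cong suc (e l)
... | false = e l

bump-comm : ∀ x y m → bump x (bump y m) ≗ bump y (bump x m)
bump-comm x y m l with x ≡ᵇ l | y ≡ᵇ l
... | true | true = refl
... | true | false = refl
... | false | true = refl
... | false | false = refl

West-cong : ∀ {m m' : State} → m ≗ m' → ∀ k → West m k → West m' k
West-cong e zero _ = tt
West-cong e (suc k) w = trans (sym (e k)) (trans w (cong suc (e (suc k))))

Step-cong : ∀ {m m' : State} → m ≗ m' → ∀ k → Step m k → Step m' k
Step-cong e k (n , w) = trans (sym (e k)) (trans n (e (suc k))) , West-cong e k w

Legal-cong : ∀ {m m' : State} → m ≗ m' → ∀ w → Legal m w → Legal m' w
Legal-cong e [] _ = tt
Legal-cong e (k ∷ w) (s , l) = Step-cong e k s , Legal-cong (bump-cong k e) w l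

adv-cong : ∀ {m m' : State} → m ≗ m' → ∀ w → adv m w ≗ adv m' w
adv-cong e [] = e
adv-cong e (k ∷ w) = adv-cong (bump-cong k e) w

adv-++ : ∀ m w w' → adv m (w ++ w') ≡ adv (adv m w) w'
adv-++ m [] w' = refl
adv-++ m (k ∷ w) w' = adv-++ (bump k m) w w'

Legal-++ : ∀ m w {w'} → Legal m (w ++ w') → Legal m w × Legal (adv m w) w'
Legal-++ m [] l = tt , l
Legal-++ m (k ∷ w) (s , l) with Legal-++ (bump k m) w l
... | a , b = (s , a) , b

++-Legal : ∀ m w {w'} → Legal m w → Legal (adv m w) w' → Legal m (w ++ w')
++-Legal m [] _ l = l
++-Legal m (k ∷ w) (s , a) b = s , ++-Legal (bump k m) w a b

no-repeat : ∀ {m x w} → ¬ Legal m (x ∷ x ∷ w)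
no-repeat {m} {x} ((n , _) , (n' , _) , _) =
  1+n≢n (trans (sym (bump-same x m)) (trans n' (trans (bump-diff x (suc x) m (1+n≢n ∘ sym)) (sym n))))

-- Whether diagonal `y` can receive a box depends only on the counts of `y` and of its two
-- neighbours, and these are untouched by an addition elsewhere.
Step-bump⁻ : ∀ {m} x y → x ≢ y → adj x y ≡ false → Step (bump x m) y → Step m y
Step-bump⁻ {m} x zero ne f (n , w) =
  trans (sym (bump-diff x 0 m ne)) (trans n (bump-diff x 1 m (far-down x 0 f))) , tt
Step-bump⁻ {m} x (suc y) ne f (n , w) =
  trans (sym (bump-diff x (suc y) m ne)) (trans n (bump-diff x _ m (far-down x (suc y) f))) ,
  trans (sym (bump-diff x y m (λ e → far-up x (suc y) f (cong suc (sym e)))))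
    (trans w (cong suc (bump-diff x (suc y) m ne)))

Step-bump : ∀ {m} x y → x ≢ y → adj x y ≡ false → Step m y → Step (bump x m) y
Step-bump {m} x zero ne f (n , w) =
  trans (bump-diff x 0 m ne) (trans n (sym (bump-diff x 1 m (far-down x 0 f)))) , tt
Step-bump {m} x (suc y) ne f (n , w) =
  trans (bump-diff x (suc y) m ne) (trans n (sym (bump-diff x _ m (far-down x (suc y) f)))) ,
  trans (bump-diff x y m (λ e → far-up x (suc y) f (cong suc (sym e))))
    (trans w (cong suc (sym (bump-diff x (suc y) m ne))))

legal-≢ : ∀ {m x y w} → Legal m (x ∷ y ∷ w) → x ≢ y
legal-≢ {m} {x} {w = w} l refl = no-repeat {m} {x} {w} l

Legal-swap : ∀ {m x y w} → adj x y ≡ false → Legal m (x ∷ y ∷ w) → Legal m (y ∷ x ∷ w)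
Legal-swap {m} {x} {y} {w} f l@(sx , sy , lw) =
  Step-bump⁻ x y ne f sy ,
  Step-bump y x (ne ∘ sym) (trans (adj-sym y x) f) sx ,
  Legal-cong (bump-comm y x m) w lw
  where ne = legal-≢ {m} {x} {y} {w} l

-- Commutation of additions on non-adjacent diagonals.

infix 4 _~_
data _~_ : List ℕ → List ℕ → Set where
  ~refl  : ∀ {w} → w ~ w
  ~trans : ∀ {u v w} → u ~ v → v ~ w → u ~ w
  ~cons  : ∀ x {v w} → v ~ w → x ∷ v ~ x ∷ w
  ~swap  : ∀ {x y w} → adj x y ≡ false → x ∷ y ∷ w ~ y ∷ x ∷ w

~sym : ∀ {v w} → v ~ w → w ~ v
~sym ~refl = ~refl
~sym (~trans p q) = ~trans (~sym q) (~sym p)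
~sym (~cons x p) = ~cons x (~sym p)
~sym (~swap {x} {y} f) = ~swap (trans (adj-sym y x) f)

~++ˡ : ∀ u {v w} → v ~ w → u ++ v ~ u ++ w
~++ˡ [] p = p
~++ˡ (x ∷ u) p = ~cons x (~++ˡ u p)

~++ʳ : ∀ u {v w} → v ~ w → v ++ u ~ w ++ u
~++ʳ u ~refl = ~refl
~++ʳ u (~trans p q) = ~trans (~++ʳ u p) (~++ʳ u q)
~++ʳ u (~cons x p) = ~cons x (~++ʳ u p)
~++ʳ u (~swap f) = ~swap f

~-Legal : ∀ {v w} → v ~ w → ∀ {m} → Legal m v → Legal m w
~-Legal ~refl l = l
~-Legal (~trans p q) l = ~-Legal q (~-Legal p l)
~-Legal (~cons x p) (s , l) = s , ~-Legal p l
~-Legal (~swap {x} {y} {w} f) {m} l = Legal-swap {m} {x} {y} {w} f l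

~-adv : ∀ {v w} → v ~ w → ∀ m → adv m v ≗ adv m w
~-adv ~refl m l = refl
~-adv (~trans p q) m l = trans (~-adv p m l) (~-adv q m l)
~-adv (~cons x p) m = ~-adv p (bump x m)
~-adv (~swap {x} {y} {w} f) m = adv-cong (bump-comm y x m) w

-- Slides, switching and evacuation of words.

-- A slide meets the entry on diagonal k while its empty box is on diagonal v:
-- if the two boxes are adjacent the entry moves into the empty box, otherwise
-- the two additions commute.  cl is the diagonal of the entry afterwards, cr
-- that of the empty box.

cl cr : ℕ → ℕ → ℕ
cl v k = if adj v k then v else k
cr v k = if adj v k then k else v

cl-inv : ∀ v k → cl (cl v k) (cr v k) ≡ v
cl-inv v k with adj v k in e
... | true rewrite e = refl
... | false rewrite trans (adj-sym k v) e = refl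

cr-inv : ∀ v k → cr (cl v k) (cr v k) ≡ k
cr-inv v k with adj v k in e
... | true rewrite e = refl
... | false rewrite trans (adj-sym k v) e = refl

passW : ℕ → List ℕ → List ℕ
passW v [] = []
passW v (k ∷ w) = cl v k ∷ passW (cr v k) w

passV : ℕ → List ℕ → ℕ
passV v [] = v
passV v (k ∷ w) = passV (cr v k) w

-- The slide run backwards: `h` starts behind `E` and travels to its front. `insH-pass` and
-- `insT-pass` show that this undoes `passV` and `passW`.
insH : ℕ → List ℕ → ℕ
insH h [] = h
insH h (e ∷ E) = cl e (insH h E)

insT : ℕ → List ℕ → List ℕ
insT h [] = []
insT h (e ∷ E) = cr e (insH h E) ∷ insT h E

-- Tableau switching, with the letters of `t` travelling in turn to the front of `X`. By `swT-∷` the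
-- same words arise when the letters of `X`, the last one first, are slid through `t`; the first
-- view fits concatenation on the right, the second one rectification.
swT swX : List ℕ → List ℕ → List ℕ
swT X [] = []
swT X (h ∷ t) = insH h X ∷ swT (insT h X) t
swX X [] = X
swX X (h ∷ t) = swX (insT h X) t

-- Evacuation grown from the left: every new letter travels to the front of what has been evacuated
-- so far. The customary form, which removes the first box and slides, is recovered in `ev-∷`.
evs : List ℕ → List ℕ → List ℕ
evs X [] = X
evs X (h ∷ t) = evs (insH h X ∷ insT h X) t

ev : List ℕ → List ℕ
ev = evs []

cross-~ : ∀ v k w → v ∷ k ∷ w ~ cl v k ∷ cr v k ∷ w
cross-~ v k w with adj v k in e
... | true = ~refl
... | false = ~swap e

pass-~ : ∀ v w u → v ∷ w ++ u ~ passW v w ++ passV v w ∷ u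
pass-~ v [] u = ~refl
pass-~ v (k ∷ w) u = ~trans (cross-~ v k _) (~cons _ (pass-~ (cr v k) w u))

ins-~ : ∀ h E u → E ++ h ∷ u ~ insH h E ∷ insT h E ++ u
ins-~ h [] u = ~refl
ins-~ h (e ∷ E) u = ~trans (~cons e (ins-~ h E u)) (cross-~ e (insH h E) _)

sw-~ : ∀ X t → X ++ t ~ swT X t ++ swX X t
sw-~ X [] rewrite ++-identityʳ X = ~refl
sw-~ X (h ∷ t) = ~trans (ins-~ h X t) (~cons _ (sw-~ (insT h X) t))

evs-~ : ∀ X t → X ++ t ~ evs X t
evs-~ X [] rewrite ++-identityʳ X = ~refl
evs-~ X (h ∷ t) = ~trans (ins-~ h X t) (evs-~ (insH h X ∷ insT h X) t)

ev-~ : ∀ w → w ~ ev w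
ev-~ = evs-~ []

length-passW : ∀ v w → length (passW v w) ≡ length w
length-passW v [] = refl
length-passW v (k ∷ w) = cong suc (length-passW (cr v k) w)

length-insT : ∀ h E → length (insT h E) ≡ length E
length-insT h [] = refl
length-insT h (e ∷ E) = cong suc (length-insT h E)

length-evs : ∀ X t → length (evs X t) ≡ length X + length t
length-evs X [] = sym (+-identityʳ _)
length-evs X (h ∷ t) = trans (length-evs _ t)
  (trans (cong (λ n → suc n + length t) (length-insT h X)) (sym (+-suc _ _)))

swT-∷ : ∀ v X t → swT (v ∷ X) t ≡ passW v (swT X t)
swT-∷ v X [] = refl
swT-∷ v X (h ∷ t) = cong (_ ∷_) (swT-∷ (cr v (insH h X)) (insT h X) t)

swX-∷ : ∀ v X t → swX (v ∷ X) t ≡ passV v (swT X t) ∷ swX X t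
swX-∷ v X [] = refl
swX-∷ v X (h ∷ t) = swX-∷ (cr v (insH h X)) (insT h X) t

swT-[] : ∀ t → swT [] t ≡ t
swT-[] [] = refl
swT-[] (h ∷ t) = cong (h ∷_) (swT-[] t)

swX-[] : ∀ t → swX [] t ≡ []
swX-[] [] = refl
swX-[] (h ∷ t) = swX-[] t

swT-++ : ∀ X Y t → swT (X ++ Y) t ≡ swT X (swT Y t)
swT-++ [] Y t = sym (swT-[] _)
swT-++ (v ∷ X) Y t = trans (swT-∷ v (X ++ Y) t)
  (trans (cong (passW v) (swT-++ X Y t)) (sym (swT-∷ v X (swT Y t))))

swX-++ : ∀ X Y t → swX (X ++ Y) t ≡ swX X (swT Y t) ++ swX Y t
swX-++ [] Y t = cong (_++ swX Y t) (sym (swX-[] (swT Y t)))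
swX-++ (v ∷ X) Y t = trans (swX-∷ v (X ++ Y) t)
  (trans (cong₂ (λ a b → passV v a ∷ b) (swT-++ X Y t) (swX-++ X Y t))
    (cong (_++ swX Y t) (sym (swX-∷ v X (swT Y t)))))

swT-++ʳ : ∀ X s t → swT X (s ++ t) ≡ swT X s ++ swT (swX X s) t
swT-++ʳ X [] t = refl
swT-++ʳ X (h ∷ s) t = cong (_ ∷_) (swT-++ʳ (insT h X) s t)

swX-++ʳ : ∀ X s t → swX X (s ++ t) ≡ swX (swX X s) t
swX-++ʳ X [] t = refl
swX-++ʳ X (h ∷ s) t = swX-++ʳ (insT h X) s t

insH-++ : ∀ h Y X → insH h (Y ++ X) ≡ insH (insH h X) Y
insH-++ h [] X = refl
insH-++ h (y ∷ Y) X = cong (cl y) (insH-++ h Y X)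

insT-++ : ∀ h Y X → insT h (Y ++ X) ≡ insT (insH h X) Y ++ insT h X
insT-++ h [] X = refl
insT-++ h (y ∷ Y) X = cong₂ (λ a b → cr y a ∷ b) (insH-++ h Y X) (insT-++ h Y X)

evs-++ˡ : ∀ Y X t → evs (Y ++ X) t ≡ evs Y (swT X t) ++ swX X t
evs-++ˡ Y X [] = refl
evs-++ˡ Y X (h ∷ t) = trans
  (cong₂ (λ a b → evs (a ∷ b) t) (insH-++ h Y X) (insT-++ h Y X))
  (evs-++ˡ (insH (insH h X) Y ∷ insT (insH h X) Y) (insT h X) t)

evs-++ʳ : ∀ X s t → evs X (s ++ t) ≡ evs (evs X s) t
evs-++ʳ X [] t = refl
evs-++ʳ X (h ∷ s) t = evs-++ʳ _ s t

-- This is one round of the generalized evacuation: the evacuated first block `ev w` is switched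
-- with the rest `t`, its image goes to the end, and the process continues with the rectified rest.
ev-++ : ∀ w t → ev (w ++ t) ≡ ev (swT (ev w) t) ++ swX (ev w) t
ev-++ w t = trans (evs-++ʳ [] w t) (evs-++ˡ [] (ev w) t)

ev-∷ : ∀ v w → ev (v ∷ w) ≡ ev (passW v w) ++ [ passV v w ]
ev-∷ v w = trans (evs-++ˡ [] [ v ] w)
  (cong₂ _++_ (cong ev (trans (swT-∷ v [] w) (cong (passW v) (swT-[] w))))
              (trans (swX-∷ v [] w) (cong₂ (λ a b → passV v a ∷ b) (swT-[] w) (swX-[] w))))

insH-pass : ∀ v w → insH (passV v w) (passW v w) ≡ v
insH-pass v [] = refl
insH-pass v (k ∷ w) = trans (cong (cl (cl v k)) (insH-pass (cr v k) w)) (cl-inv v k)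

insT-pass : ∀ v w → insT (passV v w) (passW v w) ≡ w
insT-pass v [] = refl
insT-pass v (k ∷ w) = cong₂ _∷_
  (trans (cong (cr (cl v k)) (insH-pass (cr v k) w)) (cr-inv v k)) (insT-pass (cr v k) w)

-- `ev` can be unfolded at either end. At the first letter it slides and appends the vacated
-- diagonal; at the last letter it inserts that diagonal from behind. The second evacuation thus
-- undoes the slide of the first. The recursion is on the length because `passW v w` is not a part
-- of `v ∷ w`.
ev-involutive : ∀ w → ev (ev w) ≡ w
ev-involutive w = go (length w) w ≤-refl
  where
  go : ∀ n w → length w ≤ n → ev (ev w) ≡ w
  go n [] _ = refl
  go (suc n) (v ∷ w) (s≤s le) = begin
    ev (ev (v ∷ w))                        ≡⟨ cong ev (ev-∷ v w) ⟩
    ev (ev w' ++ [ v' ])                   ≡⟨ evs-++ʳ [] (ev w') [ v' ] ⟩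
    insH v' (ev (ev w')) ∷ insT v' (ev (ev w'))
      ≡⟨ cong (λ z → insH v' z ∷ insT v' z) (go n w' (subst (_≤ n) (sym (length-passW v w)) le)) ⟩
    insH v' w' ∷ insT v' w'                ≡⟨ cong₂ _∷_ (insH-pass v w) (insT-pass v w) ⟩
    v ∷ w ∎
    where
    open ≡-Reasoning
    w' = passW v w
    v' = passV v w

-- Alternation, a test that every legal word passes.

-- Between two additions on diagonal x there is one on each neighbouring diagonal.

between : ℕ → Bool → Bool → List ℕ → Bool
between x above below [] = true
between x above below (y ∷ w) =
  if x ≡ᵇ y then above ∧ (below ∨ (x ≡ᵇ 0))
  else between x (above ∨ (suc x ≡ᵇ y)) (below ∨ (suc y ≡ᵇ x)) w

alternating : List ℕ → Bool
alternating [] = true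
alternating (x ∷ w) = between x false false w ∧ alternating w

Tight : State → ℕ → Set
Tight m zero = ⊤
Tight m (suc k) = m k ≡ m (suc k)

∨-falseˡ : ∀ {a b} → (a ∨ b) ≡ false → a ≡ false
∨-falseˡ {false} _ = refl

∨-falseʳ : ∀ {a b} → (a ∨ b) ≡ false → b ≡ false
∨-falseʳ {false} e = e

∧-trueˡ : ∀ {a b} → (a ∧ b) ≡ true → a ≡ true
∧-trueˡ {true} _ = refl

∧-trueʳ : ∀ {a b} → (a ∧ b) ≡ true → b ≡ true
∧-trueʳ {true} e = e

Tight-bump : ∀ m x y → x ≢ y → (suc y ≡ᵇ x) ≡ false → Tight m x → Tight (bump y m) x
Tight-bump m zero y ne f t = tt
Tight-bump m (suc k) y ne f t =
  trans (bump-diff y k m (≡ᵇ-false⁻ f)) (trans t (sym (bump-diff y (suc k) m (ne ∘ sym))))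

-- A flag that is still false means that the neighbouring diagonal has received nothing since the
-- last addition on `x`. The equation left behind by that addition then persists, and it forbids
-- another addition on `x`.
between-legal : ∀ m x a b w → (a ≡ false → m x ≡ suc (m (suc x))) → (b ≡ false → Tight m x) →
                Legal m w → between x a b w ≡ true
between-legal m x a b [] _ _ _ = refl
between-legal m x a b (y ∷ w) ha hb (s , l) with x ≡ᵇ y in e
... | true with ≡ᵇ-true {x} {y} e
...   | refl = close a b x ha hb s
  where
  close : ∀ a b x → (a ≡ false → m x ≡ suc (m (suc x))) → (b ≡ false → Tight m x) → Step m x →
          (a ∧ (b ∨ (x ≡ᵇ 0))) ≡ true
  close false b x ha hb (n , _) = contradiction (trans (sym n) (ha refl)) (1+n≢n ∘ sym)
  close true true x ha hb s = refl
  close true false zero ha hb s = refl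
  close true false (suc k) ha hb (_ , w) = contradiction (trans (sym (hb refl)) w) (1+n≢n ∘ sym)
between-legal m x a b (y ∷ w) ha hb (s , l) | false =
  between-legal (bump y m) x _ _ w
    (λ f → trans (bump-diff y x m (ne ∘ sym))
             (trans (ha (∨-falseˡ f))
               (cong suc (sym (bump-diff y (suc x) m (λ q → ≡ᵇ-false⁻ (∨-falseʳ {a} f) (sym q)))))))
    (λ f → Tight-bump m x y ne (∨-falseʳ {b} f) (hb (∨-falseˡ f)))
    l
  where ne = ≡ᵇ-false⁻ {x} {y} e

Step-tight : ∀ m x → Step m x → Tight (bump x m) x
Step-tight m zero s = tt
Step-tight m (suc k) (_ , w) =
  trans (bump-diff (suc k) k m 1+n≢n) (trans w (sym (bump-same (suc k) m)))

-- This trades legality, which depends on the counts `m`, for a Boolean condition on the word alone;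
-- only such a condition can guard a finite check over all words of five letters.
Legal-alternating : ∀ m w → Legal m w → alternating w ≡ true
Legal-alternating m [] _ = refl
Legal-alternating m (x ∷ w) (s , l) = cong₂ _∧_
  (between-legal (bump x m) x false false w
    (λ _ → trans (bump-same x m) (cong suc (trans (proj₁ s) (sym (bump-diff x (suc x) m (1+n≢n ∘ sym))))))
    (λ _ → Step-tight m x s) l)
  (Legal-alternating (bump x m) w l)

-- Elementary dual equivalences commute with crossings.

-- Haiman's elementary dual equivalence for shifted tableaux: the two orders of
-- four consecutive additions with a single peak are exchanged by a commutation
-- that moves the peak.

dual : List ℕ → List ℕ
dual (a ∷ b ∷ c ∷ d ∷ []) =
  if (b <ᵇ c) ∧ (d <ᵇ c)
  then (if a <ᵇ b
        then (if d <ᵇ b then a ∷ b ∷ d ∷ c ∷ [] else a ∷ c ∷ b ∷ d ∷ [])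
        else (if c <ᵇ a then b ∷ a ∷ c ∷ d ∷ [] else a ∷ c ∷ b ∷ d ∷ []))
  else (if (a <ᵇ b) ∧ (c <ᵇ b)
  then (if d <ᵇ c
        then (if a <ᵇ c then b ∷ a ∷ c ∷ d ∷ [] else a ∷ c ∷ b ∷ d ∷ [])
        else (if b <ᵇ d then a ∷ b ∷ d ∷ c ∷ [] else a ∷ c ∷ b ∷ d ∷ []))
  else a ∷ b ∷ c ∷ d ∷ [])
dual w = w

eqL : List ℕ → List ℕ → Bool
eqL [] [] = true
eqL (x ∷ v) (y ∷ w) = (x ≡ᵇ y) ∧ eqL v w
eqL _ _ = false

eqL-true : ∀ v w → eqL v w ≡ true → v ≡ w
eqL-true [] [] _ = refl
eqL-true (x ∷ v) (y ∷ w) e = cong₂ _∷_ (≡ᵇ-true {x} {y} (∧-trueˡ e)) (eqL-true v w (∧-trueʳ {x ≡ᵇ y} e))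

passOfDual dualPass insOfDual dualIns : ℕ → ℕ → ℕ → ℕ → ℕ → List ℕ
passOfDual v a b c d = passV v (dual (a ∷ b ∷ c ∷ d ∷ [])) ∷ passW v (dual (a ∷ b ∷ c ∷ d ∷ []))
dualPass v a b c d = passV v (a ∷ b ∷ c ∷ d ∷ []) ∷ dual (passW v (a ∷ b ∷ c ∷ d ∷ []))
insOfDual a b c d h = insH h (dual (a ∷ b ∷ c ∷ d ∷ [])) ∷ insT h (dual (a ∷ b ∷ c ∷ d ∷ []))
dualIns a b c d h = insH h (a ∷ b ∷ c ∷ d ∷ []) ∷ dual (insT h (a ∷ b ∷ c ∷ d ∷ []))

dualCommutes : ℕ → ℕ → ℕ → ℕ → ℕ → Bool
dualCommutes v a b c d =
  if alternating (v ∷ a ∷ b ∷ c ∷ d ∷ [])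
  then eqL (passOfDual v a b c d) (dualPass v a b c d) ∧ eqL (insOfDual v a b c d) (dualIns v a b c d)
  else true

allBelow : ℕ → (ℕ → Bool) → Bool
allBelow zero f = true
allBelow (suc n) f = f n ∧ allBelow n f

allBelow-sound : ∀ n f → allBelow n f ≡ true → ∀ {x} → x < n → f x ≡ true
allBelow-sound (suc n) f e {x} (s≤s le) with m≤n⇒m<n∨m≡n le
... | inj₁ lt = allBelow-sound n f (∧-trueʳ {f n} e) lt
... | inj₂ refl = ∧-trueˡ e

allBelow⁵ : ℕ → (ℕ → ℕ → ℕ → ℕ → ℕ → Bool) → Bool
allBelow⁵ n f = allBelow n λ v → allBelow n λ a → allBelow n λ b → allBelow n λ c → allBelow n (f v a b c)

allBelow⁵-sound : ∀ n f → allBelow⁵ n f ≡ true → ∀ {v a b c d} → v < n → a < n → b < n → c < n → d < n →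
                  f v a b c d ≡ true
allBelow⁵-sound n f e {v} {a} {b} {c} {d} lv la lb lc ld =
  allBelow-sound n _ (allBelow-sound n _ (allBelow-sound n _ (allBelow-sound n _ (allBelow-sound n _
    e lv) la) lb) lc) ld

-- Evaluation of all 161051 words of five letters below 11. The bound is 11 because `squeeze` sends
-- five letters to numbers that are at most twice five.
dualCommutes-all : allBelow⁵ 11 dualCommutes ≡ true
dualCommutes-all = refl

record PassDual (v : ℕ) (w : List ℕ) : Set where
  constructor passDual!
  field
    passV-dual : passV v (dual w) ≡ passV v w
    passW-dual : passW v (dual w) ≡ dual (passW v w)

record InsDual (w : List ℕ) (h : ℕ) : Set where
  constructor insDual!
  field
    insH-dual : insH h (dual w) ≡ insH h w
    insT-dual : insT h (dual w) ≡ dual (insT h w)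

∷-split : ∀ {x y : ℕ} {v w : List ℕ} → x ∷ v ≡ y ∷ w → (x ≡ y) × (v ≡ w)
∷-split refl = refl , refl

guarded-eqL : ∀ g p q r s → g ≡ true → (if g then eqL p q ∧ eqL r s else true) ≡ true → (p ≡ q) × (r ≡ s)
guarded-eqL true p q r s refl e = eqL-true p q (∧-trueˡ e) , eqL-true r s (∧-trueʳ {eqL p q} e)

module _ (v a b c d : ℕ) (lv : v < 11) (la : a < 11) (lb : b < 11) (lc : c < 11) (ld : d < 11)
         (alt : alternating (v ∷ a ∷ b ∷ c ∷ d ∷ []) ≡ true) where

  private
    checked : (passOfDual v a b c d ≡ dualPass v a b c d) × (insOfDual v a b c d ≡ dualIns v a b c d)
    checked = guarded-eqL (alternating (v ∷ a ∷ b ∷ c ∷ d ∷ [])) (passOfDual v a b c d) (dualPass v a b c d)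
      (insOfDual v a b c d) (dualIns v a b c d) alt
      (allBelow⁵-sound 11 dualCommutes dualCommutes-all lv la lb lc ld)

  passDual-small : PassDual v (a ∷ b ∷ c ∷ d ∷ [])
  passDual-small = passDual! (proj₁ s) (proj₂ s)
    where
    s : (passV v (dual (a ∷ b ∷ c ∷ d ∷ [])) ≡ passV v (a ∷ b ∷ c ∷ d ∷ []))
      × (passW v (dual (a ∷ b ∷ c ∷ d ∷ [])) ≡ dual (passW v (a ∷ b ∷ c ∷ d ∷ [])))
    s = ∷-split (proj₁ checked)

  insDual-small : InsDual (v ∷ a ∷ b ∷ c ∷ []) d
  insDual-small = insDual! (proj₁ s) (proj₂ s)
    where
    s : (insH d (dual (v ∷ a ∷ b ∷ c ∷ [])) ≡ insH d (v ∷ a ∷ b ∷ c ∷ []))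
      × (insT d (dual (v ∷ a ∷ b ∷ c ∷ [])) ≡ dual (insT d (v ∷ a ∷ b ∷ c ∷ [])))
    s = ∷-split (proj₂ checked)

-- squeeze X shrinks the gaps between the members of X to at most 2, which keeps
-- all comparisons that pass, ins and dual perform on them.

mark : List ℕ → ℕ → Bool
mark [] s = false
mark (y ∷ X) s = ((s ≡ᵇ y) ∨ (suc s ≡ᵇ y)) ∨ mark X s

squeeze : List ℕ → ℕ → ℕ
squeeze X zero = 0
squeeze X (suc n) = (if mark X n then 1 else 0) + squeeze X n

mark-self : ∀ {X y} → y ∈ X → mark X y ≡ true
mark-self {x ∷ X} (here refl) rewrite ≡ᵇ-refl x = refl
mark-self {x ∷ X} {y} (there p) rewrite mark-self p = ∨-zeroʳ _

mark-pred : ∀ {X y} → suc y ∈ X → mark X y ≡ true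
mark-pred {x ∷ X} {y} (here refl) rewrite ≡ᵇ-refl y | ∨-zeroʳ (y ≡ᵇ suc y) = refl
mark-pred {x ∷ X} {y} (there p) rewrite mark-pred p = ∨-zeroʳ _

squeeze-after : ∀ {X y} → y ∈ X → squeeze X (suc y) ≡ suc (squeeze X y)
squeeze-after p rewrite mark-self p = refl

squeeze-before : ∀ {X y} → suc y ∈ X → squeeze X (suc y) ≡ suc (squeeze X y)
squeeze-before p rewrite mark-pred p = refl

squeeze-mono : ∀ X {x y} → x ≤ y → squeeze X x ≤ squeeze X y
squeeze-mono X {y = zero} z≤n = z≤n
squeeze-mono X {y = suc y} le with m≤n⇒m<n∨m≡n le
... | inj₁ (s≤s lt) = ≤-trans (squeeze-mono X lt) (m≤n+m _ _)
... | inj₂ refl = ≤-refl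

squeeze-< : ∀ {X x y} → y ∈ X → x < y → squeeze X x < squeeze X y
squeeze-< {X} {x} {suc n} p (s≤s le) rewrite squeeze-before p = s≤s (squeeze-mono X le)

-- The member `x` is marked, and so is the predecessor of the member `y`; these are two different
-- marks when `y` exceeds `suc x`. Hence diagonals that are not adjacent do not become adjacent.
squeeze-far : ∀ {X x y} → x ∈ X → y ∈ X → suc x < y → suc (squeeze X x) < squeeze X y
squeeze-far {X} {x} {suc n} p q (s≤s le) rewrite squeeze-before q | sym (squeeze-after p) =
  s≤s (squeeze-mono X le)

ite≤1 : ∀ (b : Bool) → (if b then 1 else 0) ≤ 1
ite≤1 true = ≤-refl
ite≤1 false = z≤n

module _ (y : ℕ) (X : List ℕ) where

  -- A further member `y` can add only the marks `y - 1` and `y`. The three bounds count the new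
  -- marks below `x` for `x` before both, before the second, and just behind them; beyond that
  -- nothing is added.
  squeeze-∷₀ : ∀ x → x < y → squeeze (y ∷ X) x ≤ squeeze X x
  squeeze-∷₀ zero _ = z≤n
  squeeze-∷₀ (suc n) lt rewrite ≡ᵇ-false (<⇒≢ (<-trans (n<1+n n) lt)) | ≡ᵇ-false (<⇒≢ lt) =
    +-monoʳ-≤ _ (squeeze-∷₀ n (<-trans (n<1+n n) lt))

  squeeze-∷₁ : ∀ x → x ≤ y → squeeze (y ∷ X) x ≤ 1 + squeeze X x
  squeeze-∷₁ zero _ = z≤n
  squeeze-∷₁ (suc n) lt = +-mono-≤ (ite≤1 _) (≤-trans (squeeze-∷₀ n lt) (squeeze-mono X (n≤1+n n)))

  squeeze-∷₂ : ∀ x → x ≤ suc y → squeeze (y ∷ X) x ≤ 2 + squeeze X x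
  squeeze-∷₂ zero _ = z≤n
  squeeze-∷₂ (suc n) (s≤s le) =
    +-mono-≤ (ite≤1 _) (≤-trans (squeeze-∷₁ n le) (s≤s (squeeze-mono X (n≤1+n n))))

  squeeze-∷ : ∀ x → squeeze (y ∷ X) x ≤ 2 + squeeze X x
  squeeze-∷ zero = z≤n
  squeeze-∷ (suc n) with ≤-<-connex (suc n) (suc y)
  ... | inj₁ le = squeeze-∷₂ (suc n) le
  ... | inj₂ (s≤s lt)
    rewrite ≡ᵇ-false (>⇒≢ lt) | ≡ᵇ-false (>⇒≢ (<-trans lt (n<1+n n))) = begin
      (if mark X n then 1 else 0) + squeeze (y ∷ X) n ≤⟨ +-monoʳ-≤ _ (squeeze-∷ n) ⟩
      (if mark X n then 1 else 0) + (2 + squeeze X n) ≡⟨ comm3 (if mark X n then 1 else 0) (squeeze X n) ⟩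
      2 + ((if mark X n then 1 else 0) + squeeze X n) ∎
    where
    open ≤-Reasoning
    comm3 : ∀ i j → i + (2 + j) ≡ 2 + (i + j)
    comm3 i j = trans (+-suc i (suc j)) (cong suc (+-suc i j))

squeeze-[] : ∀ x → squeeze [] x ≡ 0
squeeze-[] zero = refl
squeeze-[] (suc n) = squeeze-[] n

squeeze-bound : ∀ X x → squeeze X x ≤ length X + length X
squeeze-bound [] x = ≤-reflexive (squeeze-[] x)
squeeze-bound (y ∷ X) x = ≤-trans (squeeze-∷ y X x)
  (≤-trans (s≤s (s≤s (squeeze-bound X x))) (≤-reflexive (cong suc (sym (+-suc _ _)))))

module _ (X : List ℕ) where

  private φ = squeeze X

  φ-≡ᵇ : ∀ {x y} → x ∈ X → y ∈ X → (φ x ≡ᵇ φ y) ≡ (x ≡ᵇ y)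
  φ-≡ᵇ {x} {y} p q with <-cmp x y
  ... | tri< lt _ _ = trans (≡ᵇ-false (<⇒≢ (squeeze-< q lt))) (sym (≡ᵇ-false (<⇒≢ lt)))
  ... | tri≈ _ refl _ = trans (≡ᵇ-refl (φ x)) (sym (≡ᵇ-refl x))
  ... | tri> _ _ lt = trans (≡ᵇ-false (>⇒≢ (squeeze-< p lt))) (sym (≡ᵇ-false (>⇒≢ lt)))

  φ-suc : ∀ {x y} → x ∈ X → y ∈ X → (suc (φ x) ≡ᵇ φ y) ≡ (suc x ≡ᵇ y)
  φ-suc {x} {y} p q with <-cmp (suc x) y
  ... | tri< lt _ _ = trans (≡ᵇ-false (<⇒≢ (squeeze-far p q lt))) (sym (≡ᵇ-false (<⇒≢ lt)))
  ... | tri≈ _ refl _ rewrite squeeze-before q = trans (≡ᵇ-refl (φ x)) (sym (≡ᵇ-refl x))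
  ... | tri> _ _ (s≤s le) = trans (≡ᵇ-false (>⇒≢ (s≤s (squeeze-mono X le)))) (sym (≡ᵇ-false (>⇒≢ (s≤s le))))

  φ-<ᵇ : ∀ {x y} → x ∈ X → y ∈ X → (φ x <ᵇ φ y) ≡ (x <ᵇ y)
  φ-<ᵇ {x} {y} p q with ≤-<-connex y x
  ... | inj₂ lt = trans (<⇒<ᵇ-true (squeeze-< q lt)) (sym (<⇒<ᵇ-true lt))
  ... | inj₁ le = trans (≤⇒<ᵇ-false (squeeze-mono X le)) (sym (≤⇒<ᵇ-false le))

  -- Diagonal 0 is the only one with a single neighbour, and `between` makes an exception for it;
  -- squeezing must therefore recognise it.
  φ-zero : ∀ {x} → x ∈ X → (φ x ≡ᵇ 0) ≡ (x ≡ᵇ 0)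
  φ-zero {zero} p = refl
  φ-zero {suc n} p rewrite squeeze-before p = refl

  φ-adj : ∀ {x y} → x ∈ X → y ∈ X → adj (φ x) (φ y) ≡ adj x y
  φ-adj p q = cong₂ _∨_ (φ-suc p q) (φ-suc q p)

  φ-cl : ∀ {x y} → x ∈ X → y ∈ X → cl (φ x) (φ y) ≡ φ (cl x y)
  φ-cl {x} {y} p q = trans (cong (if_then φ x else φ y) (φ-adj p q)) (sym (if-float φ (adj x y)))

  φ-cr : ∀ {x y} → x ∈ X → y ∈ X → cr (φ x) (φ y) ≡ φ (cr x y)
  φ-cr {x} {y} p q = trans (cong (if_then φ y else φ x) (φ-adj p q)) (sym (if-float φ (adj x y)))

  cl-∈ : ∀ {x y} → x ∈ X → y ∈ X → cl x y ∈ X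
  cl-∈ {x} {y} p q with adj x y
  ... | true = p
  ... | false = q

  cr-∈ : ∀ {x y} → x ∈ X → y ∈ X → cr x y ∈ X
  cr-∈ {x} {y} p q with adj x y
  ... | true = q
  ... | false = p

  φ-passW : ∀ {v w} → v ∈ X → All (_∈ X) w → passW (φ v) (map φ w) ≡ map φ (passW v w)
  φ-passW p [] = refl
  φ-passW {v} {k ∷ w} p (q ∷ qs) = cong₂ _∷_ (φ-cl p q)
    (trans (cong (λ z → passW z (map φ w)) (φ-cr p q)) (φ-passW (cr-∈ p q) qs))

  φ-passV : ∀ {v w} → v ∈ X → All (_∈ X) w → passV (φ v) (map φ w) ≡ φ (passV v w)
  φ-passV p [] = refl
  φ-passV {v} {k ∷ w} p (q ∷ qs) =
    trans (cong (λ z → passV z (map φ w)) (φ-cr p q)) (φ-passV (cr-∈ p q) qs)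

  passW-∈ : ∀ {v w} → v ∈ X → All (_∈ X) w → All (_∈ X) (passW v w)
  passW-∈ p [] = []
  passW-∈ p (q ∷ qs) = cl-∈ p q ∷ passW-∈ (cr-∈ p q) qs

  passV-∈ : ∀ {v w} → v ∈ X → All (_∈ X) w → passV v w ∈ X
  passV-∈ p [] = p
  passV-∈ p (q ∷ qs) = passV-∈ (cr-∈ p q) qs

  insH-∈ : ∀ {h w} → h ∈ X → All (_∈ X) w → insH h w ∈ X
  insH-∈ p [] = p
  insH-∈ p (q ∷ qs) = cl-∈ q (insH-∈ p qs)

  insT-∈ : ∀ {h w} → h ∈ X → All (_∈ X) w → All (_∈ X) (insT h w)
  insT-∈ p [] = []
  insT-∈ p (q ∷ qs) = cr-∈ q (insH-∈ p qs) ∷ insT-∈ p qs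

  φ-insH : ∀ {h w} → h ∈ X → All (_∈ X) w → insH (φ h) (map φ w) ≡ φ (insH h w)
  φ-insH p [] = refl
  φ-insH {h} {e ∷ w} p (q ∷ qs) = trans (cong (cl (φ e)) (φ-insH p qs)) (φ-cl q (insH-∈ p qs))

  φ-insT : ∀ {h w} → h ∈ X → All (_∈ X) w → insT (φ h) (map φ w) ≡ map φ (insT h w)
  φ-insT p [] = refl
  φ-insT {h} {e ∷ w} p (q ∷ qs) = cong₂ _∷_
    (trans (cong (cr (φ e)) (φ-insH p qs)) (φ-cr q (insH-∈ p qs))) (φ-insT p qs)

  φ-between : ∀ {x w} a b → x ∈ X → All (_∈ X) w → between (φ x) a b (map φ w) ≡ between x a b w
  φ-between a b p [] = refl
  φ-between {x} {y ∷ w} a b p (q ∷ qs)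
    rewrite φ-≡ᵇ p q | φ-suc p q | φ-suc q p | φ-zero p
          | φ-between (a ∨ (suc x ≡ᵇ y)) (b ∨ (suc y ≡ᵇ x)) p qs = refl

  φ-alternating : ∀ {w} → All (_∈ X) w → alternating (map φ w) ≡ alternating w
  φ-alternating [] = refl
  φ-alternating (p ∷ ps) = cong₂ _∧_ (φ-between false false p ps) (φ-alternating ps)

  φ-dual : ∀ {a b c d} → a ∈ X → b ∈ X → c ∈ X → d ∈ X →
           dual (φ a ∷ φ b ∷ φ c ∷ φ d ∷ []) ≡ map φ (dual (a ∷ b ∷ c ∷ d ∷ []))
  φ-dual {a} {b} {c} {d} p q r s
    rewrite φ-<ᵇ q r | φ-<ᵇ s r | φ-<ᵇ p q | φ-<ᵇ s q | φ-<ᵇ r p | φ-<ᵇ r q | φ-<ᵇ p r | φ-<ᵇ q s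
    with b <ᵇ c | d <ᵇ c | a <ᵇ b | d <ᵇ b | c <ᵇ a | c <ᵇ b | a <ᵇ c | b <ᵇ d
  ... | true | true | true | true | _ | _ | _ | _ = refl
  ... | true | true | true | false | _ | _ | _ | _ = refl
  ... | true | true | false | _ | true | _ | _ | _ = refl
  ... | true | true | false | _ | false | _ | _ | _ = refl
  ... | true | false | true | _ | _ | true | true | true = refl
  ... | true | false | true | _ | _ | true | true | false = refl
  ... | true | false | true | _ | _ | true | false | true = refl
  ... | true | false | true | _ | _ | true | false | false = refl
  ... | true | false | true | _ | _ | false | _ | _ = refl
  ... | true | false | false | _ | _ | _ | _ | _ = refl
  ... | false | true | true | _ | _ | true | true | _ = refl
  ... | false | true | true | _ | _ | true | false | _ = refl
  ... | false | false | true | _ | _ | true | _ | true = refl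
  ... | false | false | true | _ | _ | true | _ | false = refl
  ... | false | _ | true | _ | _ | false | _ | _ = refl
  ... | false | _ | false | _ | _ | _ | _ | _ = refl

  dual-∈ : ∀ {a b c d} → a ∈ X → b ∈ X → c ∈ X → d ∈ X → All (_∈ X) (dual (a ∷ b ∷ c ∷ d ∷ []))
  dual-∈ {a} {b} {c} {d} p q r s with (b <ᵇ c) ∧ (d <ᵇ c)
  ... | true with a <ᵇ b
  ...   | true with d <ᵇ b
  ...     | true = p ∷ q ∷ s ∷ r ∷ []
  ...     | false = p ∷ r ∷ q ∷ s ∷ []
  dual-∈ {a} {b} {c} {d} p q r s | true | false with c <ᵇ a
  ...     | true = q ∷ p ∷ r ∷ s ∷ []
  ...     | false = p ∷ r ∷ q ∷ s ∷ []
  dual-∈ {a} {b} {c} {d} p q r s | false with (a <ᵇ b) ∧ (c <ᵇ b)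
  ... | false = p ∷ q ∷ r ∷ s ∷ []
  ... | true with d <ᵇ c
  ...   | true with a <ᵇ c
  ...     | true = q ∷ p ∷ r ∷ s ∷ []
  ...     | false = p ∷ r ∷ q ∷ s ∷ []
  dual-∈ {a} {b} {c} {d} p q r s | false | true | false with b <ᵇ d
  ...     | true = p ∷ q ∷ s ∷ r ∷ []
  ...     | false = p ∷ r ∷ q ∷ s ∷ []

  φ-injective : ∀ {x y} → x ∈ X → y ∈ X → φ x ≡ φ y → x ≡ y
  φ-injective {x} {y} p q e =
    ≡ᵇ-true {x} {y} (trans (sym (φ-≡ᵇ p q)) (trans (cong (_≡ᵇ φ y) e) (≡ᵇ-refl (φ y))))

  map-φ-injective : ∀ {v w} → All (_∈ X) v → All (_∈ X) w → map φ v ≡ map φ w → v ≡ w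
  map-φ-injective [] [] _ = refl
  map-φ-injective [] (_ ∷ _) ()
  map-φ-injective (_ ∷ _) [] ()
  map-φ-injective (p ∷ ps) (q ∷ qs) e =
    cong₂ _∷_ (φ-injective p q (proj₁ (∷-inj e))) (map-φ-injective ps qs (proj₂ (∷-inj e)))
    where
    ∷-inj : ∀ {x y : ℕ} {v w : List ℕ} → x ∷ v ≡ y ∷ w → x ≡ y × v ≡ w
    ∷-inj refl = refl , refl

  dual-∈-all : ∀ {w} → All (_∈ X) w → length w ≡ 4 → All (_∈ X) (dual w)
  dual-∈-all (p ∷ q ∷ r ∷ s ∷ []) _ = dual-∈ p q r s

  φ-dual-all : ∀ {w} → All (_∈ X) w → length w ≡ 4 → dual (map φ w) ≡ map φ (dual w)
  φ-dual-all (p ∷ q ∷ r ∷ s ∷ []) _ = φ-dual p q r s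

  -- Crossings and `dual` never leave the set `X`, and `φ` is injective there; so an equation
  -- verified for the squeezed letters holds for the original ones.
  transfer : ∀ {l r l' r'} → l' ≡ map φ l → r' ≡ map φ r → All (_∈ X) l → All (_∈ X) r → l' ≡ r' → l ≡ r
  transfer e f p q g = map-φ-injective p q (trans (sym e) (trans g f))

  transfer₁ : ∀ {l r l' r'} → l' ≡ φ l → r' ≡ φ r → l ∈ X → r ∈ X → l' ≡ r' → l ≡ r
  transfer₁ e f p q g = φ-injective p q (trans (sym e) (trans g f))

  transfer-pass : ∀ {v w} → v ∈ X → All (_∈ X) w → length w ≡ 4 → PassDual (φ v) (map φ w) → PassDual v w
  transfer-pass {v} {w} p ps e (passDual! V W) = passDual!
    (transfer₁ (trans (cong (passV (φ v)) (φ-dual-all ps e)) (φ-passV p (dual-∈-all ps e)))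
               (φ-passV p ps) (passV-∈ p (dual-∈-all ps e)) (passV-∈ p ps) V)
    (transfer (trans (cong (passW (φ v)) (φ-dual-all ps e)) (φ-passW p (dual-∈-all ps e)))
              (trans (cong dual (φ-passW p ps)) (φ-dual-all (passW-∈ p ps) e'))
              (passW-∈ p (dual-∈-all ps e)) (dual-∈-all (passW-∈ p ps) e') W)
    where e' = trans (length-passW v w) e

  transfer-ins : ∀ {h w} → h ∈ X → All (_∈ X) w → length w ≡ 4 → InsDual (map φ w) (φ h) → InsDual w h
  transfer-ins {h} {w} p ps e (insDual! H T) = insDual!
    (transfer₁ (trans (cong (insH (φ h)) (φ-dual-all ps e)) (φ-insH p (dual-∈-all ps e)))
               (φ-insH p ps) (insH-∈ p (dual-∈-all ps e)) (insH-∈ p ps) H)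
    (transfer (trans (cong (insT (φ h)) (φ-dual-all ps e)) (φ-insT p (dual-∈-all ps e)))
              (trans (cong dual (φ-insT p ps)) (φ-dual-all (insT-∈ p ps) e'))
              (insT-∈ p (dual-∈-all ps e)) (dual-∈-all (insT-∈ p ps) e') T)
    where e' = trans (length-insT h w) e

  squeeze-small : length X ≡ 5 → ∀ x → φ x < 11
  squeeze-small e x = s≤s (subst (λ n → φ x ≤ n + n) e (squeeze-bound X x))

module _ (v a b c d : ℕ) (alt : alternating (v ∷ a ∷ b ∷ c ∷ d ∷ []) ≡ true) where

  private
    X : List ℕ
    X = v ∷ a ∷ b ∷ c ∷ d ∷ []
    φ : ℕ → ℕ
    φ = squeeze X
    lt : ∀ x → φ x < 11
    lt = squeeze-small X refl
    pv : v ∈ X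
    pv = here refl
    pa : a ∈ X
    pa = there (here refl)
    pb : b ∈ X
    pb = there (there (here refl))
    pc : c ∈ X
    pc = there (there (there (here refl)))
    pd : d ∈ X
    pd = there (there (there (there (here refl))))
    alt-φ : alternating (φ v ∷ φ a ∷ φ b ∷ φ c ∷ φ d ∷ []) ≡ true
    alt-φ = trans (φ-alternating X (pv ∷ pa ∷ pb ∷ pc ∷ pd ∷ [])) alt

  passDual : PassDual v (a ∷ b ∷ c ∷ d ∷ [])
  passDual = transfer-pass X pv (pa ∷ pb ∷ pc ∷ pd ∷ []) refl
    (passDual-small (φ v) (φ a) (φ b) (φ c) (φ d) (lt v) (lt a) (lt b) (lt c) (lt d) alt-φ)

  insDual : InsDual (v ∷ a ∷ b ∷ c ∷ []) d
  insDual = transfer-ins X pd (pv ∷ pa ∷ pb ∷ pc ∷ []) refl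
    (insDual-small (φ v) (φ a) (φ b) (φ c) (φ d) (lt v) (lt a) (lt b) (lt c) (lt d) alt-φ)

pass-dual : ∀ v q → length q ≡ 4 → alternating (v ∷ q) ≡ true → PassDual v q
pass-dual v (a ∷ b ∷ c ∷ d ∷ []) _ alt = passDual v a b c d alt

ins-dual : ∀ h q → length q ≡ 4 → alternating (q ∷ʳ h) ≡ true → InsDual q h
ins-dual h (a ∷ b ∷ c ∷ d ∷ []) _ alt =
  insDual a b c d h (subst (λ z → alternating z ≡ true) (snoc a b c d h) alt)
  where
  snoc : ∀ a b c d h → (a ∷ b ∷ c ∷ d ∷ []) ∷ʳ h ≡ a ∷ b ∷ c ∷ d ∷ h ∷ []
  snoc a b c d h = refl

-- Evacuation respects dual equivalences.

empty : State
empty _ = 0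

passW-++ : ∀ v A B → passW v (A ++ B) ≡ passW v A ++ passW (passV v A) B
passW-++ v [] B = refl
passW-++ v (a ∷ A) B = cong (_ ∷_) (passW-++ (cr v a) A B)

passV-++ : ∀ v A B → passV v (A ++ B) ≡ passV (passV v A) B
passV-++ v [] B = refl
passV-++ v (a ∷ A) B = passV-++ (cr v a) A B

-- The letters of `B` cross the quadruple one at a time. `ins-dual` applies to each of them because
-- the words stay legal under `ins-~`, hence alternating.
sw-dual : ∀ m p B → length p ≡ 4 → Legal m (p ++ B) →
          (swT (dual p) B ≡ swT p B) × (swX (dual p) B ≡ dual (swX p B))
sw-dual m p [] _ _ = refl , refl
sw-dual m p (h ∷ B) e l
  with ins-dual h p e (Legal-alternating m _ (proj₁ (Legal-++ m (p ∷ʳ h) (subst (Legal m) (sym (++-assoc p [ h ] B)) l))))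
... | insDual! eH eT rewrite eT | eH
  with sw-dual (bump (insH h p) m) (insT h p) B (trans (length-insT h p) e) (proj₂ (~-Legal (ins-~ h p B) {m} l))
... | f , g = cong (_ ∷_) f , g

length-swT : ∀ X t → length (swT X t) ≡ length t
length-swT X [] = refl
length-swT X (h ∷ t) = cong suc (length-swT (insT h X) t)

length-swX : ∀ X t → length (swX X t) ≡ length X
length-swX X [] = refl
length-swX X (h ∷ t) = trans (length-swX (insT h X) t) (length-insT h X)

-- From the empty shape only 0102, 0120 and 0123 are legal words of four letters; for these both
-- sides are evaluated, and every other pattern contradicts a count.
ev-dual-initial : ∀ q → length q ≡ 4 → Legal empty q → ev (dual q) ≡ dual (ev q)
ev-dual-initial (suc a ∷ _) _ ((_ , ()) , _)
ev-dual-initial (zero ∷ zero ∷ _) _ (_ , (() , _) , _)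
ev-dual-initial (zero ∷ suc (suc b) ∷ _) _ (_ , (_ , ()) , _)
ev-dual-initial (zero ∷ suc zero ∷ suc zero ∷ _) _ (_ , _ , (() , _) , _)
ev-dual-initial (zero ∷ suc zero ∷ suc (suc (suc c)) ∷ _) _ (_ , _ , (_ , ()) , _)
ev-dual-initial (zero ∷ suc zero ∷ zero ∷ zero ∷ []) _ (_ , _ , _ , (() , _) , _)
ev-dual-initial (zero ∷ suc zero ∷ zero ∷ suc zero ∷ []) _ (_ , _ , _ , (() , _) , _)
ev-dual-initial (zero ∷ suc zero ∷ zero ∷ suc (suc zero) ∷ []) _ _ = refl
ev-dual-initial (zero ∷ suc zero ∷ zero ∷ suc (suc (suc d)) ∷ []) _ (_ , _ , _ , (_ , ()) , _)
ev-dual-initial (zero ∷ suc zero ∷ suc (suc zero) ∷ zero ∷ []) _ _ = refl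
ev-dual-initial (zero ∷ suc zero ∷ suc (suc zero) ∷ suc zero ∷ []) _ (_ , _ , _ , (_ , ()) , _)
ev-dual-initial (zero ∷ suc zero ∷ suc (suc zero) ∷ suc (suc zero) ∷ []) _ (_ , _ , _ , (() , _) , _)
ev-dual-initial (zero ∷ suc zero ∷ suc (suc zero) ∷ suc (suc (suc zero)) ∷ []) _ _ = refl
ev-dual-initial (zero ∷ suc zero ∷ suc (suc zero) ∷ suc (suc (suc (suc d))) ∷ []) _ (_ , _ , _ , (_ , ()) , _)

-- The index `n` records where the quadruple stands. It is needed to match the pieces of an
-- evacuated word with the pieces of a reversed one by their lengths.
record DualPair (n : ℕ) (u u' : List ℕ) : Set where
  constructor dualPair
  field
    before quad after : List ℕ
    isBefore : length before ≡ n
    isQuad   : length quad ≡ 4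
    isFirst  : u ≡ before ++ quad ++ after
    isSecond : u' ≡ before ++ dual quad ++ after

-- By `ev-∷` the first letter of `A` slides through the word; `pass-dual` carries the equivalence
-- over to the slid word, and the vacated diagonal is the same for both words. When `A` is used up,
-- the quadruple is evacuated on its own and then switched with `B`. In the result the letters
-- behind the quadruple have come before it.
ev-dual : ∀ A q B → length q ≡ 4 → Legal empty (A ++ q ++ B) →
          DualPair (length B) (ev (A ++ q ++ B)) (ev (A ++ dual q ++ B))
ev-dual A q B e l = go (length A) A q B refl e l
  where
  go : ∀ n A q B → length A ≡ n → length q ≡ 4 → Legal empty (A ++ q ++ B) →
       DualPair (length B) (ev (A ++ q ++ B)) (ev (A ++ dual q ++ B))
  go _ [] q B _ e l = dualPair (ev (swT X B)) (swX X B) []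
      (trans (length-evs [] (swT X B)) (length-swT X B))
      (trans (length-swX X B) eX)
      (trans (ev-++ q B) (cong (ev (swT X B) ++_) (sym (++-identityʳ _))))
      (trans (ev-++ (dual q) B) (trans (cong (λ Y → ev (swT Y B) ++ swX Y B) (ev-dual-initial q e (proj₁ (Legal-++ empty q l))))
        (cong₂ _++_ (cong ev (proj₁ sw)) (trans (proj₂ sw) (sym (++-identityʳ _))))))
    where
    X = ev q
    eX = trans (length-evs [] q) e
    sw = sw-dual empty X B eX (~-Legal (~++ʳ B (ev-~ q)) {empty} l)
  go (suc n) (v ∷ A) q B eA e l = extend (go n A' q' B' (trans (length-passW v A) (suc-injective eA))
        (trans (length-passW u q) e) (subst (Legal empty) split legal'))
    where
    u = passV v A
    A' = passW v A
    q' = passW u q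
    B' = passW (passV u q) B
    legal-at-u : Legal (adv empty A') (u ∷ q ++ B)
    legal-at-u = proj₂ (Legal-++ empty A' (~-Legal (pass-~ v A (q ++ B)) {empty} l))
    d = pass-dual u q e (Legal-alternating _ (u ∷ q) (proj₁ (Legal-++ (adv empty A') (u ∷ q) legal-at-u)))
    split : passW v (A ++ q ++ B) ≡ A' ++ q' ++ B'
    split = trans (passW-++ v A (q ++ B)) (cong (A' ++_) (passW-++ u q B))
    split-dual : passW v (A ++ dual q ++ B) ≡ A' ++ dual q' ++ B'
    split-dual = trans (passW-++ v A (dual q ++ B)) (cong (A' ++_) (trans (passW-++ u (dual q) B)
      (cong₂ (λ a b → a ++ passW b B) (PassDual.passW-dual d) (PassDual.passV-dual d))))
    last-eq : passV v (A ++ dual q ++ B) ≡ passV v (A ++ q ++ B)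
    last-eq = trans (passV-++ v A (dual q ++ B)) (trans (passV-++ u (dual q) B)
      (trans (cong (λ b → passV b B) (PassDual.passV-dual d)) (sym (trans (passV-++ v A (q ++ B)) (passV-++ u q B)))))
    legal' : Legal empty (passW v (A ++ q ++ B))
    legal' = proj₁ (Legal-++ empty _ (~-Legal (pass-~ v (A ++ q ++ B) [])
      {empty} (subst (λ z → Legal empty (v ∷ z)) (sym (++-identityʳ (A ++ q ++ B))) l)))
    w = passV v (A ++ q ++ B)
    reassoc : ∀ (X Y Z : List ℕ) → (X ++ Y ++ Z) ++ [ w ] ≡ X ++ Y ++ (Z ∷ʳ w)
    reassoc X Y Z = trans (++-assoc X (Y ++ Z) [ w ]) (cong (X ++_) (++-assoc Y Z [ w ]))
    extend : DualPair (length B') (ev (A' ++ q' ++ B')) (ev (A' ++ dual q' ++ B')) →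
             DualPair (length B) (ev (v ∷ A ++ q ++ B)) (ev (v ∷ A ++ dual q ++ B))
    extend (dualPair C x E a b c d) = dualPair C x (E ∷ʳ w) (trans a (length-passW _ B)) b
      (trans (ev-∷ v (A ++ q ++ B)) (trans (cong (λ z → ev z ++ [ w ]) split)
        (trans (cong (_++ [ w ]) c) (reassoc C x E))))
      (trans (ev-∷ v (A ++ dual q ++ B)) (trans (cong₂ (λ z y → ev z ++ [ y ]) split-dual last-eq)
        (trans (cong (_++ [ w ]) d) (reassoc C (dual x) E))))

-- Connecting all words with the same final counts.

-- Dual equivalences which exchange the last two of four letters; they suffice
-- to connect all words with the same final state.

data Conn : List ℕ → List ℕ → Set where
  crefl  : ∀ {w} → Conn w w
  ctrans : ∀ {u v w} → Conn u v → Conn v w → Conn u w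
  cmove  : ∀ A {x y l h} B → x < y → l < y → y < h → Conn (A ++ x ∷ y ∷ l ∷ h ∷ B) (A ++ x ∷ y ∷ h ∷ l ∷ B)
  cmove⁻ : ∀ A {x y l h} B → x < y → l < y → y < h → Conn (A ++ x ∷ y ∷ h ∷ l ∷ B) (A ++ x ∷ y ∷ l ∷ h ∷ B)

csym : ∀ {u v} → Conn u v → Conn v u
csym crefl = crefl
csym (ctrans p q) = ctrans (csym q) (csym p)
csym (cmove A B p q r) = cmove⁻ A B p q r
csym (cmove⁻ A B p q r) = cmove A B p q r

csnoc : ∀ {u v} t → Conn u v → Conn (u ++ t) (v ++ t)
csnoc t crefl = crefl
csnoc t (ctrans p q) = ctrans (csnoc t p) (csnoc t q)
csnoc t (cmove A {x} {y} {l} {h} B p q r)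
  rewrite ++-assoc A (x ∷ y ∷ l ∷ h ∷ B) t | ++-assoc A (x ∷ y ∷ h ∷ l ∷ B) t = cmove A (B ++ t) p q r
csnoc t (cmove⁻ A {x} {y} {l} {h} B p q r)
  rewrite ++-assoc A (x ∷ y ∷ l ∷ h ∷ B) t | ++-assoc A (x ∷ y ∷ h ∷ l ∷ B) t = cmove⁻ A (B ++ t) p q r

between-far : ∀ {l y h} → l < y → y < h → adj l h ≡ false
between-far p q = far-< (≤-<-trans p q)

Conn-~ : ∀ {u v} → Conn u v → u ~ v
Conn-~ crefl = ~refl
Conn-~ (ctrans p q) = ~trans (Conn-~ p) (Conn-~ q)
Conn-~ (cmove A B p q r) = ~++ˡ A (~cons _ (~cons _ (~swap (between-far q r))))
Conn-~ (cmove⁻ A B p q r) = ~++ˡ A (~cons _ (~cons _ (~sym (~swap (between-far q r)))))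

++-cancel-length : ∀ {A B : List ℕ} {C D} → length A ≡ length B → A ++ C ≡ B ++ D → (A ≡ B) × (C ≡ D)
++-cancel-length {[]} {[]} _ e = refl , e
++-cancel-length {a ∷ A} {b ∷ B} p e with ∷-injective e
... | refl , e' with ++-cancel-length {A} {B} (suc-injective p) e'
...   | refl , e'' = refl , e''

reverse-quad : ∀ (A q B : List ℕ) → reverse (A ++ q ++ B) ≡ reverse B ++ reverse q ++ reverse A
reverse-quad A q B = trans (reverse-++ A (q ++ B))
  (trans (cong (_++ reverse A) (reverse-++ q B)) (++-assoc (reverse B) (reverse q) (reverse A)))

module _ {x y l h : ℕ} (p : x < y) (q : l < y) (r : y < h) where

  -- With the three companions below: on the windows used by `Conn`, `dual` is the exchange of the
  -- two outer letters, whether the window is read forwards or backwards, so it commutes with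
  -- `reverse` there.
  dual-lh : dual (x ∷ y ∷ l ∷ h ∷ []) ≡ x ∷ y ∷ h ∷ l ∷ []
  dual-lh rewrite ≤⇒<ᵇ-false (<⇒≤ q) | <⇒<ᵇ-true p | <⇒<ᵇ-true q | ≤⇒<ᵇ-false (<⇒≤ (<-trans q r)) | <⇒<ᵇ-true r = refl

  dual-hl : dual (x ∷ y ∷ h ∷ l ∷ []) ≡ x ∷ y ∷ l ∷ h ∷ []
  dual-hl rewrite <⇒<ᵇ-true r | <⇒<ᵇ-true (<-trans q r) | <⇒<ᵇ-true p | <⇒<ᵇ-true q = refl

  dual-reverse-lh : dual (h ∷ l ∷ y ∷ x ∷ []) ≡ l ∷ h ∷ y ∷ x ∷ []
  dual-reverse-lh rewrite <⇒<ᵇ-true q | <⇒<ᵇ-true p | ≤⇒<ᵇ-false (<⇒≤ (<-trans q r)) | <⇒<ᵇ-true r = refl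

  dual-reverse-hl : dual (l ∷ h ∷ y ∷ x ∷ []) ≡ h ∷ l ∷ y ∷ x ∷ []
  dual-reverse-hl rewrite ≤⇒<ᵇ-false (<⇒≤ r) | <⇒<ᵇ-true (<-trans q r) | <⇒<ᵇ-true r | <⇒<ᵇ-true p | <⇒<ᵇ-true q = refl

-- `ev-dual` presents both evacuations with a common beginning and end. Comparing the first with the
-- reversed word, piece by piece and by length, identifies these as `reverse B` and `reverse A`
-- around `reverse q`; the second has `dual (reverse q)` in the middle.
ev-reverse-dual : ∀ A q B → length q ≡ 4 → dual (reverse q) ≡ reverse (dual q) → Legal empty (A ++ q ++ B) →
  ev (A ++ q ++ B) ≡ reverse (A ++ q ++ B) → ev (A ++ dual q ++ B) ≡ reverse (A ++ dual q ++ B)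
ev-reverse-dual A q B e r l g with ev-dual A q B e l
... | dualPair C x E lC lx c d
  with ++-cancel-length {C} {reverse B} (trans lC (sym (length-reverse B))) (trans (sym c) (trans g (reverse-quad A q B)))
... | refl , e₁ with ++-cancel-length {x} {reverse q} (trans lx (trans (sym e) (sym (length-reverse q)))) e₁
... | refl , refl = trans d (trans (cong (λ z → reverse B ++ z ++ reverse A) r) (sym (reverse-quad A (dual q) B)))

ev-reverse-Conn : ∀ {u v} → Conn u v → Legal empty u → ev u ≡ reverse u → ev v ≡ reverse v
ev-reverse-Conn crefl l g = g
ev-reverse-Conn (ctrans p q) l g = ev-reverse-Conn q (~-Legal (Conn-~ p) l) (ev-reverse-Conn p l g)
ev-reverse-Conn (cmove A {x} {y} {l} {h} B p q r) lg g =
  subst (λ z → ev (A ++ z ++ B) ≡ reverse (A ++ z ++ B)) (dual-lh p q r)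
    (ev-reverse-dual A (x ∷ y ∷ l ∷ h ∷ []) B refl
      (trans (dual-reverse-lh p q r) (cong reverse (sym (dual-lh p q r)))) lg g)
ev-reverse-Conn (cmove⁻ A {x} {y} {l} {h} B p q r) lg g =
  subst (λ z → ev (A ++ z ++ B) ≡ reverse (A ++ z ++ B)) (dual-hl p q r)
    (ev-reverse-dual A (x ∷ y ∷ h ∷ l ∷ []) B refl
      (trans (dual-reverse-hl p q r) (cong reverse (sym (dual-hl p q r)))) lg g)

-- These are the counts of a shifted shape: `m k` is the number of rows longer than `k`, so
-- `m k - m (suc k)` is the number of rows of length `suc k`, which is 0 or 1 in a strict partition.
Shape : State → Set
Shape m = ∀ k → (m k ≡ m (suc k)) ⊎ (m k ≡ suc (m (suc k)))

Shape-bump : ∀ {m x} → Shape m → Step m x → Shape (bump x m)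
Shape-bump {m} {x} sh st@(n , w) k with <-cmp k x
... | tri≈ _ refl _ = inj₂ (trans (bump-same k m) (cong suc (trans n (sym (bump-diff k (suc k) m (1+n≢n ∘ sym))))))
... | tri> _ ne lt = subst₂ (λ a b → (a ≡ b) ⊎ (a ≡ suc b))
  (sym (bump-diff x k m (ne ∘ sym))) (sym (bump-diff x (suc k) m (<⇒≢ (<-trans lt (n<1+n k))))) (sh k)
... | tri< lt ne _ with m≤n⇒m<n∨m≡n lt
...   | inj₁ lt' = subst₂ (λ a b → (a ≡ b) ⊎ (a ≡ suc b))
  (sym (bump-diff x k m (ne ∘ sym))) (sym (bump-diff x (suc k) m (>⇒≢ lt'))) (sh k)
...   | inj₂ refl = inj₁ (Step-tight m (suc k) st)

Shape-adv : ∀ {m} w → Shape m → Legal m w → Shape (adv m w)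
Shape-adv [] sh _ = sh
Shape-adv (x ∷ w) sh (s , l) = Shape-adv w (Shape-bump sh s) l

Shape-empty : Shape empty
Shape-empty k = inj₁ refl

adv-≤ : ∀ m w k → m k ≤ adv m w k
adv-≤ m [] k = ≤-refl
adv-≤ m (x ∷ w) k = ≤-trans (bump-≤ x) (adv-≤ (bump x m) w k)
  where
  bump-≤ : ∀ x → m k ≤ bump x m k
  bump-≤ x with x ≡ᵇ k
  ... | true = n≤1+n _
  ... | false = ≤-refl

adv-∈ : ∀ m {w k} → k ∈ w → m k < adv m w k
adv-∈ m {x ∷ w} (here refl) = ≤-trans (≤-reflexive (sym (bump-same x m))) (adv-≤ (bump x m) w x)
adv-∈ m {x ∷ w} {k} (there p) = ≤-<-trans (adv-≤ m [ x ] k) (adv-∈ (bump x m) p)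

adv-∉ : ∀ m {w k} → k ∉ w → adv m w k ≡ m k
adv-∉ m {[]} _ = refl
adv-∉ m {x ∷ w} {k} n = trans (adv-∉ (bump x m) (n ∘ there)) (bump-diff x k m (λ e → n (here (sym e))))

record Removable (c : State) (k : ℕ) : Set where
  constructor removable
  field
    drop  : c k ≡ suc (c (suc k))
    tight : Tight c k

Tight-cong : ∀ {c d : State} k → c ≗ d → Tight c k → Tight d k
Tight-cong zero e t = tt
Tight-cong (suc k) e t = trans (sym (e k)) (trans t (e (suc k)))

Removable-cong : ∀ {c d : State} {k} → c ≗ d → Removable c k → Removable d k
Removable-cong {k = k} e (removable r t) = removable (trans (sym (e k)) (trans r (cong suc (e (suc k))))) (Tight-cong k e t)

Step-removable : ∀ {m k} → Step m k → Removable (bump k m) k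
Step-removable {m} {k} s@(n , _) = removable
  (trans (bump-same k m) (cong suc (trans n (sym (bump-diff k (suc k) m (1+n≢n ∘ sym)))))) (Step-tight m k s)

~-snoc : ∀ k w → (∀ {x} → x ∈ w → adj k x ≡ false) → k ∷ w ~ w ∷ʳ k
~-snoc k [] _ = ~refl
~-snoc k (x ∷ w) f = ~trans (~swap (f (here refl))) (~cons x (~-snoc k w (f ∘ there)))

-- Behind its last occurrence `k` meets no adjacent letter: an addition on diagonal `suc k` would
-- violate `drop`, one on the diagonal before `k` would violate `tight`. So this occurrence commutes
-- to the end.
pull : ∀ m U k → Legal m U → Removable (adv m U) k → k ∈ U → ∃ λ W → U ~ W ∷ʳ k
pull m (x ∷ U) k (s , l) r p with k ∈? U
pull m (x ∷ U) k (s , l) r p | yes q with pull (bump x m) U k l r q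
... | W , e = x ∷ W , ~cons x e
pull m (x ∷ U) k (s , l) r (there p) | no q = contradiction p q
pull m (x ∷ U) .x (s@(n , _) , l) (removable r t) (here refl) | no q = U , ~-snoc x U far
  where
  m' = bump x m
  c = adv m' U
  top : c x ≡ suc (m' (suc x))
  top = trans (adv-∉ m' q) (Removable.drop (Step-removable {m} s))
  left : ∀ y → x ≡ suc y → c y ≡ m' y
  left y refl = trans t (trans (adv-∉ m' q) (sym (Step-tight m x s)))
  far : ∀ {y} → y ∈ U → adj x y ≡ false
  far {y} y∈ = adj-far {x} {y} λ
    { up → <⇒≢ (adv-∈ m' y∈) (suc-injective (trans (sym top) r))
    ; down → <⇒≢ (adv-∈ m' y∈) (sym (left y refl)) }

bump-injective : ∀ k {a b : State} → bump k a ≗ bump k b → a ≗ b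
bump-injective k e l with k ≡ᵇ l | e l
... | true | q = suc-injective q
... | false | q = q

adv-snoc : ∀ m w k → adv m (w ∷ʳ k) ≗ bump k (adv m w)
adv-snoc m w k l = cong (λ f → f l) (adv-++ m w [ k ])

Legal-snoc : ∀ m w k → Legal m (w ∷ʳ k) → Legal m w × Step (adv m w) k
Legal-snoc m w k l with Legal-++ m w l
... | a , s , _ = a , s

∈-removable : ∀ {U k} → Removable (adv empty U) k → k ∈ U
∈-removable {U} {k} (removable r _) with k ∈? U
... | yes p = p
... | no q = contradiction (trans (sym (adv-∉ empty q)) r) λ ()

pull′ : ∀ {U k} → Legal empty U → Removable (adv empty U) k → ∃ λ W → U ~ W ∷ʳ k
pull′ {U} {k} l r = pull empty U k l r (∈-removable r)

Removable-bump⁻ : ∀ {c l k} → l ≢ k → adj l k ≡ false → Removable (bump l c) k → Removable c k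
Removable-bump⁻ {c} {l} {k} ne f (removable r t) = removable
  (trans (sym (bump-diff l k c ne)) (trans r (cong suc (bump-diff l (suc k) c (far-down l k f))))) (tight′ k ne f t)
  where
  tight′ : ∀ k → l ≢ k → adj l k ≡ false → Tight (bump l c) k → Tight c k
  tight′ zero ne f t = tt
  tight′ (suc j) ne f t = trans (sym (bump-diff l j c (λ e → far-up l (suc j) f (cong suc (sym e)))))
    (trans t (bump-diff l (suc j) c ne))

removable-far : ∀ {c l h} → l < h → Removable c l → Removable c h → suc l < h
removable-far {c} {l} {h} lt (removable r _) (removable _ t) with m≤n⇒m<n∨m≡n lt
... | inj₁ q = q
... | inj₂ refl = contradiction (trans (sym t) r) (1+n≢n ∘ sym)

-- Walking upwards from a flat place, the first drop is a removable corner, since the place just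
-- before it is flat.
find-above : ∀ {c} → Shape c → ∀ d l → c l ≡ c (suc l) → c (l + suc d) ≡ suc (c (suc (l + suc d))) →
             ∃ λ y → l < y × y ≤ l + suc d × Removable c y
find-above {c} sh d l flat drop with sh (suc l)
... | inj₂ e = suc l , ≤-refl , ≤-trans (s≤s (m≤m+n l d)) (≤-reflexive (sym (+-suc l d))) , removable e flat
find-above {c} sh zero l flat drop | inj₁ e rewrite +-comm l 1 =
  contradiction (trans (sym e) drop) (1+n≢n ∘ sym)
find-above {c} sh (suc d) l flat drop | inj₁ e
  with find-above sh d (suc l) e (subst (λ z → c z ≡ suc (c (suc z))) (+-suc l (suc d)) drop)
... | y , lt , le , r = y , <-trans (n<1+n l) lt , ≤-trans le (≤-reflexive (sym (+-suc l (suc d)))) , r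

find-below : ∀ {c} → Shape c → ∀ i → c i ≡ suc (c (suc i)) → ∃ λ x → x ≤ i × Removable c x
find-below sh zero drop = 0 , z≤n , removable drop tt
find-below {c} sh (suc i) drop with sh i
... | inj₁ e = suc i , ≤-refl , removable drop e
... | inj₂ e with find-below sh i e
...   | x , le , r = x , m≤n⇒m≤1+n le , r

-- `l` and `h` are two removable corners of the final shape. The letters `x` and `y` in front of
-- them turn the exchange of `l` and `h` into a dual equivalence, that is, into a step of `Conn`.
record Window (U : List ℕ) (l h : ℕ) : Set where
  constructor window
  field
    prefix : List ℕ
    x y    : ℕ
    x<y    : x < y
    l<y    : l < y
    y<h    : y < h
    equiv  : U ~ prefix ++ x ∷ y ∷ l ∷ h ∷ []

step-below : ∀ m y {l} → l < y → Shape m → Step m y → ∃ λ x → x < y × Removable m x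
step-below m (suc i) _ sh (_ , w) with find-below sh i w
... | x , le , r = x , s≤s le , r

step-above : ∀ m {l h} → suc l < h → Shape m → Step m l → Step m h → ∃ λ y → l < y × y < h × Removable m y
step-above m {l} {h} lt sh (flat , _) s with m≤n⇒∃[o]m+o≡n lt
... | d , refl with find-above sh d l flat (subst (λ z → m z ≡ suc (m (suc z))) (sym (+-suc l d)) (proj₂ s))
...   | y , l<y , le , r = y , l<y , s≤s (≤-trans le (≤-reflexive (+-suc l d))) , r

window-end : ∀ U W x y l h → U ~ ((W ∷ʳ y) ∷ʳ l) ∷ʳ h → x < y → l < y → y < h →
             (∃ λ X → W ~ X ∷ʳ x) → Window U l h
window-end U W x y l h e p q r (X , f) = window X x y p q r
  (subst (U ~_) assoc (~trans e (~++ʳ [ h ] (~++ʳ [ l ] (~++ʳ [ y ] f)))))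
  where
  assoc : (((X ∷ʳ x) ∷ʳ y) ∷ʳ l) ∷ʳ h ≡ X ++ x ∷ y ∷ l ∷ h ∷ []
  assoc = trans (cong (λ z → (z ∷ʳ l) ∷ʳ h) (++-assoc X [ x ] [ y ]))
    (trans (cong (_∷ʳ h) (++-assoc X (x ∷ y ∷ []) [ l ])) (++-assoc X (x ∷ y ∷ l ∷ []) [ h ]))

window-mid : ∀ U W y l h → U ~ (W ∷ʳ l) ∷ʳ h → Legal empty W → l < y → y < h →
             (∃ λ V → W ~ V ∷ʳ y) → Window U l h
window-mid U W y l h e lW q r (V , f)
  with Legal-snoc empty V y (~-Legal f lW)
... | lV , s with step-below (adv empty V) y q (Shape-adv V Shape-empty lV) s
...   | x , p , rx = window-end U V x y l h (~trans e (~++ʳ [ h ] (~++ʳ [ l ] f))) p q r (pull′ lV rx)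

window-start : ∀ U W l h → suc l < h → U ~ (W ∷ʳ l) ∷ʳ h → Legal empty W →
               Step (adv empty W) l → Step (adv empty W) h → Window U l h
window-start U W l h far e lW sl sh with step-above (adv empty W) far (Shape-adv W Shape-empty lW) sl sh
... | y , q , r , ry = window-mid U W y l h e lW q r (pull′ lW ry)

window-lh : ∀ U V l h → l < h → suc l < h → U ~ V ∷ʳ h → Legal empty V → Step (adv empty V) h →
            (∃ λ W → V ~ W ∷ʳ l) → Window U l h
window-lh U V l h lt far e lV s (W , f) with Legal-snoc empty W l (~-Legal f lV)
... | lW , sl = window-start U W l h far (~trans e (~++ʳ [ h ] f)) lW sl
  (Step-bump⁻ l h (<⇒≢ lt) (far-< far)
    (Step-cong (λ k → trans (~-adv f empty k) (adv-snoc empty W l k)) h s))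

window-h : ∀ U l h → l < h → Legal empty U → Removable (adv empty U) l → Removable (adv empty U) h →
           (∃ λ V → U ~ V ∷ʳ h) → Window U l h
window-h U l h lt lU rl rh (V , e) with Legal-snoc empty V h (~-Legal e lU)
... | lV , s = window-lh U V l h lt far e lV s (pull′ lV
  (Removable-bump⁻ (>⇒≢ lt) (trans (adj-sym h l) (far-< far))
    (Removable-cong (λ k → trans (~-adv e empty k) (adv-snoc empty V h k)) rl)))
  where far = removable-far lt rl rh

-- Remove the corners `h` and `l`. Now both places can receive a box, and between two such places
-- lies a removable corner `y`. Remove that one as well: since `y` is positive, its box had a
-- western neighbour, and descending from there one finds a removable corner `x` below `y`.
find-window : ∀ U l h → l < h → Legal empty U → Removable (adv empty U) l → Removable (adv empty U) h → Window U l h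
find-window U l h lt lU rl rh = window-h U l h lt lU rl rh (pull′ lU rh)

~-length : ∀ {u v} → u ~ v → length u ≡ length v
~-length ~refl = refl
~-length (~trans p q) = trans (~-length p) (~-length q)
~-length (~cons x p) = cong suc (~-length p)
~-length (~swap f) = refl

length-snoc : ∀ (w : List ℕ) k → length (w ∷ʳ k) ≡ suc (length w)
length-snoc w k = trans (length-++ w) (+-comm (length w) 1)

-- Induction on the length. Words with the same last letter are connected in front of it. If the
-- last letters are `l < h`, a window yields two intermediate words that differ by one dual
-- equivalence, one ending in `l` and the other in `h`; each is connected with a given word by the
-- first case.
connected : ∀ n U V → length U ≡ n → length V ≡ n → Legal empty U → Legal empty V →
            adv empty U ≗ adv empty V → Conn U V

connected-< : ∀ n U l V h → l < h → length U ≡ n → length V ≡ n →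
              Legal empty (U ∷ʳ l) → Legal empty (V ∷ʳ h) →
              adv empty (U ∷ʳ l) ≗ adv empty (V ∷ʳ h) → Conn (U ∷ʳ l) (V ∷ʳ h)

connected zero [] [] _ _ _ _ _ = crefl
connected (suc n) U V eU eV lU lV e with initLast U | initLast V
... | U' ∷ʳ′ l | V' ∷ʳ′ h
  with suc-injective (trans (sym (length-snoc U' l)) eU) | suc-injective (trans (sym (length-snoc V' h)) eV)
...   | eU' | eV' with <-cmp l h
...     | tri< lt _ _ = connected-< n U' l V' h lt eU' eV' lU lV e
...     | tri> _ _ lt = csym (connected-< n V' h U' l lt eV' eU' lV lU (λ k → sym (e k)))
...     | tri≈ _ refl _ = csnoc [ l ] (connected n U' V' eU' eV'
            (proj₁ (Legal-snoc empty U' l lU)) (proj₁ (Legal-snoc empty V' l lV))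
            (bump-injective l {adv empty U'} {adv empty V'} (λ k → trans (sym (adv-snoc empty U' l k)) (trans (e k) (adv-snoc empty V' l k)))))

snoc-removable : ∀ U l → Legal empty (U ∷ʳ l) → Removable (adv empty (U ∷ʳ l)) l
snoc-removable U l lU = Removable-cong (λ k → sym (adv-snoc empty U l k))
  (Step-removable {adv empty U} {l} (proj₂ (Legal-snoc empty U l lU)))

snoc-injective : ∀ U X l → adv empty (U ∷ʳ l) ≗ adv empty (X ∷ʳ l) → adv empty U ≗ adv empty X
snoc-injective U X l e = bump-injective l {adv empty U} {adv empty X}
  (λ k → trans (sym (adv-snoc empty U l k)) (trans (e k) (adv-snoc empty X l k)))

connected-snoc : ∀ n U X l → (∀ U V → length U ≡ n → length V ≡ n → Legal empty U → Legal empty V →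
                   adv empty U ≗ adv empty V → Conn U V) →
                 length U ≡ n → length (X ∷ʳ l) ≡ suc n → Legal empty (U ∷ʳ l) → Legal empty (X ∷ʳ l) →
                 adv empty (U ∷ʳ l) ≗ adv empty (X ∷ʳ l) → Conn (U ∷ʳ l) (X ∷ʳ l)
connected-snoc n U X l ih eU eX lU lX e = csnoc [ l ] (ih U X eU
  (suc-injective (trans (sym (length-snoc X l)) eX))
  (proj₁ (Legal-snoc empty U l lU)) (proj₁ (Legal-snoc empty X l lX)) (snoc-injective U X l e))

connected-window : ∀ n U l V h → (∀ U V → length U ≡ n → length V ≡ n → Legal empty U → Legal empty V →
                   adv empty U ≗ adv empty V → Conn U V) → length U ≡ n → length V ≡ n →
              Legal empty (U ∷ʳ l) → Legal empty (V ∷ʳ h) →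
              adv empty (U ∷ʳ l) ≗ adv empty (V ∷ʳ h) → Window (U ∷ʳ l) l h → Conn (U ∷ʳ l) (V ∷ʳ h)
connected-window n U l V h ih eU eV lU lV e (window X x y x<y l<y y<h q) =
  ctrans (subst (Conn (U ∷ʳ l)) (++-assoc X (x ∷ y ∷ h ∷ []) [ l ])
      (connected-snoc n U (X ++ x ∷ y ∷ h ∷ []) l ih eU len₂ lU (~-Legal q₂ lU) (~-adv q₂ empty)))
    (ctrans (cmove⁻ X [] x<y l<y y<h)
      (csym (subst (Conn (V ∷ʳ h)) (++-assoc X (x ∷ y ∷ l ∷ []) [ h ])
        (connected-snoc n V (X ++ x ∷ y ∷ l ∷ []) h ih eV len₁ lV (~-Legal q₁ lU)
          (λ k → trans (sym (e k)) (~-adv q₁ empty k))))))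
  where
  q₁ : U ∷ʳ l ~ (X ++ x ∷ y ∷ l ∷ []) ∷ʳ h
  q₁ = subst (U ∷ʳ l ~_) (sym (++-assoc X (x ∷ y ∷ l ∷ []) [ h ])) q
  q₂ : U ∷ʳ l ~ (X ++ x ∷ y ∷ h ∷ []) ∷ʳ l
  q₂ = subst (U ∷ʳ l ~_) (sym (++-assoc X (x ∷ y ∷ h ∷ []) [ l ]))
         (~trans q (~++ˡ X (~cons x (~cons y (~swap (between-far l<y y<h))))))
  len₁ = trans (sym (~-length q₁)) (trans (length-snoc U l) (cong suc eU))
  len₂ = trans (sym (~-length q₂)) (trans (length-snoc U l) (cong suc eU))

connected-< n U l V h lt eU eV lU lV e =
  connected-window n U l V h (connected n) eU eV lU lV e
    (find-window (U ∷ʳ l) l h lt lU (snoc-removable U l lU)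
      (Removable-cong (λ k → sym (e k)) (snoc-removable V h lV)))

-- Evacuation of the staircase.

range : ℕ → ℕ → List ℕ
range a zero = []
range a (suc n) = a ∷ range (suc a) n

range-snoc : ∀ a n → range a (suc n) ≡ range a n ∷ʳ (a + n)
range-snoc a zero rewrite +-identityʳ a = refl
range-snoc a (suc n) rewrite +-suc a n = cong (a ∷_) (range-snoc (suc a) n)

reverse-downFrom : ∀ n → reverse (downFrom n) ≡ range 0 n
reverse-downFrom zero = refl
reverse-downFrom (suc n) = trans (unfold-reverse n (downFrom n))
  (trans (cong (_∷ʳ n) (reverse-downFrom n)) (sym (range-snoc 0 n)))

-- Two fillings of the staircase with rows of lengths n, ..., 1: by columns, each downwards from
-- diagonal k to 0, and by rows, each from diagonal 0 onwards. They are reversals of each other as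
-- words, so it is enough that evacuation turns one into the other.
columns rows : ℕ → List ℕ
columns zero = []
columns (suc n) = columns n ++ downFrom (suc n)
rows zero = []
rows (suc n) = range 0 (suc n) ++ rows n

reverse-columns : ∀ n → reverse (columns n) ≡ rows n
reverse-columns zero = refl
reverse-columns (suc n) = trans (reverse-++ (columns n) (downFrom (suc n)))
  (cong₂ _++_ (reverse-downFrom (suc n)) (reverse-columns n))

ins-range : ∀ a n → (insH (a + n) (range a n) ≡ a) × (insT (a + n) (range a n) ≡ range (suc a) n)
ins-range a zero = +-identityʳ a , refl
ins-range a (suc n) rewrite +-suc a n with ins-range (suc a) n
... | p , q rewrite p | q | adj-up a = refl , refl

-- A single row has only one standard filling. Besides the staircase, this serves the smallest
-- letters of a tableau of normal shape, which always form a row.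
ev-range : ∀ n → ev (range 0 n) ≡ range 0 n
ev-range zero = refl
ev-range (suc n) = begin
  ev (range 0 (suc n))                    ≡⟨ cong ev (range-snoc 0 n) ⟩
  ev (range 0 n ∷ʳ n)                     ≡⟨ evs-++ʳ [] (range 0 n) [ n ] ⟩
  evs (ev (range 0 n)) [ n ]              ≡⟨ cong (λ z → evs z [ n ]) (ev-range n) ⟩
  insH n (range 0 n) ∷ insT n (range 0 n) ≡⟨ cong₂ _∷_ (proj₁ (ins-range 0 n)) (proj₂ (ins-range 0 n)) ⟩
  range 0 (suc n) ∎
  where open ≡-Reasoning

ins-far : ∀ h X → All (λ e → adj e h ≡ false) X → (insH h X ≡ h) × (insT h X ≡ X)
ins-far h [] [] = refl , refl
ins-far h (e ∷ X) (f ∷ fs) with ins-far h X fs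
... | p , q rewrite p | q | f = refl , refl

sw-far : ∀ X D → All (λ h → All (λ e → adj e h ≡ false) X) D → (swT X D ≡ D) × (swX X D ≡ X)
sw-far X [] [] = refl , refl
sw-far X (h ∷ D) (f ∷ fs) with ins-far h X f
... | p , q rewrite p | q with sw-far X D fs
...   | r , s rewrite r | s = refl , refl

range-all : ∀ {P : ℕ → Set} a n → (∀ {x} → a ≤ x → x < a + n → P x) → All P (range a n)
range-all a zero f = []
range-all a (suc n) f = f ≤-refl (m<m+n a (s≤s z≤n)) ∷
  range-all (suc a) n (λ p q → f (<⇒≤ p) (≤-trans q (≤-reflexive (sym (+-suc a n)))))

adj-far-> : ∀ {x y} → suc y < x → adj x y ≡ false
adj-far-> {x} {y} lt = trans (adj-sym x y) (far-< lt)

gap : ℕ → ℕ → List ℕ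
gap j d = range 0 j ++ range (suc j) d

-- Inserting j into 0 … j-1, j+1 … moves the gap one place to the right.
ins-gap : ∀ j d → (insH j (gap j (suc d)) ≡ suc j) × (insT j (gap j (suc d)) ≡ gap (suc j) d)
ins-gap j d rewrite insH-++ j (range 0 j) (range (suc j) (suc d)) | insT-++ j (range 0 j) (range (suc j) (suc d))
  with ins-far j (range (suc (suc j)) d) (range-all (suc (suc j)) d (λ p _ → adj-far-> p))
... | p , q rewrite p | q | adj-down j
  with ins-far (suc j) (range 0 j) (range-all 0 j (λ _ q → far-< (s≤s q)))
... | r , s rewrite r | s = refl , (begin
      range 0 j ++ j ∷ range (suc (suc j)) d     ≡⟨ ++-assoc (range 0 j) [ j ] _ ⟨
      (range 0 j ∷ʳ j) ++ range (suc (suc j)) d  ≡⟨ cong (_++ range (suc (suc j)) d) (range-snoc 0 j) ⟨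
      range 0 (suc j) ++ range (suc (suc j)) d   ∎)
  where open ≡-Reasoning

sw-gap : ∀ d j → (swT (gap j d) (range j d) ≡ range (suc j) d) × (swX (gap j d) (range j d) ≡ range 0 (j + d))
sw-gap zero j rewrite +-identityʳ j = refl , ++-identityʳ _
sw-gap (suc d) j with ins-gap j d
... | p , q rewrite p | q with sw-gap d (suc j)
...   | r , s rewrite r | +-suc j d = refl , s

sw-row : ∀ k → (swT (range 0 k) (k ∷ range 0 k) ≡ range 0 (suc k)) × (swX (range 0 k) (k ∷ range 0 k) ≡ range 0 k)
sw-row k with ins-range 0 k
... | p , q rewrite p | q with sw-gap k 0
...   | r , s rewrite r | s = refl , refl

-- n + d - 1, …, n
descend : ℕ → ℕ → List ℕ
descend n zero = []
descend n (suc d) = n + d ∷ descend n d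

descend-snoc : ∀ n d → descend n (suc d) ≡ descend (suc n) d ∷ʳ n
descend-snoc n zero = cong [_] (+-identityʳ n)
descend-snoc n (suc d) = cong₂ _∷_ (+-suc n d) (descend-snoc n d)

descend-all : ∀ {P : ℕ → Set} n d → (∀ {x} → n ≤ x → P x) → All P (descend n d)
descend-all n zero f = []
descend-all n (suc d) f = f (m≤m+n n d) ∷ descend-all n d f

descend-0 : ∀ d → descend 0 d ≡ downFrom d
descend-0 zero = refl
descend-0 (suc d) = cong (d ∷_) (descend-0 d)

-- The lower `suc k` boxes of a column are straightened into a row, while its `d` upper boxes and
-- the rows themselves survive. The induction needs `d`: the rows after the first see a column that
-- is too long by one, and the surplus letter `suc k` is used up by the first row (`sw-row`).
sw-rows : ∀ k d → (swT (rows k) (downFrom (suc k + d)) ≡ descend (suc k) d ++ range 0 (suc k))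
               × (swX (rows k) (downFrom (suc k + d)) ≡ rows k)
sw-rows zero d = trans (swT-[] _) (trans (sym (descend-0 (suc d))) (descend-snoc 0 d)) , swX-[] (downFrom (suc d))
sw-rows (suc k) d =
  trans (swT-++ row (rows k) t) (trans (cong (swT row) T≡) (trans (swT-++ʳ row D _)
    (trans (cong₂ (λ a b → a ++ swT b (suc k ∷ row)) (proj₁ far) (proj₂ far)) (cong (D ++_) (proj₁ (sw-row (suc k))))))) ,
  trans (swX-++ row (rows k) t) (cong₂ _++_ (trans (cong (swX row) T≡) (trans (swX-++ʳ row D _)
    (trans (cong (λ b → swX b (suc k ∷ row)) (proj₂ far)) (proj₂ (sw-row (suc k)))))) (proj₂ ih))
  where
  t = downFrom (suc (suc k) + d)
  row = range 0 (suc k)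
  D = descend (suc (suc k)) d
  ih : (swT (rows k) t ≡ descend (suc k) (suc d) ++ row) × (swX (rows k) t ≡ rows k)
  ih = subst (λ n → (swT (rows k) (downFrom (suc n)) ≡ descend (suc k) (suc d) ++ row)
                    × (swX (rows k) (downFrom (suc n)) ≡ rows k)) (+-suc k d) (sw-rows k (suc d))
  T≡ : swT (rows k) t ≡ D ++ suc k ∷ row
  T≡ = trans (proj₁ ih) (trans (cong (_++ row) (descend-snoc (suc k) d)) (++-assoc D [ suc k ] row))
  far : (swT row D ≡ D) × (swX row D ≡ row)
  far = sw-far row D (descend-all (suc (suc k)) d (λ p → range-all 0 (suc k) (λ _ q → far-< (≤-trans (s≤s q) p))))

ev-columns : ∀ n → ev (columns n) ≡ rows n
ev-columns zero = refl
ev-columns (suc n) = begin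
  ev (columns n ++ dn)                                    ≡⟨ ev-++ (columns n) dn ⟩
  ev (swT (ev (columns n)) dn) ++ swX (ev (columns n)) dn ≡⟨ cong (λ z → ev (swT z dn) ++ swX z dn) (ev-columns n) ⟩
  ev (swT (rows n) dn) ++ swX (rows n) dn                 ≡⟨ cong₂ (λ a b → ev a ++ b) T≡ X≡ ⟩
  ev (range 0 (suc n)) ++ rows n                          ≡⟨ cong (_++ rows n) (ev-range (suc n)) ⟩
  rows (suc n) ∎
  where
  open ≡-Reasoning
  dn = downFrom (suc n)
  dn≡ : downFrom (suc n + 0) ≡ dn
  dn≡ = cong downFrom (+-identityʳ (suc n))
  T≡ : swT (rows n) dn ≡ range 0 (suc n)
  T≡ = trans (cong (swT (rows n)) (sym dn≡)) (proj₁ (sw-rows n 0))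
  X≡ : swX (rows n) dn ≡ rows n
  X≡ = trans (cong (swX (rows n)) (sym dn≡)) (proj₂ (sw-rows n 0))

Legal-downFrom : ∀ j m → m j ≡ m (suc j) → (∀ k → k < j → m k ≡ suc (m (suc k))) → Legal m (downFrom (suc j))
Legal-downFrom zero m n w = (n , tt) , tt
Legal-downFrom (suc i) m n w = (n , w i ≤-refl) ,
  Legal-downFrom i (bump (suc i) m)
    (trans (bump-diff (suc i) i m 1+n≢n) (trans (w i ≤-refl) (sym (bump-same (suc i) m))))
    (λ k lt → trans (bump-diff (suc i) k m (>⇒≢ (<-trans lt (n<1+n i))))
      (trans (w k (<-trans lt (n<1+n i))) (cong suc (sym (bump-diff (suc i) (suc k) m (>⇒≢ (s≤s lt)))))))

adv-downFrom-≥ : ∀ j m {k} → j ≤ k → adv m (downFrom j) k ≡ m k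
adv-downFrom-≥ zero m le = refl
adv-downFrom-≥ (suc j) m {k} le = trans (adv-downFrom-≥ j (bump j m) (<⇒≤ le)) (bump-diff j k m (<⇒≢ le))

adv-downFrom-< : ∀ j m {k} → k < j → adv m (downFrom j) k ≡ suc (m k)
adv-downFrom-< (suc j) m {k} (s≤s le) with m≤n⇒m<n∨m≡n le
... | inj₁ lt = trans (adv-downFrom-< j (bump j m) lt) (cong suc (bump-diff j k m (>⇒≢ lt)))
... | inj₂ refl = trans (adv-downFrom-≥ j (bump j m) ≤-refl) (bump-same j m)

adv-columns : ∀ n → adv empty (columns n) ≗ (n ∸_)
adv-columns zero k = sym (0∸n≡0 k)
adv-columns (suc n) k rewrite adv-++ empty (columns n) (downFrom (suc n)) with ≤-<-connex k n
... | inj₁ le = trans (adv-downFrom-< (suc n) _ (s≤s le)) (trans (cong suc (adv-columns n k)) (sym (+-∸-assoc 1 le)))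
... | inj₂ lt = trans (adv-downFrom-≥ (suc n) _ lt) (trans (adv-columns n k)
  (trans (m≤n⇒m∸n≡0 (<⇒≤ lt)) (sym (m≤n⇒m∸n≡0 lt))))

Legal-columns : ∀ n → Legal empty (columns n)
Legal-columns zero = tt
Legal-columns (suc n) = ++-Legal empty (columns n) (Legal-columns n) (Legal-downFrom n _
  (trans (adv-columns n n) (trans (n∸n≡0 n) (trans (sym (m≤n⇒m∸n≡0 (n≤1+n n))) (sym (adv-columns n (suc n))))))
  (λ k lt → trans (adv-columns n k) (trans (drop n k lt) (cong suc (sym (adv-columns n (suc k)))))))
  where
  drop : ∀ n k → k < n → n ∸ k ≡ suc (n ∸ suc k)
  drop (suc n) k (s≤s le) = +-∸-assoc 1 le

-- The last letter of `V` is a removable corner of the common shape, so it can be pulled to the end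
-- of `U` and removed from both words.
same-length : ∀ n U V → length V ≡ n → Legal empty U → Legal empty V → adv empty U ≗ adv empty V →
              length U ≡ n
same-length zero [] [] _ _ _ _ = refl
same-length zero (x ∷ U) [] _ _ _ e = contradiction (sym (e x)) (<⇒≢ (adv-∈ empty {x ∷ U} (here refl)))
same-length (suc n) U V eV lU lV e with initLast V
... | V' ∷ʳ′ h with pull′ lU (Removable-cong (λ k → sym (e k)) (snoc-removable V' h lV))
...   | W , p = trans (~-length p) (trans (length-snoc W h) (cong suc
  (same-length n W V' (suc-injective (trans (sym (length-snoc V' h)) eV))
    (proj₁ (Legal-snoc empty W h (~-Legal p lU))) (proj₁ (Legal-snoc empty V' h lV))
    (snoc-injective W V' h (λ k → trans (sym (~-adv p empty k)) (e k))))))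

-- The filling by columns is the one computed case; every other legal filling is reached from it by
-- `Conn`, along which the property is inherited.
ev-staircase : ∀ n U → Legal empty U → adv empty U ≗ (n ∸_) → ev U ≡ reverse U
ev-staircase n U l e = ev-reverse-Conn
  (connected (length (columns n)) (columns n) U refl
    (same-length _ U (columns n) refl l (Legal-columns n) (λ k → trans (e k) (sym (adv-columns n k))))
    (Legal-columns n) l (λ k → trans (adv-columns n k) (sym (e k))))
  (Legal-columns n) (trans (ev-columns n) (sym (reverse-columns n)))

-- Embed b followed by r in the staircase, after replacing b by its evacuation.
rect-ev : ∀ n b r → Legal empty (b ++ r) → adv empty (b ++ r) ≗ (n ∸_) → swT b r ≡ ev (reverse r)
rect-ev n b r l e = trans (sym (ev-involutive (swT b r))) (cong ev ev-swT)
  where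
  c : b ++ r ~ ev b ++ r
  c = ~++ʳ r (ev-~ b)
  whole : ev (ev b ++ r) ≡ reverse (ev b ++ r)
  whole = ev-staircase n (ev b ++ r) (~-Legal c l) (λ k → trans (sym (~-adv c empty k)) (e k))
  -- By `ev-++` the evacuation of `ev b ++ r` begins with `ev (swT b r)`, because `ev (ev b)` is `b`
  -- again; its reversal begins with `reverse r`. Both beginnings have the same length.
  split : ev (swT b r) ++ swX b r ≡ reverse r ++ reverse (ev b)
  split = trans (sym (trans (ev-++ (ev b) r) (cong (λ z → ev (swT z r) ++ swX z r) (ev-involutive b))))
            (trans whole (reverse-++ (ev b) r))
  ev-swT : ev (swT b r) ≡ reverse r
  ev-swT = proj₁ (++-cancel-length {ev (swT b r)} {reverse r}
    (trans (length-evs [] (swT b r)) (trans (length-swT b r) (sym (length-reverse r)))) split)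

-- Fillings coded by words.

-- A filling is coded by its entries in the order of standardization, each
-- with its diagonal.

Code : Set → Set
Code A = List (ℕ × A)

module _ {A : Set} where

  labels : Code A → List ℕ
  labels = map proj₁

  cells : State → Code A → Fill A
  cells m [] = []
  cells m ((k , x) ∷ L) = ((suc (m k) , suc (m k) + k) , x) ∷ cells (bump k m) L

  -- Lookup by row and diagonal instead of row and column: the row is compared with a count, and no
  -- subtraction of coordinates is needed.
  look : State → Code A → ℕ → ℕ → Maybe A
  look m [] i k = nothing
  look m ((l , x) ∷ L) i k = if (l ≡ᵇ k) ∧ (suc (m k) ≡ᵇ i) then just x else look (bump l m) L i k

  first : ℕ → Code A → Maybe A
  first k [] = nothing
  first k ((l , x) ∷ L) = if l ≡ᵇ k then just x else first k L

  at-cells : ∀ m L i k → at (cells m L) i (i + k) ≡ look m L i k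
  at-cells m [] i k = refl
  at-cells m ((l , x) ∷ L) i k with l ≡ᵇ k in e
  ... | true rewrite ≡ᵇ-true {l} {k} e with suc (m k) ≡ᵇ i in e'
  ...   | true rewrite sym (≡ᵇ-true {suc (m k)} {i} e') | ≡ᵇ-refl (m k + k) = refl
  ...   | false = at-cells (bump k m) L i k
  at-cells m ((l , x) ∷ L) i k | false with suc (m l) ≡ᵇ i in e'
  ...   | false = at-cells (bump l m) L i k
  ...   | true rewrite sym (≡ᵇ-true {suc (m l)} {i} e')
               | ≡ᵇ-false {m l + l} {m l + k} (λ q → ≡ᵇ-false⁻ {l} {k} e (+-cancelˡ-≡ (m l) l k q)) =
             at-cells (bump l m) L (suc (m l)) k

  at-cells-below : ∀ m L i j → j < i → at (cells m L) i j ≡ nothing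
  at-cells-below m [] i j lt = refl
  at-cells-below m ((l , x) ∷ L) i j lt with suc (m l) ≡ᵇ i in e | suc (m l) + l ≡ᵇ j in e'
  ... | false | _ = at-cells-below (bump l m) L i j lt
  ... | true | false = at-cells-below (bump l m) L i j lt
  ... | true | true with ≡ᵇ-true {suc (m l)} {i} e | ≡ᵇ-true {suc (m l) + l} {j} e'
  ...   | refl | refl = contradiction lt (≤⇒≯ (m≤m+n (suc (m l)) l))

  look-cong : ∀ {m m' : State} → m ≗ m' → ∀ L i k → look m L i k ≡ look m' L i k
  look-cong e [] i k = refl
  look-cong {m} {m'} e ((l , x) ∷ L) i k rewrite e k | look-cong (bump-cong l {m} {m'} e) L i k = refl

  look-skip : ∀ m X Y i k → adv m (labels X) k < i → look m (X ++ Y) i k ≡ look (adv m (labels X)) Y i k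
  look-skip m [] Y i k lt = refl
  look-skip m ((l , x) ∷ X) Y i k lt with l ≡ᵇ k in e
  ... | false = look-skip (bump l m) X Y i k lt
  ... | true rewrite ≡ᵇ-true {l} {k} e
             | ≡ᵇ-false (<⇒≢ (≤-<-trans (≤-trans (≤-reflexive (sym (bump-same k m))) (adv-≤ (bump k m) (labels X) k)) lt)) =
      look-skip (bump k m) X Y i k lt

  look-first : ∀ m Y k → look m Y (suc (m k)) k ≡ first k Y
  look-first m [] k = refl
  look-first m ((l , x) ∷ Y) k with l ≡ᵇ k in e
  ... | true rewrite ≡ᵇ-refl (m k) = refl
  ... | false = trans (cong (λ z → look (bump l m) Y (suc z) k) (sym (bump-diff l k m (≡ᵇ-false⁻ e))))
                  (look-first (bump l m) Y k)

  look-next : ∀ m X Y k → look m (X ++ Y) (suc (adv m (labels X) k)) k ≡ first k Y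
  look-next m X Y k = trans (look-skip m X Y _ k ≤-refl) (look-first (adv m (labels X)) Y k)

  look-at : ∀ m X Y k x → look m (X ++ (k , x) ∷ Y) (suc (adv m (labels X) k)) k ≡ just x
  look-at m X Y k x = trans (look-next m X ((k , x) ∷ Y) k) (own k)
    where
    own : ∀ k → first k ((k , x) ∷ Y) ≡ just x
    own k rewrite ≡ᵇ-refl k = refl

  look-commute : ∀ m X Y k x l y → adj k l ≡ false → Legal m (labels (X ++ (k , x) ∷ (l , y) ∷ Y)) → ∀ i j →
                 look m (X ++ (k , x) ∷ (l , y) ∷ Y) i j ≡ look m (X ++ (l , y) ∷ (k , x) ∷ Y) i j
  look-commute m ((h , z) ∷ X) Y k x l y f (_ , lg) i j rewrite look-commute (bump h m) X Y k x l y f lg i j = refl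
  look-commute m [] Y k x l y f lg i j with k ≡ᵇ j in e | l ≡ᵇ j in e'
  ... | true | true with trans (≡ᵇ-true {k} {j} e) (sym (≡ᵇ-true {l} {j} e'))
  ...   | refl = contradiction lg (no-repeat {m} {k} {labels Y})
  look-commute m [] Y k x l y f lg i j | true | false
    rewrite look-cong (bump-comm l k m) Y i j = refl
  look-commute m [] Y k x l y f lg i j | false | true
    rewrite look-cong (bump-comm l k m) Y i j = refl
  look-commute m [] Y k x l y f lg i j | false | false
    rewrite look-cong (bump-comm l k m) Y i j = refl

  labels-++ : ∀ X Y → labels (X ++ Y) ≡ labels X ++ labels Y
  labels-++ X Y = map-++ proj₁ X Y

module _ {A : Set} (m : State) (X : Code A) where

  row : ℕ → ℕ
  row k = suc (adv m (labels X) k)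

  -- `Step` makes the counts of `k` and `suc k` equal, so the next box on diagonal `suc k` is in the
  -- row of the new box. Its eastern neighbour is therefore simply the first later entry on that
  -- diagonal; the other neighbours are found in the same way.
  look-east : ∀ k x Y → Step (adv m (labels X)) k → look m (X ++ (k , x) ∷ Y) (row k) (suc k) ≡ first (suc k) Y
  look-east k x Y (n , _) = trans (cong (λ z → look m (X ++ (k , x) ∷ Y) (suc z) (suc k)) n)
    (trans (look-next m X ((k , x) ∷ Y) (suc k)) skip)
    where
    skip : first (suc k) ((k , x) ∷ Y) ≡ first (suc k) Y
    skip rewrite ≡ᵇ-false (<⇒≢ (n<1+n k)) = refl

  look-south : ∀ k x Y → Step (adv m (labels X)) (suc k) →
               look m (X ++ (suc k , x) ∷ Y) (suc (row (suc k))) k ≡ first k Y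
  look-south k x Y (_ , w) = trans (cong (λ z → look m (X ++ (suc k , x) ∷ Y) (suc z) k) (sym w))
    (trans (look-next m X ((suc k , x) ∷ Y) k) skip)
    where
    skip : first k ((suc k , x) ∷ Y) ≡ first k Y
    skip rewrite ≡ᵇ-false (>⇒≢ (n<1+n k)) = refl

  look-southeast : ∀ k x Y → look m (X ++ (k , x) ∷ Y) (suc (row k)) k ≡ first k Y
  look-southeast k x Y = begin
    look m (X ++ (k , x) ∷ Y) (suc (row k)) k
      ≡⟨ look-skip m X ((k , x) ∷ Y) (suc (row k)) k (n≤1+n _) ⟩
    look M ((k , x) ∷ Y) (suc (suc (M k))) k
      ≡⟨ skip k ⟩
    look (bump k M) Y (suc (suc (M k))) k
      ≡⟨ cong (λ z → look (bump k M) Y (suc z) k) (bump-same k M) ⟨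
    look (bump k M) Y (suc (bump k M k)) k
      ≡⟨ look-first (bump k M) Y k ⟩
    first k Y ∎
    where
    open ≡-Reasoning
    M = adv m (labels X)
    skip : ∀ k → look M ((k , x) ∷ Y) (suc (suc (M k))) k ≡ look (bump k M) Y (suc (suc (M k))) k
    skip k rewrite ≡ᵇ-refl k | ≡ᵇ-false (<⇒≢ (n<1+n (M k))) = refl

-- Letters and their primes

Entry : Set
Entry = ℕ × Letter

value : Entry → ℤ
value e = val (proj₂ e)

==ℤ-refl : ∀ a → (a ==ℤ a) ≡ true
==ℤ-refl a = dec-true (a ℤP.≟ a) refl

==ℤ-true : ∀ {a b} → (a ==ℤ b) ≡ true → a ≡ b
==ℤ-true {a} {b} e with a ℤP.≟ b
... | yes p = p

==ℤ-false : ∀ {a b} → a ≢ b → (a ==ℤ b) ≡ false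
==ℤ-false {a} {b} ne = dec-false (a ℤP.≟ b) ne

-- Consecutive entries with the same value ascend or descend according to their
-- diagonals.  Within a block of equal values the entries descend and then
-- ascend; the descending ones are primed, the ascending ones unprimed, and only
-- the prime of the entry at the bottom of the valley is free: it is ε value.

data Dir : Set where
  none asc desc flat : Dir

cmp : ℕ → ℕ → Dir
cmp k l = if k <ᵇ l then asc else (if l <ᵇ k then desc else flat)

dir : Entry → Entry → Dir
dir (k , x) (l , y) = if val x ==ℤ val y then cmp k l else none

isPrimed : Bool → Dir → Dir → Maybe Bool
isPrimed ε none none = just ε
isPrimed ε none asc  = just ε
isPrimed ε desc none = just ε
isPrimed ε desc asc  = just ε
isPrimed ε none desc = just true
isPrimed ε desc desc = just true
isPrimed ε asc  none = just false
isPrimed ε asc  asc  = just false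
isPrimed ε _    _    = nothing

nextDir : Entry → List Entry → Dir
nextDir e [] = none
nextDir e (e' ∷ _) = dir e e'

-- The argument `s` is the sign with which the list is entered, so that coherence can be cut and
-- resumed at any place of a word.
Coh : (ℤ → Bool) → Dir → List Entry → Set
Coh ε s [] = ⊤
Coh ε s (e ∷ L) = isPrimed (ε (value e)) s (nextDir e L) ≡ just (primed (proj₂ e)) × Coh ε (nextDir e L) L

Sorted : List Entry → Set
Sorted = AllPairs (λ e e' → value e ℤ.≤ value e')

<⇒cmp : ∀ {k l} → k < l → cmp k l ≡ asc
<⇒cmp lt rewrite <⇒<ᵇ-true lt = refl

>⇒cmp : ∀ {k l} → l < k → cmp k l ≡ desc
>⇒cmp {k} {l} lt rewrite ≤⇒<ᵇ-false (<⇒≤ lt) | <⇒<ᵇ-true lt = refl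

≡⇒cmp : ∀ k → cmp k k ≡ flat
≡⇒cmp k rewrite ≤⇒<ᵇ-false (≤-refl {k}) = refl

cmp-asc : ∀ k l → cmp k l ≡ asc → k < l
cmp-asc k l e with <-cmp k l
... | tri< lt _ _ = lt
... | tri≈ _ refl _ with trans (sym (≡⇒cmp k)) e
...   | ()
cmp-asc k l e | tri> _ _ lt with trans (sym (>⇒cmp lt)) e
...   | ()

dir-same : ∀ e e' → value e ≡ value e' → dir e e' ≡ cmp (proj₁ e) (proj₁ e')
dir-same (k , x) (l , y) e rewrite e | ==ℤ-refl (val y) = refl

dir-diff : ∀ e e' → value e ≢ value e' → dir e e' ≡ none
dir-diff (k , x) (l , y) ne rewrite ==ℤ-false ne = refl

incoming-asc : ∀ ε t {b} → isPrimed ε asc t ≡ just b → b ≡ false × t ≢ desc × t ≢ flat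
incoming-asc ε none refl = refl , (λ ()) , (λ ())
incoming-asc ε asc refl = refl , (λ ()) , (λ ())

incoming-any : ∀ ε s t {b} → isPrimed ε s t ≡ just b → t ≢ flat
incoming-any ε none flat ()
incoming-any ε asc flat ()
incoming-any ε desc flat ()
incoming-any ε flat flat ()

outgoing-desc : ∀ ε s {b} → isPrimed ε s desc ≡ just b → b ≡ true
outgoing-desc ε none refl = refl
outgoing-desc ε desc refl = refl

-- `isPrimed` rejects a descent or a repetition after an ascent, so the rest of the block can only
-- ascend.
ascending : ∀ {ε e L} → Coh ε asc (e ∷ L) → Sorted (e ∷ L) →
            ∀ {e'} → e' ∈ L → value e' ≡ value e → proj₁ e < proj₁ e' × primed (proj₂ e') ≡ false
ascending {ε} {e} {f ∷ L} (o , c@(o' , _)) (s@(ef ∷ _) ∷ ss@(s' ∷ _)) {e'} p q = go p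
  where
  vf : value f ≡ value e
  vf = ℤP.≤-antisym (ℤP.≤-trans (lemma p) (ℤP.≤-reflexive q)) ef
    where
    lemma : e' ∈ f ∷ L → value f ℤ.≤ value e'
    lemma (here refl) = ℤP.≤-refl
    lemma (there r) = All.lookup s' r
  d : dir e f ≡ asc
  d with <-cmp (proj₁ e) (proj₁ f)
  ... | tri< l _ _ = trans (dir-same e f (sym vf)) (<⇒cmp l)
  ... | tri≈ _ k≡l _ = contradiction (trans (dir-same e f (sym vf)) (trans (cong (cmp (proj₁ e)) (sym k≡l)) (≡⇒cmp (proj₁ e))))
                         (proj₂ (proj₂ (incoming-asc (ε (value e)) (dir e f) o)))
  ... | tri> _ _ l = contradiction (trans (dir-same e f (sym vf)) (>⇒cmp l)) (proj₁ (proj₂ (incoming-asc (ε (value e)) (dir e f) o)))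
  lt : proj₁ e < proj₁ f
  lt = cmp-asc (proj₁ e) (proj₁ f) (trans (sym (dir-same e f (sym vf))) d)
  c' : ∀ {ε L} → Coh ε (dir e f) (f ∷ L) → Coh ε asc (f ∷ L)
  c' {ε} {L} = subst (λ z → Coh ε z (f ∷ L)) d
  go : e' ∈ f ∷ L → proj₁ e < proj₁ e' × primed (proj₂ e') ≡ false
  go (here refl) = lt , proj₁ (incoming-asc (ε (value f)) (nextDir f L) (proj₁ (c' c)))
  go (there r) with ascending (c' c) ss r (trans q (sym vf))
  ... | lt' , u = <-trans lt lt' , u

same-block : ∀ {e f L e'} → Sorted (e ∷ f ∷ L) → e' ∈ f ∷ L → value e' ≡ value e → value f ≡ value e
same-block {e} {f} {L} {e'} ((ef ∷ _) ∷ (s' ∷ _)) p q = ℤP.≤-antisym (ℤP.≤-trans (lemma p) (ℤP.≤-reflexive q)) ef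
  where
  lemma : e' ∈ f ∷ L → value f ℤ.≤ value e'
  lemma (here refl) = ℤP.≤-refl
  lemma (there r) = All.lookup s' r

data Dir-view (e f : Entry) : Set where
  isAsc  : proj₁ e < proj₁ f → dir e f ≡ asc → Dir-view e f
  isDesc : proj₁ f < proj₁ e → dir e f ≡ desc → Dir-view e f

dir-view : ∀ {ε s e f L} → Coh ε s (e ∷ f ∷ L) → value f ≡ value e → Dir-view e f
dir-view {ε} {s} {e} {f} (o , _) v with <-cmp (proj₁ e) (proj₁ f)
... | tri< lt _ _ = isAsc lt (trans (dir-same e f (sym v)) (<⇒cmp lt))
... | tri> _ _ lt = isDesc lt (trans (dir-same e f (sym v)) (>⇒cmp lt))
... | tri≈ _ k≡l _ = contradiction
  (trans (dir-same e f (sym v)) (trans (cong (cmp (proj₁ e)) (sym k≡l)) (≡⇒cmp (proj₁ e)))) (incoming-any (ε (value e)) s (dir e f) o)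

-- If the block ascended right after `e`, it would never get below `e` again. This and
-- `later-larger` decide ties of absolute value between the eastern and the southern neighbour of an
-- empty box, and in switching.
later-smaller : ∀ {ε s e L} → Coh ε s (e ∷ L) → Sorted (e ∷ L) →
                ∀ {e'} → e' ∈ L → value e' ≡ value e → proj₁ e' < proj₁ e →
                primed (proj₂ e) ≡ true × nextDir e L ≡ desc
later-smaller {ε} {s} {e} {f ∷ L} c@(o , c') ss p q lt with dir-view c (same-block ss p q)
... | isDesc _ d = outgoing-desc (ε (value e)) s (trans (cong (isPrimed (ε (value e)) s) (sym d)) o) , d
later-smaller {ε} {s} {e} {f ∷ L} c@(o , c') ss@(_ ∷ ss') (here refl) q lt | isAsc lt' d =
  contradiction lt (<⇒≯ lt')
later-smaller {ε} {s} {e} {f ∷ L} c@(o , c') ss@(_ ∷ ss') (there p) q lt | isAsc lt' d =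
  contradiction (proj₁ (ascending (subst (λ z → Coh ε z (f ∷ L)) d c') ss' p (trans q (sym (same-block ss (there p) q)))))
    (<⇒≯ (<-trans lt lt'))

later-larger : ∀ {ε s e L} → Coh ε s (e ∷ L) → Sorted (e ∷ L) →
               ∀ {e'} → e' ∈ L → value e' ≡ value e → proj₁ e < proj₁ e' → primed (proj₂ e') ≡ false
later-larger {ε} {s} {e} {f ∷ L} c@(o , c') ss@(_ ∷ ss') p q lt with dir-view c (same-block ss p q)
later-larger {ε} {s} {e} {f ∷ L} c@(o , c') ss@(_ ∷ ss') (here refl) q lt | isAsc _ d =
  proj₁ (incoming-asc (ε (value f)) (nextDir f L) (proj₁ (subst (λ z → Coh ε z (f ∷ L)) d c')))
later-larger {ε} {s} {e} {f ∷ L} c@(o , c') ss@(_ ∷ ss') (there p) q lt | isAsc _ d =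
  proj₂ (ascending (subst (λ z → Coh ε z (f ∷ L)) d c') ss' p (trans q (sym (same-block ss (there p) q))))
later-larger {ε} {s} {e} {f ∷ L} c@(o , c') ss@(_ ∷ ss') (here refl) q lt | isDesc lt' _ = contradiction lt (<⇒≯ lt')
later-larger {ε} {s} {e} {f ∷ L} c@(o , c') ss@(_ ∷ ss') (there p) q lt | isDesc lt' _ =
  later-larger c' ss' p (trans q (sym (same-block ss (there p) q))) (<-trans lt' lt)

later-distinct : ∀ {ε s e L} → Coh ε s (e ∷ L) → Sorted (e ∷ L) → proj₁ e ≡ 0 →
                 ∀ {e'} → e' ∈ L → value e' ≡ value e → proj₁ e' ≢ 0
later-distinct {ε} {s} {e} {f ∷ L} c@(o , c') ss@(_ ∷ ss') z p q z' with dir-view c (same-block ss p q)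
... | isDesc lt _ = n≮0 (subst (proj₁ f <_) z lt)
later-distinct {ε} {s} {e} {f ∷ L} c@(o , c') ss@(_ ∷ ss') z (here refl) q z' | isAsc lt d = n≮0 (subst (proj₁ e <_) z' lt)
later-distinct {ε} {s} {e} {f ∷ L} c@(o , c') ss@(_ ∷ ss') z (there p) q z' | isAsc lt d =
  n≮0 (subst (proj₁ f <_) z' (proj₁ (ascending (subst (λ y → Coh ε y (f ∷ L)) d c') ss' p (trans q (sym (same-block ss (there p) q))))))

prevDir : Dir → List Entry → Entry → Dir
prevDir s [] e = s
prevDir s (z ∷ []) e = dir z e
prevDir s (z ∷ z' ∷ W) e = prevDir none (z' ∷ W) e

prevDir-∷ : ∀ s z W e → prevDir s (z ∷ W) e ≡ prevDir (dir z e) W e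
prevDir-∷ s z [] e = refl
prevDir-∷ s z (z' ∷ []) e = refl
prevDir-∷ s z (z' ∷ z'' ∷ W) e = refl

Coh-suffix : ∀ {ε s} W {e Y} → Coh ε s (W ++ e ∷ Y) → Coh ε (prevDir s W e) (e ∷ Y)
Coh-suffix [] c = c
Coh-suffix (z ∷ []) (_ , c) = c
Coh-suffix {ε} {s} (z ∷ z' ∷ W) {e} {Y} (_ , c) =
  subst (λ t → Coh ε t (e ∷ Y)) (trans (prevDir-∷ (dir z z') z' W e) (sym (prevDir-∷ none z' W e))) (Coh-suffix (z' ∷ W) c)

Coh-replace : ∀ {ε s} W {e f Y Y'} → Coh ε s (W ++ e ∷ Y) → prevDir s W e ≡ prevDir s W f →
              Coh ε (prevDir s W f) (f ∷ Y') → Coh ε s (W ++ f ∷ Y')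
Coh-replace [] c p d = d
Coh-replace {ε} {s} (z ∷ []) {e} {f} (o , c) p d =
  trans (cong (λ t → isPrimed (ε (value z)) s t) (sym p)) o , d
Coh-replace {ε} {s} (z ∷ z' ∷ W) {e} {f} {Y} {Y'} (o , c) p d =
  o , Coh-replace (z' ∷ W) c
        (trans (prevDir-∷ (dir z z') z' W e) (trans (sym (prevDir-∷ none z' W e)) (trans p (trans (prevDir-∷ none z' W f) (sym (prevDir-∷ (dir z z') z' W f))))))
        (subst (λ t → Coh ε t (f ∷ Y')) (trans (prevDir-∷ none z' W f) (sym (prevDir-∷ (dir z z') z' W f))) d)

Sorted-suffix : ∀ W {Y} → Sorted (W ++ Y) → Sorted Y
Sorted-suffix [] s = s
Sorted-suffix (z ∷ W) (_ ∷ s) = Sorted-suffix W s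

-- Two additions on `a` require one on every neighbouring diagonal in between. A single letter
-- between them suffices only where there is a single neighbour, on the main diagonal; this is where
-- the exceptional rules come from.
sandwich : ∀ {m a b w} → Legal m (a ∷ b ∷ a ∷ w) → Adj a b → a ≡ 0 × b ≡ 1
sandwich {m} {a} {b} {w} l ad = go ad (∧-trueˡ (Legal-alternating m (a ∷ b ∷ a ∷ w) l))
  where
  go : ∀ {a b} → Adj a b → between a false false (b ∷ a ∷ w) ≡ true → a ≡ 0 × b ≡ 1
  go {a} up e rewrite ≡ᵇ-false (<⇒≢ (n<1+n a)) | ≡ᵇ-refl a | ≡ᵇ-false {suc (suc a)} {a} (>⇒≢ (<-trans (n<1+n a) (n<1+n (suc a)))) =
    z e , cong suc (z e)
    where
    z : ∀ {a} → (a ≡ᵇ 0) ≡ true → a ≡ 0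
    z {zero} _ = refl
  go {suc b} down e rewrite ≡ᵇ-false {suc b} {b} 1+n≢n | ≡ᵇ-false {suc (suc b)} {b} (>⇒≢ (<-trans (n<1+n b) (n<1+n (suc b)))) | ≡ᵇ-refl b with e
  ... | ()

cmp-adjˡ : ∀ {v k z} → Adj v k → z ≢ v → z ≢ k → cmp z k ≡ cmp z v
cmp-adjˡ {v} {k} {z} a nv nk with <-cmp z v | a
... | tri< lt _ _ | up = trans (<⇒cmp (<-trans lt (n<1+n v))) (sym (<⇒cmp lt))
... | tri< (s≤s le) _ _ | down = trans (<⇒cmp (≤∧≢⇒< le nk)) (sym (<⇒cmp (s≤s le)))
... | tri≈ _ e _ | _ = contradiction e nv
... | tri> _ _ lt | up = trans (>⇒cmp (≤∧≢⇒< lt (nk ∘ sym))) (sym (>⇒cmp lt))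
... | tri> _ _ lt | down = trans (>⇒cmp (<-trans (n<1+n _) lt)) (sym (>⇒cmp lt))

cmp-adjʳ : ∀ {v k z} → Adj v k → z ≢ v → z ≢ k → cmp k z ≡ cmp v z
cmp-adjʳ {v} {k} {z} a nv nk with <-cmp z v | a
... | tri< lt _ _ | up = trans (>⇒cmp (<-trans lt (n<1+n v))) (sym (>⇒cmp lt))
... | tri< (s≤s le) _ _ | down = trans (>⇒cmp (≤∧≢⇒< le nk)) (sym (>⇒cmp (s≤s le)))
... | tri≈ _ e _ | _ = contradiction e nv
... | tri> _ _ lt | up = trans (<⇒cmp (≤∧≢⇒< lt (nk ∘ sym))) (sym (<⇒cmp lt))
... | tri> _ _ lt | down = trans (<⇒cmp (<-trans (n<1+n _) lt)) (sym (<⇒cmp lt))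

-- The diagonal rules (S3) and of the slide: an entry below the empty diagonal
-- box and its western neighbour of the same value both move.

Special : ℕ → ℕ → Letter → List Entry → Set
Special v k x W = Σ Letter λ y → Σ (List Entry) λ W' →
  v ≡ 0 × k ≡ 1 × W ≡ (0 , y) ∷ W' × val x ≡ val y

special? : ∀ v k x W → Dec (Special v k x W)
special? zero (suc zero) x ((zero , y) ∷ W) with val x ℤP.≟ val y
... | yes e = yes (y , W , refl , refl , refl , e)
... | no ne = no λ { (_ , _ , _ , _ , refl , e) → ne e }
special? zero (suc zero) x [] = no λ { (_ , _ , _ , _ , () , _) }
special? zero (suc zero) x ((suc _ , _) ∷ W) = no λ { (_ , _ , _ , _ , () , _) }
special? zero zero x W = no λ { (_ , _ , _ , () , _) }
special? zero (suc (suc k)) x W = no λ { (_ , _ , _ , () , _) }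
special? (suc v) k x W = no λ { (_ , _ , () , _) }

data View : ℕ → List Entry → Set where
  vnil  : ∀ {v} → View v []
  vskip : ∀ {v k x W} → adj v k ≡ false → View v ((k , x) ∷ W)
  vmove : ∀ {v k x W} → Adj v k → ¬ Special v k x W → View v ((k , x) ∷ W)
  vspec : ∀ {x y W} → val x ≡ val y → View 0 ((1 , x) ∷ (0 , y) ∷ W)

view : ∀ v W → View v W
view v [] = vnil
view v ((k , x) ∷ W) with special? v k x W
... | yes (y , W' , refl , refl , refl , e) = vspec e
... | no n with adj v k in a
...   | false = vskip a
...   | true = vmove (adj-true {v} {k} a) n

Sorted-values : ∀ {L L'} → map value L ≡ map value L' → Sorted L → Sorted L'
Sorted-values {L} {L'} e s = AllPairsP.map⁻ (subst (AllPairs ℤ._≤_) e (AllPairsP.map⁺ s))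

module _ {ε : ℤ → Bool} where

  dirˡ-adj : ∀ z v k x y → val x ≡ val y → Adj v k → proj₁ z ≢ v → dir z (k , x) ≢ flat →
             dir z (k , x) ≡ dir z (v , y)
  dirˡ-adj z v k x y e a nv nf = go (value z ℤP.≟ val x)
    where
    go : Dec (value z ≡ val x) → dir z (k , x) ≡ dir z (v , y)
    go (no ne) = trans (dir-diff z (k , x) ne) (sym (dir-diff z (v , y) (λ q → ne (trans q (sym e)))))
    go (yes q) = trans (dir-same z (k , x) q) (trans (cmp-adjˡ a nv nk) (sym (dir-same z (v , y) (trans q e))))
      where
      nk : proj₁ z ≢ k
      nk refl = nf (trans (dir-same z (k , x) q) (≡⇒cmp k))

  dirʳ-adj : ∀ z v k x y → val x ≡ val y → Adj v k → proj₁ z ≢ v → proj₁ z ≢ k →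
             dir (k , x) z ≡ dir (v , y) z
  dirʳ-adj z v k x y e a nv nk = go (val x ℤP.≟ value z)
    where
    go : Dec (val x ≡ value z) → dir (k , x) z ≡ dir (v , y) z
    go (no ne) = trans (dir-diff (k , x) z ne) (sym (dir-diff (v , y) z (λ q → ne (trans e q))))
    go (yes q) = trans (dir-same (k , x) z q) (trans (cmp-adjʳ a nv nk) (sym (dir-same (v , y) z (trans (sym e) q))))

  prevDir-adj : ∀ {m s} W v k {x y Y w} → val x ≡ val y → Adj v k → Legal m (labels W ++ v ∷ w) →
                Coh ε s (W ++ (k , x) ∷ Y) → prevDir s W (k , x) ≡ prevDir s W (v , y)
  prevDir-adj [] v k e a l c = refl
  prevDir-adj {m} {s} (z ∷ []) v k {x} {y} {w = w} e a l (o , _) =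
    dirˡ-adj z v k x y e a (legal-≢ {m} {w = w} l) (incoming-any (ε (value z)) s (dir z (k , x)) o)
  prevDir-adj {m} (z ∷ z' ∷ W) v k {x} {y} e a (_ , l) (_ , c) = begin
      prevDir none (z' ∷ W) (k , x)        ≡⟨ prevDir-∷ none z' W (k , x) ⟩
      prevDir (dir z' (k , x)) W (k , x)   ≡⟨ prevDir-∷ (dir z z') z' W (k , x) ⟨
      prevDir (dir z z') (z' ∷ W) (k , x)  ≡⟨ prevDir-adj {bump (proj₁ z) m} (z' ∷ W) v k e a l c ⟩
      prevDir (dir z z') (z' ∷ W) (v , y)  ≡⟨ prevDir-∷ (dir z z') z' W (v , y) ⟩
      prevDir (dir z' (v , y)) W (v , y)   ≡⟨ prevDir-∷ none z' W (v , y) ⟨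
      prevDir none (z' ∷ W) (v , y)        ∎
    where open ≡-Reasoning

  move-next : ∀ {m} v k x W → Legal m (v ∷ k ∷ labels W) → Adj v k → ¬ Special v k x W →
              nextDir (k , x) W ≡ nextDir (v , x) W
  move-next v k x [] l a n = refl
  move-next {m} v k x ((l , y) ∷ W) lg a n with l ≟ v
  ... | no nv = dirʳ-adj (l , y) v k x x refl a nv (λ e → legal-≢ {bump v m} {k} {l} {labels W} (proj₂ lg) (sym e))
  ... | yes refl with sandwich {m} {l} {k} {labels W} lg a
  ...   | refl , refl = trans (dir-diff (1 , x) (0 , y) ne) (sym (dir-diff (0 , x) (0 , y) ne))
    where
    ne : val x ≢ val y
    ne e = n (y , W , refl , refl , refl , e)

  -- An entry moves to an adjacent diagonal, which changes its comparison with another diagonal only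
  -- if that one is among the two. Coherence or legality exclude this for the preceding entry of the
  -- block, and for the following one `sandwich` leaves nothing but the special case.
  move-coh : ∀ {m s} Wp v k x W → Legal m (labels Wp ++ v ∷ k ∷ labels W) → Coh ε s (Wp ++ (k , x) ∷ W) →
             Adj v k → ¬ Special v k x W → Coh ε s (Wp ++ (v , x) ∷ W)
  move-coh {m} {s} Wp v k x W l c a n = Coh-replace Wp c same
    (trans (cong₂ (isPrimed (ε (val x))) (sym same) (sym nx)) (proj₁ c') , subst (λ t → Coh ε t W) nx (proj₂ c'))
    where
    same = prevDir-adj {m} {s} Wp v k refl a l c
    c' = Coh-suffix Wp c
    nx = move-next {adv m (labels Wp)} v k x W (proj₂ (Legal-++ m (labels Wp) l)) a n

  special-next : ∀ {m} W x y → val x ≡ val y → Legal m (0 ∷ 1 ∷ 0 ∷ labels W) →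
                 nextDir (0 , y) W ≡ nextDir (1 , x) W
  special-next [] x y e l = refl
  special-next {m} ((k , z) ∷ W) x y e lg = sym (dirʳ-adj (k , z) 0 1 x y e up
    (λ { refl → legal-≢ {bump 1 (bump 0 m)} {0} {0} {labels W} (proj₂ (proj₂ lg)) refl })
    (λ { refl → 1≢0 (proj₁ (sandwich {bump 0 m} {1} {0} {labels W} (proj₂ lg) down)) }))
    where
    1≢0 : 1 ≢ 0
    1≢0 ()

  bottom-next : ∀ y W → nextDir (0 , y) W ≢ desc
  bottom-next y ((k , z) ∷ W) e with val y ==ℤ val z
  bottom-next y ((zero , z) ∷ W) () | true
  bottom-next y ((suc k , z) ∷ W) () | true
  bottom-next y ((k , z) ∷ W) () | false

  special-ok : ∀ e t t' {b b'} → isPrimed e t desc ≡ just b → isPrimed e desc t' ≡ just b' → t' ≢ desc →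
               isPrimed e t asc ≡ just b' × isPrimed e asc t' ≡ just false
  special-ok e none none o o' n = o' , refl
  special-ok e none asc o o' n = o' , refl
  special-ok e desc none o o' n = o' , refl
  special-ok e desc asc o o' n = o' , refl
  special-ok e t desc o o' n = contradiction refl n
  special-ok e asc asc () o' n
  special-ok e asc none () o' n
  special-ok e flat none () o' n
  special-ok e flat asc () o' n
  special-ok e none flat o () n
  special-ok e desc flat o () n

  -- A descent from diagonal 1 to 0 becomes an ascent from 0 to 1. The entry `y` is the bottom of
  -- the valley before and after, so it keeps its free prime, whereas `x` passes to the ascending
  -- side and loses its prime, as the diagonal rule prescribes.
  special-coh : ∀ {m s} Wp x y W → Legal m (labels Wp ++ 0 ∷ 1 ∷ 0 ∷ labels W) →
                Coh ε s (Wp ++ (1 , x) ∷ (0 , y) ∷ W) → val x ≡ val y →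
                Coh ε s (Wp ++ (0 , y) ∷ (1 , un (val x)) ∷ W)
  special-coh {m} {s} Wp x y W l c e = Coh-replace Wp c same
    ( trans (cong (λ t → isPrimed (ε (val y)) t (dir (0 , y) (1 , un (val x)))) (sym same))
        (trans (cong (isPrimed (ε (val y)) t) d₁) (proj₁ oks))
    , trans (cong₂ (isPrimed (ε (val x))) d₁ (sym nx)) (trans (cong (λ a → isPrimed (ε a) asc (nextDir (0 , y) W)) e) (proj₂ oks))
    , subst (λ t → Coh ε t W) nx (proj₂ (proj₂ c')))
    where
    same = prevDir-adj {m} {s} Wp 0 1 e up l c
    t = prevDir s Wp (1 , x)
    c' = Coh-suffix Wp c
    d₁ : dir (0 , y) (1 , un (val x)) ≡ asc
    d₁ = dir-same (0 , y) (1 , un (val x)) (sym e)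
    d₀ : dir (1 , x) (0 , y) ≡ desc
    d₀ = dir-same (1 , x) (0 , y) e
    nx : nextDir (0 , y) W ≡ nextDir (1 , un (val x)) W
    nx = special-next {adv m (labels Wp)} W (un (val x)) y e (proj₂ (Legal-++ m (labels Wp) l))
    oks = special-ok (ε (val y)) t (nextDir (0 , y) W)
      (trans (cong₂ (λ a d → isPrimed (ε a) t d) (sym e) (sym d₀)) (proj₁ c'))
      (trans (cong (λ d → isPrimed (ε (val y)) d (nextDir (0 , y) W)) (sym d₀)) (proj₁ (proj₂ c')))
      (bottom-next y W)

-- Slides

hit : ℕ → ℕ → ℕ → ℕ → Bool
hit i j i' j' = (i ≡ᵇ i') ∧ (j ≡ᵇ j')

hit-true : ∀ i j i' j' → hit i j i' j' ≡ true → i ≡ i' × j ≡ j'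
hit-true i j i' j' e with i ≡ᵇ i' in e₁ | j ≡ᵇ j' in e₂
... | true | true = ≡ᵇ-true e₁ , ≡ᵇ-true e₂

hit-refl : ∀ i j → hit i j i j ≡ true
hit-refl i j rewrite ≡ᵇ-refl i | ≡ᵇ-refl j = refl

hit-false : ∀ i j i' j' → (i ≡ i' → j ≢ j') → hit i j i' j' ≡ false
hit-false i j i' j' n with hit i j i' j' in e
... | false = refl
... | true = contradiction (proj₂ (hit-true i j i' j' e)) (n (proj₁ (hit-true i j i' j' e)))

hit-false-sym : ∀ a b i j → hit a b i j ≡ false → hit i j a b ≡ false
hit-false-sym a b i j e = hit-false i j a b λ { refl refl → true≢false (trans (sym (hit-refl i j)) e) }
  where
  true≢false : true ≢ false
  true≢false ()

module _ {A : Set} where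

  at-del : ∀ i j (T : Fill A) i' j' → at (del i j T) i' j' ≡ (if hit i j i' j' then nothing else at T i' j')
  at-del i j [] i' j' with hit i j i' j'
  ... | true = refl
  ... | false = refl
  at-del i j (((a , b) , x) ∷ T) i' j' with hit a b i j in e
  ... | true with hit-true a b i j e
  ...   | refl , refl with at-del a b T i' j'
  ...     | ih with hit a b i' j'
  ...       | true = ih
  ...       | false = ih
  at-del i j (((a , b) , x) ∷ T) i' j' | false with hit a b i' j' in e'
  ... | false = at-del i j T i' j'
  ... | true with hit-true a b i' j' e'
  ...   | refl , refl rewrite hit-false-sym a b i j e = refl

  at-put : ∀ i j x (T : Fill A) i' j' → at (put i j x T) i' j' ≡ (if hit i j i' j' then just x else at T i' j')
  at-put i j x T i' j' with hit i j i' j' in e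
  ... | true = refl
  ... | false = trans (at-del i j T i' j') (cong (if_then nothing else at T i' j') e)

  override : ℕ → ℕ → Maybe A → (ℕ → ℕ → Maybe A) → ℕ → ℕ → Maybe A
  override i j c f i' j' = if hit i j i' j' then c else f i' j'

  rowOf : State → Code A → ℕ → ℕ
  rowOf m X k = suc (adv m (labels X) k)

  row-≢ : ∀ m l z X k → ¬ (suc (m l) ≡ rowOf m ((l , z) ∷ X) k × suc (m l) + l ≡ rowOf m ((l , z) ∷ X) k + k)
  row-≢ m l z X k (e , e') with +-cancelˡ-≡ (suc (m l)) l k (trans e' (cong (_+ k) (sym e)))
  ... | refl = <⇒≢ (adv-∈ m {l ∷ labels X} (here refl)) (suc-injective e)

  at-set : ∀ m X Y k x y i j → at (cells m (X ++ (k , x) ∷ Y)) i j ≡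
           override (rowOf m X k) (rowOf m X k + k) (just x) (at (cells m (X ++ (k , y) ∷ Y))) i j
  at-set m [] Y k x y i j with hit (suc (m k)) (suc (m k) + k) i j
  ... | true = refl
  ... | false = refl
  at-set m ((l , z) ∷ X) Y k x y i j
    with hit (suc (m l)) (suc (m l) + l) i j in e | hit (rowOf m ((l , z) ∷ X) k) (rowOf m ((l , z) ∷ X) k + k) i j in e'
       | at-set (bump l m) X Y k x y i j
  ... | false | true | ih = ih
  ... | false | false | ih = ih
  ... | true | false | _ = refl
  ... | true | true | _ = contradiction
    ( trans (proj₁ h) (sym (proj₁ h')) , trans (proj₂ h) (sym (proj₂ h'))) (row-≢ m l z X k)
    where
    h = hit-true (suc (m l)) (suc (m l) + l) i j e
    h' = hit-true (rowOf m ((l , z) ∷ X) k) (rowOf m ((l , z) ∷ X) k + k) i j e'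

  at-commute : ∀ m X Y k (x : A) l y → adj k l ≡ false → Legal m (labels (X ++ (k , x) ∷ (l , y) ∷ Y)) → ∀ i j →
               at (cells m (X ++ (k , x) ∷ (l , y) ∷ Y)) i j ≡ at (cells m (X ++ (l , y) ∷ (k , x) ∷ Y)) i j
  at-commute m X Y k x l y f lg i j with ≤-<-connex i j
  ... | inj₂ lt = trans (at-cells-below m (X ++ (k , x) ∷ (l , y) ∷ Y) i j lt)
                    (sym (at-cells-below m (X ++ (l , y) ∷ (k , x) ∷ Y) i j lt))
  ... | inj₁ le with m≤n⇒∃[o]m+o≡n le
  ...   | d , refl = trans (at-cells m (X ++ (k , x) ∷ (l , y) ∷ Y) i d)
    (trans (look-commute m X Y k x l y f lg i d) (sym (at-cells m (X ++ (l , y) ∷ (k , x) ∷ Y) i d)))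

  labels-snoc : ∀ X k (x : A) → labels (X ∷ʳ (k , x)) ≡ labels X ∷ʳ k
  labels-snoc X k x = labels-++ X [ k , x ]

  rowOf-snoc-≢ : ∀ m X k x l → k ≢ l → rowOf m (X ∷ʳ (k , x)) l ≡ rowOf m X l
  rowOf-snoc-≢ m X k x l ne = cong suc (trans (cong (λ w → adv m w l) (labels-snoc X k x))
    (trans (cong (λ g → g l) (adv-++ m (labels X) [ k ])) (bump-diff k l (adv m (labels X)) ne)))

  rowOf-snoc-≡ : ∀ m X k x → rowOf m (X ∷ʳ (k , x)) k ≡ suc (rowOf m X k)
  rowOf-snoc-≡ m X k x = cong suc (trans (cong (λ w → adv m w k) (labels-snoc X k x))
    (trans (cong (λ g → g k) (adv-++ m (labels X) [ k ])) (bump-same k (adv m (labels X)))))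

  at-swap : ∀ m X Y v x k y i j → v ≢ k → at (cells m (X ++ (v , y) ∷ (k , x) ∷ Y)) i j ≡
    override (rowOf m X v) (rowOf m X v + v) (just y) (override (rowOf m X k) (rowOf m X k + k) (just x)
      (at (cells m (X ++ (v , x) ∷ (k , y) ∷ Y)))) i j
  at-swap m X Y v x k y i j ne = trans (at-set m X ((k , x) ∷ Y) v y x i j)
    (cong (if hit (rowOf m X v) (rowOf m X v + v) i j then just y else_) second)
    where
    second : at (cells m (X ++ (v , x) ∷ (k , x) ∷ Y)) i j ≡
             override (rowOf m X k) (rowOf m X k + k) (just x) (at (cells m (X ++ (v , x) ∷ (k , y) ∷ Y))) i j
    second = subst₂ (λ P Q → at (cells m P) i j ≡ override (rowOf m X k) (rowOf m X k + k) (just x) (at (cells m Q)) i j)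
      (++-assoc X [ v , x ] ((k , x) ∷ Y)) (++-assoc X [ v , x ] ((k , y) ∷ Y))
      (subst (λ r → at (cells m ((X ∷ʳ (v , x)) ++ (k , x) ∷ Y)) i j ≡ override r (r + k) (just x) (at (cells m ((X ∷ʳ (v , x)) ++ (k , y) ∷ Y))) i j)
        (rowOf-snoc-≢ m X v x k ne) (at-set m (X ∷ʳ (v , x)) Y k x y i j))

  at-set₃ : ∀ m X Y (a b c a' b' c' : A) i j →
    at (cells m (X ++ (0 , a') ∷ (1 , b') ∷ (0 , c') ∷ Y)) i j ≡
    override (rowOf m X 0) (rowOf m X 0 + 0) (just a') (override (rowOf m X 1) (rowOf m X 1 + 1) (just b')
      (override (suc (rowOf m X 0)) (suc (rowOf m X 0) + 0) (just c')
        (at (cells m (X ++ (0 , a) ∷ (1 , b) ∷ (0 , c) ∷ Y))))) i j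
  at-set₃ m X Y a b c a' b' c' i j = trans (at-set m X ((1 , b') ∷ (0 , c') ∷ Y) 0 a' a i j)
    (cong (if hit (rowOf m X 0) (rowOf m X 0 + 0) i j then just a' else_) (trans second
      (cong (if hit (rowOf m X 1) (rowOf m X 1 + 1) i j then just b' else_) third)))
    where
    second : at (cells m (X ++ (0 , a) ∷ (1 , b') ∷ (0 , c') ∷ Y)) i j ≡
             override (rowOf m X 1) (rowOf m X 1 + 1) (just b') (at (cells m (X ++ (0 , a) ∷ (1 , b) ∷ (0 , c') ∷ Y))) i j
    second = subst₂ (λ P Q → at (cells m P) i j ≡ override (rowOf m X 1) (rowOf m X 1 + 1) (just b') (at (cells m Q)) i j)
      (++-assoc X [ 0 , a ] ((1 , b') ∷ (0 , c') ∷ Y)) (++-assoc X [ 0 , a ] ((1 , b) ∷ (0 , c') ∷ Y))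
      (subst (λ r → at (cells m ((X ∷ʳ (0 , a)) ++ (1 , b') ∷ (0 , c') ∷ Y)) i j ≡ override r (r + 1) (just b') (at (cells m ((X ∷ʳ (0 , a)) ++ (1 , b) ∷ (0 , c') ∷ Y))) i j)
        (rowOf-snoc-≢ m X 0 a 1 λ ()) (at-set m (X ∷ʳ (0 , a)) ((0 , c') ∷ Y) 1 b' b i j))
    X₂ = (X ∷ʳ (0 , a)) ∷ʳ (1 , b)
    assoc₂ : ∀ (z : ℕ × A) → X₂ ++ z ∷ Y ≡ X ++ (0 , a) ∷ (1 , b) ∷ z ∷ Y
    assoc₂ z = trans (++-assoc (X ∷ʳ (0 , a)) [ 1 , b ] (z ∷ Y)) (++-assoc X [ 0 , a ] ((1 , b) ∷ z ∷ Y))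
    third : at (cells m (X ++ (0 , a) ∷ (1 , b) ∷ (0 , c') ∷ Y)) i j ≡
            override (suc (rowOf m X 0)) (suc (rowOf m X 0) + 0) (just c') (at (cells m (X ++ (0 , a) ∷ (1 , b) ∷ (0 , c) ∷ Y))) i j
    third = subst₂ (λ P Q → at (cells m P) i j ≡ override (suc (rowOf m X 0)) (suc (rowOf m X 0) + 0) (just c') (at (cells m Q)) i j)
      (assoc₂ (0 , c')) (assoc₂ (0 , c))
      (subst (λ r → at (cells m (X₂ ++ (0 , c') ∷ Y)) i j ≡ override r (r + 0) (just c') (at (cells m (X₂ ++ (0 , c) ∷ Y))) i j)
        (trans (rowOf-snoc-≢ m (X ∷ʳ (0 , a)) 1 b 0 λ ()) (rowOf-snoc-≡ m X 0 a)) (at-set m X₂ Y 0 c' c i j))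

module _ (f : ℕ) (T : Cells) (i j : ℕ) where

  slide-stop : at T i (suc j) ≡ nothing → at T (suc i) j ≡ nothing → slide (suc f) T i j ≡ T
  slide-stop e s rewrite e | s = refl

  slide-south : ∀ {y} → at T i (suc j) ≡ nothing → at T (suc i) j ≡ just y →
                slide (suc f) T i j ≡ slide f (put i j y (del (suc i) j T)) (suc i) j
  slide-south e s rewrite e | s | s = refl

  slide-east-both : ∀ {x y} → at T i (suc j) ≡ just x → at T (suc i) j ≡ just y →
                    ((val x <ℤ val y) ∨ ((val x ==ℤ val y) ∧ primed x)) ≡ true →
                    slide (suc f) T i j ≡ slide f (put i j x (del i (suc j) T)) i (suc j)
  slide-east-both e s c rewrite e | s | c | e = refl

  slide-south-both : ∀ {x y} → at T i (suc j) ≡ just x → at T (suc i) j ≡ just y →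
                     ((val x <ℤ val y) ∨ ((val x ==ℤ val y) ∧ primed x)) ≡ false →
                     slide (suc f) T i j ≡ slide f (put i j y (del (suc i) j T)) (suc i) j
  slide-south-both e s c rewrite e | s | c | s = refl

  slide-east-off : ∀ {x} → at T i (suc j) ≡ just x → at T (suc i) j ≡ nothing → (i ≡ᵇ j) ≡ false →
                   slide (suc f) T i j ≡ slide f (put i j x (del i (suc j) T)) i (suc j)
  slide-east-off e s c rewrite e | s | c | e = refl

data Plain : Letter → Maybe Letter → Set where
  plain-unprimed : ∀ {a z} → Plain (un a) z
  plain-alone    : ∀ {x} → Plain x nothing
  plain-value    : ∀ {x z} → val x ≢ val z → Plain x (just z)

module _ (f : ℕ) (T : Cells) (i : ℕ) where

  slide-east-diagonal : ∀ {x} → at T i (suc i) ≡ just x → at T (suc i) i ≡ nothing →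
                        Plain x (at T (suc i) (suc i)) →
                        slide (suc f) T i i ≡ slide f (put i i x (del i (suc i) T)) i (suc i)
  slide-east-diagonal {x} e s c rewrite e | s | ≡ᵇ-refl i with x | at T (suc i) (suc i) | c
  ... | un a | _ | _ = cong (λ z → slide f (Maybe.maybe (λ x → put i i x (del i (suc i) T)) T z) i (suc i)) e
  ... | pr a | nothing | _ = cong (λ z → slide f (Maybe.maybe (λ x → put i i x (del i (suc i) T)) T z) i (suc i)) e
  ... | pr a | just (un b) | plain-value ne rewrite ==ℤ-false ne = cong (λ z → slide f (Maybe.maybe (λ x → put i i x (del i (suc i) T)) T z) i (suc i)) e
  ... | pr a | just (pr b) | plain-value ne rewrite ==ℤ-false ne = cong (λ z → slide f (Maybe.maybe (λ x → put i i x (del i (suc i) T)) T z) i (suc i)) e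

  slide-special : ∀ {a y} → at T i (suc i) ≡ just (pr a) → at T (suc i) i ≡ nothing →
                  at T (suc i) (suc i) ≡ just y → a ≡ val y →
                  slide (suc f) T i i ≡
                  slide f (put i i y (put i (suc i) (un a) (del (suc i) (suc i) T))) (suc i) (suc i)
  slide-special {a} {un b} e s d refl rewrite e | s | ≡ᵇ-refl i | d | ≡ᵇ-refl i | ==ℤ-refl a = refl
  slide-special {a} {pr b} e s d refl rewrite e | s | ≡ᵇ-refl i | d | ≡ᵇ-refl i | ==ℤ-refl a = refl

labels-snoc-++ : ∀ {A : Set} (W : Code A) e w → labels (W ∷ʳ e) ++ w ≡ labels W ++ proj₁ e ∷ w
labels-snoc-++ W e w = trans (cong (_++ w) (labels-++ W [ e ])) (++-assoc (labels W) [ proj₁ e ] w)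

record Mid (ε : ℤ → Bool) (s : Dir) (m : State) (Wp : List Entry) (v : ℕ) (Wr : List Entry) : Set where
  constructor mid
  field
    legal  : Legal m (labels Wp ++ v ∷ labels Wr)
    coh    : Coh ε s (Wp ++ Wr)
    sorted : Sorted (Wp ++ Wr)

module _ {ε : ℤ → Bool} {s : Dir} {m : State} where

  mid-skip : ∀ {Wp v k x W} → adj v k ≡ false → Mid ε s m Wp v ((k , x) ∷ W) → Mid ε s m (Wp ∷ʳ (k , x)) v W
  mid-skip {Wp} {v} {k} {x} {W} f (mid l c o) = mid
    (subst (Legal m) (sym (labels-snoc-++ Wp (k , x) (v ∷ labels W))) (~-Legal (~++ˡ (labels Wp) (~swap f)) {m} l))
    (subst (Coh ε s) (sym (++-assoc Wp [ k , x ] W)) c)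
    (subst Sorted (sym (++-assoc Wp [ k , x ] W)) o)

  mid-move : ∀ {Wp v k x W} → Adj v k → ¬ Special v k x W → Mid ε s m Wp v ((k , x) ∷ W) → Mid ε s m (Wp ∷ʳ (v , x)) k W
  mid-move {Wp} {v} {k} {x} {W} a n (mid l c o) = mid
    (subst (Legal m) (sym (labels-snoc-++ Wp (v , x) (k ∷ labels W))) l)
    (subst (Coh ε s) (sym (++-assoc Wp [ v , x ] W)) (move-coh Wp v k x W l c a n))
    (subst Sorted (sym (++-assoc Wp [ v , x ] W)) (Sorted-values (values-eq Wp) o))
    where
    values-eq : ∀ Wp → map value (Wp ++ (k , x) ∷ W) ≡ map value (Wp ++ (v , x) ∷ W)
    values-eq Wp = trans (map-++ value Wp _) (sym (map-++ value Wp _))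

  special-values : ∀ Wp x y W → val x ≡ val y →
                   map value (Wp ++ (1 , x) ∷ (0 , y) ∷ W) ≡ map value (Wp ++ (0 , y) ∷ (1 , un (val x)) ∷ W)
  special-values Wp x y W e = trans (map-++ value Wp _)
    (trans (cong₂ (λ a b → map value Wp ++ a ∷ b ∷ map value W) e (sym e)) (sym (map-++ value Wp _)))

  mid-special : ∀ {Wp x y W} → val x ≡ val y → Mid ε s m Wp 0 ((1 , x) ∷ (0 , y) ∷ W) →
                Mid ε s m ((Wp ∷ʳ (0 , y)) ∷ʳ (1 , un (val x))) 0 W
  mid-special {Wp} {x} {y} {W} e (mid l c o) = mid
    (subst (Legal m) (sym (trans (labels-snoc-++ (Wp ∷ʳ (0 , y)) _ (0 ∷ labels W)) (labels-snoc-++ Wp (0 , y) _))) l)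
    (subst (Coh ε s) (sym assoc) (special-coh Wp x y W l c e))
    (subst Sorted (sym assoc) (Sorted-values (special-values Wp x y W e) o))
    where
    assoc : ((Wp ∷ʳ (0 , y)) ∷ʳ (1 , un (val x))) ++ W ≡ Wp ++ (0 , y) ∷ (1 , un (val x)) ∷ W
    assoc = trans (++-assoc (Wp ∷ʳ (0 , y)) [ 1 , un (val x) ] W) (++-assoc Wp [ 0 , y ] _)

joinM : ∀ {A : Set} → Maybe (Maybe A) → Maybe A
joinM nothing = nothing
joinM (just c) = c

filled : List Entry → Code (Maybe Letter)
filled = map (λ e → proj₁ e , just (proj₂ e))

-- The empty box is an entry with content `nothing`. It thereby keeps its place in the counts and
-- moves by the same rewriting of words as a letter; `joinM` makes it look like an absent box.
withHole : List Entry → ℕ → List Entry → Code (Maybe Letter)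
withHole Wp v Wr = filled Wp ++ (v , nothing) ∷ filled Wr

Rep : State → Code (Maybe Letter) → Cells → Set
Rep m L T = ∀ i j → at T i j ≡ joinM (at (cells m L) i j)

labels-filled : ∀ W → labels (filled W) ≡ labels W
labels-filled [] = refl
labels-filled (e ∷ W) = cong (proj₁ e ∷_) (labels-filled W)

first-filled : ∀ k W → joinM (first k (filled W)) ≡ first k W
first-filled k [] = refl
first-filled k ((l , x) ∷ W) with l ≡ᵇ k
... | true = refl
... | false = first-filled k W

filled-snoc-++ : ∀ W e Y → filled (W ∷ʳ e) ++ Y ≡ filled W ++ (proj₁ e , just (proj₂ e)) ∷ Y
filled-snoc-++ W e Y = trans (cong (_++ Y) (map-++ _ W [ e ])) (++-assoc (filled W) _ Y)

rowOf-filled : ∀ m W k → rowOf m (filled W) k ≡ rowOf m W k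
rowOf-filled m W k = cong (λ w → suc (adv m w k)) (labels-filled W)

Rep-end : ∀ m W v i j → joinM (at (cells m (filled W ++ [ v , nothing ])) i j) ≡ at (cells m W) i j
Rep-end m [] v i j with hit (suc (m v)) (suc (m v) + v) i j
... | true = refl
... | false = refl
Rep-end m ((k , x) ∷ W) v i j with hit (suc (m k)) (suc (m k) + k) i j
... | true = refl
... | false = Rep-end (bump k m) W v i j

south : ℕ → List Entry → Maybe Letter
south zero W = nothing
south (suc q) W = first q W

first-∈ : ∀ k (W : List Entry) {y : Letter} → first k W ≡ just y → (k , y) ∈ W
first-∈ k ((l , x) ∷ W) e with l ≡ᵇ k in q
first-∈ k ((l , x) ∷ W) refl | true rewrite ≡ᵇ-true {l} {k} q = here refl
... | false = there (first-∈ k W e)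

module _ {m : State} {Wp : List Entry} {v : ℕ} {Wr : List Entry} (lg : Legal m (labels Wp ++ v ∷ labels Wr)) where

  hole-step : Step (adv m (labels (filled Wp))) v
  hole-step = subst (λ w → Step (adv m w) v) (sym (labels-filled Wp)) (proj₁ (proj₂ (Legal-++ m (labels Wp) lg)))

  row-east : rowOf m Wp (suc v) ≡ rowOf m Wp v
  row-east = cong suc (sym (proj₁ (proj₁ (proj₂ (Legal-++ m (labels Wp) lg)))))

  row-south : ∀ q → v ≡ suc q → rowOf m Wp q ≡ suc (rowOf m Wp v)
  row-south q refl = cong suc (proj₂ (proj₁ (proj₂ (Legal-++ m (labels Wp) lg))))

  module _ {T : Cells} (rep : Rep m (withHole Wp v Wr) T) where

    private
      L = withHole Wp v Wr
      r = rowOf m Wp v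
      r≡ : rowOf m (filled Wp) v ≡ r
      r≡ = rowOf-filled m Wp v

    at-east : at T r (suc (r + v)) ≡ first (suc v) Wr
    at-east = begin
      at T r (suc (r + v))                    ≡⟨ cong (at T r) (+-suc r v) ⟨
      at T r (r + suc v)                      ≡⟨ rep r (r + suc v) ⟩
      joinM (at (cells m L) r (r + suc v))    ≡⟨ cong joinM (at-cells m L r (suc v)) ⟩
      joinM (look m L r (suc v))              ≡⟨ cong (λ z → joinM (look m L z (suc v))) r≡ ⟨
      joinM (look m L (rowOf m (filled Wp) v) (suc v))
        ≡⟨ cong joinM (look-east m (filled Wp) v nothing (filled Wr) hole-step) ⟩
      joinM (first (suc v) (filled Wr))       ≡⟨ first-filled (suc v) Wr ⟩
      first (suc v) Wr ∎
      where open ≡-Reasoning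

    at-southeast : at T (suc r) (suc r + v) ≡ first v Wr
    at-southeast = begin
      at T (suc r) (suc r + v)                ≡⟨ rep (suc r) (suc r + v) ⟩
      joinM (at (cells m L) (suc r) (suc r + v)) ≡⟨ cong joinM (at-cells m L (suc r) v) ⟩
      joinM (look m L (suc r) v)              ≡⟨ cong (λ z → joinM (look m L (suc z) v)) r≡ ⟨
      joinM (look m L (suc (rowOf m (filled Wp) v)) v)
        ≡⟨ cong joinM (look-southeast m (filled Wp) v nothing (filled Wr)) ⟩
      joinM (first v (filled Wr))             ≡⟨ first-filled v Wr ⟩
      first v Wr ∎
      where open ≡-Reasoning

  at-south : ∀ {T} → Rep m (withHole Wp v Wr) T → at T (suc (rowOf m Wp v)) (rowOf m Wp v + v) ≡ south v Wr
  at-south {T} rep = go v refl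
    where
    r = rowOf m Wp v
    L = withHole Wp v Wr
    go : ∀ q → v ≡ q → at T (suc r) (r + q) ≡ south q Wr
    go zero e = trans (rep (suc r) (r + 0)) (cong joinM (at-cells-below m L (suc r) (r + 0)
      (s≤s (≤-reflexive (+-identityʳ r)))))
    go (suc q) refl = begin
      at T (suc r) (r + suc q)              ≡⟨ cong (at T (suc r)) (+-suc r q) ⟩
      at T (suc r) (suc r + q)              ≡⟨ rep (suc r) (suc r + q) ⟩
      joinM (at (cells m L) (suc r) (suc r + q)) ≡⟨ cong joinM (at-cells m L (suc r) q) ⟩
      joinM (look m L (suc r) q)            ≡⟨ cong (λ z → joinM (look m L (suc z) q)) (rowOf-filled m Wp (suc q)) ⟨
      joinM (look m L (suc (rowOf m (filled Wp) (suc q))) q)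
        ≡⟨ cong joinM (look-south m (filled Wp) q nothing (filled Wr) hole-step) ⟩
      joinM (first q (filled Wr))           ≡⟨ first-filled q Wr ⟩
      first q Wr ∎
      where open ≡-Reasoning

joinM-if : ∀ {A : Set} b (c : Maybe (Maybe A)) d → joinM (if b then c else d) ≡ (if b then joinM c else joinM d)
joinM-if true c d = refl
joinM-if false c d = refl

Rep-move : ∀ {m Wp v k x W T i j i' j'} → Legal m (labels Wp ++ v ∷ k ∷ labels W) →
           i ≡ rowOf m Wp v → j ≡ i + v → i' ≡ rowOf m Wp k → j' ≡ i' + k →
           Rep m (withHole Wp v ((k , x) ∷ W)) T →
           Rep m (withHole (Wp ∷ʳ (v , x)) k W) (put i j x (del i' j' T))
Rep-move {m} {Wp} {v} {k} {x} {W} {T} lg refl refl refl refl rep a b = begin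
  at (put i (i + v) x (del i' (i' + k) T)) a b
    ≡⟨ at-put i (i + v) x (del i' (i' + k) T) a b ⟩
  (if hit i (i + v) a b then just x else at (del i' (i' + k) T) a b)
    ≡⟨ cong (if hit i (i + v) a b then just x else_) (trans (at-del i' (i' + k) T a b)
         (trans (cong (if hit i' (i' + k) a b then nothing else_) (rep a b))
           (sym (joinM-if (hit i' (i' + k) a b) (just nothing) (at (cells m L) a b))))) ⟩
  (if hit i (i + v) a b then just x else joinM (override i' (i' + k) (just nothing) (at (cells m L)) a b))
    ≡⟨ joinM-if (hit i (i + v) a b) (just (just x)) _ ⟨
  joinM (override i (i + v) (just (just x)) (override i' (i' + k) (just nothing) (at (cells m L))) a b)
    ≡⟨ cong joinM (trans (at-swap m (filled Wp) (filled W) v nothing k (just x) a b ne)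
         (cong₂ (λ r r' → override r (r + v) (just (just x)) (override r' (r' + k) (just nothing) (at (cells m L))) a b)
           (rowOf-filled m Wp v) (rowOf-filled m Wp k))) ⟨
  joinM (at (cells m (filled Wp ++ (v , just x) ∷ (k , nothing) ∷ filled W)) a b)
    ≡⟨ cong (λ z → joinM (at (cells m z) a b)) (filled-snoc-++ Wp (v , x) _) ⟨
  joinM (at (cells m (withHole (Wp ∷ʳ (v , x)) k W)) a b) ∎
  where
  open ≡-Reasoning
  i = rowOf m Wp v
  i' = rowOf m Wp k
  L = withHole Wp v ((k , x) ∷ W)
  ne : v ≢ k
  ne = legal-≢ {adv m (labels Wp)} {v} {k} {labels W} (proj₂ (Legal-++ m (labels Wp) lg))

Rep-skip : ∀ {m Wp v k x W T} → adj v k ≡ false → Legal m (labels Wp ++ v ∷ k ∷ labels W) →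
           Rep m (withHole Wp v ((k , x) ∷ W)) T → Rep m (withHole (Wp ∷ʳ (k , x)) v W) T
Rep-skip {m} {Wp} {v} {k} {x} {W} f lg rep a b = trans (rep a b) (cong joinM (trans
  (at-commute m (filled Wp) (filled W) v nothing k (just x) f (subst (Legal m) lab lg) a b)
  (cong (λ z → at (cells m z) a b) (sym (filled-snoc-++ Wp (k , x) _)))))
  where
  lab : labels Wp ++ v ∷ k ∷ labels W ≡ labels (filled Wp ++ (v , nothing) ∷ (k , just x) ∷ filled W)
  lab = sym (trans (labels-++ (filled Wp) _) (cong₂ (λ y z → y ++ v ∷ k ∷ z) (labels-filled Wp) (labels-filled W)))

Rep-special : ∀ {m Wp x y c W T i} → Legal m (labels Wp ++ 0 ∷ 1 ∷ 0 ∷ labels W) → i ≡ rowOf m Wp 0 →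
              Rep m (withHole Wp 0 ((1 , x) ∷ (0 , y) ∷ W)) T →
              Rep m (withHole ((Wp ∷ʳ (0 , y)) ∷ʳ (1 , c)) 0 W)
                (put i i y (put i (suc i) c (del (suc i) (suc i) T)))
Rep-special {m} {Wp} {x} {y} {c} {W} {T} lg refl rep a b = begin
  at (put i i y (put i (suc i) c (del (suc i) (suc i) T))) a b
    ≡⟨ trans (at-put i i y (put i (suc i) c (del (suc i) (suc i) T)) a b) (cong (if hit i i a b then just y else_)
         (trans (at-put i (suc i) c (del (suc i) (suc i) T) a b) (cong (if hit i (suc i) a b then just c else_)
           (trans (at-del (suc i) (suc i) T a b) (cong (if hit (suc i) (suc i) a b then nothing else_) (rep a b)))))) ⟩
  override i i (just y) (override i (suc i) (just c) (override (suc i) (suc i) nothing (λ a b → joinM (at (cells m L) a b)))) a b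
    ≡⟨ pull-join (hit i i a b) (hit i (suc i) a b) (hit (suc i) (suc i) a b) (at (cells m L) a b) ⟩
  joinM (override i i (just (just y)) (override i (suc i) (just (just c)) (override (suc i) (suc i) (just nothing) (at (cells m L)))) a b)
    ≡⟨ cong joinM (trans (at-set₃ m (filled Wp) (filled W) nothing (just x) (just y) (just y) (just c) nothing a b) boxes) ⟨
  joinM (at (cells m (filled Wp ++ (0 , just y) ∷ (1 , just c) ∷ (0 , nothing) ∷ filled W)) a b)
    ≡⟨ cong (λ z → joinM (at (cells m z) a b)) (trans (filled-snoc-++ (Wp ∷ʳ (0 , y)) (1 , c) _) (filled-snoc-++ Wp (0 , y) _)) ⟨
  joinM (at (cells m (withHole ((Wp ∷ʳ (0 , y)) ∷ʳ (1 , c)) 0 W)) a b) ∎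
  where
  open ≡-Reasoning
  i = rowOf m Wp 0
  L = withHole Wp 0 ((1 , x) ∷ (0 , y) ∷ W)
  pull-join : ∀ b₁ b₂ b₃ (z : Maybe (Maybe Letter)) →
    (if b₁ then just y else (if b₂ then just c else (if b₃ then nothing else joinM z))) ≡
    joinM (if b₁ then just (just y) else (if b₂ then just (just c) else (if b₃ then just nothing else z)))
  pull-join true _ _ z = refl
  pull-join false true _ z = refl
  pull-join false false true z = refl
  pull-join false false false z = refl
  r₀ : rowOf m (filled Wp) 0 ≡ i
  r₀ = rowOf-filled m Wp 0
  r₁ : rowOf m (filled Wp) 1 ≡ i
  r₁ = trans (rowOf-filled m Wp 1) (row-east {m} {Wp} {0} {(1 , x) ∷ (0 , y) ∷ W} lg)
  box : ℕ → ℕ → ℕ → Maybe (Maybe Letter)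
  box c₀ c₁ c₂ = override i c₀ (just (just y)) (override i c₁ (just (just c)) (override (suc i) c₂ (just nothing) (at (cells m L)))) a b
  boxes : override (rowOf m (filled Wp) 0) (rowOf m (filled Wp) 0 + 0) (just (just y))
            (override (rowOf m (filled Wp) 1) (rowOf m (filled Wp) 1 + 1) (just (just c))
              (override (suc (rowOf m (filled Wp) 0)) (suc (rowOf m (filled Wp) 0) + 0) (just nothing) (at (cells m L)))) a b
          ≡ box i (suc i) (suc i)
  boxes = trans (cong₂ (λ r s → override r (r + 0) (just (just y)) (override s (s + 1) (just (just c))
              (override (suc r) (suc r + 0) (just nothing) (at (cells m L)))) a b) r₀ r₁)
            (trans (cong (λ z → box z (i + 1) (suc z)) (+-identityʳ i)) (cong (λ z → box i z (suc i)) (+-comm i 1)))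

record Slid (ε : ℤ → Bool) (s : Dir) (m : State) (Wp : List Entry) (v : ℕ) (Wr : List Entry) (T : Cells) : Set where
  constructor slid
  field
    result   : List Entry
    isLabels : labels result ≡ labels Wp ++ passW v (labels Wr)
    isValues : map value result ≡ map value (Wp ++ Wr)
    isCoh    : Coh ε s result
    isRep    : T ≈F cells m result

east-first : ∀ {x y} → val x ℤ.≤ val y → (val x ≡ val y → primed x ≡ true) →
             ((val x <ℤ val y) ∨ ((val x ==ℤ val y) ∧ primed x)) ≡ true
east-first {x} {y} le h = go (val x ℤP.<? val y) (val x ℤP.≟ val y)
  where
  go : (d : Dec (val x ℤ.< val y)) (e : Dec (val x ≡ val y)) → (does d ∨ (does e ∧ primed x)) ≡ true
  go (yes _) _ = refl
  go (no n) (yes e) = h e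
  go (no n) (no ne) = contradiction (ℤP.≤∧≢⇒< le ne) n

south-first : ∀ {x y} → val y ℤ.≤ val x → (val y ≡ val x → primed x ≡ false) →
              ((val x <ℤ val y) ∨ ((val x ==ℤ val y) ∧ primed x)) ≡ false
south-first {x} {y} le h = go (val x ℤP.<? val y) (val x ℤP.≟ val y)
  where
  go : (d : Dec (val x ℤ.< val y)) (e : Dec (val x ≡ val y)) → (does d ∨ (does e ∧ primed x)) ≡ false
  go (yes lt) _ = contradiction lt (ℤP.≤⇒≯ le)
  go (no n) (yes e) = h (sym e)
  go (no n) (no ne) = refl

first-head : ∀ k (x : Letter) W → first k ((k , x) ∷ W) ≡ just x
first-head k x W rewrite ≡ᵇ-refl k = refl

first-tail : ∀ k l (x : Letter) W → l ≢ k → first k ((l , x) ∷ W) ≡ first k W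
first-tail k l x W ne rewrite ≡ᵇ-false ne = refl

module _ {ε : ℤ → Bool} {s : Dir} {m : State} where

  suffix : ∀ {Wp v k x W} → Mid ε s m Wp v ((k , x) ∷ W) →
           Coh ε (prevDir s Wp (k , x)) ((k , x) ∷ W) × Sorted ((k , x) ∷ W)
  suffix {Wp} (mid _ c o) = Coh-suffix Wp c , Sorted-suffix Wp o

  sorted-head : ∀ {Wp v k x W} → Mid ε s m Wp v ((k , x) ∷ W) → ∀ {e} → e ∈ W → val x ℤ.≤ value e
  sorted-head M p with suffix M
  ... | _ , (a ∷ _) = All.lookup a p

  -- The first entry on an adjacent diagonal is the neighbour that the slide moves. The other
  -- neighbour comes later in the word: its absolute value is larger, or it is equal and
  -- `later-smaller` makes `x` primed. On the main diagonal, equality of values with the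
  -- southeastern entry would be the special case.
  slide-up : ∀ f T Wp v x W → Mid ε s m Wp v ((suc v , x) ∷ W) → ¬ Special v (suc v) x W →
    Rep m (withHole Wp v ((suc v , x) ∷ W)) T → (r j : ℕ) → r ≡ rowOf m Wp v → j ≡ r + v →
    slide (suc f) T r j ≡ slide f (put r j x (del r (suc j) T)) r (suc j)
  slide-up f T Wp v x W M n rep r j refl refl = decide (south v W) refl
    where
    lg = Mid.legal M
    aE : at T r (suc (r + v)) ≡ just x
    aE = trans (at-east lg {T} rep) (first-head (suc v) x W)
    aS : at T (suc r) (r + v) ≡ south v W
    aS = trans (at-south lg {T} rep) (skip v)
      where
      skip : ∀ v → south v ((suc v , x) ∷ W) ≡ south v W
      skip zero = refl
      skip (suc q) = first-tail q (suc (suc q)) x W (>⇒≢ (<-trans (n<1+n q) (n<1+n (suc q))))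
    south-∈ : ∀ v {y} → south v W ≡ just y → ∃ λ q → v ≡ suc q × (q , y) ∈ W
    south-∈ (suc q) e = q , refl , first-∈ q W e
    both : ∀ y → south v W ≡ just y → ((val x <ℤ val y) ∨ ((val x ==ℤ val y) ∧ primed x)) ≡ true
    both y e with south-∈ v e
    ... | q , refl , y∈ = east-first {x} {y} (sorted-head M y∈)
      (λ e → proj₁ (later-smaller (proj₁ (suffix M)) (proj₂ (suffix M)) y∈ (sym e) (<-trans (n<1+n q) (n<1+n (suc q)))))
    plain : v ≡ 0 → ∀ x' → x' ≡ x → ∀ z → z ≡ first 0 W → Plain x' z
    plain refl x' refl nothing e = plain-alone
    plain refl x' refl (just z) e = plain-value λ q → contradiction-special q (later-smaller (proj₁ (suffix M)) (proj₂ (suffix M))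
                               (first-∈ 0 W (sym e)) (sym q) (s≤s z≤n))
      where
      contradiction-special : val x ≡ val z → primed x ≡ true × nextDir (1 , x) W ≡ desc → ⊥
      contradiction-special q (_ , d) = go W d n
        where
        go : ∀ W → nextDir (1 , x) W ≡ desc → ¬ Special 0 1 x W → ⊥
        go ((k , w) ∷ W') d n with val x ℤP.≟ val w
        go ((zero , w) ∷ W') d n | yes e = n (w , W' , refl , refl , refl , e)
        go ((suc zero , w) ∷ W') () n | yes e
        go ((suc (suc k) , w) ∷ W') () n | yes e
    decide : ∀ c → south v W ≡ c → slide (suc f) T r (r + v) ≡ slide f (put r (r + v) x (del r (suc (r + v)) T)) r (suc (r + v))
    decide (just y) e = slide-east-both f T r (r + v) aE (trans aS e) (both y e)
    decide nothing e = offdiag v refl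
      where
      offdiag : ∀ q → v ≡ q → slide (suc f) T r (r + v) ≡ slide f (put r (r + v) x (del r (suc (r + v)) T)) r (suc (r + v))
      offdiag (suc q) refl = slide-east-off f T r (r + suc q) aE (trans aS e)
        (≡ᵇ-false (<⇒≢ (m<m+n r (s≤s z≤n))))
      offdiag zero refl = diag (r + 0) (sym (+-identityʳ r)) aE (trans aS e)
        (trans (cong (at T (suc r)) (cong suc (sym (+-identityʳ r)))) (trans (at-southeast lg {T} rep) (first-tail 0 1 x W λ ())))
        where
        diag : ∀ j → r ≡ j → at T r (suc j) ≡ just x → at T (suc r) j ≡ nothing → at T (suc r) (suc r) ≡ first 0 W →
               slide (suc f) T r j ≡ slide f (put r j x (del r (suc j) T)) r (suc j)
        diag _ refl a b c = slide-east-diagonal f T r a b (plain refl x refl (at T (suc r) (suc r)) c)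

  slide-down : ∀ f T Wp q x W → Mid ε s m Wp (suc q) ((q , x) ∷ W) →
    Rep m (withHole Wp (suc q) ((q , x) ∷ W)) T → (r j : ℕ) → r ≡ rowOf m Wp (suc q) → j ≡ r + suc q →
    slide (suc f) T r j ≡ slide f (put r j x (del (suc r) j T)) (suc r) j
  slide-down f T Wp q x W M rep r j refl refl = decide (first (suc (suc q)) W) refl
    where
    lg = Mid.legal M
    aS : at T (suc r) (r + suc q) ≡ just x
    aS = trans (at-south lg {T} rep) (first-head q x W)
    aE : at T r (suc (r + suc q)) ≡ first (suc (suc q)) W
    aE = trans (at-east lg {T} rep) (first-tail (suc (suc q)) q x W (<⇒≢ (<-trans (n<1+n q) (n<1+n (suc q)))))
    decide : ∀ c → first (suc (suc q)) W ≡ c → slide (suc f) T r (r + suc q) ≡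
             slide f (put r (r + suc q) x (del (suc r) (r + suc q) T)) (suc r) (r + suc q)
    decide nothing e = slide-south f T r (r + suc q) (trans aE e) aS
    decide (just y) e = slide-south-both f T r (r + suc q) (trans aE e) aS
      (south-first {y} {x} (sorted-head M y∈)
        (λ v → later-larger (proj₁ (suffix M)) (proj₂ (suffix M)) y∈ (sym v) (<-trans (n<1+n q) (n<1+n (suc q)))))
      where y∈ = first-∈ (suc (suc q)) W e

  slide-spec : ∀ f T Wp x y W → val x ≡ val y → Mid ε s m Wp 0 ((1 , x) ∷ (0 , y) ∷ W) →
    Rep m (withHole Wp 0 ((1 , x) ∷ (0 , y) ∷ W)) T → (r : ℕ) → r ≡ rowOf m Wp 0 →
    slide (suc f) T r r ≡ slide f (put r r y (put r (suc r) (un (val x)) (del (suc r) (suc r) T))) (suc r) (suc r)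
  slide-spec f T Wp x y W e M rep r refl = letter x refl (proj₁ (later-smaller (proj₁ (suffix M)) (proj₂ (suffix M))
                                             (here refl) (sym e) (s≤s z≤n)))
    where
    lg = Mid.legal M
    r0 : r + 0 ≡ r
    r0 = +-identityʳ r
    aE : at T r (suc r) ≡ just x
    aE = trans (cong (λ z → at T r (suc z)) (sym r0)) (at-east lg {T} rep)
    aS : at T (suc r) r ≡ nothing
    aS = trans (cong (at T (suc r)) (sym r0)) (at-south lg {T} rep)
    aD : at T (suc r) (suc r) ≡ just y
    aD = trans (cong (λ z → at T (suc r) (suc z)) (sym r0)) (at-southeast lg {T} rep)
    letter : ∀ x' → x' ≡ x → primed x ≡ true →
      slide (suc f) T r r ≡ slide f (put r r y (put r (suc r) (un (val x)) (del (suc r) (suc r) T))) (suc r) (suc r)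
    letter (un a) refl ()
    letter (pr a) refl _ = slide-special f T r aE aS aD e

  Slid-snoc : ∀ {Wp v Wr Wp' v' Wr' T} →
    labels Wp' ++ passW v' (labels Wr') ≡ labels Wp ++ passW v (labels Wr) →
    map value (Wp' ++ Wr') ≡ map value (Wp ++ Wr) → Slid ε s m Wp' v' Wr' T → Slid ε s m Wp v Wr T
  Slid-snoc e e' (slid R a b c d) = slid R (trans a e) (trans b e') c d

  slide-stop′ : ∀ f T r j → at T r (suc j) ≡ nothing → at T (suc r) j ≡ nothing → slide f T r j ≡ T
  slide-stop′ zero T r j _ _ = refl
  slide-stop′ (suc f) T r j e e' = slide-stop f T r j e e'

  value-snoc : ∀ Wp k l (x : Letter) W → map value ((Wp ∷ʳ (k , x)) ++ W) ≡ map value (Wp ++ (l , x) ∷ W)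
  value-snoc Wp k l x W = trans (cong (map value) (++-assoc Wp [ k , x ] W))
    (trans (map-++ value Wp _) (sym (map-++ value Wp _)))

  -- Only entries that move cost fuel, and each entry is met once, so the length of the remaining
  -- word bounds the number of steps. The special case spends one unit for two entries.
  slide-sim : ∀ f T Wp v Wr → length Wr ≤ f → Mid ε s m Wp v Wr → Rep m (withHole Wp v Wr) T →
              ∀ r j → r ≡ rowOf m Wp v → j ≡ r + v → Slid ε s m Wp v Wr (slide f T r j)
  slide-sim f T Wp v Wr le M rep r j er ej = go f T Wp v Wr le M rep r j er ej (view v Wr)
    where
    go : ∀ f T Wp v Wr → length Wr ≤ f → Mid ε s m Wp v Wr → Rep m (withHole Wp v Wr) T →
         ∀ r j → r ≡ rowOf m Wp v → j ≡ r + v → View v Wr → Slid ε s m Wp v Wr (slide f T r j)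
    go f T Wp v [] le M rep r j refl refl vnil = slid Wp (sym (++-identityʳ _)) (cong (map value) (sym (++-identityʳ Wp)))
      (subst (Coh ε s) (++-identityʳ Wp) (Mid.coh M))
      (λ i k → trans (cong (λ Z → at Z i k) (slide-stop′ f T r j (at-east (Mid.legal M) {T} rep) (trans (at-south (Mid.legal M) {T} rep) (noSouth v))))
                 (trans (rep i k) (Rep-end m Wp v i k)))
      where
      noSouth : ∀ v → south v [] ≡ nothing
      noSouth zero = refl
      noSouth (suc v) = refl
    go f T Wp v ((k , x) ∷ W) le M rep r j er ej (vskip a) =
      Slid-snoc {Wp' = Wp ∷ʳ (k , x)} lab (value-snoc Wp k k x W)
        (slide-sim f T (Wp ∷ʳ (k , x)) v W (<⇒≤ le) (mid-skip a M) (Rep-skip {m} {Wp} {T = T} a (Mid.legal M) rep) r j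
          (trans er (sym (rowOf-snoc-≢ m Wp k x v ne))) ej)
      where
      ne : k ≢ v
      ne q = legal-≢ {adv m (labels Wp)} {v} {k} {labels W} (proj₂ (Legal-++ m (labels Wp) (Mid.legal M))) (sym q)
      lab : labels (Wp ∷ʳ (k , x)) ++ passW v (labels W) ≡ labels Wp ++ passW v (k ∷ labels W)
      lab rewrite a = labels-snoc-++ Wp (k , x) _
    go (suc f) T Wp v ((.(suc v) , x) ∷ W) (s≤s le) M rep r j er ej (vmove up n) =
      Slid-snoc {Wp' = Wp ∷ʳ (v , x)} lab (value-snoc Wp v (suc v) x W)
        (subst (Slid ε s m (Wp ∷ʳ (v , x)) (suc v) W) (sym (slide-up f T Wp v x W M n rep r j er ej))
          (slide-sim f _ (Wp ∷ʳ (v , x)) (suc v) W le (mid-move up n M)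
            (Rep-move {m} {Wp} {T = T} (Mid.legal M) er ej er' ej' rep) r (suc j)
            (trans er' (sym (rowOf-snoc-≢ m Wp v x (suc v) (<⇒≢ (n<1+n v))))) ej'))
      where
      er' : r ≡ rowOf m Wp (suc v)
      er' = trans er (sym (row-east {m} {Wp} {v} {(suc v , x) ∷ W} (Mid.legal M)))
      ej' : suc j ≡ r + suc v
      ej' = trans (cong suc ej) (sym (+-suc r v))
      lab : labels (Wp ∷ʳ (v , x)) ++ passW (suc v) (labels W) ≡ labels Wp ++ passW v (suc v ∷ labels W)
      lab rewrite adj-up v = labels-snoc-++ Wp (v , x) _
    go (suc f) T Wp (suc q) ((.q , x) ∷ W) (s≤s le) M rep r j er ej (vmove down n) =
      Slid-snoc {Wp' = Wp ∷ʳ (suc q , x)} lab (value-snoc Wp (suc q) q x W)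
        (subst (Slid ε s m (Wp ∷ʳ (suc q , x)) q W) (sym (slide-down f T Wp q x W M rep r j er ej))
          (slide-sim f _ (Wp ∷ʳ (suc q , x)) q W le (mid-move down n M)
            (Rep-move {m} {Wp} {T = T} (Mid.legal M) er ej er' ej' rep) (suc r) j
            (trans er' (sym (rowOf-snoc-≢ m Wp (suc q) x q (>⇒≢ (n<1+n q))))) ej'))
      where
      er' : suc r ≡ rowOf m Wp q
      er' = trans (cong suc er) (sym (row-south {m} {Wp} {suc q} {(q , x) ∷ W} (Mid.legal M) q refl))
      ej' : j ≡ suc r + q
      ej' = trans ej (+-suc r q)
      lab : labels (Wp ∷ʳ (suc q , x)) ++ passW q (labels W) ≡ labels Wp ++ passW (suc q) (q ∷ labels W)
      lab rewrite adj-down q = labels-snoc-++ Wp (suc q , x) _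
    go (suc f) T Wp .0 ((.1 , x) ∷ (.0 , y) ∷ W) (s≤s le) M rep r j er ej (vspec e) =
      Slid-snoc {Wp' = (Wp ∷ʳ (0 , y)) ∷ʳ (1 , un (val x))} lab vals
        (subst (Slid ε s m ((Wp ∷ʳ (0 , y)) ∷ʳ (1 , un (val x))) 0 W)
          (sym (trans (cong (slide (suc f) T r) j≡) (slide-spec f T Wp x y W e M rep r er)))
          (slide-sim f _ ((Wp ∷ʳ (0 , y)) ∷ʳ (1 , un (val x))) 0 W (<⇒≤ le) (mid-special e M)
            (Rep-special {m} {Wp} {T = T} (Mid.legal M) er rep) (suc r) (suc r)
            (trans (cong suc er) (sym (trans (rowOf-snoc-≢ m (Wp ∷ʳ (0 , y)) 1 (un (val x)) 0 λ ()) (rowOf-snoc-≡ m Wp 0 y))))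
            (sym (+-identityʳ (suc r)))))
      where
      j≡ : j ≡ r
      j≡ = trans ej (+-identityʳ r)
      lab : labels ((Wp ∷ʳ (0 , y)) ∷ʳ (1 , un (val x))) ++ passW 0 (labels W) ≡ labels Wp ++ passW 0 (1 ∷ 0 ∷ labels W)
      lab = trans (labels-snoc-++ (Wp ∷ʳ (0 , y)) _ _) (labels-snoc-++ Wp (0 , y) _)
      vals : map value (((Wp ∷ʳ (0 , y)) ∷ʳ (1 , un (val x))) ++ W) ≡ map value (Wp ++ (1 , x) ∷ (0 , y) ∷ W)
      vals = trans (cong (map value) (trans (++-assoc (Wp ∷ʳ (0 , y)) [ 1 , un (val x) ] W) (++-assoc Wp [ 0 , y ] _)))
               (sym (special-values {ε} {s} {m} Wp x y W e))

-- The entries of one block while they are being switched.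

passV-snoc : ∀ v W k → passV v (W ∷ʳ k) ≡ cr (passV v W) k
passV-snoc v [] k = refl
passV-snoc v (l ∷ W) k = passV-snoc (cr v l) W k

-- The relative position of two consecutive entries of a block survives an
-- exchange with a third entry, except in the situation of (S4).
pair-step : ∀ {m} a c k w → Legal m (a ∷ c ∷ k ∷ w) → ¬ (a ≡ 0 × c ≡ 1 × k ≡ 0) →
            cmp (cr a (cl c k)) (cr c k) ≡ cmp a c
pair-step {m} a c k w l n = go (adj c k) refl
  where
  c≢a : c ≢ a
  c≢a e = legal-≢ {m} {a} {c} {k ∷ w} l (sym e)
  c≢k : c ≢ k
  c≢k = legal-≢ {bump a m} {c} {k} {w} (proj₂ l)
  outer : ∀ {a c k} → Adj a c → Adj c k → k ≢ a → cmp c k ≡ cmp a c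
  outer {a} up up _ = trans (<⇒cmp (n<1+n (suc a))) (sym (<⇒cmp (n<1+n a)))
  outer up down ne = contradiction refl ne
  outer down up ne = contradiction refl ne
  outer down (down {k}) _ = trans (>⇒cmp (n<1+n k)) (sym (>⇒cmp (n<1+n (suc k))))
  far : ∀ t → adj a k ≡ t → cmp (if adj a k then k else a) c ≡ cmp a c
  far true e rewrite e = cmp-adjʳ (adj-true {a} {k} e) c≢a c≢k
  far false e rewrite e = refl
  near : Adj c k → ∀ t → adj a c ≡ t → cmp (if adj a c then c else a) k ≡ cmp a c
  near ad true e rewrite e = outer (adj-true {a} {c} e) ad k≢a
    where
    k≢a : k ≢ a
    k≢a refl with sandwich {m} {a} {c} {w} l (adj-true {a} {c} e)
    ... | refl , refl = n (refl , refl , refl)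
  near ad false e rewrite e = cmp-adjˡ ad (c≢a ∘ sym) a≢k
    where
    a≢k : a ≢ k
    a≢k refl with trans (sym e) (trans (adj-sym a c) (adj-of ad))
      where
      adj-of : ∀ {x y} → Adj x y → adj x y ≡ true
      adj-of (up {x}) = adj-up x
      adj-of (down {x}) = adj-down x
    ... | ()
  go : ∀ t → adj c k ≡ t → cmp (cr a (cl c k)) (cr c k) ≡ cmp a c
  go true e rewrite e = near (adj-true {c} {k} e) (adj a c) refl
  go false e rewrite e = far (adj a k) refl

pass-≢0 : ∀ v W → v ≢ 0 → 0 ∉ W → passV v W ≢ 0
pass-≢0 v [] nv nW = nv
pass-≢0 v (k ∷ W) nv nW = pass-≢0 (cr v k) W nc (nW ∘ there)
  where
  nc : cr v k ≢ 0
  nc e with adj v k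
  ... | true = nW (here (sym e))
  ... | false = nv e

pass-far : ∀ v W → All (λ k → adj v k ≡ false) W → passV v W ≡ v × passW v W ≡ W
pass-far v [] [] = refl , refl
pass-far v (k ∷ W) (f ∷ fs) rewrite f with pass-far v W fs
... | p , q rewrite p | q = refl , refl

raise : ∀ {m k} w → m k ≡ suc (m (suc k)) → Legal m w → k ∈ w →
        ∃ λ X → ∃ λ Y → w ≡ X ++ suc k ∷ Y × k ∈ Y
raise {m} {k} (x ∷ w) e (s , l) k∈ with x ≟ k | x ≟ suc k
... | yes refl | _ = contradiction (trans (sym e) (proj₁ s)) (1+n≢n)
... | no ne | yes refl = [] , w , refl , tail-∈ k∈
  where
  tail-∈ : k ∈ suc k ∷ w → k ∈ w
  tail-∈ (there q) = q
  tail-∈ (here q) = contradiction (sym q) 1+n≢n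
... | no ne | no ne' with raise w (trans (bump-diff x k m ne) (trans e (cong suc (sym (bump-diff x (suc k) m ne'))))) l (tail-∈ k∈)
  where
  tail-∈ : k ∈ x ∷ w → k ∈ w
  tail-∈ (there q) = q
  tail-∈ (here q) = contradiction (sym q) ne
...   | X , Y , q , r = x ∷ X , Y , cong (x ∷_) q , r

after-step : ∀ {m k} → Step m k → bump k m k ≡ suc (bump k m (suc k))
after-step {m} {k} (n , _) = trans (bump-same k m) (cong suc (trans n (sym (bump-diff k (suc k) m (1+n≢n ∘ sym)))))

lower : ∀ {m k} w → m k ≡ m (suc k) → Legal m w → suc k ∈ w → k ∈ w
lower {m} {k} (x ∷ w) e (s , l) k∈ with x ≟ k | x ≟ suc k
... | yes refl | _ = here refl
... | no ne | yes refl = contradiction (trans (sym e) (proj₂ s)) (1+n≢n ∘ sym)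
... | no ne | no ne' = there (lower w (trans (bump-diff x k m ne) (trans e (sym (bump-diff x (suc k) m ne')))) l (tail-∈ k∈))
  where
  tail-∈ : suc k ∈ x ∷ w → suc k ∈ w
  tail-∈ (there q) = q
  tail-∈ (here q) = contradiction (sym q) ne'

after-step-west : ∀ {m k} → Step m (suc k) → bump (suc k) m k ≡ bump (suc k) m (suc k)
after-step-west {m} {k} (_ , w) = trans (bump-diff (suc k) k m 1+n≢n) (trans w (sym (bump-same (suc k) m)))

-- Between two entries on diagonal k lies one on diagonal k + 1. It would be unprimed because it is
-- larger than the earlier of the two, and primed because the later one is smaller.
block-distinct : ∀ {ε s m e L} → Coh ε s (e ∷ L) → Sorted (e ∷ L) → Legal m (labels (e ∷ L)) →
           ∀ {e'} → e' ∈ L → value e' ≡ value e → All (λ f → value f ≡ value e) L → proj₁ e' ≢ proj₁ e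
block-distinct {ε} {s} {m} {e} {L} c o (st , l) {e'} p q vs refl
  with raise (labels L) (after-step {m} {proj₁ e} st) l (∈-labels p)
  where
  ∈-labels : ∀ {e'} {L : List Entry} → e' ∈ L → proj₁ e' ∈ labels L
  ∈-labels (here refl) = here refl
  ∈-labels (there p) = there (∈-labels p)
... | X , Y , eq , k∈Y = clash L X Y eq k∈Y c o vs
  where
  ∈-unlabel : ∀ (L : List Entry) {k} → k ∈ labels L → ∃ λ x → (k , x) ∈ L
  ∈-unlabel ((k , x) ∷ L) (here refl) = x , here refl
  ∈-unlabel (e ∷ L) (there p) with ∈-unlabel L p
  ... | x , q = x , there q
  locate : ∀ {ε s} (L : List Entry) X Y {k a} → labels L ≡ X ++ suc k ∷ Y → k ∈ Y → Coh ε s L → Sorted L →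
           All (λ f → value f ≡ a) L → ∃ λ x → (suc k , x) ∈ L × val x ≡ a × primed x ≡ true
  locate (f ∷ L) [] Y refl k∈ c o (v ∷ vs) with ∈-unlabel L k∈
  ... | y , y∈ = _ , here refl , v , proj₁ (later-smaller c o y∈ (trans (All.lookup vs y∈) (sym v)) (n<1+n _))
  locate (f ∷ L) (x ∷ X) Y eq k∈ (_ , c) (_ ∷ o) (v ∷ vs) with locate L X Y (cons-tail eq) k∈ c o vs
    where
    cons-tail : ∀ {a b : ℕ} {u w : List ℕ} → a ∷ u ≡ b ∷ w → u ≡ w
    cons-tail refl = refl
  ... | y , y∈ , r = y , there y∈ , r
  clash : ∀ L X Y → labels L ≡ X ++ suc (proj₁ e) ∷ Y → proj₁ e ∈ Y → Coh ε s (e ∷ L) → Sorted (e ∷ L) →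
          All (λ f → value f ≡ value e) L → ⊥
  clash L X Y eq k∈ c@(_ , c') o@(_ ∷ o') vs with locate L X Y eq k∈ c' o' vs
  ... | y , y∈ , vy , py with trans (sym py) (later-larger c o y∈ vy (n<1+n _))
  ...   | ()

Shape-≤ : ∀ {m} → Shape m → ∀ k d → m (k + d) ≤ m k
Shape-≤ {m} sh k zero = ≤-reflexive (cong m (+-identityʳ k))
Shape-≤ {m} sh k (suc d) = ≤-trans (≤-reflexive (cong m (+-suc k d))) (≤-trans (one (k + d)) (Shape-≤ sh k d))
  where
  one : ∀ i → m (suc i) ≤ m i
  one i with sh i
  ... | inj₁ e = ≤-reflexive (sym e)
  ... | inj₂ e = ≤-trans (n≤1+n _) (≤-reflexive (sym e))

Shape-+ : ∀ {m} → Shape m → ∀ k d → m k + k ≤ m (k + d) + (k + d)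
Shape-+ {m} sh k zero rewrite +-identityʳ k = ≤-refl
Shape-+ {m} sh k (suc d) = ≤-trans (Shape-+ sh k d) (≤-trans (one (k + d)) (≤-reflexive (cong (λ z → m z + z) (sym (+-suc k d)))))
  where
  one : ∀ i → m i + i ≤ m (suc i) + suc i
  one i with sh i
  ... | inj₁ e = ≤-trans (+-monoʳ-≤ (m i) (n≤1+n i)) (≤-reflexive (cong (_+ suc i) e))
  ... | inj₂ e = ≤-reflexive (trans (cong (_+ i) e) (sym (+-suc (m (suc i)) i)))

module _ {m : State} (sh : Shape m) {k} {X : List ℕ} (l : Legal m (k ∷ X)) where

  private
    M : State
    M = adv m (k ∷ X)
    shM : Shape M
    shM = Shape-adv {m} (k ∷ X) sh l
    M≥ : suc (m k) ≤ M k
    M≥ = adv-∈ m {k ∷ X} (here refl)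

  later-south : ∀ {l} → l < k → suc (m k) < suc (M l)
  later-south {l} lt with m≤n⇒∃[o]m+o≡n (<⇒≤ lt)
  ... | d , refl = s≤s (≤-trans M≥ (Shape-≤ shM l d))

  later-east : ∀ {l} → k < l → suc (m k) + k < suc (M l) + l
  later-east {l} lt with m≤n⇒∃[o]m+o≡n (<⇒≤ lt)
  ... | d , refl = s≤s (≤-trans (+-monoˡ-≤ k M≥) (Shape-+ shM k d))

-- Signs between the entries of a block that is being moved: the entries of R
-- (in reverse) have not moved, the entry p has passed W and has still to pass V,
-- those of D have passed everything.

inR : List Entry → ℕ → Dir
inR [] k = none
inR ((l , _) ∷ R) k = cmp l k

CohR : Bool → List Entry → Dir → Set
CohR ε [] t = t ≡ none
CohR ε ((l , y) ∷ R) t = isPrimed ε (inR R l) t ≡ just (primed y) × CohR ε R (inR R l)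

-- The entry `l` has not yet passed `W`, while `c` has. Their sign is taken where `l` will be after
-- passing `W`, so that both are compared at the same stage; this is the quantity that `before-step`
-- keeps constant.
before : List Entry → List ℕ → ℕ → Dir
before [] W c = none
before ((l , _) ∷ R) W c = cmp (passV l W) c

after : ℕ → List ℕ → List Entry → Dir
after c V [] = none
after c V ((l , _) ∷ D) = cmp (passV c V) l

record Moving (ε : Bool) (R : List Entry) (W : List ℕ) (c : ℕ) (α : Letter) (V : List ℕ) (D : List Entry) : Set where
  constructor moving
  field
    cohR : CohR ε R (before R W c)
    cohP : isPrimed ε (before R W c) (after c V D) ≡ just (primed α)
    cohD : Coh (λ _ → ε) (after c V D) D

before-step : ∀ {m} R {W c k V} → (∀ l y R' → R ≡ (l , y) ∷ R' → Legal m (l ∷ W ++ c ∷ k ∷ V) × ¬ (passV l W ≡ 0 × c ≡ 1 × k ≡ 0)) →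
              before R (W ∷ʳ cl c k) (cr c k) ≡ before R W c
before-step [] h = refl
before-step {m} ((l , y) ∷ R) {W} {c} {k} {V} h with h l y R refl
... | lg , n = trans (cong (λ z → cmp z (cr c k)) (passV-snoc l W (cl c k)))
  (pair-step {adv m (passW l W)} (passV l W) c k V
    (proj₂ (Legal-++ m (passW l W) (~-Legal (pass-~ l W (c ∷ k ∷ V)) {m} lg))) n)

Moving-step : ∀ {ε R W c α k V D} → before R (W ∷ʳ cl c k) (cr c k) ≡ before R W c →
              Moving ε R W c α (k ∷ V) D → Moving ε R (W ∷ʳ cl c k) (cr c k) α V D
Moving-step {ε} {R} {W} {c} {α} {k} {V} {D} e (moving a b d) = moving
  (subst (CohR ε R) (sym e) a)
  (trans (cong₂ (isPrimed ε) e (aft D)) b)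
  (subst (λ t → Coh (λ _ → ε) t D) (sym (aft D)) d)
  where
  aft : ∀ D → after (cr c k) V D ≡ after c (k ∷ V) D
  aft [] = refl
  aft (_ ∷ _) = refl

next-after : ∀ c α D → All (λ f → value f ≡ val α) D → nextDir (c , α) D ≡ after c [] D
next-after c α [] _ = refl
next-after c α ((l , y) ∷ D) (v ∷ _) = dir-same (c , α) (l , y) (sym v)

-- When one entry has passed everything, the word `W` behind it is what the next entry of `R` has in
-- front of it, and the anticipated sign becomes the actual one.
Moving-done : ∀ {ε l y R W c α D} → All (λ f → value f ≡ val α) D →
              Moving ε ((l , y) ∷ R) W c α [] D → Moving ε R [] l y W ((c , α) ∷ D)
Moving-done {ε} {l} {y} {R} {W} {c} {α} {D} vs (moving (a , a') b d) = moving
  (subst (CohR ε R) (sym (bef R)) a')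
  (trans (cong (λ z → isPrimed ε z (cmp (passV l W) c)) (bef R)) a)
  (trans (cong (isPrimed ε (cmp (passV l W) c)) (next-after c α D vs)) b ,
   subst (λ t → Coh (λ _ → ε) t D) (sym (next-after c α D vs)) d)
  where
  bef : ∀ R → before R [] l ≡ inR R l
  bef [] = refl
  bef (_ ∷ _) = refl

Moving-final : ∀ {ε W c α D} → All (λ f → value f ≡ val α) D → Moving ε [] W c α [] D →
               Coh (λ _ → ε) none ((c , α) ∷ D)
Moving-final {ε} {W} {c} {α} {D} vs (moving a b d) =
  trans (cong (isPrimed ε none) (next-after c α D vs)) b , subst (λ t → Coh (λ _ → ε) t D) (sym (next-after c α D vs)) d

ok-bottom : ∀ ε t {b} → isPrimed ε t asc ≡ just b → t ≢ asc → isPrimed ε t desc ≡ just true × (ε ≡ b)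
ok-bottom ε none refl n = refl , refl
ok-bottom ε desc refl n = refl , refl
ok-bottom ε asc e n = contradiction refl n

ok-turn : ∀ ε t {b b'} → isPrimed ε asc t ≡ just b → ε ≡ b' → isPrimed ε desc t ≡ just b'
ok-turn ε none refl refl = refl
ok-turn ε asc refl refl = refl

-- (S4): the entry c = 1 and the entry of R on the main diagonal both move.
Moving-S4 : ∀ {ε a α₀ R W α V D} →
  (∀ l y R' → R ≡ (l , y) ∷ R' → 0 < l × 1 < passV l (W ∷ʳ 0)) → passV 0 W ≡ 0 → passV 0 V ≡ 0 → passV 1 V ≢ 0 →
  All (λ f → value f ≡ val α₀) D → Moving ε ((0 , α₀) ∷ R) W 1 α (0 ∷ V) D → Moving ε R (W ∷ʳ 0) 1 (pr a) V ((0 , α₀) ∷ D)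
Moving-S4 {ε} {a} {α₀} {R} {W} {α} {V} {D} hR e₀ e₁ ne vs (moving (o , o') o'' d) = moving
  (subst (CohR ε R) (sym (bef R hR)) o')
  (trans (cong₂ (isPrimed ε) (bef R hR) (>⇒cmp (n≢0⇒n>0 ne))) (proj₁ bottom))
  (trans (cong₂ (isPrimed ε) (>⇒cmp (n≢0⇒n>0 ne)) (nxt D vs)) (ok-turn ε (after 1 (0 ∷ V) D) o₃ (proj₂ bottom)) ,
   subst (λ t → Coh (λ _ → ε) t D) (sym (nxt D vs)) d)
  where
  bef : ∀ R → (∀ l y R' → R ≡ (l , y) ∷ R' → 0 < l × 1 < passV l (W ∷ʳ 0)) → before R (W ∷ʳ 0) 1 ≡ inR R 0
  bef [] h = refl
  bef ((l , y) ∷ R) h = trans (>⇒cmp (proj₂ (h l y R refl))) (sym (>⇒cmp (proj₁ (h l y R refl))))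
  b≡ : cmp (passV 0 W) 1 ≡ asc
  b≡ = cong (λ z → cmp z 1) e₀
  notAsc : ∀ R → inR R 0 ≢ asc
  notAsc [] ()
  notAsc ((l , _) ∷ R) e with cmp-asc l 0 e
  ... | ()
  bottom : isPrimed ε (inR R 0) desc ≡ just true × (ε ≡ primed α₀)
  bottom = ok-bottom ε (inR R 0) (trans (cong (isPrimed ε (inR R 0)) (sym b≡)) o) (notAsc R)
  o₃ : isPrimed ε asc (after 1 (0 ∷ V) D) ≡ just (primed α)
  o₃ = trans (cong (λ z → isPrimed ε z (after 1 (0 ∷ V) D)) (sym b≡)) o''
  nxt : ∀ D → All (λ f → value f ≡ val α₀) D → nextDir (0 , α₀) D ≡ after 1 (0 ∷ V) D
  nxt [] _ = refl
  nxt ((l , y) ∷ D) (v ∷ _) = trans (dir-same (0 , α₀) (l , y) (sym v)) (cong (λ z → cmp z l) (sym e₁))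

Moving-init : ∀ {ε a} R e L V → All (λ f → value f ≡ a) (e ∷ L) → CohR ε R (inR R (proj₁ e)) →
  Coh (λ _ → ε) (inR R (proj₁ e)) (e ∷ L) →
  ∃ λ R' → ∃ λ e' → reverse R ++ e ∷ L ≡ reverse R' ++ [ e' ] × Moving ε R' [] (proj₁ e') (proj₂ e') V []
Moving-init {ε} R e [] V vs cR (o , _) = R , e , refl , moving (subst (CohR ε R) (sym (bef R)) cR)
  (trans (cong (λ t → isPrimed ε t none) (bef R)) o) tt
  where
  bef : ∀ R → before R [] (proj₁ e) ≡ inR R (proj₁ e)
  bef [] = refl
  bef (_ ∷ _) = refl
Moving-init {ε} R e (f ∷ L) V (v ∷ vs@(v' ∷ _)) cR (o , c)
  with Moving-init (e ∷ R) f L V vs (trans (cong (isPrimed ε (inR R (proj₁ e))) (sym d)) o , cR)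
         (subst (λ t → Coh (λ _ → ε) t (f ∷ L)) d c)
  where
  d : dir e f ≡ cmp (proj₁ e) (proj₁ f)
  d = dir-same e f (trans v (sym v'))
... | R' , e' , eq , M = R' , e' ,
  trans (trans (sym (++-assoc (reverse R) [ e ] (f ∷ L))) (cong (_++ f ∷ L) (sym (unfold-reverse e R)))) eq , M

-- The alternatives mirror the choice of the box to be switched. Against an unprimed `e`, every
-- earlier unprimed `f` lies further west; if `e` is primed, every earlier `f` is primed and lies
-- further north. So the last entry of a block is chosen first.
Placed : State → List Entry → Set
Placed m L = ∀ X f Y e Z → L ≡ X ++ f ∷ Y ++ e ∷ Z →
  let r = rowOf m X (proj₁ f) ; r' = rowOf m (X ++ f ∷ Y) (proj₁ e) in
  (proj₁ f < proj₁ e × primed (proj₂ e) ≡ false × r + proj₁ f < r' + proj₁ e)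
  ⊎ (proj₁ e < proj₁ f × primed (proj₂ f) ≡ true × r < r')

placed : ∀ {ε s m a} L → Shape m → Legal m (labels L) → Coh ε s L → All (λ f → value f ≡ a) L → Placed m L
placed {ε} {s} {m} {a} L sh lg c vs X f Y e Z refl = go (<-cmp (proj₁ f) (proj₁ e))
  where
  S = f ∷ Y ++ e ∷ Z
  M : State
  M = adv m (labels X)
  lS : Legal M (labels S)
  lS = proj₂ (Legal-++ m (labels X) (subst (Legal m) (labels-++ X S) lg))
  lY : Legal M (proj₁ f ∷ labels Y)
  lY = proj₁ (Legal-++ M (proj₁ f ∷ labels Y) (subst (λ z → Legal M (proj₁ f ∷ z)) (labels-++ Y (e ∷ Z)) lS))
  shM : Shape M
  shM = Shape-adv (labels X) sh (proj₁ (Legal-++ m (labels X) (subst (Legal m) (labels-++ X S) lg)))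
  cS : Coh ε (prevDir s X f) S
  cS = Coh-suffix X c
  vS : All (λ g → value g ≡ a) S
  vS = AllP.++⁻ʳ X vs
  e∈ : e ∈ Y ++ e ∷ Z
  e∈ = MP.∈-++⁺ʳ Y (here refl)
  same : ∀ {L} → All (λ g → value g ≡ a) L → Sorted L
  same [] = []
  same (v ∷ vs) = All.map (λ w → ℤP.≤-reflexive (trans v (sym w))) vs ∷ same vs
  ve : value e ≡ value f
  ve = trans (All.lookup (All.tail vS) e∈) (sym (All.head vS))
  row≡ : rowOf m (X ++ f ∷ Y) (proj₁ e) ≡ suc (adv M (proj₁ f ∷ labels Y) (proj₁ e))
  row≡ = cong suc (cong (λ g → g (proj₁ e)) (trans (cong (adv m) (labels-++ X (f ∷ Y))) (adv-++ m (labels X) (proj₁ f ∷ labels Y))))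
  go : _ → _
  go (tri< lt _ _) = inj₁ (lt , later-larger cS (same vS) e∈ ve lt ,
    ≤-trans (later-east {M} shM {proj₁ f} {labels Y} lY lt) (≤-reflexive (cong (_+ proj₁ e) (sym row≡))))
  go (tri> _ _ lt) = inj₂ (lt , proj₁ (later-smaller cS (same vS) e∈ ve lt) ,
    ≤-trans (later-south {M} shM {proj₁ f} {labels Y} lY lt) (≤-reflexive (sym row≡)))
  go (tri≈ _ k≡ _) = contradiction (sym k≡) (block-distinct {m = M} cS (same vS) lS e∈ ve
    (All.map (λ w → trans w (sym (All.head vS))) (All.tail vS)))

-- Switching

-- No box is listed twice. The candidates for a switch are read off the list itself, all other
-- arguments use lookup, and this property connects the two.
Keyed : ∀ {A : Set} → Fill A → Set
Keyed U = ∀ {c x} → (c , x) ∈ U → at U (proj₁ c) (proj₂ c) ≡ just x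

at-∈ : ∀ {A : Set} (U : Fill A) i j {x} → at U i j ≡ just x → ((i , j) , x) ∈ U
at-∈ (((a , b) , y) ∷ U) i j e with hit a b i j in h
at-∈ (((a , b) , y) ∷ U) i j refl | true with hit-true a b i j h
... | refl , refl = here refl
at-∈ (((a , b) , y) ∷ U) i j e | false = there (at-∈ U i j e)

∈-del : ∀ {A : Set} i j (U : Fill A) {c x} → (c , x) ∈ del i j U →
        (c , x) ∈ U × hit i j (proj₁ c) (proj₂ c) ≡ false
∈-del i j (((a , b) , y) ∷ U) q with hit a b i j in h
∈-del i j (((a , b) , y) ∷ U) q | true with ∈-del i j U q
... | r , s = there r , s
∈-del i j (((a , b) , y) ∷ U) (here refl) | false = here refl , hit-false-sym a b i j h
∈-del i j (((a , b) , y) ∷ U) (there q) | false with ∈-del i j U q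
... | r , s = there r , s

Keyed-put : ∀ {A : Set} i j (x : A) U → Keyed U → Keyed (put i j x U)
Keyed-put i j x U K (here refl) rewrite hit-refl i j = refl
Keyed-put i j x U K {c} {y} (there q) with ∈-del i j U q
... | r , s = trans (at-put i j x U (proj₁ c) (proj₂ c)) (trans (cong (λ b → if b then just x else at U (proj₁ c) (proj₂ c)) s) (K r))

mapMaybe-∈⁻ : ∀ {A B : Set} (f : A → Maybe B) L {y} → y ∈ mapMaybe f L → ∃ λ x → x ∈ L × f x ≡ just y
mapMaybe-∈⁻ f (x ∷ L) q with f x in e
mapMaybe-∈⁻ f (x ∷ L) (here refl) | just y = x , here refl , e
mapMaybe-∈⁻ f (x ∷ L) (there q) | just y with mapMaybe-∈⁻ f L q
... | z , r , s = z , there r , s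
mapMaybe-∈⁻ f (x ∷ L) q | nothing with mapMaybe-∈⁻ f L q
... | z , r , s = z , there r , s

mapMaybe-∈⁺ : ∀ {A B : Set} (f : A → Maybe B) L {x y} → x ∈ L → f x ≡ just y → y ∈ mapMaybe f L
mapMaybe-∈⁺ f (x ∷ L) (here refl) e rewrite e = here refl
mapMaybe-∈⁺ f (x ∷ L) (there q) e with f x
... | just _ = there (mapMaybe-∈⁺ f L q e)
... | nothing = mapMaybe-∈⁺ f L q e

module _ (better : Box → Box → Bool) where

  pickBest-∈ : ∀ cs {d} → pickBest better cs ≡ just d → d ∈ cs
  pickBest-∈ (c ∷ cs) e with pickBest better cs in q
  pickBest-∈ (c ∷ cs) refl | nothing = here refl
  pickBest-∈ (c ∷ cs) e | just d with better c d
  pickBest-∈ (c ∷ cs) refl | just d | true = here refl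
  pickBest-∈ (c ∷ cs) refl | just d | false = there (pickBest-∈ cs q)

  pickBest-≢[] : ∀ c cs → pickBest better (c ∷ cs) ≢ nothing
  pickBest-≢[] c cs e with pickBest better cs
  pickBest-≢[] c cs () | nothing
  pickBest-≢[] c cs e | just d with better c d
  pickBest-≢[] c cs () | just d | true
  pickBest-≢[] c cs () | just d | false

  pickBest-best : ∀ c cs → c ∈ cs → (∀ d → d ∈ cs → d ≢ c → better c d ≡ true × better d c ≡ false) →
                  pickBest better cs ≡ just c
  pickBest-best c (x ∷ cs) p h with pickBest better cs in q
  pickBest-best c (.c ∷ cs) (here refl) h | nothing = refl
  pickBest-best c (x ∷ y ∷ cs) (there p) h | nothing = contradiction q (pickBest-≢[] y cs)
  pickBest-best c (x ∷ cs) p h | just d with dec d c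
    where
    dec : ∀ (a b : Box) → Dec (a ≡ b)
    dec (i , j) (i' , j') with i ≟ i' | j ≟ j'
    ... | yes refl | yes refl = yes refl
    ... | no n | _ = no λ { refl → n refl }
    ... | _ | no n = no λ { refl → n refl }
  pickBest-best c (.c ∷ cs) (here refl) h | just .c | yes refl with better c c
  ... | true = refl
  ... | false = refl
  pickBest-best c (x ∷ cs) (there p) h | just .c | yes refl with better x c in b
  ... | false = refl
  ... | true with x ≟B c
    where
    _≟B_ : ∀ (a b : Box) → Dec (a ≡ b)
    (i , j) ≟B (i' , j') with i ≟ i' | j ≟ j'
    ... | yes refl | yes refl = yes refl
    ... | no n | _ = no λ { refl → n refl }
    ... | _ | no n = no λ { refl → n refl }
  ...   | yes refl = refl
  ...   | no n = contradiction (trans (sym b) (proj₂ (h x (here refl) n))) λ ()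
  pickBest-best c (.c ∷ cs) (here refl) h | just d | no n rewrite proj₁ (h d (there (pickBest-∈ cs q)) n) = refl
  pickBest-best c (x ∷ cs) (there p) h | just d | no n =
    contradiction (just-injective (trans (sym q) (pickBest-best c cs p (λ e e∈ → h e (there e∈))))) n

hasB : ℤ → LFill → Box → Bool
hasB b U c = bBox b U (proj₁ c) (suc (proj₂ c)) ∨ bBox b U (suc (proj₁ c)) (proj₂ c)

candidate : ℤ → ℤ → LFill → Bool → Box × (Letter × Lab) → Maybe Box
candidate a b U t c = if isP (proj₂ (proj₂ c)) ∧ (val (proj₁ (proj₂ c)) ==ℤ a)
                        ∧ (primed (proj₁ (proj₂ c)) xor not t) ∧ hasB b U (proj₁ c)
                      then just (proj₁ c) else nothing

candidates : ℤ → ℤ → LFill → Bool → List Box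
candidates a b U t = mapMaybe (candidate a b U t) U

eastOf southOf : Box → Box → Bool
eastOf c d = (proj₂ d <ᵇ proj₂ c) ∨ ((proj₂ c ≡ᵇ proj₂ d) ∧ (proj₁ d <ᵇ proj₁ c))
southOf c d = (proj₁ d <ᵇ proj₁ c) ∨ ((proj₁ c ≡ᵇ proj₁ d) ∧ (proj₂ d <ᵇ proj₂ c))

firstOf : Maybe Box → Maybe Box → Maybe Box
firstOf (just c) _ = just c
firstOf nothing r = r

TypeOf : ∀ {A : Set} → A → Set
TypeOf {A} _ = A

-- The orderings of the definition of switchBox are local to it, so they cannot
-- be named: abstracting over pickBest lets the type of generalized be inferred,
-- and TypeOf specializes it to the two branches of the case distinction.

PickBest : Set
PickBest = (Box → Box → Bool) → List Box → Maybe Box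

generalized : ∀ (a b : ℤ) (U : LFill) (pick : PickBest) → _

switchBox-def : ∀ a b U → switchBox a b U ≡
  firstOf (pickBest eastOf (candidates a b U false)) (pickBest southOf (candidates a b U true))
switchBox-def a b U with pickBest
... | pick = generalized a b U pick

branches : ∀ a b U (x y : Maybe Box) → TypeOf (generalized a b U (λ f _ → if f (1 , 2) (2 , 1) then x else y))
branches a b U (just c) y = refl
branches a b U nothing y = refl

generalized a b U pick = branches a b U (pick eastOf (candidates a b U false)) (pick southOf (candidates a b U true))

eastOf-< : ∀ c d → proj₂ d < proj₂ c → eastOf c d ≡ true × eastOf d c ≡ false
eastOf-< c d lt rewrite <⇒<ᵇ-true lt | ≤⇒<ᵇ-false (<⇒≤ lt) | ≡ᵇ-false (<⇒≢ lt) = refl , refl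

southOf-< : ∀ c d → proj₁ d < proj₁ c → southOf c d ≡ true × southOf d c ≡ false
southOf-< c d lt rewrite <⇒<ᵇ-true lt | ≤⇒<ᵇ-false (<⇒≤ lt) | ≡ᵇ-false (<⇒≢ lt) = refl , refl

module _ {a b : ℤ} {U : LFill} (K : Keyed U) where

  candidate⁻ : ∀ t {c} → c ∈ candidates a b U t →
               ∃ λ y → at U (proj₁ c) (proj₂ c) ≡ just (y , Pl) × val y ≡ a × primed y ≡ t × hasB b U c ≡ true
  candidate⁻ t q with mapMaybe-∈⁻ (candidate a b U t) U q
  ... | ((i , j) , (y , l)) , r , s = go l (val y ==ℤ a) (primed y) t (hasB b U (i , j)) refl refl refl refl r s
    where
    go : ∀ l v pd t h → (val y ==ℤ a) ≡ v → primed y ≡ pd → hasB b U (i , j) ≡ h → l ≡ l → ((i , j) , (y , l)) ∈ U → ∀ {c} →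
         (if isP l ∧ v ∧ (pd xor not t) ∧ h then just (i , j) else nothing) ≡ just c →
         ∃ λ y → at U (proj₁ c) (proj₂ c) ≡ just (y , Pl) × val y ≡ a × primed y ≡ t × hasB b U c ≡ true
    go Pl true true true true e₁ e₂ e₃ _ r refl = y , K r , ==ℤ-true e₁ , e₂ , e₃
    go Pl true false false true e₁ e₂ e₃ _ r refl = y , K r , ==ℤ-true e₁ , e₂ , e₃

  candidate⁺ : ∀ {i j y} → at U i j ≡ just (y , Pl) → val y ≡ a → hasB b U (i , j) ≡ true →
               (i , j) ∈ candidates a b U (primed y)
  candidate⁺ {i} {j} {y} e v h = mapMaybe-∈⁺ (candidate a b U (primed y)) U (at-∈ U i j e) lem
    where
    lem : candidate a b U (primed y) ((i , j) , (y , Pl)) ≡ just (i , j)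
    lem rewrite v | ==ℤ-refl a | h with primed y
    ... | true = refl
    ... | false = refl

  Dominated : Letter → Box → Set
  Dominated α c₀ = ∀ c y → at U (proj₁ c) (proj₂ c) ≡ just (y , Pl) → val y ≡ a → hasB b U c ≡ true → c ≢ c₀ →
    (primed α ≡ false → primed y ≡ false → proj₂ c < proj₂ c₀) ×
    (primed α ≡ true → primed y ≡ true × proj₁ c < proj₁ c₀)

  switchBox-select : ∀ {i j α} → at U i j ≡ just (α , Pl) → val α ≡ a → hasB b U (i , j) ≡ true →
                     Dominated α (i , j) → switchBox a b U ≡ just (i , j)
  switchBox-select {i} {j} {α} e v h D = trans (switchBox-def a b U) (go (primed α) refl)
    where
    east-best : primed α ≡ false → pickBest eastOf (candidates a b U false) ≡ just (i , j)
    east-best q = pickBest-best eastOf (i , j) (candidates a b U false)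
      (subst (λ t → (i , j) ∈ candidates a b U t) q (candidate⁺ e v h)) dom
      where
      dom : ∀ d → d ∈ candidates a b U false → d ≢ (i , j) → eastOf (i , j) d ≡ true × eastOf d (i , j) ≡ false
      dom d d∈ n with candidate⁻ false d∈
      ... | y , e' , v' , pd , h' = eastOf-< (i , j) d (proj₁ (D d y e' v' h' n) q pd)
    true≢false : true ≢ false
    true≢false ()
    no-east : primed α ≡ true → ∀ r → pickBest eastOf (candidates a b U false) ≡ r → r ≡ nothing
    no-east q nothing r = refl
    no-east q (just d) r with candidate⁻ false (pickBest-∈ eastOf _ r)
    ... | y , e' , v' , pd , h' = contradiction pd (impossible (dec d))
      where
      dec : ∀ d → Dec (d ≡ (i , j))
      dec (i' , j') with i' ≟ i | j' ≟ j
      ... | yes refl | yes refl = yes refl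
      ... | no n | _ = no λ { refl → n refl }
      ... | _ | no n = no λ { refl → n refl }
      impossible : Dec (d ≡ (i , j)) → primed y ≢ false
      impossible (yes refl) pd = true≢false (trans (sym q) (trans (cong primed (cong proj₁ (just-injective (trans (sym e) e')))) pd))
      impossible (no n) pd = true≢false (trans (sym (proj₁ (proj₂ (D d y e' v' h' n) q))) pd)
    south-best : primed α ≡ true → pickBest southOf (candidates a b U true) ≡ just (i , j)
    south-best q = pickBest-best southOf (i , j) (candidates a b U true)
      (subst (λ t → (i , j) ∈ candidates a b U t) q (candidate⁺ e v h)) dom
      where
      dom : ∀ d → d ∈ candidates a b U true → d ≢ (i , j) → southOf (i , j) d ≡ true × southOf d (i , j) ≡ false
      dom d d∈ n with candidate⁻ true d∈
      ... | y , e' , v' , pd , h' = southOf-< (i , j) d (proj₂ (proj₂ (D d y e' v' h' n) q))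
    go : ∀ t → primed α ≡ t → firstOf (pickBest eastOf (candidates a b U false)) (pickBest southOf (candidates a b U true)) ≡ just (i , j)
    go false q rewrite east-best q = refl
    go true q rewrite no-east q _ refl = south-best q

  switchBox-none : (∀ c y → at U (proj₁ c) (proj₂ c) ≡ just (y , Pl) → val y ≡ a → hasB b U c ≡ false) →
                   switchBox a b U ≡ nothing
  switchBox-none h = trans (switchBox-def a b U)
    (cong₂ firstOf (nothing-picked eastOf false _ refl) (nothing-picked southOf true _ refl))
    where
    nothing-picked : ∀ better t r → pickBest better (candidates a b U t) ≡ r → r ≡ nothing
    nothing-picked better t nothing e = refl
    nothing-picked better t (just c) e with candidate⁻ t (pickBest-∈ better _ e)
    ... | y , e' , v' , _ , h' with trans (sym (h c y e' v')) h'
    ...   | ()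

isB : ℤ → Maybe (Letter × Lab) → Bool
isB b (just (x , l)) = isQ l ∧ (val x ==ℤ b)
isB b nothing = false

bBox-at : ∀ b U i j → bBox b U i j ≡ isB b (at U i j)
bBox-at b U i j with at U i j
... | just _ = refl
... | nothing = refl

isA : ℤ → Maybe (Letter × Lab) → Bool
isA a (just (x , l)) = isP l ∧ (val x ==ℤ a)
isA a nothing = false

aBox-at : ∀ a U i j → aBox a U i j ≡ isA a (at U i j)
aBox-at a U i j with at U i j
... | just _ = refl
... | nothing = refl

entryPrimed-at : ∀ U i j {x l} → at U i j ≡ just (x , l) → entryPrimed U i j ≡ primed x
entryPrimed-at U i j e rewrite e = refl

entryUnprimed-at : ∀ U i j {x l} → at U i j ≡ just (x , l) → entryUnprimed U i j ≡ not (primed x)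
entryUnprimed-at U i j e rewrite e = refl

∧-falseʳ : ∀ x {y} → y ≡ false → (x ∧ y) ≡ false
∧-falseʳ true e = e
∧-falseʳ false e = refl

module _ (a b : ℤ) (U : LFill) where

  switch-east : ∀ i j → bBox b U i (suc j) ≡ true →
    ((i ≡ᵇ j) ≡ false ⊎ (entryPrimed U i (suc i) ∧ bBox b U (suc i) (suc i)) ≡ false) →
    (bBox b U (suc i) j ≡ false ⊎ (entryPrimed U i (suc j) ≡ true × entryUnprimed U i (suc j) ≡ false)) →
    switchAt a b U i j ≡ swapBoxes U (i , j) (i , suc j)
  switch-east i j e (inj₁ d) (inj₁ s) rewrite d | e | s = refl
  switch-east i j e (inj₁ d) (inj₂ (s , s')) rewrite d | e with bBox b U (suc i) j
  ... | false = refl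
  ... | true rewrite s | s' | ∧-zeroʳ ((j ≡ᵇ suc i) ∧ entryUnprimed U i j ∧ aBox a U i i ∧ true) = refl
  switch-east i j e (inj₂ d) (inj₁ s) rewrite e | d | ∧-zeroʳ (i ≡ᵇ j) | s = refl
  switch-east i j e (inj₂ d) (inj₂ (s , s')) rewrite e | d | ∧-zeroʳ (i ≡ᵇ j) with bBox b U (suc i) j
  ... | false = refl
  ... | true rewrite s | s' | ∧-zeroʳ ((j ≡ᵇ suc i) ∧ entryUnprimed U i j ∧ aBox a U i i ∧ true) = refl

  switch-south : ∀ i j → (i ≡ᵇ j) ≡ false → bBox b U (suc i) j ≡ true →
    (bBox b U i (suc j) ≡ false ⊎ (bBox b U i (suc j) ≡ true × entryPrimed U i (suc j) ≡ false)) →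
    ((j ≡ᵇ suc i) ≡ false ⊎ aBox a U i i ≡ false) →
    switchAt a b U i j ≡ swapBoxes U (i , j) (suc i , j)
  switch-south i j d s (inj₁ e) (inj₁ c) rewrite d | s | e | c = refl
  switch-south i j d s (inj₁ e) (inj₂ c) rewrite d | s | e | c | ∧-zeroʳ (entryUnprimed U i j) | ∧-zeroʳ (j ≡ᵇ suc i) = refl
  switch-south i j d s (inj₂ (e , e')) (inj₁ c) rewrite d | s | e | c | e' = refl
  switch-south i j d s (inj₂ (e , e')) (inj₂ c)
    rewrite d | s | e | c | ∧-zeroʳ (entryUnprimed U i j) | ∧-zeroʳ (j ≡ᵇ suc i) | e' = refl

  switch-S3 : ∀ i {x y} → bBox b U i (suc i) ≡ true → entryPrimed U i (suc i) ≡ true → bBox b U (suc i) (suc i) ≡ true →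
    at U i i ≡ just x → at U (suc i) (suc i) ≡ just y →
    switchAt a b U i i ≡ put i i y (put i (suc i) (un b , Ql) (put (suc i) (suc i) x U))
  switch-S3 i {x} {y} e p s x≡ y≡ = trans (chosen (cong₂ _∧_ (≡ᵇ-refl i) (cong₂ _∧_ e (cong₂ _∧_ p s))))
    (cong₂ (λ c d → setM i i c (put i (suc i) (un b , Ql) (setM (suc i) (suc i) d U))) y≡ x≡)
    where
    chosen : ((i ≡ᵇ i) ∧ bBox b U i (suc i) ∧ entryPrimed U i (suc i) ∧ bBox b U (suc i) (suc i)) ≡ true →
      switchAt a b U i i ≡ setM i i (at U (suc i) (suc i)) (put i (suc i) (un b , Ql) (setM (suc i) (suc i) (at U i i) U))
    chosen c rewrite c = refl

  switch-S4 : ∀ i {x y} → bBox b U (suc i) (suc i) ≡ true →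
    (bBox b U i (suc (suc i)) ≡ false ⊎ (bBox b U i (suc (suc i)) ≡ true × entryUnprimed U i (suc (suc i)) ≡ true)) →
    entryUnprimed U i (suc i) ≡ true → aBox a U i i ≡ true →
    at U i i ≡ just x → at U (suc i) (suc i) ≡ just y →
    switchAt a b U i (suc i) ≡ put i i y (put i (suc i) (pr a , Pl) (put (suc i) (suc i) x U))
  switch-S4 i {x} {y} s e p c x≡ y≡ = trans (chosen (cong₂ _∧_ (≡ᵇ-refl i) (cong₂ _∧_ p (cong₂ _∧_ c s))) e)
    (cong₂ (λ c d → setM i i c (put i (suc i) (pr a , Pl) (setM (suc i) (suc i) d U))) y≡ x≡)
    where
    chosen : ((suc i ≡ᵇ suc i) ∧ entryUnprimed U i (suc i) ∧ aBox a U i i ∧ bBox b U (suc i) (suc i)) ≡ true →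
      (bBox b U i (suc (suc i)) ≡ false ⊎ (bBox b U i (suc (suc i)) ≡ true × entryUnprimed U i (suc (suc i)) ≡ true)) →
      switchAt a b U i (suc i) ≡
      setM i i (at U (suc i) (suc i)) (put i (suc i) (pr a , Pl) (setM (suc i) (suc i) (at U i i) U))
    chosen c (inj₁ e) rewrite ≡ᵇ-false {i} {suc i} (<⇒≢ (n<1+n i)) | c | e = refl
    chosen c (inj₂ (e , e')) rewrite ≡ᵇ-false {i} {suc i} (<⇒≢ (n<1+n i)) | c | e | s | e' = refl

Labelled : Set
Labelled = Letter × Lab

qlab plab : List Entry → Code Labelled
qlab = map (λ e → proj₁ e , (proj₂ e , Ql))
plab = map (λ e → proj₁ e , (proj₂ e , Pl))

labels-qlab : ∀ W → labels (qlab W) ≡ labels W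
labels-qlab [] = refl
labels-qlab (e ∷ W) = cong (proj₁ e ∷_) (labels-qlab W)

labels-plab : ∀ W → labels (plab W) ≡ labels W
labels-plab [] = refl
labels-plab (e ∷ W) = cong (proj₁ e ∷_) (labels-plab W)

southOfC : ∀ {A : Set} → ℕ → Code A → Maybe A
southOfC zero Y = nothing
southOfC (suc q) Y = first q Y

module _ {A : Set} (m : State) (X : Code A) (k : ℕ) (x : A) (Y : Code A) where

  private
    L = X ++ (k , x) ∷ Y
    r = rowOf m X k

  at-own : at (cells m L) r (r + k) ≡ just x
  at-own = trans (at-cells m L r k) (look-at m X Y k x)

  at-se : at (cells m L) (suc r) (suc r + k) ≡ first k Y
  at-se = trans (at-cells m L (suc r) k) (look-southeast m X k x Y)

  at-e : Legal m (labels L) → at (cells m L) r (suc (r + k)) ≡ first (suc k) Y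
  at-e lg = trans (cong (at (cells m L) r) (sym (+-suc r k)))
    (trans (at-cells m L r (suc k)) (look-east m X k x Y st))
    where
    st : Step (adv m (labels X)) k
    st = proj₁ (proj₂ (Legal-++ m (labels X) (subst (Legal m) (labels-++ X ((k , x) ∷ Y)) lg)))

at-s : ∀ {A : Set} m (X : Code A) k x Y → Legal m (labels (X ++ (k , x) ∷ Y)) →
       at (cells m (X ++ (k , x) ∷ Y)) (suc (rowOf m X k)) (rowOf m X k + k) ≡ southOfC k Y
at-s m X zero x Y lg = at-cells-below m (X ++ (0 , x) ∷ Y) (suc (rowOf m X 0)) (rowOf m X 0 + 0) (s≤s (≤-reflexive (+-identityʳ _)))
at-s m X (suc q) x Y lg = trans (cong (at (cells m (X ++ (suc q , x) ∷ Y)) (suc r)) (+-suc r q))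
  (trans (at-cells m (X ++ (suc q , x) ∷ Y) (suc r) q) (look-south m X q x Y st))
  where
  r = rowOf m X (suc q)
  st : Step (adv m (labels X)) (suc q)
  st = proj₁ (proj₂ (Legal-++ m (labels X) (subst (Legal m) (labels-++ X ((suc q , x) ∷ Y)) lg)))

loc-Q : ∀ m W (L : Code Labelled) i j {y} → at (cells m (qlab W ++ L)) i j ≡ just (y , Pl) →
        at (cells (adv m (labels W)) L) i j ≡ just (y , Pl)
loc-Q m [] L i j e = e
loc-Q m ((k , x) ∷ W) L i j e with hit (suc (m k)) (suc (m k) + k) i j
loc-Q m ((k , x) ∷ W) L i j () | true
... | false = loc-Q (bump k m) W L i j e

loc-P : ∀ m W (L : Code Labelled) i j {y} → at (cells m (plab W ++ L)) i j ≡ just (y , Pl) →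
        (∃ λ X → ∃ λ l → ∃ λ Y → W ≡ X ++ (l , y) ∷ Y × i ≡ rowOf m X l × j ≡ rowOf m X l + l)
        ⊎ at (cells (adv m (labels W)) L) i j ≡ just (y , Pl)
loc-P m [] L i j e = inj₂ e
loc-P m ((k , x) ∷ W) L i j e with hit (suc (m k)) (suc (m k) + k) i j in h
loc-P m ((k , x) ∷ W) L i j refl | true with hit-true (suc (m k)) (suc (m k) + k) i j h
... | refl , refl = inj₁ ([] , k , W , refl , refl , refl)
loc-P m ((k , x) ∷ W) L i j e | false with loc-P (bump k m) W L i j e
... | inj₁ (X , l , Y , refl , p , q) = inj₁ ((k , x) ∷ X , l , Y , refl , p , q)
... | inj₂ r = inj₂ r

first-qlab : ∀ k W C {x} → first k W ≡ just x → first k (qlab W ++ C) ≡ just (x , Ql)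
first-qlab k ((l , y) ∷ W) C e with l ≡ᵇ k
first-qlab k ((l , y) ∷ W) C refl | true = refl
... | false = first-qlab k W C e

first-skip : ∀ k W C → first k W ≡ nothing → first k (qlab W ++ C) ≡ first k C
first-skip k [] C e = refl
first-skip k ((l , y) ∷ W) C e with l ≡ᵇ k
first-skip k ((l , y) ∷ W) C () | true
... | false = first-skip k W C e

first-notB : ∀ b k W → All (λ f → value f ≢ b) W → isB b (first k (qlab W)) ≡ false
first-notB b k [] [] = refl
first-notB b k ((l , y) ∷ W) (n ∷ ns) with l ≡ᵇ k
... | true = ==ℤ-false n
... | false = first-notB b k W ns

first-plab-notB : ∀ b k D C → isB b (first k C) ≡ false → isB b (first k (plab D ++ C)) ≡ false
first-plab-notB b k [] C e = e
first-plab-notB b k ((l , y) ∷ D) C e with l ≡ᵇ k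
... | true = refl
... | false = first-plab-notB b k D C e

first-isB : ∀ b k W C {x} → All (λ f → value f ≡ b) W → first k W ≡ just x → isB b (first k (qlab W ++ C)) ≡ true
first-isB b k ((l , y) ∷ W) C (v ∷ vs) e with l ≡ᵇ k
first-isB b k ((l , y) ∷ W) C (v ∷ vs) refl | true rewrite v = ==ℤ-refl b
... | false = first-isB b k W C vs e

swapBoxes-eq : ∀ U i j k l {x y} → at U i j ≡ just x → at U k l ≡ just y →
               swapBoxes U (i , j) (k , l) ≡ put i j y (put k l x U)
swapBoxes-eq U i j k l e f rewrite e | f = refl

Repr : Code Labelled → LFill → Set
Repr L U = ∀ i j → at U i j ≡ at (cells empty L) i j

module _ where

  Repr-swap : ∀ X Y v k (x y : Labelled) U i j i' j' → v ≢ k → i ≡ rowOf empty X v → j ≡ i + v →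
              i' ≡ rowOf empty X k → j' ≡ i' + k → Repr (X ++ (v , x) ∷ (k , y) ∷ Y) U →
              Repr (X ++ (v , y) ∷ (k , x) ∷ Y) (put i j y (put i' j' x U))
  Repr-swap X Y v k x y U i j i' j' ne refl refl refl refl rep a b =
    trans (at-put i j y (put i' j' x U) a b) (trans (cong (if hit i j a b then just y else_)
      (trans (at-put i' j' x U a b) (cong (if hit i' j' a b then just x else_) (rep a b))))
      (sym (at-swap empty X Y v x k y a b ne)))

  Repr-set₃ : ∀ X Y (x y z x' y' z' : Labelled) U i → rowOf empty X 0 ≡ i → rowOf empty X 1 ≡ i →
    Repr (X ++ (0 , x) ∷ (1 , y) ∷ (0 , z) ∷ Y) U →
    Repr (X ++ (0 , x') ∷ (1 , y') ∷ (0 , z') ∷ Y) (put i i x' (put i (suc i) y' (put (suc i) (suc i) z' U)))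
  Repr-set₃ X Y x y z x' y' z' U i r₀ r₁ rep a b = trans
    (trans (at-put i i x' (put i (suc i) y' (put (suc i) (suc i) z' U)) a b) (cong (if hit i i a b then just x' else_)
      (trans (at-put i (suc i) y' (put (suc i) (suc i) z' U) a b) (cong (if hit i (suc i) a b then just y' else_)
        (trans (at-put (suc i) (suc i) z' U a b) (cong (if hit (suc i) (suc i) a b then just z' else_) (rep a b)))))))
    (sym (trans (at-set₃ empty X Y x y z x' y' z' a b) boxes))
    where
    f = at (cells empty (X ++ (0 , x) ∷ (1 , y) ∷ (0 , z) ∷ Y))
    box : ℕ → ℕ → ℕ → Maybe Labelled
    box c₀ c₁ c₂ = override i c₀ (just x') (override i c₁ (just y') (override (suc i) c₂ (just z') f)) a b
    boxes : override (rowOf empty X 0) (rowOf empty X 0 + 0) (just x')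
              (override (rowOf empty X 1) (rowOf empty X 1 + 1) (just y')
                (override (suc (rowOf empty X 0)) (suc (rowOf empty X 0) + 0) (just z') f)) a b ≡ box i (suc i) (suc i)
    boxes = trans (cong₂ (λ r s → override r (r + 0) (just x') (override s (s + 1) (just y') (override (suc r) (suc r + 0) (just z') f)) a b) r₀ r₁)
              (trans (cong (λ z → box z (i + 1) (suc z)) (+-identityʳ i)) (cong (λ z → box i z (suc i)) (+-comm i 1)))

sorted-const : ∀ {a L} → All (λ f → value f ≡ a) L → Sorted L
sorted-const [] = []
sorted-const (v ∷ vs) = All.map (λ w → ℤP.≤-reflexive (trans v (sym w))) vs ∷ sorted-const vs

module Block (a b : ℤ) (δ : Bool) (ε : ℤ → Bool) (A B P : List Entry) where

  m₀ : State
  m₀ = adv empty (labels A)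

  pre : List Entry → List Entry → Code Labelled
  pre R Wp = qlab A ++ (plab (reverse R) ++ qlab Wp)

  tailC : List Entry → Code Labelled
  tailC D = plab D ++ qlab B

  rest : List Entry → List Entry → Code Labelled
  rest Wr D = qlab Wr ++ tailC D

  -- The word during a switch: `A`, the entries of the block that have not moved, the `b`s already
  -- passed by the current entry, this entry, the `b`s still ahead of it, the finished entries of
  -- the block, and `B`.
  full : List Entry → List Entry → ℕ → Letter → List Entry → List Entry → Code Labelled
  full R Wp c α Wr D = pre R Wp ++ (c , (α , Pl)) ∷ rest Wr D

  word : List Entry → List Entry → ℕ → List Entry → List Entry → List ℕ
  word R Wp c Wr D = labels A ++ labels (reverse R) ++ labels Wp ++ c ∷ labels Wr ++ labels D ++ labels B

  mid-state : List Entry → State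
  mid-state R = adv m₀ (labels (reverse R))

  labels-pre : ∀ R Wp → labels (pre R Wp) ≡ labels A ++ labels (reverse R) ++ labels Wp
  labels-pre R Wp = trans (labels-++ (qlab A) _) (cong₂ _++_ (labels-qlab A)
    (trans (labels-++ (plab (reverse R)) _) (cong₂ _++_ (labels-plab (reverse R)) (labels-qlab Wp))))

  labels-rest : ∀ Wr D → labels (rest Wr D) ≡ labels Wr ++ labels D ++ labels B
  labels-rest Wr D = trans (labels-++ (qlab Wr) _) (cong₂ _++_ (labels-qlab Wr)
    (trans (labels-++ (plab D) _) (cong₂ _++_ (labels-plab D) (labels-qlab B))))

  labels-full : ∀ R Wp c α Wr D → labels (full R Wp c α Wr D) ≡ word R Wp c Wr D
  labels-full R Wp c α Wr D = trans (labels-++ (pre R Wp) _)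
    (trans (cong₂ (λ x y → x ++ c ∷ y) (labels-pre R Wp) (labels-rest Wr D))
      (trans (++-assoc (labels A) _ _) (cong (labels A ++_) (++-assoc (labels (reverse R)) _ _))))

  adv-pre : ∀ R Wp → adv empty (labels (pre R Wp)) ≡ adv (mid-state R) (labels Wp)
  adv-pre R Wp = trans (cong (adv empty) (labels-pre R Wp))
    (trans (adv-++ empty (labels A) _) (adv-++ m₀ (labels (reverse R)) (labels Wp)))

  rowC : List Entry → List Entry → ℕ → ℕ
  rowC R Wp c = rowOf empty (pre R Wp) c

  pre-snoc : ∀ R Wp e → pre R (Wp ∷ʳ e) ≡ pre R Wp ∷ʳ (proj₁ e , (proj₂ e , Ql))
  pre-snoc R Wp e = sym (trans (++-assoc (qlab A) _ _) (cong (qlab A ++_)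
    (trans (++-assoc (plab (reverse R)) (qlab Wp) _) (cong (plab (reverse R) ++_) (sym (map-++ _ Wp [ e ]))))))

  pre-snoc-++ : ∀ R Wp e Y → pre R (Wp ∷ʳ e) ++ Y ≡ pre R Wp ++ (proj₁ e , (proj₂ e , Ql)) ∷ Y
  pre-snoc-++ R Wp e Y = trans (cong (_++ Y) (pre-snoc R Wp e)) (++-assoc (pre R Wp) _ Y)

  rowC-snoc : ∀ R Wp k x c → k ≢ c → rowC R (Wp ∷ʳ (k , x)) c ≡ rowC R Wp c
  rowC-snoc R Wp k x c ne = trans (cong (λ X → rowOf empty X c) (pre-snoc R Wp (k , x)))
    (rowOf-snoc-≢ empty (pre R Wp) k (x , Ql) c ne)

  rowC-snoc-≡ : ∀ R Wp k x → rowC R (Wp ∷ʳ (k , x)) k ≡ suc (rowC R Wp k)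
  rowC-snoc-≡ R Wp k x = trans (cong (λ X → rowOf empty X k) (pre-snoc R Wp (k , x)))
    (rowOf-snoc-≡ empty (pre R Wp) k (x , Ql))

  Sel : List Entry → Letter → ℕ → ℕ → Set
  Sel R α i j = ∀ X l y Y → reverse R ≡ X ++ (l , y) ∷ Y →
    (primed α ≡ false → primed y ≡ false → rowOf m₀ X l + l < j) ×
    (primed α ≡ true → primed y ≡ true × rowOf m₀ X l < i)

  Sel-mono : ∀ {R α i j i' j'} → i ≤ i' → j ≤ j' → Sel R α i j → Sel R α i' j'
  Sel-mono p q s X l y Y e = (λ f g → ≤-trans (proj₁ (s X l y Y e) f g) q) ,
    (λ t → proj₁ (proj₂ (s X l y Y e) t) , ≤-trans (proj₂ (proj₂ (s X l y Y e) t)) p)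

  -- `sel` ensures that the current entry is the box that `switchBox` selects. `orig` keeps `R` a
  -- beginning of the original block, so that the positions recorded once in `Placed` can renew
  -- `sel` whenever the next entry becomes current.
  record Inv (R Wp : List Entry) (c : ℕ) (α : Letter) (Wr D : List Entry) (U : LFill) : Set where
    field
      repr  : Repr (full R Wp c α Wr D) U
      keyed : Keyed U
      legal : Legal empty (word R Wp c Wr D)
      coh   : Coh ε none (Wp ++ Wr)
      valW  : All (λ f → value f ≡ b) (Wp ++ Wr)
      valR  : All (λ f → value f ≡ a) R
      valα  : val α ≡ a
      valD  : All (λ f → value f ≡ a) D
      mov   : Moving δ R (labels Wp) c α (labels Wr) D
      sel   : Sel R α (rowC R Wp c) (rowC R Wp c + c)
      orig  : ∃ λ Z → P ≡ reverse R ++ Z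

  module _ (valB : All (λ f → value f ≢ b) B) {R Wp c α Wr D U} (I : Inv R Wp c α Wr D U) where

    open Inv I

    legal-full : Legal empty (labels (full R Wp c α Wr D))
    legal-full = subst (Legal empty) (sym (labels-full R Wp c α Wr D)) legal

    legal-R : Legal m₀ (labels (reverse R) ++ labels Wp ++ c ∷ labels Wr ++ labels D ++ labels B)
    legal-R = proj₂ (Legal-++ empty (labels A) legal)

    legal-W : Legal (mid-state R) (labels Wp ++ c ∷ labels Wr ++ labels D ++ labels B)
    legal-W = proj₂ (Legal-++ m₀ (labels (reverse R)) legal-R)

    legal-mid : Legal (mid-state R) (labels Wp ++ c ∷ labels Wr)
    legal-mid = proj₁ (Legal-++ (mid-state R) (labels Wp ++ c ∷ labels Wr)
      (subst (Legal (mid-state R)) (sym (++-assoc (labels Wp) (c ∷ labels Wr) _)) legal-W))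

    toMid : Mid ε none (mid-state R) Wp c Wr
    toMid = mid legal-mid coh (sorted-const valW)

    step-c : Step (adv empty (labels (pre R Wp))) c
    step-c = subst (λ m → Step m c) (sym (adv-pre R Wp)) (proj₁ (proj₂ (Legal-++ (mid-state R) (labels Wp) legal-W)))

    at-c : at U (rowC R Wp c) (rowC R Wp c + c) ≡ just (α , Pl)
    at-c = trans (repr _ _) (at-own empty (pre R Wp) c (α , Pl) (rest Wr D))

    at-c-e : at U (rowC R Wp c) (suc (rowC R Wp c + c)) ≡ first (suc c) (rest Wr D)
    at-c-e = trans (repr _ _) (at-e empty (pre R Wp) c (α , Pl) (rest Wr D) legal-full)

    at-c-s : at U (suc (rowC R Wp c)) (rowC R Wp c + c) ≡ southOfC c (rest Wr D)
    at-c-s = trans (repr _ _) (at-s empty (pre R Wp) c (α , Pl) (rest Wr D) legal-full)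

    at-c-se : at U (suc (rowC R Wp c)) (suc (rowC R Wp c) + c) ≡ first c (rest Wr D)
    at-c-se = trans (repr _ _) (at-se empty (pre R Wp) c (α , Pl) (rest Wr D))

    tail-notB : ∀ k → isB b (first k (tailC D)) ≡ false
    tail-notB k = first-plab-notB b k D (qlab B) (first-notB b k B valB)

    valWr : All (λ f → value f ≡ b) Wr
    valWr = AllP.++⁻ʳ Wp valW

    rest-B : ∀ k {x} → first k Wr ≡ just x → isB b (first k (rest Wr D)) ≡ true
    rest-B k e = first-isB b k Wr (tailC D) valWr e

    rest-notB : ∀ k → first k Wr ≡ nothing → isB b (first k (rest Wr D)) ≡ false
    rest-notB k e = trans (cong (isB b) (first-skip k Wr (tailC D) e)) (tail-notB k)

    -- The eastern and the southern neighbour of a box come later in the word; behind a finished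
    -- entry there are only finished entries and `B`, hence no `b`-box.
    done-noB : ∀ X l y Y → D ≡ X ++ (l , y) ∷ Y → ∀ i →
               i ≡ rowOf (adv (bump c (adv (mid-state R) (labels Wp))) (labels Wr)) X l → hasB b U (i , i + l) ≡ false
    done-noB X l y Y refl i refl = trans (cong₂ _∨_ (trans (bBox-at b U i (suc (i + l))) (cong (isB b) east))
                                                  (trans (bBox-at b U (suc i) (i + l)) (cong (isB b) south′)))
                                       (cong₂ _∨_ (notB (suc l)) (notS l))
      where
      X' = pre R Wp ++ (c , (α , Pl)) ∷ qlab Wr ++ plab X
      Y' = plab Y ++ qlab B
      split : full R Wp c α Wr (X ++ (l , y) ∷ Y) ≡ X' ++ (l , (y , Pl)) ∷ Y'
      split = trans (cong (λ Z → pre R Wp ++ (c , (α , Pl)) ∷ qlab Wr ++ Z)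
                (trans (cong (_++ qlab B) (map-++ _ X ((l , y) ∷ Y))) (++-assoc (plab X) _ (qlab B))))
              (trans (cong (λ Z → pre R Wp ++ (c , (α , Pl)) ∷ Z) (sym (++-assoc (qlab Wr) (plab X) _)))
                (sym (++-assoc (pre R Wp) _ _)))
      row≡ : rowOf empty X' l ≡ i
      row≡ = cong suc (cong (λ g → g l) (trans (cong (adv empty) (labels-++ (pre R Wp) _)) (trans (adv-++ empty (labels (pre R Wp)) _)
        (trans (cong (λ m → adv (bump c m) (labels (qlab Wr ++ plab X))) (adv-pre R Wp))
          (trans (cong (adv (bump c (adv (mid-state R) (labels Wp)))) (trans (labels-++ (qlab Wr) (plab X)) (cong₂ _++_ (labels-qlab Wr) (labels-plab X))))
            (adv-++ (bump c (adv (mid-state R) (labels Wp))) (labels Wr) (labels X)))))))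
      lg : Legal empty (labels (X' ++ (l , (y , Pl)) ∷ Y'))
      lg = subst (λ L → Legal empty (labels L)) split legal-full
      rep' : Repr (X' ++ (l , (y , Pl)) ∷ Y') U
      rep' = subst (λ L → Repr L U) split repr
      east : at U i (suc (i + l)) ≡ first (suc l) Y'
      east = subst (λ r → at U r (suc (r + l)) ≡ first (suc l) Y') row≡ (trans (rep' _ _) (at-e empty X' l (y , Pl) Y' lg))
      south′ : at U (suc i) (i + l) ≡ southOfC l Y'
      south′ = subst (λ r → at U (suc r) (r + l) ≡ southOfC l Y') row≡ (trans (rep' _ _) (at-s empty X' l (y , Pl) Y' lg))
      notB : ∀ k → isB b (first k Y') ≡ false
      notB k = first-plab-notB b k Y (qlab B) (first-notB b k B valB)
      notS : ∀ l → isB b (southOfC l Y') ≡ false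
      notS zero = refl
      notS (suc q) = notB q

    data Located (i j : ℕ) (y : Letter) : Set where
      inRest : ∀ X l Y → reverse R ≡ X ++ (l , y) ∷ Y → i ≡ rowOf m₀ X l → j ≡ i + l → Located i j y
      isCurr : i ≡ rowC R Wp c → j ≡ i + c → y ≡ α → Located i j y
      inDone : ∀ X l Y → D ≡ X ++ (l , y) ∷ Y →
               i ≡ rowOf (adv (bump c (adv (mid-state R) (labels Wp))) (labels Wr)) X l → j ≡ i + l → Located i j y

    locate : ∀ i j {y} → at U i j ≡ just (y , Pl) → Located i j y
    locate i j {y} e with loc-P m₀ (reverse R) (qlab Wp ++ (c , (α , Pl)) ∷ rest Wr D) i j
      (loc-Q empty A _ i j (trans (cong (λ L → at (cells empty L) i j) (sym assoc)) (trans (sym (repr i j)) e)))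
      where
      assoc : full R Wp c α Wr D ≡ qlab A ++ (plab (reverse R) ++ (qlab Wp ++ (c , (α , Pl)) ∷ rest Wr D))
      assoc = trans (++-assoc (qlab A) _ _) (cong (qlab A ++_) (++-assoc (plab (reverse R)) (qlab Wp) _))
    ... | inj₁ (X , l , Y , p , refl , refl) = inRest X l Y p refl refl
    ... | inj₂ e₂ with loc-P (adv (mid-state R) (labels Wp)) [ c , α ] (rest Wr D) i j (loc-Q (mid-state R) Wp _ i j e₂)
    ...   | inj₁ ([] , .c , [] , refl , p , q) = isCurr (trans p (cong suc (cong (λ g → g c) (sym (adv-pre R Wp)))))
                (trans q (cong (_+ c) (sym p))) refl
    ...   | inj₁ ((_ ∷ []) , l , Y , () , p , q)
    ...   | inj₁ ((_ ∷ _ ∷ X) , l , Y , () , p , q)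
    ...   | inj₂ e₃ with loc-P (adv (bump c (adv (mid-state R) (labels Wp))) (labels Wr)) D (qlab B) i j (loc-Q (bump c (adv (mid-state R) (labels Wp))) Wr (tailC D) i j e₃)
    ...     | inj₁ (X , l , Y , p , refl , refl) = inDone X l Y p refl refl
    ...     | inj₂ e₄ with loc-Q (adv (adv (bump c (adv (mid-state R) (labels Wp))) (labels Wr)) (labels D)) B [] i j
                             (trans (cong (λ L → at (cells _ L) i j) (++-identityʳ (qlab B))) e₄)
    ...       | ()

    select : hasB b U (rowC R Wp c , rowC R Wp c + c) ≡ true → switchBox a b U ≡ just (rowC R Wp c , rowC R Wp c + c)
    select h = switchBox-select keyed at-c valα h dominated
      where
      dominated : Dominated {a} {b} keyed α (rowC R Wp c , rowC R Wp c + c)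
      dominated (i , j) y e v h' n with locate i j e
      ... | inRest X l Y eq refl refl = sel X l y Y eq
      ... | isCurr refl refl _ = contradiction refl n
      ... | inDone X l Y eq p refl = contradiction (trans (sym h') (done-noB X l y Y eq i p)) λ ()

    selected : hasB b U (rowC R Wp c , rowC R Wp c + c) ≡ true →
               sigma a b U ≡ just (switchAt a b U (rowC R Wp c) (rowC R Wp c + c))
    selected h = cong (Maybe.map (λ c → switchAt a b U (proj₁ c) (proj₂ c))) (select h)

  finished-none : ∀ (valB : All (λ f → value f ≢ b) B) {Wp c α D U} → Inv [] Wp c α [] D U → sigma a b U ≡ nothing
  finished-none valB {Wp} {c} {α} {D} {U} I =
    cong (Maybe.map (λ c → switchAt a b U (proj₁ c) (proj₂ c))) (switchBox-none (Inv.keyed I) noB)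
    where
    noB : ∀ d y → at U (proj₁ d) (proj₂ d) ≡ just (y , Pl) → val y ≡ a → hasB b U d ≡ false
    noB (i , j) y e v with locate valB I i j e
    ... | inRest [] l Y () _ _
    ... | inRest (_ ∷ X) l Y () _ _
    ... | inDone X l Y eq p refl = done-noB valB I X l y Y eq i p
    ... | isCurr refl refl _ = cong₂ _∨_
      (trans (bBox-at b U _ _) (trans (cong (isB b) (at-c-e valB I)) (tail-notB valB I (suc c))))
      (trans (bBox-at b U _ _) (trans (cong (isB b) (at-c-s valB I)) (southNone c)))
      where
      southNone : ∀ q → isB b (southOfC q (rest [] D)) ≡ false
      southNone zero = refl
      southNone (suc q) = tail-notB valB I q

special-from : ∀ x (W : List Entry) → nextDir (1 , x) W ≡ desc → Special 0 1 x W
special-from x ((k , w) ∷ W) d with val x ℤP.≟ val w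
special-from x ((zero , w) ∷ W) d | yes e = w , W , refl , refl , refl , e
special-from x ((suc zero , w) ∷ W) () | yes e
special-from x ((suc (suc k) , w) ∷ W) () | yes e

Adj-adj : ∀ {c k} → Adj c k → adj c k ≡ true
Adj-adj (up {k}) = adj-up k
Adj-adj (down {k}) = adj-down k

module Steps (a b : ℤ) (δ : Bool) (ε : ℤ → Bool) (A B P : List Entry)
             (valB : All (λ f → value f ≢ b) B) (PL : Placed (adv empty (labels A)) P) where

  open Block a b δ ε A B P

  vals-snoc : ∀ Wp (e f : Entry) W → value e ≡ value f → All (λ g → value g ≡ b) (Wp ++ e ∷ W) →
              All (λ g → value g ≡ b) ((Wp ∷ʳ f) ++ W)
  vals-snoc Wp e f W q vs = subst (All (λ g → value g ≡ b)) (sym (++-assoc Wp [ f ] W))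
    (AllP.++⁺ (AllP.++⁻ˡ Wp vs) (trans (sym q) (All.head (AllP.++⁻ʳ Wp vs)) ∷ All.tail (AllP.++⁻ʳ Wp vs)))

  head-legal : ∀ {R Wp c α Wr D U} → Inv R Wp c α Wr D U → ∀ l y R' → R ≡ (l , y) ∷ R' →
               Legal (adv m₀ (labels (reverse R'))) (l ∷ labels Wp ++ c ∷ labels Wr)
  head-legal {R} {Wp} {c} {α} {Wr} {D} I l y R' refl = proj₁ (Legal-++ _ (l ∷ labels Wp ++ c ∷ labels Wr)
    (subst (Legal _) (cong (l ∷_) (sym (++-assoc (labels Wp) (c ∷ labels Wr) _)))
      (proj₂ (Legal-++ m₀ (labels (reverse R')) (subst (Legal m₀) split (legal-R valB I))))))
    where
    split : labels (reverse ((l , y) ∷ R')) ++ labels Wp ++ c ∷ labels Wr ++ labels D ++ labels B ≡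
            labels (reverse R') ++ l ∷ labels Wp ++ c ∷ labels Wr ++ labels D ++ labels B
    split = trans (cong (λ z → labels z ++ labels Wp ++ c ∷ labels Wr ++ labels D ++ labels B) (unfold-reverse (l , y) R'))
      (labels-snoc-++ (reverse R') (l , y) _)

  mov-step : ∀ {R Wp c α k x W D U} e → Inv R Wp c α ((k , x) ∷ W) D U → cl c k ≡ proj₁ e →
    (∀ l y R' → R ≡ (l , y) ∷ R' → ¬ (passV l (labels Wp) ≡ 0 × c ≡ 1 × k ≡ 0)) →
    Moving δ R (labels (Wp ∷ʳ e)) (cr c k) α (labels W) D
  mov-step {R} {Wp} {c} {α} {k} {x} {W} {D} e I q n = subst (λ z → Moving δ R z (cr c k) α (labels W) D)
    (trans (cong (labels Wp ∷ʳ_) q) (sym (labels-++ Wp [ e ])))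
    (Moving-step {R = R} {W = labels Wp} {V = labels W} {D} (before-step′ R refl) (Inv.mov I))
    where
    before-step′ : ∀ R₁ → R₁ ≡ R → before R₁ (labels Wp ∷ʳ cl c k) (cr c k) ≡ before R₁ (labels Wp) c
    before-step′ [] e = refl
    before-step′ ((l , y) ∷ R') refl = before-step {adv m₀ (labels (reverse R'))} ((l , y) ∷ R') {labels Wp} {c} {k} {labels W}
      (λ { _ _ _ refl → head-legal I l y R' refl , n l y R' refl })

  skip-step : ∀ {R Wp c α k x W D U} → adj c k ≡ false → Inv R Wp c α ((k , x) ∷ W) D U →
              Inv R (Wp ∷ʳ (k , x)) c α W D U
  skip-step {R} {Wp} {c} {α} {k} {x} {W} {D} {U} f I = record
    { repr  = λ i j → trans (Inv.repr I i j) (trans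
        (at-commute empty (pre R Wp) (rest W D) c (α , Pl) k (x , Ql) f (legal-full valB I) i j)
        (cong (λ L → at (cells empty L) i j) (sym (pre-snoc-++ R Wp (k , x) _))))
    ; keyed = Inv.keyed I
    ; legal = subst (λ z → Legal empty (labels A ++ labels (reverse R) ++ z)) (sym (labels-snoc-++ Wp (k , x) _))
        (~-Legal (~++ˡ (labels A) (~++ˡ (labels (reverse R)) (~++ˡ (labels Wp) (~swap f)))) {empty} (Inv.legal I))
    ; coh   = Mid.coh (mid-skip f (toMid valB I))
    ; valW  = vals-snoc Wp (k , x) (k , x) W refl (Inv.valW I)
    ; valR  = Inv.valR I
    ; valα  = Inv.valα I
    ; valD  = Inv.valD I
    ; mov   = subst (λ z → Moving δ R (labels (Wp ∷ʳ (k , x))) z α (labels W) D) (proj₂ cross)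
        (mov-step (k , x) I (proj₁ cross) (λ { _ _ _ _ (_ , refl , refl) → true≢false (trans (sym refl) f) }))
    ; sel   = subst (λ r → Sel R α r (r + c)) (sym (rowC-snoc R Wp k x c k≢c)) (Inv.sel I)
    ; orig  = Inv.orig I
    }
    where
    true≢false : true ≢ false
    true≢false ()
    cross : cl c k ≡ k × cr c k ≡ c
    cross rewrite f = refl , refl
    k≢c : k ≢ c
    k≢c e = legal-≢ {adv (mid-state R) (labels Wp)} {c} {k} {labels W}
      (proj₂ (Legal-++ (mid-state R) (labels Wp) (legal-mid valB I))) (sym e)

  -- The filling does not change here. Only the bookkeeping passes on to the previous entry of the
  -- block, for which all the `b`s are ahead again.
  done-step : ∀ {l y R Wp c α D U} → Inv ((l , y) ∷ R) Wp c α [] D U → Inv R [] l y Wp ((c , α) ∷ D) U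
  done-step {l} {y} {R} {Wp} {c} {α} {D} {U} I = record
    { repr  = subst (λ L → Repr L U) full≡ (Inv.repr I)
    ; keyed = Inv.keyed I
    ; legal = subst (Legal empty) (cong (labels A ++_) (trans
        (cong (λ z → labels z ++ labels Wp ++ c ∷ labels D ++ labels B) (unfold-reverse (l , y) R))
        (labels-snoc-++ (reverse R) (l , y) _))) (Inv.legal I)
    ; coh   = subst (Coh ε none) (++-identityʳ Wp) (Inv.coh I)
    ; valW  = subst (All (λ f → value f ≡ b)) (++-identityʳ Wp) (Inv.valW I)
    ; valR  = All.tail (Inv.valR I)
    ; valα  = All.head (Inv.valR I)
    ; valD  = Inv.valα I ∷ Inv.valD I
    ; mov   = Moving-done {y = y} {R} {labels Wp} {c} {α} {D} (All.map (λ v → trans v (sym (Inv.valα I))) (Inv.valD I)) (Inv.mov I)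
    ; sel   = sel
    ; orig  = (l , y) ∷ Z , eqP
    }
    where
    Z = proj₁ (Inv.orig I)
    eqP : P ≡ reverse R ++ (l , y) ∷ Z
    eqP = trans (proj₂ (Inv.orig I)) (trans (cong (_++ Z) (unfold-reverse (l , y) R)) (++-assoc (reverse R) [ l , y ] Z))
    full≡ : full ((l , y) ∷ R) Wp c α [] D ≡ full R [] l y Wp ((c , α) ∷ D)
    full≡ = trans (++-assoc (qlab A) _ _) (trans (cong (qlab A ++_) (trans (++-assoc (plab (reverse ((l , y) ∷ R))) (qlab Wp) _)
      (trans (cong (_++ (qlab Wp ++ (c , (α , Pl)) ∷ tailC D)) (trans (cong plab (unfold-reverse (l , y) R)) (map-++ _ (reverse R) [ l , y ])))
        (trans (++-assoc (plab (reverse R)) _ _) (cong (_++ ((l , (y , Pl)) ∷ qlab Wp ++ (c , (α , Pl)) ∷ tailC D)) (sym (++-identityʳ (plab (reverse R)))))))))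
      (sym (++-assoc (qlab A) _ _)))
    row≡ : rowC R [] l ≡ rowOf m₀ (reverse R) l
    row≡ = cong suc (cong (λ g → g l) (adv-pre R []))
    sel : Sel R y (rowC R [] l) (rowC R [] l + l)
    sel X k w Y e = subst (λ r → (primed y ≡ false → primed w ≡ false → rowOf m₀ X k + k < r + l) ×
                               (primed y ≡ true → primed w ≡ true × rowOf m₀ X k < r)) (sym row≡) (go (PL X (k , w) Y (l , y) Z
        (trans eqP (trans (cong (_++ (l , y) ∷ Z) e) (++-assoc X ((k , w) ∷ Y) ((l , y) ∷ Z))))))
      where
      r = rowOf m₀ (reverse R) l
      re : rowOf m₀ (X ++ (k , w) ∷ Y) l ≡ r
      re = cong (λ L → rowOf m₀ L l) (sym e)
      true≢false : true ≢ false
      true≢false ()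
      go : (k < l × primed y ≡ false × rowOf m₀ X k + k < rowOf m₀ (X ++ (k , w) ∷ Y) l + l)
           ⊎ (l < k × primed w ≡ true × rowOf m₀ X k < rowOf m₀ (X ++ (k , w) ∷ Y) l) →
           (primed y ≡ false → primed w ≡ false → rowOf m₀ X k + k < r + l) ×
           (primed y ≡ true → primed w ≡ true × rowOf m₀ X k < r)
      go (inj₁ (_ , u , lt)) = (λ _ _ → ≤-trans lt (≤-reflexive (cong (_+ l) re))) , λ t → contradiction (trans (sym t) u) true≢false
      go (inj₂ (_ , v , lt)) = (λ _ u → contradiction (trans (sym v) u) true≢false) , λ _ → v , ≤-trans lt (≤-reflexive re)

  swapped : ∀ {R Wp c α k x W D U} → Inv R Wp c α ((k , x) ∷ W) D U → LFill
  swapped {R} {Wp} {c} {α} {k} {x} {W} {D} {U} I =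
    put (rowC R Wp c) (rowC R Wp c + c) (x , Ql) (put (rowC R Wp k) (rowC R Wp k + k) (α , Pl) U)

  move-inv : ∀ {R Wp c α k x W D U} (I : Inv R Wp c α ((k , x) ∷ W) D U) → Adj c k → ¬ Special c k x W →
    (∀ l y R' → R ≡ (l , y) ∷ R' → ¬ (passV l (labels Wp) ≡ 0 × c ≡ 1 × k ≡ 0)) →
    rowC R Wp c ≤ rowC R Wp k → rowC R Wp c + c ≤ rowC R Wp k + k →
    Inv R (Wp ∷ʳ (c , x)) k α W D (swapped I)
  move-inv {R} {Wp} {c} {α} {k} {x} {W} {D} {U} I ad ns n le le' = record
    { repr  = subst (λ L → Repr L (swapped I)) (sym (pre-snoc-++ R Wp (c , x) _))
        (Repr-swap (pre R Wp) (rest W D) c k (α , Pl) (x , Ql) U (rowC R Wp c) (rowC R Wp c + c) (rowC R Wp k) (rowC R Wp k + k) c≢k refl refl refl refl (Inv.repr I))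
    ; keyed = Keyed-put (rowC R Wp c) (rowC R Wp c + c) (x , Ql) (put (rowC R Wp k) (rowC R Wp k + k) (α , Pl) U)
                (Keyed-put (rowC R Wp k) (rowC R Wp k + k) (α , Pl) U (Inv.keyed I))
    ; legal = subst (λ z → Legal empty (labels A ++ labels (reverse R) ++ z)) (sym (labels-snoc-++ Wp (c , x) _)) (Inv.legal I)
    ; coh   = Mid.coh (mid-move ad ns (toMid valB I))
    ; valW  = vals-snoc Wp (k , x) (c , x) W refl (Inv.valW I)
    ; valR  = Inv.valR I
    ; valα  = Inv.valα I
    ; valD  = Inv.valD I
    ; mov   = subst (λ z → Moving δ R (labels (Wp ∷ʳ (c , x))) z α (labels W) D) (proj₂ cross) (mov-step (c , x) I (proj₁ cross) n)
    ; sel   = subst (λ r → Sel R α r (r + k)) (sym (rowC-snoc R Wp c x k c≢k)) (Sel-mono {R} {α} le le' (Inv.sel I))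
    ; orig  = Inv.orig I
    }
    where
    cross : cl c k ≡ c × cr c k ≡ k
    cross rewrite Adj-adj ad = refl , refl
    c≢k : c ≢ k
    c≢k = legal-≢ {adv (mid-state R) (labels Wp)} {c} {k} {labels W}
      (proj₂ (Legal-++ (mid-state R) (labels Wp) (legal-mid valB I)))

  suffixW : ∀ {R Wp c α k x W D U} → Inv R Wp c α ((k , x) ∷ W) D U →
            Coh ε (prevDir none Wp (k , x)) ((k , x) ∷ W) × Sorted ((k , x) ∷ W) × All (λ f → value f ≡ val x) W
  suffixW {Wp = Wp} I = Coh-suffix Wp (Inv.coh I) , Sorted-suffix Wp (sorted-const (Inv.valW I)) ,
    All.map (λ v → trans v (sym (All.head (AllP.++⁻ʳ Wp (Inv.valW I))))) (All.tail (AllP.++⁻ʳ Wp (Inv.valW I)))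

  val-head : ∀ {R Wp c α k x W D U} → Inv R Wp c α ((k , x) ∷ W) D U → val x ≡ b
  val-head {Wp = Wp} I = All.head (AllP.++⁻ʳ Wp (Inv.valW I))

  hasB-east : ∀ {R Wp c α x W D U} (I : Inv R Wp c α ((suc c , x) ∷ W) D U) →
              bBox b U (rowC R Wp c) (suc (rowC R Wp c + c)) ≡ true
  hasB-east {R} {Wp} {c} {α} {x} {W} {D} {U} I = trans (bBox-at b U (rowC R Wp c) (suc (rowC R Wp c + c))) (trans (cong (isB b) (at-c-e valB I))
    (rest-B valB I (suc c) (first-head (suc c) x W)))

  hasB-south : ∀ {R Wp q α x W D U} (I : Inv R Wp (suc q) α ((q , x) ∷ W) D U) →
               bBox b U (suc (rowC R Wp (suc q))) (rowC R Wp (suc q) + suc q) ≡ true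
  hasB-south {R} {Wp} {q} {α} {x} {W} {D} {U} I = trans (bBox-at b U (suc (rowC R Wp (suc q))) (rowC R Wp (suc q) + suc q)) (trans (cong (isB b) (at-c-s valB I))
    (rest-B valB I q (first-head q x W)))

  rowC-up : ∀ {R Wp c α Wr D U} → Inv R Wp c α Wr D U → rowC R Wp (suc c) ≡ rowC R Wp c
  rowC-up {R} {Wp} {c} I = cong suc (sym (proj₁ (step-c valB I)))

  rowC-down : ∀ {R Wp q α Wr D U} → Inv R Wp (suc q) α Wr D U → rowC R Wp q ≡ suc (rowC R Wp (suc q))
  rowC-down {R} {Wp} {q} I = cong suc (proj₂ (step-c valB I))

  first-rest : ∀ {R Wp c α k x W D U} → Inv R Wp c α ((k , x) ∷ W) D U → ∀ l → l ≢ k →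
    (∃ λ y → (l , y) ∈ W × first l (rest ((k , x) ∷ W) D) ≡ just (y , Ql))
    ⊎ isB b (first l (rest ((k , x) ∷ W) D)) ≡ false
  first-rest {k = k} {x} {W} {D} I l ne = go (first l W) refl
    where
    go : ∀ c → first l W ≡ c →
      (∃ λ y → (l , y) ∈ W × first l (rest ((k , x) ∷ W) D) ≡ just (y , Ql)) ⊎ isB b (first l (rest ((k , x) ∷ W) D)) ≡ false
    go nothing e = inj₂ (rest-notB valB I l (trans (first-tail l k x W (ne ∘ sym)) e))
    go (just y) e = inj₁ (y , first-∈ l W e , first-qlab l ((k , x) ∷ W) (tailC D) (trans (first-tail l k x W (ne ∘ sym)) e))

  suc-suc≢ : ∀ q → suc (suc q) ≢ q
  suc-suc≢ q e = <⇒≢ (<-trans (n<1+n q) (n<1+n (suc q))) (sym e)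

  -- (S1) and (S5)
  east-step : ∀ {R Wp c α x W D U} (I : Inv R Wp c α ((suc c , x) ∷ W) D U) → ¬ Special c (suc c) x W →
              sigma a b U ≡ just (swapped I) × Inv R (Wp ∷ʳ (c , x)) (suc c) α W D (swapped I)
  east-step {R} {Wp} {c} {α} {x} {W} {D} {U} I ns =
    trans (selected valB I (cong (_∨ bBox b U (suc r) (r + c)) (hasB-east I)))
      (cong just (trans (switch-east a b U r (r + c) (hasB-east I) (diagonal c refl) (southern c refl))
        (swapBoxes-eq U r (r + c) r (suc (r + c)) (at-c valB I) east≡ ≫ cong₂ (λ i j → put r (r + c) (x , Ql) (put i j (α , Pl) U))
          (sym (rowC-up I)) (trans (sym (+-suc r c)) (cong (_+ suc c) (sym (rowC-up I))))))) ,
    move-inv I up ns (λ _ _ _ _ → λ { (_ , refl , ()) }) (≤-reflexive (sym (rowC-up I)))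
      (≤-trans (n≤1+n _) (≤-reflexive (trans (sym (+-suc r c)) (cong (_+ suc c) (sym (rowC-up I))))))
    where
    r = rowC R Wp c
    _≫_ : ∀ {X : Set} {x y z : X} → x ≡ y → y ≡ z → x ≡ z
    _≫_ = trans
    east≡ : at U r (suc (r + c)) ≡ just (x , Ql)
    east≡ = trans (at-c-e valB I) (first-qlab (suc c) ((suc c , x) ∷ W) (tailC D) (first-head (suc c) x W))
    smaller : ∀ {l y} → (l , y) ∈ W → l < suc c → primed x ≡ true × nextDir (suc c , x) W ≡ desc
    smaller y∈ lt with suffixW I
    ... | co , so , vs = later-smaller co so y∈ (All.lookup vs y∈) lt
    diagonal : ∀ q → c ≡ q → (r ≡ᵇ r + c) ≡ false ⊎ (entryPrimed U r (suc r) ∧ bBox b U (suc r) (suc r)) ≡ false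
    diagonal (suc q) refl = inj₁ (≡ᵇ-false (<⇒≢ (m<m+n r (s≤s z≤n))))
    diagonal zero refl with first-rest I 0 (λ ())
    ... | inj₁ (y , y∈ , _) = contradiction (special-from x W (proj₂ (smaller y∈ (s≤s z≤n)))) ns
    ... | inj₂ e = inj₂ (∧-falseʳ _ (trans (bBox-at b U (suc r) (suc r)) (trans (cong (isB b)
            (trans (cong (at U (suc r)) (cong suc (sym (+-identityʳ r)))) (at-c-se valB I))) e)))
    southern : ∀ q → c ≡ q → bBox b U (suc r) (r + c) ≡ false ⊎
               (entryPrimed U r (suc (r + c)) ≡ true × entryUnprimed U r (suc (r + c)) ≡ false)
    southern zero refl = inj₁ (trans (bBox-at b U (suc r) (r + 0)) (cong (isB b) (at-c-s valB I)))
    southern (suc q) refl with first-rest I q (suc-suc≢ q ∘ sym)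
    ... | inj₂ e = inj₁ (trans (bBox-at b U (suc r) (r + suc q)) (trans (cong (isB b) (at-c-s valB I)) e))
    ... | inj₁ (y , y∈ , _) = inj₂ (trans (entryPrimed-at U r (suc (r + c)) east≡) pd , trans (entryUnprimed-at U r (suc (r + c)) east≡) (cong not pd))
      where pd = proj₁ (smaller y∈ (<-trans (n<1+n q) (n<1+n (suc q))))

∈-labels : ∀ {L : List Entry} {k x} → (k , x) ∈ L → k ∈ labels L
∈-labels (here refl) = here refl
∈-labels (there q) = there (∈-labels q)

labels-∈ : ∀ (L : List Entry) {k} → k ∈ labels L → ∃ λ x → (k , x) ∈ L
labels-∈ ((k , x) ∷ L) (here refl) = x , here refl
labels-∈ (e ∷ L) (there q) with labels-∈ L q
... | x , r = x , there r

passV-0⁻ : ∀ v W → 0 ∉ W → passV v W ≡ 0 → v ≡ 0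
passV-0⁻ v W n e with v ≟ 0
... | yes q = q
... | no q = contradiction e (pass-≢0 v W q n)

isPrimed-asc : ∀ ε t {x} → isPrimed ε asc t ≡ just x → t ≡ none ⊎ t ≡ asc
isPrimed-asc ε none e = inj₁ refl
isPrimed-asc ε asc e = inj₂ refl

cmp-none : ∀ k l → cmp k l ≢ none
cmp-none k l e with k <ᵇ l | l <ᵇ k
cmp-none k l () | true | _
cmp-none k l () | false | true
cmp-none k l () | false | false

-- A block that has reached the main diagonal can only ascend afterwards.
after-bottom : ∀ ε R l → CohR ε R (inR R l) → 0 ∈ labels R → l ≢ 0 → inR R l ≡ asc
after-bottom ε ((zero , y) ∷ R) l c p ne = <⇒cmp (n≢0⇒n>0 ne)
after-bottom ε ((suc k , y) ∷ R) l (o , c) (there p) ne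
  with isPrimed-asc ε (cmp (suc k) l) (trans (cong (λ z → isPrimed ε z (cmp (suc k) l)) (sym (after-bottom ε R (suc k) c p λ ()))) o)
... | inj₁ e = contradiction e (cmp-none (suc k) l)
... | inj₂ e = e

module Steps₂ (a b : ℤ) (δ : Bool) (ε : ℤ → Bool) (A B P : List Entry)
             (valB : All (λ f → value f ≢ b) B) (PL : Placed (adv empty (labels A)) P) where

  open Block a b δ ε A B P
  open Steps a b δ ε A B P valB PL

  Event : ℕ → List Entry → Set
  Event q R = q ≡ 0 × ∃ λ α₀ → ∃ λ R' → R ≡ (0 , α₀) ∷ R'

  bottom-Wp : ∀ {R Wp c α x W D U} → Inv R Wp c α ((0 , x) ∷ W) D U → 0 ∉ labels Wp
  bottom-Wp {Wp = Wp} {x = x} {W} I p with labels-∈ Wp p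
  ... | w , w∈ = go Wp w∈ (Inv.coh I) (Inv.valW I)
    where
    go : ∀ {s} Wp → (0 , w) ∈ Wp → Coh ε s (Wp ++ (0 , x) ∷ W) → All (λ f → value f ≡ b) (Wp ++ (0 , x) ∷ W) → ⊥
    go (e ∷ Wp) (here refl) c (v ∷ vs) = later-distinct c (sorted-const (v ∷ vs)) refl
      (MP.∈-++⁺ʳ Wp (here refl)) (trans (All.lookup vs (MP.∈-++⁺ʳ Wp (here refl))) (sym v)) refl
    go (e ∷ Wp) (there q) (_ , c) (v ∷ vs) = go Wp q c vs

  bottom-W : ∀ {R Wp c α x W D U} → Inv R Wp c α ((0 , x) ∷ W) D U → 0 ∉ labels W
  bottom-W {W = W} I p with labels-∈ W p | suffixW I
  ... | w , w∈ | co , so , vs = later-distinct co so refl w∈ (All.lookup vs w∈) refl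

  -- If some entry of `R` were on the main diagonal, the block would ascend from it to the current
  -- entry, and the last entry of `R` would reach diagonal 0 after passing `Wp`. But it starts
  -- elsewhere, and `Wp` contains no 0.
  no-diagonal : ∀ {R Wp α x W D U} → Inv R Wp 1 α ((0 , x) ∷ W) D U → ¬ Event 0 R → 0 ∉ labels R
  no-diagonal {(zero , y) ∷ R} I ne p = ne (refl , y , R , refl)
  no-diagonal {(suc l , y) ∷ R} {Wp} I ne (there p) with isPrimed-asc δ (cmp (passV (suc l) (labels Wp)) 1)
      (trans (cong (λ z → isPrimed δ z (cmp (passV (suc l) (labels Wp)) 1)) (sym (after-bottom δ R (suc l) (proj₂ (Moving.cohR (Inv.mov I))) p λ ())))
        (proj₁ (Moving.cohR (Inv.mov I))))
  ... | inj₁ e = cmp-none (passV (suc l) (labels Wp)) 1 e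
  ... | inj₂ e = pass-≢0 (suc l) (labels Wp) (λ ()) (bottom-Wp I) (n<1⇒n≡0 (cmp-asc (passV (suc l) (labels Wp)) 1 e))

  aBox-diagonal : ∀ {R Wp α x W D U} → Inv R Wp 1 α ((0 , x) ∷ W) D U → 0 ∉ labels R →
                  aBox a U (rowC R Wp 1) (rowC R Wp 1) ≡ false
  aBox-diagonal {R} {Wp} {α} {x} {W} {D} {U} I n0 = trans (aBox-at a U r r) (go (at U r r) refl)
    where
    r = rowC R Wp 1
    M = adv (mid-state R) (labels Wp)
    r≡ : r ≡ M 0
    r≡ = trans (cong suc (cong (λ g → g 1) (adv-pre R Wp)))
           (sym (proj₂ (subst (λ m → Step m 1) (adv-pre R Wp) (step-c valB I))))
    diag : ∀ i l → i ≡ i + l → l ≡ 0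
    diag i l e = +-cancelˡ-≡ i l 0 (trans (sym e) (sym (+-identityʳ i)))
    go : ∀ c → at U r r ≡ c → isA a c ≡ false
    go nothing e = refl
    go (just (y , Ql)) e = refl
    go (just (y , Pl)) e with locate valB I r r e
    ... | isCurr _ q _ = contradiction q (<⇒≢ (m<m+n r (s≤s z≤n)))
    ... | inRest X l Y eq _ q with diag r l q
    ...   | refl = contradiction (∈-labels (rev-∈ R (subst ((0 , y) ∈_) (sym eq) (MP.∈-++⁺ʳ X (here refl))))) n0
      where
      rev-∈ : ∀ R {e : Entry} → e ∈ reverse R → e ∈ R
      rev-∈ R q = AnyP.reverse⁻ q
    go (just (y , Pl)) e | inDone X l Y eq p q with diag r l q
    ...   | refl = contradiction (trans (sym r≡) p) (<⇒≢ (s≤s (≤-trans M≤ (adv-≤ _ (labels X) 0))))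
      where
      M≤ : M 0 ≤ adv (bump 1 M) (labels ((0 , x) ∷ W)) 0
      M≤ = adv-≤ (bump 1 M) (labels ((0 , x) ∷ W)) 0

  -- (S2) and (S6)
  south-step : ∀ {R Wp q α x W D U} (I : Inv R Wp (suc q) α ((q , x) ∷ W) D U) → ¬ Event q R →
               sigma a b U ≡ just (swapped I) × Inv R (Wp ∷ʳ (suc q , x)) q α W D (swapped I)
  south-step {R} {Wp} {q} {α} {x} {W} {D} {U} I ne =
    trans (selected valB I (trans (cong (bBox b U r (suc (r + c)) ∨_) (hasB-south I)) (∨-zero (bBox b U r (suc (r + c))))))
      (cong just (trans (switch-south a b U r (r + c) (≡ᵇ-false (<⇒≢ (m<m+n r (s≤s z≤n)))) (hasB-south I) eastern (offEvent q refl))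
        (trans (swapBoxes-eq U r (r + c) (suc r) (r + c) (at-c valB I) south≡)
          (cong₂ (λ i j → put r (r + c) (x , Ql) (put i j (α , Pl) U)) (sym (rowC-down I)) col≡)))) ,
    move-inv I down (λ { (_ , _ , () , _) }) notEvent (≤-trans (n≤1+n r) (≤-reflexive (sym (rowC-down I)))) (≤-reflexive col≡)
    where
    c = suc q
    r = rowC R Wp c
    ∨-zero : ∀ t → (t ∨ true) ≡ true
    ∨-zero true = refl
    ∨-zero false = refl
    col≡ : r + c ≡ rowC R Wp q + q
    col≡ = trans (+-suc r q) (cong (_+ q) (sym (rowC-down I)))
    south≡ : at U (suc r) (r + c) ≡ just (x , Ql)
    south≡ = trans (at-c-s valB I) (first-qlab q ((q , x) ∷ W) (tailC D) (first-head q x W))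
    eastern : bBox b U r (suc (r + c)) ≡ false ⊎ (bBox b U r (suc (r + c)) ≡ true × entryPrimed U r (suc (r + c)) ≡ false)
    eastern with first-rest I (suc c) (suc-suc≢ q)
    ... | inj₂ e = inj₁ (trans (bBox-at b U r (suc (r + c))) (trans (cong (isB b) (at-c-e valB I)) e))
    ... | inj₁ (y , y∈ , e) with suffixW I
    ...   | co , so , vs = inj₂ (trans (bBox-at b U r (suc (r + c))) (trans (cong (isB b) (trans (at-c-e valB I) e))
                (trans (cong (_==ℤ b) (trans (All.lookup vs y∈) (val-head I))) (==ℤ-refl b))) ,
              trans (entryPrimed-at U r (suc (r + c)) (trans (at-c-e valB I) e))
                (later-larger co so y∈ (All.lookup vs y∈) (<-trans (n<1+n q) (n<1+n (suc q)))))
    offEvent : ∀ k → q ≡ k → (r + c ≡ᵇ suc r) ≡ false ⊎ aBox a U r r ≡ false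
    offEvent zero refl = inj₂ (aBox-diagonal I (no-diagonal I ne))
    offEvent (suc k) refl = inj₁ (≡ᵇ-false λ e → absurd (trans (sym (+-suc r (suc k))) e))
      where
      absurd : suc (r + suc k) ≡ suc r → ⊥
      absurd e = m+1+n≢m r (suc-injective e)
    notEvent : ∀ l y R' → R ≡ (l , y) ∷ R' → ¬ (passV l (labels Wp) ≡ 0 × c ≡ 1 × q ≡ 0)
    notEvent l y R' refl (e , refl , refl) = no-diagonal I ne (here (sym (passV-0⁻ l (labels Wp) (bottom-Wp I) e)))

  S3-result : ∀ {R Wp α x y W D U} → Inv R Wp 0 α ((1 , x) ∷ (0 , y) ∷ W) D U → LFill
  S3-result {R} {Wp} {α} {x} {y} {W} {D} {U} I =
    put r r (y , Ql) (put r (suc r) (un b , Ql) (put (suc r) (suc r) (α , Pl) U))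
    where r = rowC R Wp 0

  -- On diagonals the single switch (S3) amounts to two ordinary crossings of the current entry,
  -- from 0 to 1 and back to 0; only the letters differ from those of two ordinary switches.
  -- Accordingly the signs are updated twice.
  S3-step : ∀ {R Wp α x y W D U} (I : Inv R Wp 0 α ((1 , x) ∷ (0 , y) ∷ W) D U) → val x ≡ val y →
            sigma a b U ≡ just (S3-result I) × Inv R ((Wp ∷ʳ (0 , y)) ∷ʳ (1 , un b)) 0 α W D (S3-result I)
  S3-step {R} {Wp} {α} {x} {y} {W} {D} {U} I e =
    trans (selected valB I (cong (_∨ bBox b U (suc r) (r + 0)) (hasB-east I)))
      (cong just (trans (cong (switchAt a b U r) (+-identityʳ r))
        (switch-S3 a b U r (subst (λ z → bBox b U r (suc z) ≡ true) (+-identityʳ r) (hasB-east I))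
          (trans (entryPrimed-at U r (suc r) east≡) (proj₁ smaller)) seB (subst (λ z → at U r z ≡ just (α , Pl)) (+-identityʳ r) (at-c valB I)) se≡))) ,
    record
    { repr  = subst (λ L → Repr L (S3-result I)) (sym (trans (pre-snoc-++ R (Wp ∷ʳ (0 , y)) (1 , un b) _) (pre-snoc-++ R Wp (0 , y) _)))
        (Repr-set₃ (pre R Wp) (rest W D) (α , Pl) (x , Ql) (y , Ql) (y , Ql) (un b , Ql) (α , Pl) U r refl (rowC-up I) (Inv.repr I))
    ; keyed = Keyed-put r r (y , Ql) _ (Keyed-put r (suc r) (un b , Ql) _ (Keyed-put (suc r) (suc r) (α , Pl) U (Inv.keyed I)))
    ; legal = subst (λ z → Legal empty (labels A ++ labels (reverse R) ++ z))
        (sym (trans (labels-snoc-++ (Wp ∷ʳ (0 , y)) (1 , un b) _) (labels-snoc-++ Wp (0 , y) _))) (Inv.legal I)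
    ; coh   = subst (λ z → Coh ε none (((Wp ∷ʳ (0 , y)) ∷ʳ (1 , un z)) ++ W)) (val-head I) (Mid.coh (mid-special e (toMid valB I)))
    ; valW  = subst (All (λ f → value f ≡ b)) (sym (trans (++-assoc (Wp ∷ʳ (0 , y)) [ 1 , un b ] W) (++-assoc Wp [ 0 , y ] _)))
        (AllP.++⁺ (AllP.++⁻ˡ Wp (Inv.valW I)) (trans (sym e) (val-head I) ∷ refl ∷ All.tail (All.tail (AllP.++⁻ʳ Wp (Inv.valW I)))))
    ; valR  = Inv.valR I
    ; valα  = Inv.valα I
    ; valD  = Inv.valD I
    ; mov   = mov
    ; sel   = subst (λ z → Sel R α z (z + 0)) (sym row≡) (Sel-mono {R} {α} (n≤1+n r) (n≤1+n (r + 0)) (Inv.sel I))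
    ; orig  = Inv.orig I
    }
    where
    r = rowC R Wp 0
    smaller : primed x ≡ true × nextDir (1 , x) ((0 , y) ∷ W) ≡ desc
    smaller with suffixW I
    ... | co , so , vs = later-smaller co so (here refl) (sym e) (s≤s z≤n)
    east≡ : at U r (suc r) ≡ just (x , Ql)
    east≡ = trans (cong (λ z → at U r (suc z)) (sym (+-identityʳ r))) (at-c-e valB I)
    se≡ : at U (suc r) (suc r) ≡ just (y , Ql)
    se≡ = trans (cong (λ z → at U (suc r) (suc z)) (sym (+-identityʳ r))) (at-c-se valB I)
    seB : bBox b U (suc r) (suc r) ≡ true
    seB = trans (bBox-at b U (suc r) (suc r)) (trans (cong (isB b) se≡) (trans (cong (_==ℤ b) (trans (sym e) (val-head I))) (==ℤ-refl b)))
    row≡ : rowC R ((Wp ∷ʳ (0 , y)) ∷ʳ (1 , un b)) 0 ≡ suc r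
    row≡ = trans (rowC-snoc R (Wp ∷ʳ (0 , y)) 1 (un b) 0 (λ ())) (rowC-snoc-≡ R Wp 0 y)
    Wl = labels Wp
    mov₁ : Moving δ R (Wl ∷ʳ 0) 1 α (0 ∷ labels W) D
    mov₁ = subst (λ z → Moving δ R z 1 α (0 ∷ labels W) D) (labels-++ Wp [ 0 , y ])
      (mov-step (0 , y) I refl (λ { _ _ _ _ (_ , () , _) }))
    -- The exception in `before-step` would require the previous entry of the block to arrive at 0
    -- after passing the new 0. This would need a repeated letter or a 1 enclosed too tightly, both
    -- illegal.
    second : ∀ R₁ → R₁ ≡ R → before R₁ ((Wl ∷ʳ 0) ∷ʳ 1) 0 ≡ before R₁ (Wl ∷ʳ 0) 1
    second [] _ = refl
    second ((l , w) ∷ R') refl = before-step {adv m₀ (labels (reverse R'))} ((l , w) ∷ R') {Wl ∷ʳ 0} {1} {0} {labels W} h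
      where
      lg : Legal (adv m₀ (labels (reverse R'))) (l ∷ Wl ++ 0 ∷ 1 ∷ 0 ∷ labels W)
      lg = head-legal I l w R' refl
      after-Wp : Legal (adv (adv m₀ (labels (reverse R'))) (passW l Wl)) (passV l Wl ∷ 0 ∷ 1 ∷ 0 ∷ labels W)
      after-Wp = proj₂ (Legal-++ (adv m₀ (labels (reverse R'))) (passW l Wl)
        (~-Legal (pass-~ l Wl (0 ∷ 1 ∷ 0 ∷ labels W)) {adv m₀ (labels (reverse R'))} lg))
      impossible : ∀ {m} v → Legal m (v ∷ 0 ∷ 1 ∷ 0 ∷ labels W) → cr v 0 ≢ 0
      impossible {m} zero lg' q = legal-≢ {m} {0} {0} {1 ∷ 0 ∷ labels W} lg' refl
      impossible {m} (suc zero) lg' q with sandwich {m} {1} {0} {0 ∷ labels W} lg' down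
      ... | () , _
      impossible (suc (suc v)) lg' ()
      h : ∀ l' y' R'' → (l , w) ∷ R' ≡ (l' , y') ∷ R'' →
          Legal (adv m₀ (labels (reverse R'))) (l' ∷ (Wl ∷ʳ 0) ++ 1 ∷ 0 ∷ labels W) × ¬ (passV l' (Wl ∷ʳ 0) ≡ 0 × 1 ≡ 1 × 0 ≡ 0)
      h _ _ _ refl = subst (λ z → Legal (adv m₀ (labels (reverse R'))) (l ∷ z)) (sym (++-assoc Wl [ 0 ] _)) lg ,
        λ { (q , _ , _) → impossible (passV l Wl) after-Wp (trans (sym (passV-snoc l Wl 0)) q) }
    mov : Moving δ R (labels ((Wp ∷ʳ (0 , y)) ∷ʳ (1 , un b))) 0 α (labels W) D
    mov = subst (λ z → Moving δ R z 0 α (labels W) D)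
      (trans (cong (_∷ʳ 1) (sym (labels-++ Wp [ 0 , y ]))) (sym (labels-++ (Wp ∷ʳ (0 , y)) [ 1 , un b ])))
      (Moving-step {R = R} {W = Wl ∷ʳ 0} {V = labels W} {D} (second R refl) mov₁)

far-from-0 : ∀ W → 1 ∉ W → All (λ k → adj 0 k ≡ false) W
far-from-0 [] n = []
far-from-0 (zero ∷ W) n = refl ∷ far-from-0 W (n ∘ there)
far-from-0 (suc zero ∷ W) n = contradiction (here refl) n
far-from-0 (suc (suc k) ∷ W) n = refl ∷ far-from-0 W (n ∘ there)

~-past : ∀ k Y Z → All (λ l → adj k l ≡ false) Y → k ∷ Y ++ Z ~ Y ++ k ∷ Z
~-past k [] Z [] = ~refl
~-past k (l ∷ Y) Z (f ∷ fs) = ~trans (~swap f) (~cons l (~-past k Y Z fs))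

at-commutes : ∀ {C : Set} m (X : Code C) k c Y Z → All (λ l → adj k l ≡ false) (labels Y) →
  Legal m (labels (X ++ (k , c) ∷ Y ++ Z)) → ∀ i j →
  at (cells m (X ++ (k , c) ∷ Y ++ Z)) i j ≡ at (cells m (X ++ Y ++ (k , c) ∷ Z)) i j
at-commutes m X k c [] Z fs lg i j = refl
at-commutes m X k c ((l , y) ∷ Y) Z (f ∷ fs) lg i j =
  trans (at-commute m X (Y ++ Z) k c l y f lg i j)
    (trans (cong (λ L → at (cells m L) i j) (sym (++-assoc X [ l , y ] _)))
      (trans (at-commutes m (X ∷ʳ (l , y)) k c Y Z fs lg' i j)
        (cong (λ L → at (cells m L) i j) (++-assoc X [ l , y ] _))))
  where
  lg' : Legal m (labels ((X ∷ʳ (l , y)) ++ (k , c) ∷ Y ++ Z))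
  lg' = subst (Legal m) (trans (sym (labels-++ X _)) (cong labels (sym (++-assoc X [ l , y ] _))))
    (~-Legal (~++ˡ (labels X) (~swap f)) {m} (subst (Legal m) (labels-++ X _) lg))

module Steps₃ (a b : ℤ) (δ : Bool) (ε : ℤ → Bool) (A B P : List Entry)
             (valB : All (λ f → value f ≢ b) B) (PL : Placed (adv empty (labels A)) P) where

  open Block a b δ ε A B P
  open Steps a b δ ε A B P valB PL
  open Steps₂ a b δ ε A B P valB PL

  module _ {R Wp α₀ α x W D U} (I : Inv ((0 , α₀) ∷ R) Wp 1 α ((0 , x) ∷ W) D U) where

    private
      R⁺ : List Entry
      R⁺ = (0 , α₀) ∷ R
      r : ℕ
      r = rowC R⁺ Wp 1
      M : State
      M = adv (mid-state R) (labels Wp)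

    S4-result : LFill
    S4-result = put r r (x , Ql) (put r (suc r) (pr a , Pl) (put (suc r) (suc r) (α₀ , Pl) U))

    private
      tailW : List ℕ
      tailW = labels W ++ labels D ++ labels B

      reverse-split : ∀ Y → labels (reverse R⁺) ++ Y ≡ labels (reverse R) ++ 0 ∷ Y
      reverse-split Y = trans (cong (λ z → labels z ++ Y) (unfold-reverse (0 , α₀) R)) (labels-snoc-++ (reverse R) (0 , α₀) Y)

      legal₀ : Legal (mid-state R) (0 ∷ labels Wp ++ 1 ∷ 0 ∷ tailW)
      legal₀ = proj₂ (Legal-++ m₀ (labels (reverse R)) (subst (Legal m₀) (reverse-split _) (legal-R valB I)))

      bottomWp : 0 ∉ labels Wp
      bottomWp = bottom-Wp I

      -- Together with the current entry on diagonal 1, a 1 in `Wp` would enclose a 0, and `Wp` has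
      -- none.
      oneWp : 1 ∉ labels Wp
      oneWp p with MP.∈-∃++ p
      ... | X , Y , eq = bottomWp (subst (0 ∈_) (sym eq) (MP.∈-++⁺ʳ X (there (strip Y (lower (Y ++ [ 1 ]) (after-step-west {N} {0} (proj₁ lY)) (proj₂ lY) (MP.∈-++⁺ʳ Y (here refl)))))))
        where
        N = adv (mid-state R) (0 ∷ X)
        strip : ∀ Y → 0 ∈ Y ++ [ 1 ] → 0 ∈ Y
        strip Y q with MP.∈-++⁻ Y q
        ... | inj₁ q' = q'
        ... | inj₂ (here ())
        ... | inj₂ (there ())
        assoc : 0 ∷ labels Wp ++ 1 ∷ 0 ∷ tailW ≡ (0 ∷ X) ++ (1 ∷ Y ++ [ 1 ]) ++ 0 ∷ tailW
        assoc = trans (cong (λ z → 0 ∷ z ++ 1 ∷ 0 ∷ tailW) eq) (cong (0 ∷_) (trans (++-assoc X (1 ∷ Y) _)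
          (cong (λ z → X ++ 1 ∷ z) (sym (++-assoc Y [ 1 ] _)))))
        lY : Legal N (1 ∷ Y ++ [ 1 ])
        lY = proj₁ (Legal-++ N (1 ∷ Y ++ [ 1 ]) (proj₂ (Legal-++ (mid-state R) (0 ∷ X) (subst (Legal (mid-state R)) assoc legal₀))))

      farWp : All (λ k → adj 0 k ≡ false) (labels Wp)
      farWp = far-from-0 (labels Wp) oneWp

      legal₁ : Legal (mid-state R) (labels Wp ++ 0 ∷ 1 ∷ 0 ∷ tailW)
      legal₁ = ~-Legal (~-past 0 (labels Wp) _ farWp) {mid-state R} legal₀

      legal₂ : Legal M (0 ∷ 1 ∷ 0 ∷ tailW)
      legal₂ = proj₂ (Legal-++ (mid-state R) (labels Wp) legal₁)

      1≢0 : 1 ≢ 0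
      1≢0 ()

      -- A 1 immediately after the 0 is excluded by `sandwich`. If the block first goes to a
      -- diagonal beyond 1 and then down to 1, that larger entry is unprimed because it follows the
      -- 0, yet primed because a smaller one follows it.
      oneW : 1 ∉ labels W
      oneW = go W (proj₂ legal₂) (suffixW I) (bottom-W I)
        where
        go : ∀ W {s m} → Legal m (1 ∷ 0 ∷ labels W ++ labels D ++ labels B) →
             Coh ε s ((0 , x) ∷ W) × Sorted ((0 , x) ∷ W) × All (λ f → value f ≡ val x) W → 0 ∉ labels W → 1 ∉ labels W
        go ((zero , w) ∷ W) lg c n0 p = n0 (here refl)
        go ((suc zero , w) ∷ W) {m = m} lg c n0 p = 1≢0 (proj₁ (sandwich {m} {1} {0} {labels W ++ labels D ++ labels B} lg down))
        go ((suc (suc k) , w) ∷ W) lg (c@(_ , c') , o@(_ ∷ o') , (v ∷ vs)) n0 (there p) with labels-∈ W p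
        ... | y , y∈ with trans (sym (proj₁ (later-smaller c' o' y∈ (trans (All.lookup vs y∈) (sym v)) (s≤s (s≤s z≤n)))))
                            (later-larger c o (here refl) v (s≤s z≤n))
        ...   | ()

      farW : All (λ k → adj 0 k ≡ false) (labels W)
      farW = far-from-0 (labels W) oneW

      row-1 : r ≡ rowOf empty (pre R Wp) 1
      row-1 = cong suc (begin
        adv empty (labels (pre R⁺ Wp)) 1       ≡⟨ cong (λ g → g 1) (adv-pre R⁺ Wp) ⟩
        adv (mid-state R⁺) (labels Wp) 1       ≡⟨ cong (λ z → adv z (labels Wp) 1) ms≡ ⟩
        adv (mid-state R) (0 ∷ labels Wp) 1    ≡⟨ ~-adv (subst (λ z → 0 ∷ z ~ labels Wp ∷ʳ 0) (++-identityʳ (labels Wp)) (~-past 0 (labels Wp) [] farWp)) (mid-state R) 1 ⟩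
        adv (mid-state R) (labels Wp ∷ʳ 0) 1   ≡⟨ cong (λ g → g 1) (adv-++ (mid-state R) (labels Wp) [ 0 ]) ⟩
        bump 0 M 1                             ≡⟨ refl ⟩
        M 1                                    ≡⟨ cong (λ g → g 1) (adv-pre R Wp) ⟨
        adv empty (labels (pre R Wp)) 1 ∎)
        where
        open ≡-Reasoning
        ms≡ : mid-state R⁺ ≡ bump 0 (mid-state R)
        ms≡ = trans (cong (adv m₀) (trans (cong labels (unfold-reverse (0 , α₀) R)) (labels-++ (reverse R) [ 0 , α₀ ])))
                (adv-++ m₀ (labels (reverse R)) [ 0 ])

      row-0 : rowOf empty (pre R Wp) 0 ≡ r
      row-0 = trans (cong suc (trans (cong (λ g → g 0) (adv-pre R Wp)) (trans (proj₁ (proj₁ legal₂)) (cong (λ g → g 1) (sym (adv-pre R Wp)))))) (sym row-1)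

      labels-at : ∀ Y → labels (pre R Wp ++ Y) ≡ labels A ++ labels (reverse R) ++ labels Wp ++ labels Y
      labels-at Y = trans (labels-++ (pre R Wp) Y) (trans (cong (_++ labels Y) (labels-pre R Wp))
        (trans (++-assoc (labels A) _ _) (cong (labels A ++_) (++-assoc (labels (reverse R)) _ _))))

      full-split : full R⁺ Wp 1 α ((0 , x) ∷ W) D ≡
        (qlab A ++ plab (reverse R)) ++ (0 , (α₀ , Pl)) ∷ qlab Wp ++ (1 , (α , Pl)) ∷ (0 , (x , Ql)) ∷ rest W D
      full-split = trans (++-assoc (qlab A) _ _) (trans (cong (qlab A ++_) (trans (++-assoc (plab (reverse R⁺)) (qlab Wp) _)
        (trans (cong (_++ (qlab Wp ++ (1 , (α , Pl)) ∷ (0 , (x , Ql)) ∷ rest W D))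
            (trans (cong plab (unfold-reverse (0 , α₀) R)) (map-++ _ (reverse R) [ 0 , α₀ ])))
          (++-assoc (plab (reverse R)) _ _)))) (sym (++-assoc (qlab A) _ _)))

      -- As `Wp` has neither 0 nor 1, the diagonal entry `α₀` can be written next to the current
      -- one, and the three boxes of (S4) become consecutive letters 0, 1, 0.
      repr₁ : Repr (pre R Wp ++ (0 , (α₀ , Pl)) ∷ (1 , (α , Pl)) ∷ (0 , (x , Ql)) ∷ rest W D) U
      repr₁ i j = trans (Inv.repr I i j) (trans (cong (λ L → at (cells empty L) i j) full-split)
        (trans (at-commutes empty (qlab A ++ plab (reverse R)) 0 (α₀ , Pl) (qlab Wp) _
            (subst (All (λ k → adj 0 k ≡ false)) (sym (labels-qlab Wp)) farWp)
            (subst (λ L → Legal empty (labels L)) full-split (legal-full valB I)) i j)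
          (cong (λ L → at (cells empty L) i j) (trans (++-assoc (qlab A) _ _) (trans (cong (qlab A ++_)
            (sym (++-assoc (plab (reverse R)) (qlab Wp) _))) (sym (++-assoc (qlab A) _ _)))))))

      repr₂ : Repr (pre R Wp ++ (0 , (x , Ql)) ∷ (1 , (pr a , Pl)) ∷ (0 , (α₀ , Pl)) ∷ rest W D) S4-result
      repr₂ = Repr-set₃ (pre R Wp) (rest W D) (α₀ , Pl) (α , Pl) (x , Ql) (x , Ql) (pr a , Pl) (α₀ , Pl) U r row-0 (sym row-1) repr₁

      pre₂ : Code Labelled
      pre₂ = (pre R Wp ∷ʳ (0 , (x , Ql))) ∷ʳ (1 , (pr a , Pl))

      pre₂-++ : ∀ Y → pre₂ ++ Y ≡ pre R Wp ++ (0 , (x , Ql)) ∷ (1 , (pr a , Pl)) ∷ Y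
      pre₂-++ Y = trans (++-assoc (pre R Wp ∷ʳ (0 , (x , Ql))) _ Y) (++-assoc (pre R Wp) _ _)

      legal-A : ∀ {w} → Legal (mid-state R) w → Legal empty (labels A ++ labels (reverse R) ++ w)
      legal-A {w} l = ++-Legal empty (labels A) (proj₁ (Legal-++ empty (labels A) (Inv.legal I)))
        (++-Legal m₀ (labels (reverse R)) (proj₁ (Legal-++ m₀ (labels (reverse R)) (subst (Legal m₀) (reverse-split _) (legal-R valB I)))) l)

      legal₃ : Legal (mid-state R) (labels Wp ++ 0 ∷ 1 ∷ labels W ++ 0 ∷ labels D ++ labels B)
      legal₃ = ~-Legal (~++ˡ (labels Wp) (~cons 0 (~cons 1 (~-past 0 (labels W) _ farW)))) {mid-state R} legal₁

      repr₃ : Repr (full R (Wp ∷ʳ (0 , x)) 1 (pr a) W ((0 , α₀) ∷ D)) S4-result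
      repr₃ i j = trans (repr₂ i j) (trans (cong (λ L → at (cells empty L) i j) (sym (pre₂-++ _)))
        (trans (at-commutes empty pre₂ 0 (α₀ , Pl) (qlab W) (tailC D) (subst (All (λ k → adj 0 k ≡ false)) (sym (labels-qlab W)) farW)
            (subst (Legal empty) (sym (trans (cong labels (pre₂-++ _)) (trans (labels-at _)
               (cong (λ z → labels A ++ labels (reverse R) ++ labels Wp ++ 0 ∷ 1 ∷ 0 ∷ z) (labels-rest W D)))))
              (legal-A legal₁)) i j)
          (cong (λ L → at (cells empty L) i j) (trans (pre₂-++ _) (sym (pre-snoc-++ R Wp (0 , x) _))))))

      at-rr : at U r r ≡ just (α₀ , Pl)
      at-rr = trans (cong₂ (at U) (sym row-0) (trans (sym row-0) (sym (+-identityʳ _))))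
        (trans (repr₁ _ _) (at-own empty (pre R Wp) 0 (α₀ , Pl) _))

      at-south₄ : at U (suc r) (suc r) ≡ just (x , Ql)
      at-south₄ = trans (cong (at U (suc r)) (+-comm 1 r)) (trans (at-c-s valB I) refl)

      unprimedα : primed α ≡ false
      unprimedα = proj₁ (incoming-asc δ (after 1 (labels ((0 , x) ∷ W)) D)
        (trans (cong (λ z → isPrimed δ (cmp z 1) (after 1 (labels ((0 , x) ∷ W)) D)) (sym (proj₁ (pass-far 0 (labels Wp) farWp))))
          (Moving.cohP (Inv.mov I))))

      southB : bBox b U (suc r) (suc r) ≡ true
      southB = trans (bBox-at b U (suc r) (suc r)) (trans (cong (isB b) at-south₄) (trans (cong (_==ℤ b) (val-head I)) (==ℤ-refl b)))

      east≡ : ∀ {c} → first 2 (rest ((0 , x) ∷ W) D) ≡ c → at U r (suc (suc r)) ≡ c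
      east≡ e = trans (cong (λ z → at U r (suc z)) (+-comm 1 r)) (trans (at-c-e valB I) e)

      eastern : bBox b U r (suc (suc r)) ≡ false ⊎ (bBox b U r (suc (suc r)) ≡ true × entryUnprimed U r (suc (suc r)) ≡ true)
      eastern with first-rest I 2 (λ ())
      ... | inj₂ e = inj₁ (trans (bBox-at b U r (suc (suc r))) (trans (cong (isB b) (east≡ refl)) e))
      ... | inj₁ (y , y∈ , e) with suffixW I
      ...   | co , so , vs = inj₂ (trans (bBox-at b U r (suc (suc r))) (trans (cong (isB b) (east≡ e))
                  (trans (cong (_==ℤ b) (trans (All.lookup vs y∈) (val-head I))) (==ℤ-refl b))) ,
                trans (entryUnprimed-at U r (suc (suc r)) (east≡ e)) (cong not (later-larger co so y∈ (All.lookup vs y∈) (s≤s z≤n))))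

      sigma≡ : sigma a b U ≡ just S4-result
      sigma≡ = trans (selected valB I (trans (cong (bBox b U r (suc (r + 1)) ∨_) (hasB-south I)) (∨-zero (bBox b U r (suc (r + 1))))))
        (cong just (trans (cong (switchAt a b U r) (+-comm r 1))
          (switch-S4 a b U r southB eastern
            (trans (entryUnprimed-at U r (suc r) (trans (cong (at U r) (+-comm 1 r)) (at-c valB I))) (cong not unprimedα))
            (trans (aBox-at a U r r) (trans (cong (isA a) at-rr) (trans (cong (_==ℤ a) (All.head (Inv.valR I))) (==ℤ-refl a))))
            at-rr at-south₄)))
        where
        ∨-zero : ∀ t → (t ∨ true) ≡ true
        ∨-zero true = refl
        ∨-zero false = refl

      Z = proj₁ (Inv.orig I)
      eqP : P ≡ reverse R ++ (0 , α₀) ∷ Z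
      eqP = trans (proj₂ (Inv.orig I)) (trans (cong (_++ Z) (unfold-reverse (0 , α₀) R)) (++-assoc (reverse R) [ 0 , α₀ ] Z))

      -- The current entry is now primed, so it must lie south of all the entries of `R` and these
      -- must be primed. `Placed` says so for `α₀`, whose row is that of the current entry and
      -- which, on the main diagonal, can only have been reached by descending.
      sel₄ : Sel R (pr a) r (r + 1)
      sel₄ X l y Y e = (λ ()) , λ _ → go (PL X (l , y) Y (0 , α₀) Z (trans eqP (trans (cong (_++ (0 , α₀) ∷ Z) e) (++-assoc X ((l , y) ∷ Y) _))))
        where
        r₀≡ : rowOf m₀ (X ++ (l , y) ∷ Y) 0 ≡ r
        r₀≡ = trans (cong (λ L → rowOf m₀ L 0) (sym e)) (trans (cong suc (trans (sym (adv-∉ (mid-state R) bottomWp)) (cong (λ g → g 0) (sym (adv-pre R Wp))))) row-0)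
        go : (l < 0 × primed α₀ ≡ false × rowOf m₀ X l + l < rowOf m₀ (X ++ (l , y) ∷ Y) 0 + 0)
             ⊎ (0 < l × primed y ≡ true × rowOf m₀ X l < rowOf m₀ (X ++ (l , y) ∷ Y) 0) →
             primed y ≡ true × rowOf m₀ X l < r
        go (inj₁ (() , _))
        go (inj₂ (_ , t , lt)) = t , ≤-trans lt (≤-reflexive r₀≡)

      hR : ∀ l y R' → R ≡ (l , y) ∷ R' → 0 < l × 1 < passV l (labels Wp ∷ʳ 0)
      hR l y R' refl = n≢0⇒n>0 (λ e → legal-≢ {adv m₀ (labels (reverse R'))} {l} {0} {labels Wp ++ 1 ∷ 0 ∷ tailW} lg e) ,
        subst (1 <_) (sym (passV-snoc l (labels Wp) 0)) (big (passV l (labels Wp)) after-Wp)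
        where
        S = adv m₀ (labels (reverse R'))
        lg : Legal S (l ∷ 0 ∷ labels Wp ++ 1 ∷ 0 ∷ tailW)
        lg = proj₂ (Legal-++ m₀ (labels (reverse R')) (subst (Legal m₀)
          (trans (reverse-split _) (trans (cong (λ z → labels z ++ 0 ∷ labels Wp ++ 1 ∷ 0 ∷ tailW) (unfold-reverse (l , y) R')) (labels-snoc-++ (reverse R') (l , y) _)))
          (legal-R valB I)))
        after-Wp : Legal (adv S (passW l (labels Wp))) (passV l (labels Wp) ∷ 0 ∷ 1 ∷ 0 ∷ tailW)
        after-Wp = proj₂ (Legal-++ S (passW l (labels Wp)) (~-Legal (~trans (~cons l (~-past 0 (labels Wp) _ farWp)) (pass-~ l (labels Wp) _)) {S} lg))
        big : ∀ {m} v → Legal m (v ∷ 0 ∷ 1 ∷ 0 ∷ tailW) → 1 < cr v 0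
        big {m} zero lg' = contradiction refl (legal-≢ {m} {0} {0} {1 ∷ 0 ∷ tailW} lg')
        big {m} (suc zero) lg' = contradiction (proj₁ (sandwich {m} {1} {0} {0 ∷ tailW} lg' down)) 1≢0
        big (suc (suc v)) lg' = s≤s (s≤s z≤n)

    -- (S4) turns the ascent from 0 to 1 inside the block into a descent from 1 to 0. The valley
    -- keeps its bottom on the main diagonal, hence `α₀` with its free prime goes to the end and is
    -- finished at once, since `W` has no letter adjacent to 0. The other entry, now on the
    -- descending side, stays current with a prime.
    S4-step : sigma a b U ≡ just S4-result × Inv R (Wp ∷ʳ (0 , x)) 1 (pr a) W ((0 , α₀) ∷ D) S4-result
    S4-step = sigma≡ , record
      { repr  = repr₃
      ; keyed = Keyed-put r r (x , Ql) (put r (suc r) (pr a , Pl) (put (suc r) (suc r) (α₀ , Pl) U))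
          (Keyed-put r (suc r) (pr a , Pl) (put (suc r) (suc r) (α₀ , Pl) U) (Keyed-put (suc r) (suc r) (α₀ , Pl) U (Inv.keyed I)))
      ; legal = subst (λ z → Legal empty (labels A ++ labels (reverse R) ++ z)) (sym (labels-snoc-++ Wp (0 , x) _)) (legal-A legal₃)
      ; coh   = subst (Coh ε none) (sym (++-assoc Wp [ 0 , x ] W)) (Inv.coh I)
      ; valW  = vals-snoc Wp (0 , x) (0 , x) W refl (Inv.valW I)
      ; valR  = All.tail (Inv.valR I)
      ; valα  = refl
      ; valD  = All.head (Inv.valR I) ∷ Inv.valD I
      ; mov   = subst (λ z → Moving δ R z 1 (pr a) (labels W) ((0 , α₀) ∷ D)) (sym (labels-++ Wp [ 0 , x ]))
          (Moving-S4 {R = R} {labels Wp} hR (proj₁ (pass-far 0 (labels Wp) farWp)) (proj₁ (pass-far 0 (labels W) farW))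
            (pass-≢0 1 (labels W) 1≢0 (bottom-W I))
            (All.map (λ v → trans v (sym (All.head (Inv.valR I)))) (Inv.valD I)) (Inv.mov I))
      ; sel   = subst (λ z → Sel R (pr a) z (z + 1)) (sym (trans (rowC-snoc R Wp 0 x 1 (λ ())) (sym row-1))) sel₄
      ; orig  = (0 , α₀) ∷ Z , eqP
      }

    S4-far : All (λ k → adj 0 k ≡ false) (labels Wp) × All (λ k → adj 0 k ≡ false) (labels W)
    S4-far = farWp , farW

-- The switching process of one block with another, and with all blocks.

module Run (a b : ℤ) (δ : Bool) (ε : ℤ → Bool) (A B P : List Entry)
           (valB : All (λ f → value f ≢ b) B) (PL : Placed (adv empty (labels A)) P) where

  open Block a b δ ε A B P
  open Steps a b δ ε A B P valB PL
  open Steps₂ a b δ ε A B P valB PL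
  open Steps₃ a b δ ε A B P valB PL

  -- `T` is the word of the `b`s once the current entry has passed them all, and thus what the
  -- entries of `R` will meet; `t` lists the final diagonals of the current and the finished
  -- entries. Stated in this way, the result stays the same during the whole run.
  record Result (R : List Entry) (T : List ℕ) (t : List ℕ) (U : LFill) : Set where
    constructor ran
    field
      V      : LFill
      W' P'  : List Entry
      proc   : SwitchProc a b U V
      keyed  : Keyed V
      repr   : Repr (qlab A ++ qlab W' ++ plab P' ++ qlab B) V
      labW   : labels W' ≡ swT (labels (reverse R)) T
      labP   : labels P' ≡ swX (labels (reverse R)) T ++ t
      cohW   : Coh ε none W'
      valW   : All (λ f → value f ≡ b) W'
      cohP   : Coh (λ _ → δ) none P'
      valP   : All (λ f → value f ≡ a) P'

  Run : List Entry → List Entry → ℕ → List Entry → List Entry → LFill → Set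
  Run R Wp c Wr D U = Result R (labels Wp ++ passW c (labels Wr)) (passV c (labels Wr) ∷ labels D) U

  onward : ∀ {R R' T T' t t' U U'} → sigma a b U ≡ just U' →
           swT (labels (reverse R')) T' ≡ swT (labels (reverse R)) T →
           swX (labels (reverse R')) T' ++ t' ≡ swX (labels (reverse R)) T ++ t → Result R' T' t' U' → Result R T t U
  onward s e e' (ran V W' P' p k r lw lp cw vw cp vp) =
    ran V W' P' (advance s p) k r (trans lw e) (trans lp e') cw vw cp vp

  relabel : ∀ {R R' T T' t t' U} →
           swT (labels (reverse R')) T' ≡ swT (labels (reverse R)) T →
           swX (labels (reverse R')) T' ++ t' ≡ swX (labels (reverse R)) T ++ t → Result R' T' t' U → Result R T t U
  relabel e e' (ran V W' P' p k r lw lp cw vw cp vp) =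
    ran V W' P' p k r (trans lw e) (trans lp e') cw vw cp vp

  labels-rev : ∀ l (y : Letter) R → labels (reverse ((l , y) ∷ R)) ≡ labels (reverse R) ++ [ l ]
  labels-rev l y R = trans (cong labels (unfold-reverse (l , y) R)) (labels-++ (reverse R) [ l , y ])

  swT-rev : ∀ l (y : Letter) R T → swT (labels (reverse ((l , y) ∷ R))) T ≡ swT (labels (reverse R)) (passW l T)
  swT-rev l y R T = trans (cong (λ z → swT z T) (labels-rev l y R)) (trans (swT-++ (labels (reverse R)) [ l ] T)
    (cong (swT (labels (reverse R))) (trans (swT-∷ l [] T) (cong (passW l) (swT-[] T)))))

  swX-rev : ∀ l (y : Letter) R T t → swX (labels (reverse ((l , y) ∷ R))) T ++ t ≡ swX (labels (reverse R)) (passW l T) ++ passV l T ∷ t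
  swX-rev l y R T t = trans (cong (λ z → swX z T ++ t) (labels-rev l y R)) (trans (cong (_++ t) (swX-++ (labels (reverse R)) [ l ] T))
    (trans (++-assoc (swX (labels (reverse R)) (swT [ l ] T)) (swX [ l ] T) t)
      (cong₂ (λ x y → swX (labels (reverse R)) x ++ y ++ t) (trans (swT-∷ l [] T) (cong (passW l) (swT-[] T)))
        (trans (swX-∷ l [] T) (cong₂ (λ x y → passV l x ∷ y) (swT-[] T) (swX-[] T))))))

  event? : ∀ q R → Dec (Event q R)
  event? zero ((zero , α₀) ∷ R) = yes (refl , α₀ , R , refl)
  event? zero [] = no λ { (_ , _ , _ , ()) }
  event? zero ((suc _ , _) ∷ _) = no λ { (_ , _ , _ , ()) }
  event? (suc q) R = no λ { (() , _) }

  run : ∀ R Wp c α Wr D U → Inv R Wp c α Wr D U → Run R Wp c Wr D U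
  run [] Wp c α [] D U I = ran U Wp ((c , α) ∷ D) (finish (finished-none valB I)) (Inv.keyed I)
    (subst (λ L → Repr L U) (++-assoc (qlab A) (qlab Wp) _) (Inv.repr I))
    (sym (trans (swT-[] _) (++-identityʳ _)))
    (cong (_++ c ∷ labels D) (sym (swX-[] (labels Wp ++ []))))
    (subst (Coh ε none) (++-identityʳ Wp) (Inv.coh I))
    (subst (All (λ f → value f ≡ b)) (++-identityʳ Wp) (Inv.valW I))
    (Moving-final (All.map (λ v → trans v (sym (Inv.valα I))) (Inv.valD I)) (Inv.mov I))
    (Inv.valα I ∷ Inv.valD I)
  run ((l , y) ∷ R) Wp c α [] D U I = relabel {R' = R}
    (sym (trans (swT-rev l y R (labels Wp ++ [])) (cong (λ z → swT (labels (reverse R)) (passW l z)) (++-identityʳ (labels Wp)))))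
    (sym (trans (swX-rev l y R (labels Wp ++ []) (c ∷ labels D)) (cong (λ z → swX (labels (reverse R)) (passW l z) ++ passV l z ∷ c ∷ labels D) (++-identityʳ (labels Wp)))))
    (run R [] l y Wp ((c , α) ∷ D) U (done-step I))
  run R Wp c α ((k , x) ∷ W) D U I with view c ((k , x) ∷ W)
  ... | vskip f = relabel {R' = R} (cong (swT (labels (reverse R))) word≡) (cong₂ (λ z v → swX (labels (reverse R)) z ++ passV v (labels W) ∷ labels D) word≡ (sym (proj₂ cross)))
          (run R (Wp ∷ʳ (k , x)) c α W D U (skip-step f I))
    where
    cross : cl c k ≡ k × cr c k ≡ c
    cross rewrite f = refl , refl
    word≡ : labels (Wp ∷ʳ (k , x)) ++ passW c (labels W) ≡ labels Wp ++ passW c (k ∷ labels W)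
    word≡ = trans (labels-snoc-++ Wp (k , x) _) (cong₂ (λ p q → labels Wp ++ p ∷ passW q (labels W)) (sym (proj₁ cross)) (sym (proj₂ cross)))
  ... | vmove up ns = onward {R' = R} (proj₁ s) (cong (swT (labels (reverse R))) word≡)
          (cong₂ (λ z v → swX (labels (reverse R)) z ++ passV v (labels W) ∷ labels D) word≡ (sym (proj₂ cross)))
          (run R (Wp ∷ʳ (c , x)) (suc c) α W D _ (proj₂ s))
    where
    s = east-step I ns
    cross : cl c (suc c) ≡ c × cr c (suc c) ≡ suc c
    cross rewrite adj-up c = refl , refl
    word≡ : labels (Wp ∷ʳ (c , x)) ++ passW (suc c) (labels W) ≡ labels Wp ++ passW c (suc c ∷ labels W)
    word≡ = trans (labels-snoc-++ Wp (c , x) _) (cong₂ (λ p q → labels Wp ++ p ∷ passW q (labels W)) (sym (proj₁ cross)) (sym (proj₂ cross)))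
  run R Wp .0 α ((.1 , x) ∷ (.0 , y) ∷ W) D U I | vspec e = onward {R' = R} (proj₁ s) (cong (swT (labels (reverse R))) word≡)
          (cong (λ z → swX (labels (reverse R)) z ++ passV 0 (labels W) ∷ labels D) word≡)
          (run R ((Wp ∷ʳ (0 , y)) ∷ʳ (1 , un b)) 0 α W D _ (proj₂ s))
    where
    s = S3-step I e
    word≡ : labels ((Wp ∷ʳ (0 , y)) ∷ʳ (1 , un b)) ++ passW 0 (labels W) ≡ labels Wp ++ 0 ∷ 1 ∷ passW 0 (labels W)
    word≡ = trans (labels-snoc-++ (Wp ∷ʳ (0 , y)) (1 , un b) _) (labels-snoc-++ Wp (0 , y) _)
  run R Wp (suc q) α ((.q , x) ∷ W) D U I | vmove down ns with event? q R
  ... | no ne = onward {R' = R} (proj₁ s) (cong (swT (labels (reverse R))) word≡)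
          (cong₂ (λ z v → swX (labels (reverse R)) z ++ passV v (labels W) ∷ labels D) word≡ (sym (proj₂ cross)))
          (run R (Wp ∷ʳ (suc q , x)) q α W D _ (proj₂ s))
    where
    s = south-step I ne
    cross : cl (suc q) q ≡ suc q × cr (suc q) q ≡ q
    cross rewrite adj-down q = refl , refl
    word≡ : labels (Wp ∷ʳ (suc q , x)) ++ passW q (labels W) ≡ labels Wp ++ passW (suc q) (q ∷ labels W)
    word≡ = trans (labels-snoc-++ Wp (suc q , x) _) (cong₂ (λ p r → labels Wp ++ p ∷ passW r (labels W)) (sym (proj₁ cross)) (sym (proj₂ cross)))
  run .((0 , α₀) ∷ R) Wp .1 α ((.0 , x) ∷ W) D U I | vmove down ns | yes (refl , α₀ , R , refl) =
    onward {R' = R} (proj₁ s) (trans (cong (swT (labels (reverse R))) word≡) (sym (swT-rev 0 α₀ R T₀)))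
      (trans (cong₂ (λ z t → swX (labels (reverse R)) z ++ t) word≡ tail≡) (sym (swX-rev 0 α₀ R T₀ _)))
      (run R (Wp ∷ʳ (0 , x)) 1 (pr a) W ((0 , α₀) ∷ D) _ (proj₂ s))
    where
    s = S4-step I
    farWp = pass-far 0 (labels Wp) (proj₁ (S4-far I))
    farW = pass-far 0 (labels W) (proj₂ (S4-far I))
    -- The word that `α₀` would meet if the current entry had crossed the 0 in the ordinary way.
    -- Crossing its letter 1 would send `α₀` on from diagonal 1, with the other entry ending on 0.
    -- After (S4) the two final diagonals are the same but the two entries have exchanged roles.
    T₀ = labels Wp ++ 1 ∷ passW 0 (labels W)
    word≡ : labels (Wp ∷ʳ (0 , x)) ++ passW 1 (labels W) ≡ passW 0 T₀
    word≡ = sym (trans (passW-++ 0 (labels Wp) (1 ∷ passW 0 (labels W)))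
      (trans (cong₂ (λ z v → z ++ passW v (1 ∷ passW 0 (labels W))) (proj₂ farWp) (proj₁ farWp))
        (trans (cong (λ z → labels Wp ++ 0 ∷ passW 1 z) (proj₂ farW)) (sym (labels-snoc-++ Wp (0 , x) _)))))
    tail≡ : passV 1 (labels W) ∷ 0 ∷ labels D ≡ passV 0 T₀ ∷ passV 0 (labels W) ∷ labels D
    tail≡ = cong₂ (λ u v → u ∷ v ∷ labels D)
      (sym (trans (passV-++ 0 (labels Wp) (1 ∷ passW 0 (labels W))) (trans (cong (λ v → passV v (1 ∷ passW 0 (labels W))) (proj₁ farWp))
        (cong (passV 1) (proj₂ farW))))) (sym (proj₁ farW))

next-other : ∀ {j} e B → value e ≡ j → All (λ f → value f ≢ j) B → nextDir e B ≡ none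
next-other e [] v ns = refl
next-other e (f ∷ B) v (n ∷ ns) = dir-diff e f (λ q → n (trans (sym q) v))

Coh-++⁻ : ∀ {ε s j} e W B → All (λ f → value f ≡ j) (e ∷ W) → All (λ f → value f ≢ j) B → Coh ε s (e ∷ W ++ B) →
          Coh ε s (e ∷ W) × Coh ε none B
Coh-++⁻ {ε} {s} e [] B (v ∷ []) ns (o , c) =
  (trans (cong (isPrimed (ε (value e)) s) (sym (next-other e B v ns))) o , tt) , subst (λ t → Coh ε t B) (next-other e B v ns) c
Coh-++⁻ e (f ∷ W) B (v ∷ vs) ns (o , c) with Coh-++⁻ f W B vs ns c
... | c₁ , c₂ = (o , c₁) , c₂

Coh-++⁺ : ∀ {ε s j} e W B → All (λ f → value f ≡ j) (e ∷ W) → All (λ f → value f ≢ j) B → Coh ε s (e ∷ W) → Coh ε none B →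
          Coh ε s (e ∷ W ++ B)
Coh-++⁺ {ε} {s} e [] B (v ∷ []) ns (o , _) c =
  trans (cong (isPrimed (ε (value e)) s) (next-other e B v ns)) o , subst (λ t → Coh ε t B) (sym (next-other e B v ns)) c
Coh-++⁺ e (f ∷ W) B (v ∷ vs) ns (o , c₁) c₂ = o , Coh-++⁺ f W B vs ns c₁ c₂

Coh-split : ∀ {ε j} W B → All (λ f → value f ≡ j) W → All (λ f → value f ≢ j) B → Coh ε none (W ++ B) →
            Coh ε none W × Coh ε none B
Coh-split [] B vs ns c = tt , c
Coh-split (e ∷ W) B vs ns c = Coh-++⁻ e W B vs ns c

Coh-join : ∀ {ε j} W B → All (λ f → value f ≡ j) W → All (λ f → value f ≢ j) B → Coh ε none W → Coh ε none B →
           Coh ε none (W ++ B)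
Coh-join [] B vs ns c c' = c'
Coh-join (e ∷ W) B vs ns c c' = Coh-++⁺ e W B vs ns c c'

map-value : ∀ {j} {W W' : List Entry} → All (λ f → value f ≡ j) W → All (λ f → value f ≡ j) W' → length W' ≡ length W → map value W' ≡ map value W
map-value [] [] e = refl
map-value (v ∷ vs) (w ∷ ws) e = cong₂ _∷_ (trans w (sym v)) (map-value vs ws (suc-injective e))

length-labels : ∀ (L : List Entry) → length (labels L) ≡ length L
length-labels L = length-map proj₁ L

split-value : ∀ j (R : List Entry) → Sorted R → All (λ f → j ℤ.≤ value f) R →
              ∃ λ W → ∃ λ B → R ≡ W ++ B × All (λ f → value f ≡ j) W × All (λ f → j ℤ.< value f) B
split-value j [] _ _ = [] , [] , refl , [] , []
split-value j (e ∷ R) (le ∷ s) (p ∷ ps) with value e ℤP.≟ j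
... | yes v with split-value j R s ps
...   | W , B , refl , vs , ns = e ∷ W , B , refl , v ∷ vs , ns
split-value j (e ∷ R) (le ∷ s) (p ∷ ps) | no n =
  [] , e ∷ R , refl , [] , lt ∷ All.map (λ q → ℤP.<-≤-trans lt q) le
  where lt = ℤP.≤∧≢⇒< p (n ∘ sym)

module _ (a : ℤ) (δ : Bool) (ε : ℤ → Bool) where

  record Switched (A P R B : List Entry) (Proc : LFill → LFill → Set) (U : LFill) : Set where
    constructor switched
    field
      V     : LFill
      R' P' : List Entry
      proc  : Proc U V
      keyed : Keyed V
      repr  : Repr (qlab A ++ qlab R' ++ plab P' ++ qlab B) V
      labR  : labels R' ≡ swT (labels P) (labels R)
      labP  : labels P' ≡ swX (labels P) (labels R)
      cohR  : Coh ε none R'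
      valR  : map value R' ≡ map value R
      cohP  : Coh (λ _ → δ) none P'
      valP  : All (λ f → value f ≡ a) P'

  -- The run starts with the last entry of the block and works backwards; except in (S4), an entry
  -- passes all of `W` before the one ahead of it starts.
  block : ∀ b A e P W B U → Repr (qlab A ++ plab (e ∷ P) ++ qlab W ++ qlab B) U → Keyed U →
    Legal empty (labels A ++ labels (e ∷ P) ++ labels W ++ labels B) →
    Coh (λ _ → δ) none (e ∷ P) → All (λ f → value f ≡ a) (e ∷ P) → Coh ε none W → All (λ f → value f ≡ b) W →
    All (λ f → value f ≢ b) B → Switched A (e ∷ P) W B (SwitchProc a b) U
  block b A e P W B U rp K lg cP vP cW vW nB with Moving-init [] e P (labels W) vP refl cP
  ... | R , (c , α) , eq , M = wrap (run R [] c α W [] U inv)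
    where
    m₀ : State
    m₀ = adv empty (labels A)
    lgP : Legal m₀ (labels (e ∷ P) ++ labels W ++ labels B)
    lgP = proj₂ (Legal-++ empty (labels A) lg)
    PL : Placed m₀ (e ∷ P)
    PL = placed (e ∷ P) (Shape-adv (labels A) Shape-empty (proj₁ (Legal-++ empty (labels A) lg)))
           (proj₁ (Legal-++ m₀ (labels (e ∷ P)) lgP)) cP vP
    open Block a b δ ε A B (e ∷ P) hiding (m₀)
    open Run a b δ ε A B (e ∷ P) nB PL renaming (Run to RunT)
    vRev : All (λ f → value f ≡ a) (reverse R ++ [ c , α ])
    vRev = subst (All (λ f → value f ≡ a)) eq vP
    full≡ : qlab A ++ plab (e ∷ P) ++ qlab W ++ qlab B ≡ full R [] c α W []
    full≡ = trans (cong (λ z → qlab A ++ z ++ qlab W ++ qlab B) (trans (cong plab eq) (map-++ _ (reverse R) [ c , α ])))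
      (trans (cong (qlab A ++_) (++-assoc (plab (reverse R)) _ _))
        (trans (cong (λ z → qlab A ++ (z ++ (c , (α , Pl)) ∷ qlab W ++ qlab B)) (sym (++-identityʳ (plab (reverse R))))) (sym (++-assoc (qlab A) _ _))))
    labelsP : ∀ Y → labels (e ∷ P) ++ Y ≡ labels (reverse R) ++ c ∷ Y
    labelsP Y = trans (cong (λ z → labels z ++ Y) eq) (labels-snoc-++ (reverse R) (c , α) Y)
    sel : Sel R α (rowC R [] c) (rowC R [] c + c)
    sel X l y Y e' = subst (λ r → (primed α ≡ false → primed y ≡ false → rowOf m₀ X l + l < r + c) ×
                                (primed α ≡ true → primed y ≡ true × rowOf m₀ X l < r)) row≡
        (go (PL X (l , y) Y (c , α) [] (trans eq (trans (cong (_++ [ c , α ]) e') (++-assoc X ((l , y) ∷ Y) _)))))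
      where
      r₁ = rowOf m₀ (X ++ (l , y) ∷ Y) c
      row≡ : r₁ ≡ rowC R [] c
      row≡ = trans (cong (λ L → rowOf m₀ L c) (sym e')) (cong suc (cong (λ g → g c) (sym (adv-pre R []))))
      go : (l < c × primed α ≡ false × rowOf m₀ X l + l < r₁ + c) ⊎ (c < l × primed y ≡ true × rowOf m₀ X l < r₁) →
           (primed α ≡ false → primed y ≡ false → rowOf m₀ X l + l < r₁ + c) × (primed α ≡ true → primed y ≡ true × rowOf m₀ X l < r₁)
      go (inj₁ (_ , t , lt)) = (λ _ _ → lt) , λ t' → contradiction (trans (sym t') t) λ ()
      go (inj₂ (_ , t , lt)) = (λ _ f → contradiction (trans (sym t) f) λ ()) , λ _ → t , lt
    inv : Inv R [] c α W [] U
    inv = record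
      { repr  = subst (λ L → Repr L U) full≡ rp
      ; keyed = K
      ; legal = subst (Legal empty) (cong (labels A ++_) (labelsP _)) lg
      ; coh   = cW
      ; valW  = vW
      ; valR  = All.tabulate (λ q → All.lookup (AllP.++⁻ˡ (reverse R) vRev) (AnyP.reverse⁺ q))
      ; valα  = All.head (AllP.++⁻ʳ (reverse R) vRev)
      ; valD  = []
      ; mov   = M
      ; sel   = sel
      ; orig  = [ c , α ] , eq
      }
    wrap : RunT R [] c W [] U → Switched A (e ∷ P) W B (SwitchProc a b) U
    wrap (ran V W' P' p k r lw lp cw vw cp vp) = switched V W' P' p k r
      (trans lw (sym T≡)) (trans lp (sym X≡)) cw (map-value vW vw len) cp vp
      where
      lab≡ : labels (e ∷ P) ≡ labels (reverse ((c , α) ∷ R))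
      lab≡ = cong labels (trans eq (sym (unfold-reverse (c , α) R)))
      T≡ : swT (labels (e ∷ P)) (labels W) ≡ swT (labels (reverse R)) (passW c (labels W))
      T≡ = trans (cong (λ z → swT z (labels W)) lab≡) (swT-rev c α R (labels W))
      X≡ : swX (labels (e ∷ P)) (labels W) ≡ swX (labels (reverse R)) (passW c (labels W)) ++ passV c (labels W) ∷ []
      X≡ = trans (sym (++-identityʳ _)) (trans (cong (λ z → swX z (labels W) ++ []) lab≡) (swX-rev c α R (labels W) []))
      len : length W' ≡ length W
      len = trans (sym (length-labels W')) (trans (cong length (trans lw (sym T≡)))
        (trans (length-swT (labels (e ∷ P)) (labels W)) (length-labels W)))

  -- A block that has passed the letters `j` leaves them as a part of `A` and meets the next larger
  -- ones. `swT-++ʳ` and `swX-++ʳ` assemble these rounds into one switch with the whole of `R`.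
  inner : ∀ js A P R U → Repr (qlab A ++ plab P ++ qlab R) U → Keyed U → P ≢ [] →
    Legal empty (labels A ++ labels P ++ labels R) →
    Coh (λ _ → δ) none P → All (λ f → value f ≡ a) P → Coh ε none R → Sorted R →
    AllPairs ℤ._<_ js → All (λ f → value f ∈ js) R → Switched A P R [] (InnerLoop a js) U
  inner js A [] R U rp K ne = contradiction refl ne
  inner [] A (e ∷ P) [] U rp K ne lg cP vP cR oR aj mj = switched U [] (e ∷ P) finished K
    rp refl refl tt refl cP vP
  inner [] A (e ∷ P) (f ∷ R) U rp K ne lg cP vP cR oR aj (() ∷ mj)
  inner (j ∷ js) A (e ∷ P) R U rp K ne lg cP vP cR oR (lj ∷ aj) mj
    with split-value j R oR (All.map (λ { (here refl) → ℤP.≤-refl ; (there q) → ℤP.<⇒≤ (All.lookup lj q) }) mj)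
  ... | W , B , refl , vW , gB = combine (block j A e P W B U
          (subst (λ L → Repr L U) (cong (λ z → qlab A ++ plab (e ∷ P) ++ z) (map-++ _ W B)) rp) K
          (subst (Legal empty) (cong (λ z → labels A ++ labels (e ∷ P) ++ z) (labels-++ W B)) lg)
          cP vP (proj₁ cohs) vW nB)
    where
    nB : All (λ f → value f ≢ j) B
    nB = All.map (λ lt q → ℤP.<-irrefl (sym q) lt) gB
    cohs = Coh-split W B vW nB cR
    inTail : All (λ f → value f ∈ js) B
    inTail = All.zipWith (λ { (n , here q) → contradiction q n ; (n , there q) → q }) (nB , AllP.++⁻ʳ W mj)
    legalW : Legal empty (labels A ++ (labels (e ∷ P) ++ labels W) ++ labels B)
    legalW = subst (Legal empty) (cong (labels A ++_) (trans (cong (labels (e ∷ P) ++_) (labels-++ W B)) (sym (++-assoc (labels (e ∷ P)) (labels W) (labels B))))) lg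
    combine : Switched A (e ∷ P) W B (SwitchProc a j) U → Switched A (e ∷ P) (W ++ B) [] (InnerLoop a (j ∷ js)) U
    combine (switched V W' P' p k r lw lp cw vw cp vp) =
      conclude (inner js (A ++ W') P' B V (subst (λ L → Repr L V) repr≡ r) k P'≢[] legal' cp vp (proj₂ cohs) (Sorted-suffix W oR) aj inTail)
      where
      repr≡ : qlab A ++ qlab W' ++ plab P' ++ qlab B ≡ qlab (A ++ W') ++ plab P' ++ qlab B
      repr≡ = trans (sym (++-assoc (qlab A) (qlab W') _)) (cong (_++ plab P' ++ qlab B) (sym (map-++ _ A W')))
      P'≢[] : P' ≢ []
      P'≢[] refl with trans (cong length lp) (length-swX (labels (e ∷ P)) (labels W))
      ... | ()
      legal' : Legal empty (labels (A ++ W') ++ labels P' ++ labels B)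
      legal' = subst (Legal empty) (trans (cong (labels A ++_) (trans (cong (_++ labels B) (cong₂ _++_ (sym lw) (sym lp))) (++-assoc (labels W') (labels P') _)))
          (trans (sym (++-assoc (labels A) (labels W') _)) (cong (_++ labels P' ++ labels B) (sym (labels-++ A W')))))
        (~-Legal (~++ˡ (labels A) (~++ʳ (labels B) (sw-~ (labels (e ∷ P)) (labels W)))) {empty} legalW)
      conclude : Switched (A ++ W') P' B [] (InnerLoop a js) V → Switched A (e ∷ P) (W ++ B) [] (InnerLoop a (j ∷ js)) U
      conclude (switched V' R' P'' p' k' r' lr lp' cr vr cp' vp') = switched V' (W' ++ R') P'' (andThen p p') k'
        (subst (λ L → Repr L V') repr'≡ r')
        (trans (labels-++ W' R') (trans (cong₂ _++_ lw (trans lr (cong (λ z → swT z (labels B)) lp)))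
          (trans (sym (swT-++ʳ (labels (e ∷ P)) (labels W) (labels B))) (cong (swT (labels (e ∷ P))) (sym (labels-++ W B))))))
        (trans lp' (trans (cong (λ z → swX z (labels B)) lp) (trans (sym (swX-++ʳ (labels (e ∷ P)) (labels W) (labels B)))
          (cong (swX (labels (e ∷ P))) (sym (labels-++ W B))))))
        (Coh-join W' R' (values-of W' W vw vW) (values-≢ R' B vr nB) cw cr)
        (trans (map-++ value W' R') (trans (cong₂ _++_ vw vr) (sym (map-++ value W B)))) cp' vp'
        where
        repr'≡ : qlab (A ++ W') ++ qlab R' ++ plab P'' ++ [] ≡ qlab A ++ qlab (W' ++ R') ++ plab P'' ++ []
        repr'≡ = trans (cong (_++ qlab R' ++ plab P'' ++ []) (map-++ _ A W')) (trans (++-assoc (qlab A) (qlab W') _)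
          (cong (qlab A ++_) (trans (sym (++-assoc (qlab W') (qlab R') _)) (cong (_++ plab P'' ++ []) (sym (map-++ _ W' R'))))))
        values-of : ∀ (X Y : List Entry) → map value X ≡ map value Y → All (λ f → value f ≡ j) Y → All (λ f → value f ≡ j) X
        values-of [] [] e vs = []
        values-of (x ∷ X) (y ∷ Y) e (v ∷ vs) = trans (proj₁ (split e)) v ∷ values-of X Y (proj₂ (split e)) vs
          where
          split : ∀ {x y : ℤ} {u v : List ℤ} → x ∷ u ≡ y ∷ v → x ≡ y × u ≡ v
          split refl = refl , refl
        values-≢ : ∀ (X Y : List Entry) → map value X ≡ map value Y → All (λ f → value f ≢ j) Y → All (λ f → value f ≢ j) X
        values-≢ [] [] e vs = []
        values-≢ (x ∷ X) (y ∷ Y) e (v ∷ vs) = (λ q → v (trans (sym (proj₁ (split e))) q)) ∷ values-≢ X Y (proj₂ (split e)) vs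
          where
          split : ∀ {x y : ℤ} {u v : List ℤ} → x ∷ u ≡ y ∷ v → x ≡ y × u ≡ v
          split refl = refl , refl

-- Evacuation

at-++ : ∀ {A : Set} (X Y : Fill A) i j → at (X ++ Y) i j ≡ (at X i j <∣> at Y i j)
at-++ [] Y i j = refl
at-++ (((a , b) , x) ∷ X) Y i j with hit a b i j
... | true = refl
... | false = at-++ X Y i j

cells-++ : ∀ {A : Set} m (X Y : Code A) → cells m (X ++ Y) ≡ cells m X ++ cells (adv m (labels X)) Y
cells-++ m [] Y = refl
cells-++ m ((k , x) ∷ X) Y = cong (_ ∷_) (cells-++ (bump k m) X Y)

cells-cong : ∀ {A : Set} {m m' : State} → m ≗ m' → ∀ (L : Code A) → cells m L ≡ cells m' L
cells-cong e [] = refl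
cells-cong e ((k , x) ∷ L) = cong₂ _∷_ (cong (λ z → (suc z , suc z + k) , x) (e k)) (cells-cong (bump-cong k e) L)

at-cells-++ : ∀ {A : Set} m (X Y : Code A) i j →
  at (cells m (X ++ Y)) i j ≡ (at (cells m X) i j <∣> at (cells (adv m (labels X)) Y) i j)
at-cells-++ m X Y i j = trans (cong (λ T → at T i j) (cells-++ m X Y)) (at-++ (cells m X) _ i j)

at-cells-map : ∀ {A B : Set} (h : A → B) m (L : Code A) i j →
  at (cells m (map (λ e → proj₁ e , h (proj₂ e)) L)) i j ≡ Maybe.map h (at (cells m L) i j)
at-cells-map h m [] i j = refl
at-cells-map h m ((k , x) ∷ L) i j with hit (suc (m k)) (suc (m k) + k) i j
... | true = refl
... | false = at-cells-map h (bump k m) L i j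

∈-cells : ∀ {A : Set} m (L : Code A) {c x} → (c , x) ∈ cells m L → ∃ λ k → (k , x) ∈ L
∈-cells m ((k , x) ∷ L) (here refl) = k , here refl
∈-cells m ((k , x) ∷ L) (there q) with ∈-cells (bump k m) L q
... | l , r = l , there r

∈-at : ∀ {A : Set} (T : Fill A) {i j x} → ((i , j) , x) ∈ T → at T i j ≢ nothing
∈-at (((i , j) , x) ∷ T) (here refl) e rewrite hit-refl i j with e
... | ()
∈-at (((a , b) , x) ∷ T) {i} {j} (there q) e with hit a b i j
∈-at (((a , b) , x) ∷ T) {i} {j} (there q) () | true
... | false = ∈-at T q e

-- Fillings are lists whose order changes under filtering, splitting and sorting. This relation
-- disregards the order and still determines every lookup once the source lists no box twice.
record Image {A B : Set} (g : Box → A → Maybe B) (S : Fill A) (T : Fill B) : Set where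
  field
    from : ∀ {c y} → (c , y) ∈ T → ∃ λ x → (c , x) ∈ S × g c x ≡ just y
    to   : ∀ {c x y} → (c , x) ∈ S → g c x ≡ just y → (c , y) ∈ T

module _ {A B : Set} {g : Box → A → Maybe B} {S : Fill A} {T : Fill B} (K : Keyed S) (I : Image g S T) where
  open Image I

  at-image : ∀ i j → at T i j ≡ (at S i j >>= g (i , j))
  at-image i j = go (at T i j) (at S i j) refl refl
    where
    go : ∀ t s → at T i j ≡ t → at S i j ≡ s → t ≡ (s >>= g (i , j))
    go (just y) s et es with from (at-∈ T i j et)
    ... | x , p , q = trans (sym q) (cong (_>>= g (i , j)) (trans (sym (K p)) es))
    go nothing nothing et es = refl
    go nothing (just x) et es with g (i , j) x in q
    ... | nothing = refl
    ... | just y = contradiction et (∈-at T (to (at-∈ S i j es) q))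

  Keyed-image : Keyed T
  Keyed-image {c} q with from q
  ... | x , p , e = trans (at-image (proj₁ c) (proj₂ c)) (trans (cong (_>>= g c) (K p)) e)

∈-filterᵇ⁻ : ∀ {A : Set} (p : A → Bool) L {x} → x ∈ filterᵇ p L → x ∈ L × p x ≡ true
∈-filterᵇ⁻ p (y ∷ L) q with p y in e
∈-filterᵇ⁻ p (y ∷ L) (here refl) | true = here refl , e
∈-filterᵇ⁻ p (y ∷ L) (there q) | true with ∈-filterᵇ⁻ p L q
... | r , s = there r , s
∈-filterᵇ⁻ p (y ∷ L) q | false with ∈-filterᵇ⁻ p L q
... | r , s = there r , s

∈-filterᵇ⁺ : ∀ {A : Set} (p : A → Bool) L {x} → x ∈ L → p x ≡ true → x ∈ filterᵇ p L
∈-filterᵇ⁺ p (y ∷ L) (here refl) e rewrite e = here refl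
∈-filterᵇ⁺ p (y ∷ L) (there q) e with p y
... | true = there (∈-filterᵇ⁺ p L q e)
... | false = ∈-filterᵇ⁺ p L q e

IsMin : Cells → ℤ → Set
IsMin S a = (∃ λ c → ∃ λ x → (c , x) ∈ S × val x ≡ a) × (∀ {c x} → (c , x) ∈ S → a ℤ.≤ val x)

IsMax : Cells → ℤ → Set
IsMax S a = (∃ λ c → ∃ λ x → (c , x) ∈ S × val x ≡ a) × (∀ {c x} → (c , x) ∈ S → val x ℤ.≤ a)

minC-[] : ∀ T → minC T ≡ nothing → T ≡ []
minC-[] [] e = refl
minC-[] (c ∷ T) e with minC T
minC-[] (c ∷ T) () | nothing
minC-[] (c ∷ T) () | just _

maxC-[] : ∀ T → maxC T ≡ nothing → T ≡ []
maxC-[] [] e = refl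
maxC-[] (c ∷ T) e with maxC T
maxC-[] (c ∷ T) () | nothing
maxC-[] (c ∷ T) () | just _

minC-spec : ∀ T {a} → minC T ≡ just a → IsMin T a
minC-spec ((c , x) ∷ T) e with minC T in q
minC-spec ((c , x) ∷ T) refl | nothing with minC-[] T q
... | refl = (c , x , here refl , refl) , λ { (here refl) → ℤP.≤-refl }
minC-spec ((c , x) ∷ T) refl | just m with minC-spec T q
... | (d , y , p , v) , le = wit (ℤP.⊓-sel (val x) m) , λ { (here refl) → ℤP.i⊓j≤i (val x) m ; (there r) → ℤP.≤-trans (ℤP.i⊓j≤j (val x) m) (le r) }
  where
  wit : (val x ℤ.⊓ m ≡ val x) ⊎ (val x ℤ.⊓ m ≡ m) → ∃ λ c' → ∃ λ y' → (c' , y') ∈ (c , x) ∷ T × val y' ≡ val x ℤ.⊓ m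
  wit (inj₁ s) = c , x , here refl , sym s
  wit (inj₂ s) = d , y , there p , trans v (sym s)

maxC-spec : ∀ T {a} → maxC T ≡ just a → IsMax T a
maxC-spec ((c , x) ∷ T) e with maxC T in q
maxC-spec ((c , x) ∷ T) refl | nothing with maxC-[] T q
... | refl = (c , x , here refl , refl) , λ { (here refl) → ℤP.≤-refl }
maxC-spec ((c , x) ∷ T) refl | just m with maxC-spec T q
... | (d , y , p , v) , le = wit (ℤP.⊔-sel (val x) m) , λ { (here refl) → ℤP.i≤i⊔j (val x) m ; (there r) → ℤP.≤-trans (le r) (ℤP.i≤j⊔i (val x) m) }
  where
  wit : (val x ℤ.⊔ m ≡ val x) ⊎ (val x ℤ.⊔ m ≡ m) → ∃ λ c' → ∃ λ y' → (c' , y') ∈ (c , x) ∷ T × val y' ≡ val x ℤ.⊔ m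
  wit (inj₁ s) = c , x , here refl , sym s
  wit (inj₂ s) = d , y , there p , trans v (sym s)

insertℤ-∈ : ∀ x L → x ∈ insertℤ x L × (∀ {y} → y ∈ L → y ∈ insertℤ x L)
insertℤ-∈ x [] = here refl , λ ()
insertℤ-∈ x (y ∷ L) with x ℤP.≟ y
... | yes refl = here refl , id
... | no _ with x ℤP.<? y
...   | yes _ = here refl , there
...   | no _ with insertℤ-∈ x L
...     | p , q = there p , λ { (here refl) → here refl ; (there r) → there (q r) }

insertℤ-All : ∀ {P : ℤ → Set} x L → P x → All P L → All P (insertℤ x L)
insertℤ-All x [] px [] = px ∷ []
insertℤ-All x (y ∷ L) px (py ∷ ps) with x ℤP.≟ y
... | yes _ = py ∷ ps
... | no _ with x ℤP.<? y
...   | yes _ = px ∷ py ∷ ps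
...   | no _ = py ∷ insertℤ-All x L px ps

insertℤ-asc : ∀ x L → AllPairs ℤ._<_ L → AllPairs ℤ._<_ (insertℤ x L)
insertℤ-asc x [] [] = [] ∷ []
insertℤ-asc x (y ∷ L) (ps ∷ s) with x ℤP.≟ y
... | yes _ = ps ∷ s
... | no n with x ℤP.<? y
...   | yes lt = (lt ∷ All.map (ℤP.<-trans lt) ps) ∷ ps ∷ s
...   | no nl = insertℤ-All x L (ℤP.≤∧≢⇒< (ℤP.≮⇒≥ nl) (n ∘ sym)) ps ∷ insertℤ-asc x L s

lettersAsc-asc : ∀ T → AllPairs ℤ._<_ (lettersAsc T)
lettersAsc-asc [] = []
lettersAsc-asc (c ∷ T) = insertℤ-asc (val (proj₂ c)) (lettersAsc T) (lettersAsc-asc T)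

lettersAsc-∈ : ∀ T {c x} → (c , x) ∈ T → val x ∈ lettersAsc T
lettersAsc-∈ (d ∷ T) (here refl) = proj₁ (insertℤ-∈ _ (lettersAsc T))
lettersAsc-∈ (d ∷ T) (there q) = proj₂ (insertℤ-∈ _ (lettersAsc T)) (lettersAsc-∈ T q)

lettersAsc-const : ∀ a T → T ≢ [] → (∀ {c x} → (c , x) ∈ T → val x ≡ a) → lettersAsc T ≡ [ a ]
lettersAsc-const a [] ne h = contradiction refl ne
lettersAsc-const a ((c , x) ∷ []) ne h = cong [_] (h (here refl))
lettersAsc-const a ((c , x) ∷ d ∷ T) ne h
  rewrite lettersAsc-const a (d ∷ T) (λ ()) (λ q → h (there q)) | h (here refl) | ==ℤ-refl a = refl

negLetter : ℤ → Box → Letter → Letter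
negLetter a (i , j) x = if (i ≡ᵇ 1) ∧ (j ≡ᵇ 1) then star x else un (ℤ.- a)

val-star : ∀ x → val (star x) ≡ ℤ.- val x
val-star (un k) = refl
val-star (pr k) = refl

val-negLetter : ∀ a c x → val x ≡ a → val (negLetter a c x) ≡ ℤ.- a
val-negLetter a (i , j) x v with (i ≡ᵇ 1) ∧ (j ≡ᵇ 1)
... | true = trans (val-star x) (cong ℤ.-_ v)
... | false = refl

part-∈⁻ : ∀ a S {c x} → (c , x) ∈ part a S → (c , x) ∈ S × val x ≡ a
part-∈⁻ a S q with ∈-filterᵇ⁻ _ S q
... | r , e = r , ==ℤ-true e

negPart-∈⁻ : ∀ a S {c y} → (c , y) ∈ negPart a S → ∃ λ x → (c , x) ∈ S × val x ≡ a × y ≡ negLetter a c x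
negPart-∈⁻ a S q with MP.∈-map⁻ _ q
... | ((i , j) , x) , r , refl with part-∈⁻ a S r
...   | r' , v = x , r' , v , refl

negPart-∈⁺ : ∀ a S {c x} → (c , x) ∈ S → val x ≡ a → (c , negLetter a c x) ∈ negPart a S
negPart-∈⁺ a S {i , j} {x} q v = MP.∈-map⁺ _ (∈-filterᵇ⁺ _ S q (trans (cong (_==ℤ a) v) (==ℤ-refl a)))

negPart-image : ∀ a S → (∀ {c x} → (c , x) ∈ S → val x ≡ a) → Image (λ c x → just (negLetter a c x)) S (negPart a S)
negPart-image a S h = record
  { from = λ q → let x , r , v , e = negPart-∈⁻ a S q in x , r , cong just (sym e)
  ; to = λ { q refl → negPart-∈⁺ a S q (h q) } }

pieceLetter : ℤ → Box → Letter → Labelled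
pieceLetter a c x = if val x ==ℤ a then (negLetter a c x , Pl) else (x , Ql)

pieces : ℤ → ℤ → Cells → LFill
pieces a m S = labelWith Pl (negPart a S) ++ labelWith Ql (upperPart a m S)

module _ (a m : ℤ) (S : Cells) (bound : ∀ {c x} → (c , x) ∈ S → a ℤ.≤ val x × val x ℤ.≤ m) where

  upper-∈⁺ : ∀ {c x} → (c , x) ∈ S → val x ≢ a → (c , x) ∈ upperPart a m S
  upper-∈⁺ {c} {x} q n = ∈-filterᵇ⁺ _ S q (both (raised (proj₁ (bound q))) (proj₂ (bound q)))
    where
    raised : a ℤ.≤ val x → a ℤ.+ ℤ.1ℤ ℤ.≤ val x
    raised le = subst (ℤ._≤ val x) (ℤP.+-comm ℤ.1ℤ a) (ℤP.i<j⇒suc[i]≤j (ℤP.≤∧≢⇒< le (n ∘ sym)))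
    ≤ᵇ-true : ∀ {i j} → i ℤ.≤ j → (i ℤ.≤ᵇ j) ≡ true
    ≤ᵇ-true {i} {j} le with i ℤ.≤ᵇ j | ℤP.≤⇒≤ᵇ le
    ... | true | _ = refl
    both : a ℤ.+ ℤ.1ℤ ℤ.≤ val x → val x ℤ.≤ m → ((a ℤ.+ ℤ.1ℤ) ℤ.≤ᵇ val x) ∧ (val x ℤ.≤ᵇ m) ≡ true
    both p q rewrite ≤ᵇ-true p | ≤ᵇ-true q = refl

  upper-∈⁻ : ∀ {c x} → (c , x) ∈ upperPart a m S → (c , x) ∈ S × val x ≢ a
  upper-∈⁻ {c} {x} q with ∈-filterᵇ⁻ _ S q
  ... | r , e = r , λ v → absurd (trans (sym e) (cong (λ z → ((a ℤ.+ ℤ.1ℤ) ℤ.≤ᵇ z) ∧ (z ℤ.≤ᵇ m)) v))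
    where
    absurd : true ≢ ((a ℤ.+ ℤ.1ℤ) ℤ.≤ᵇ a) ∧ (a ℤ.≤ᵇ m)
    absurd t with (a ℤ.+ ℤ.1ℤ) ℤ.≤ᵇ a in w
    ... | true = ℤP.<-irrefl refl (ℤP.suc[i]≤j⇒i<j (subst (ℤ._≤ a) (ℤP.+-comm a ℤ.1ℤ) (ℤP.≤ᵇ⇒≤ (subst T (sym w) tt))))
    absurd () | false

  pieceLetter-≡ : ∀ c x → val x ≡ a → pieceLetter a c x ≡ (negLetter a c x , Pl)
  pieceLetter-≡ c x v rewrite v | ==ℤ-refl a = refl

  pieceLetter-≢ : ∀ c x → val x ≢ a → pieceLetter a c x ≡ (x , Ql)
  pieceLetter-≢ c x n rewrite ==ℤ-false n = refl

  pieces-image : Image (λ c x → just (pieceLetter a c x)) S (pieces a m S)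
  pieces-image = record { from = from ; to = to }
    where
    from : ∀ {c y} → (c , y) ∈ pieces a m S → ∃ λ x → (c , x) ∈ S × just (pieceLetter a c x) ≡ just y
    from {c} q with MP.∈-++⁻ (labelWith Pl (negPart a S)) q
    ... | inj₁ r with MP.∈-map⁻ _ r
    ...   | _ , r' , refl with negPart-∈⁻ a S r'
    ...     | x , s , v , refl = x , s , cong just (pieceLetter-≡ c x v)
    from {c} q | inj₂ r with MP.∈-map⁻ _ r
    ...   | (_ , x) , r' , refl with upper-∈⁻ r'
    ...     | s , n = x , s , cong just (pieceLetter-≢ c x n)
    to : ∀ {c x y} → (c , x) ∈ S → just (pieceLetter a c x) ≡ just y → (c , y) ∈ pieces a m S
    to {c} {x} q refl with val x ℤP.≟ a
    ... | yes v = MP.∈-++⁺ˡ (MP.∈-map⁺ _ (negPart-∈⁺ a S q v))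
    ... | no n = MP.∈-++⁺ʳ (labelWith Pl (negPart a S)) (MP.∈-map⁺ _ (upper-∈⁺ q n))

onlyP onlyQ : Labelled → Maybe Letter
onlyP (x , Pl) = just x
onlyP (x , Ql) = nothing
onlyQ (x , Pl) = nothing
onlyQ (x , Ql) = just x

extract-P : ∀ V → Image (λ _ → onlyP) V (extract Pl V)
extract-P V = record { from = λ q → from (mapMaybe-∈⁻ _ V q) ; to = λ { q e → mapMaybe-∈⁺ _ V q (to _ e) } }
  where
  from : ∀ {c y} → (∃ λ z → z ∈ V × (if isP (proj₂ (proj₂ z)) xor isP Pl then nothing else just (proj₁ z , proj₁ (proj₂ z))) ≡ just (c , y)) →
         ∃ λ x → (c , x) ∈ V × onlyP x ≡ just y
  from ((c , x , Pl) , r , refl) = (x , Pl) , r , refl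
  to : ∀ {c : Box} x {y} → onlyP x ≡ just y → (if isP (proj₂ x) xor isP Pl then nothing else just (c , proj₁ x)) ≡ just (c , y)
  to (x , Pl) refl = refl

extract-Q : ∀ V → Image (λ _ → onlyQ) V (extract Ql V)
extract-Q V = record { from = λ q → from (mapMaybe-∈⁻ _ V q) ; to = λ { q e → mapMaybe-∈⁺ _ V q (to _ e) } }
  where
  from : ∀ {c y} → (∃ λ z → z ∈ V × (if isP (proj₂ (proj₂ z)) xor isP Ql then nothing else just (proj₁ z , proj₁ (proj₂ z))) ≡ just (c , y)) →
         ∃ λ x → (c , x) ∈ V × onlyQ x ≡ just y
  from ((c , x , Ql) , r , refl) = (x , Ql) , r , refl
  to : ∀ {c : Box} x {y} → onlyQ x ≡ just y → (if isP (proj₂ x) xor isP Ql then nothing else just (c , proj₁ x)) ≡ just (c , y)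
  to (x , Ql) refl = refl

record Coded (ε : ℤ → Bool) (L : List Entry) (S : Cells) : Set where
  constructor coded
  field
    keyed  : Keyed S
    repr   : ∀ i j → at S i j ≡ at (cells empty L) i j
    legal  : Legal empty (labels L)
    coh    : Coh ε none L
    sorted : Sorted L

  code⇒ : ∀ {e} → e ∈ L → ∃ λ c → (c , proj₂ e) ∈ S
  code⇒ {k , x} q with MP.∈-∃++ q
  ... | X , Y , refl = _ , at-∈ S _ _ (trans (repr _ _) (at-own empty X k x Y))

  code⇐ : ∀ {c x} → (c , x) ∈ S → ∃ λ k → (k , x) ∈ L
  code⇐ {i , j} q = ∈-cells empty L (at-∈ (cells empty L) i j (trans (sym (repr i j)) (keyed q)))

-- The hypothesis on `m` describes a single row of `suc j` boxes. A block that starts on the main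
-- diagonal can only ascend, so every next box is farther east; beyond the end of the only row there
-- is just one place for it.
row-block : ∀ {ε s} j m x P → (∀ i → m i ≡ (if i <ᵇ suc j then 1 else 0)) → Legal m (labels P) →
            Coh ε s ((j , x) ∷ P) → All (λ f → value f ≡ val x) P → s ≡ asc ⊎ j ≡ 0 → labels P ≡ range (suc j) (length P)
row-block j m x [] me lg c vs h = refl
row-block {ε} {s} j m x ((l , y) ∷ P) me (st , lg) c@(o , c') (v ∷ vs) h = go (dir-view c v) h
  where
  go : Dir-view (j , x) (l , y) → s ≡ asc ⊎ j ≡ 0 → l ∷ labels P ≡ range (suc j) (suc (length P))
  go (isDesc lt _) (inj₂ refl) = contradiction lt λ ()
  go (isDesc lt d) (inj₁ refl) = contradiction d (proj₁ (proj₂ (incoming-asc (ε (val x)) (dir (j , x) (l , y)) o)))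
  go (isAsc lt d) _ = next l lt st refl
    where
    next : ∀ l' → j < l' → Step m l' → l ≡ l' → l ∷ labels P ≡ range (suc j) (suc (length P))
    next (suc l') (s≤s le) (_ , w) refl = cong₂ _∷_ (cong suc l'≡j)
      (row-block (suc j) (bump l m) y P me' (subst (λ z → Legal z (labels P)) refl lg) (subst (λ k → Coh ε asc ((k , y) ∷ P)) (cong suc l'≡j) (subst (λ t → Coh ε t ((l , y) ∷ P)) d c'))
        (All.map (λ q → trans q (sym v)) vs) (inj₁ refl))
      where
      zero≡ : m (suc l') ≡ 0
      zero≡ = trans (me (suc l')) (cong (if_then 1 else 0) (≤⇒<ᵇ-false (s≤s le)))
      inRow : (l' <ᵇ suc j) ≡ true
      inRow with l' <ᵇ suc j | me l'
      ... | true | _ = refl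
      ... | false | e = contradiction (trans (sym e) (trans w (cong suc zero≡))) λ ()
      l'≡j : l' ≡ j
      l'≡j = ≤-antisym (≤-pred (<ᵇ-true inRow)) le
      me' : ∀ i → bump (suc l') m i ≡ (if i <ᵇ suc (suc j) then 1 else 0)
      me' i with l' ≟ j
      ... | no n = contradiction l'≡j n
      ... | yes refl with <-cmp i (suc j)
      ...   | tri< lt' _ _ = trans (bump-diff (suc j) i m (>⇒≢ lt')) (trans (me i)
              (trans (cong (if_then 1 else 0) (<⇒<ᵇ-true lt')) (cong (if_then 1 else 0) (sym (<⇒<ᵇ-true (<-trans lt' (n<1+n (suc j))))))))
      ...   | tri≈ _ refl _ = trans (bump-same (suc j) m) (trans (cong suc zero≡) (cong (if_then 1 else 0) (sym (<⇒<ᵇ-true (n<1+n (suc j))))))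
      ...   | tri> _ _ gt = trans (bump-diff (suc j) i m (<⇒≢ gt)) (trans (me i)
              (trans (cong (if_then 1 else 0) (≤⇒<ᵇ-false (<⇒≤ gt))) (cong (if_then 1 else 0) (sym (≤⇒<ᵇ-false gt)))))

constant : ℤ → List Entry → List Entry
constant c = map (λ e → proj₁ e , un c)

row-coh : ∀ δ s j z c P → val z ≡ c → (∀ t → t ≡ none ⊎ t ≡ asc → isPrimed δ s t ≡ just (primed z)) →
          labels P ≡ range (suc j) (length P) → Coh (λ _ → δ) s ((j , z) ∷ constant c P)
row-coh δ s j z c [] v h e = h none (inj₁ refl) , tt
row-coh δ s j z c ((l , y) ∷ P) v h e = trans (cong (isPrimed δ s) d) (h asc (inj₂ refl)) ,
  subst (λ t → Coh (λ _ → δ) t ((l , un c) ∷ constant c P)) (sym d)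
    (row-coh δ asc l (un c) c P refl (λ { none _ → refl ; asc _ → refl ; desc (inj₁ ()) ; desc (inj₂ ()) ; flat (inj₁ ()) ; flat (inj₂ ()) })
      (trans (tail-≡ e) (cong (λ k → range (suc k) (length P)) (sym l≡))))
  where
  tail-≡ : ∀ {x y : ℕ} {X Y : List ℕ} → x ∷ X ≡ y ∷ Y → X ≡ Y
  tail-≡ refl = refl
  head-≡ : ∀ {x y : ℕ} {X Y : List ℕ} → x ∷ X ≡ y ∷ Y → x ≡ y
  head-≡ refl = refl
  l≡ : l ≡ suc j
  l≡ = head-≡ e
  d : dir (j , z) (l , un c) ≡ asc
  d = trans (dir-same (j , z) (l , un c) v) (<⇒cmp (subst (j <_) (sym l≡) (n<1+n j)))

constant-≡ : ∀ {c} {X Y : List ℤ} → All (_≡ c) X → All (_≡ c) Y → length X ≡ length Y → X ≡ Y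
constant-≡ [] [] e = refl
constant-≡ (refl ∷ p) (refl ∷ q) e = cong (_ ∷_) (constant-≡ p q (suc-injective e))

at-neg : ∀ {B : Set} (g : Box → Letter → B) (h : Letter → B) x (P : List Entry) → (∀ {c x} → c ≢ (1 , 1) → g c x ≡ h x) → ∀ i j →
         Maybe.map (g (i , j)) (at (cells empty ((0 , x) ∷ P)) i j) ≡
         at (cells empty ((0 , g (1 , 1) x) ∷ map (λ e → proj₁ e , h (proj₂ e)) P)) i j
at-neg g h x P eq i j with hit 1 1 i j in q
... | true with hit-true 1 1 i j q
...   | refl , refl = refl
at-neg g h x P eq i j | false = trans (step (at (cells (bump 0 empty) P) i j)) (sym (at-cells-map h (bump 0 empty) P i j))
  where
  not11 : (i , j) ≢ (1 , 1)
  not11 e = contradiction (trans (sym (cong (λ c → hit 1 1 (proj₁ c) (proj₂ c)) e)) q) λ ()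
  step : ∀ z → Maybe.map (g (i , j)) z ≡ Maybe.map h z
  step nothing = refl
  step (just y) = cong just (eq not11)

negLetter-≢ : ∀ a c x → c ≢ (1 , 1) → negLetter a c x ≡ un (ℤ.- a)
negLetter-≢ a (i , j) x n with i ≡ᵇ 1 in p | j ≡ᵇ 1 in q
... | true | true = contradiction (cong₂ _,_ (≡ᵇ-true p) (≡ᵇ-true q)) n
... | true | false = refl
... | false | _ = refl

record FirstBlock (ε : ℤ → Bool) (a : ℤ) (L : List Entry) : Set where
  constructor firstBlock
  field
    x₀     : Letter
    Pr Q   : List Entry
    split  : L ≡ ((0 , x₀) ∷ Pr) ++ Q
    valx   : val x₀ ≡ a
    valPr  : All (λ f → value f ≡ a) Pr
    valQ   : All (λ f → a ℤ.< value f) Q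
    labPr  : labels Pr ≡ range 1 (length Pr)
    prime  : primed x₀ ≡ ε a
    cohQ   : Coh ε none Q

  negBlock : List Entry
  negBlock = (0 , star x₀) ∷ constant (ℤ.- a) Pr

  labels-constant : ∀ c P → labels (constant c P) ≡ labels P
  labels-constant c [] = refl
  labels-constant c (e ∷ P) = cong (proj₁ e ∷_) (labels-constant c P)

  labels-neg : labels negBlock ≡ labels ((0 , x₀) ∷ Pr)
  labels-neg = cong (0 ∷_) (labels-constant (ℤ.- a) Pr)

  labels-row : labels ((0 , x₀) ∷ Pr) ≡ range 0 (suc (length Pr))
  labels-row = cong (0 ∷_) labPr

  value-neg : All (λ f → value f ≡ ℤ.- a) negBlock
  value-neg = trans (val-star x₀) (cong ℤ.-_ valx) ∷ AllP.map⁺ (All.tabulate (λ _ → refl))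

  coh-neg : Coh (λ _ → not (ε a)) none negBlock
  coh-neg = row-coh (not (ε a)) none 0 (star x₀) (ℤ.- a) Pr (All.head value-neg)
    (λ { none _ → cong just (sym pp) ; asc _ → cong just (sym pp) ; desc (inj₁ ()) ; desc (inj₂ ()) ; flat (inj₁ ()) ; flat (inj₂ ()) }) labPr
    where
    primed-star : ∀ x → primed (star x) ≡ not (primed x)
    primed-star (un k) = refl
    primed-star (pr k) = refl
    pp : primed (star x₀) ≡ not (ε a)
    pp = trans (primed-star x₀) (cong not prime)

  valP : All (λ f → value f ≡ a) ((0 , x₀) ∷ Pr)
  valP = valx ∷ valPr

first-block : ∀ {ε a L S} → Coded ε L S → IsMin S a → FirstBlock ε a L
first-block {ε} {a} {L} {S} C ((c , x , q , v) , least) = go (split-value a L sorted low)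
  where
  open Coded C
  low : All (λ f → a ℤ.≤ value f) L
  low = All.tabulate (λ r → least (proj₂ (code⇒ r)))
  go : (∃ λ W → ∃ λ B → L ≡ W ++ B × All (λ f → value f ≡ a) W × All (λ f → a ℤ.< value f) B) → FirstBlock ε a L
  go ([] , B , refl , vW , vB) = contradiction (All.lookup vB (proj₂ (code⇐ q))) (ℤP.<-irrefl (sym v))
  go ((suc k , x₀) ∷ Pr , B , refl , vW , vB) = contradiction (proj₂ (proj₁ legal)) λ ()
  go ((0 , x₀) ∷ Pr , B , refl , vx ∷ vW , vB) = firstBlock x₀ Pr B refl vx vW vB
      (row-block 0 (bump 0 empty) x₀ Pr (λ { zero → refl ; (suc i) → refl })
        (proj₁ (Legal-++ (bump 0 empty) (labels Pr) (subst (Legal (bump 0 empty)) (labels-++ Pr B) (proj₂ legal))))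
        cohP (All.map (λ w → trans w (sym vx)) vW) (inj₂ refl))
      (bottom Pr cohP vW) (proj₂ both)
    where
    both = Coh-split {j = a} ((0 , x₀) ∷ Pr) B (vx ∷ vW) (All.map (λ lt w → ℤP.<-irrefl (sym w) lt) vB) coh
    cohP = proj₁ both
    bottom : ∀ P → Coh ε none ((0 , x₀) ∷ P) → All (λ f → value f ≡ a) P → primed x₀ ≡ ε a
    bottom [] (o , _) _ = sym (trans (cong ε (sym vx)) (just-injective o))
    bottom (f ∷ P) c@(o , _) (w ∷ _) with dir-view c (trans w (sym vx))
    ... | isDesc lt _ = contradiction lt λ ()
    ... | isAsc lt d = sym (trans (cong ε (sym vx)) (just-injective (trans (cong (isPrimed (ε (val x₀)) none) (sym d)) o)))

-- The bits of the starred tableau: values are negated and primes flipped. Evacuation produces the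
-- same bits, because it stars the corner entry, and this is the bottom of the valley formed by the
-- smallest letters.
mirror : (ℤ → Bool) → ℤ → Bool
mirror ε v = not (ε (ℤ.- v))

Coh-ε : ∀ {ε ε' : ℤ → Bool} {s} L → All (λ e → ε (value e) ≡ ε' (value e)) L → Coh ε s L → Coh ε' s L
Coh-ε [] [] c = tt
Coh-ε {s = s} (e ∷ L) (p ∷ ps) (o , c) = trans (cong (λ b → isPrimed b s (nextDir e L)) (sym p)) o , Coh-ε L ps c

Coh-append : ∀ {ε s j} e W B → All (λ f → value f ≢ j) (e ∷ W) → All (λ f → value f ≡ j) B → Coh ε s (e ∷ W) → Coh ε none B →
             Coh ε s (e ∷ W ++ B)
Coh-append e [] [] ns vs c c' = c
Coh-append {ε} {s} e [] (f ∷ B) (n ∷ _) (v ∷ _) (o , _) c' =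
  trans (cong (isPrimed (ε (value e)) s) d) o , subst (λ t → Coh ε t (f ∷ B)) (sym d) c'
  where
  d : dir e f ≡ none
  d = dir-diff e f (λ q → n (trans q v))
Coh-append e (f ∷ W) B (n ∷ ns) vs (o , c) c' = o , Coh-append f W B ns vs c c'

Coh-append′ : ∀ {ε j} W B → All (λ f → value f ≢ j) W → All (λ f → value f ≡ j) B → Coh ε none W → Coh ε none B → Coh ε none (W ++ B)
Coh-append′ [] B ns vs c c' = c'
Coh-append′ (e ∷ W) B ns vs c c' = Coh-append e W B ns vs c c'

look-below : ∀ {A : Set} m (L : Code A) i k → i ≤ m k → look m L i k ≡ nothing
look-below m [] i k le = refl
look-below m ((l , x) ∷ L) i k le with l ≡ᵇ k in e
... | false = look-below (bump l m) L i k (≤-trans le (≤-reflexive (sym (bump-diff l k m (≡ᵇ-false⁻ e)))))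
... | true rewrite ≡ᵇ-true {l} {k} e | ≡ᵇ-false {suc (m k)} {i} (>⇒≢ (s≤s le)) =
    look-below (bump k m) L i k (≤-trans le (≤-trans (n≤1+n _) (≤-reflexive (sym (bump-same k m)))))

look-within : ∀ {A : Set} m (L : Code A) i k → m k < i → i ≤ adv m (labels L) k → look m L i k ≢ nothing
look-within m [] i k lt le = contradiction lt (≤⇒≯ le)
look-within m ((l , x) ∷ L) i k lt le with l ≡ᵇ k in e
... | false = look-within (bump l m) L i k (subst (_< i) (sym (bump-diff l k m (≡ᵇ-false⁻ e))) lt) le
... | true with suc (m k) ≟ i
...   | yes refl rewrite ≡ᵇ-true {l} {k} e | ≡ᵇ-refl (m k) = λ ()
...   | no n rewrite ≡ᵇ-true {l} {k} e | ≡ᵇ-false n =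
        look-within (bump k m) L i k (subst (_< i) (sym (bump-same k m)) (≤∧≢⇒< lt n)) le

same-support : ∀ {A B : Set} (X : Code A) (Y : Code B) → adv empty (labels X) ≗ adv empty (labels Y) → ∀ i j →
               at (cells empty X) i j ≡ nothing → at (cells empty Y) i j ≡ nothing
same-support X Y e i j q with <-≤-connex j i
... | inj₁ lt = at-cells-below empty Y i j lt
... | inj₂ le with m≤n⇒∃[o]m+o≡n le
...   | k , refl = trans (at-cells empty Y i k) (go i (trans (sym (at-cells empty X i k)) q))
  where
  go : ∀ i → look empty X i k ≡ nothing → look empty Y i k ≡ nothing
  go zero _ = look-below empty Y zero k z≤n
  go (suc i) h with <-≤-connex (adv empty (labels Y) k) (suc i)
  ... | inj₁ lt = trans (cong (λ Z → look empty Z (suc i) k) (sym (++-identityʳ Y))) (look-skip empty Y [] (suc i) k lt)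
  ... | inj₂ le = contradiction h (look-within empty X (suc i) k (s≤s z≤n) (≤-trans le (≤-reflexive (sym (e k)))))

>>=-just : ∀ {A B : Set} (f : A → B) z → (z >>= λ x → just (f x)) ≡ Maybe.map f z
>>=-just f nothing = refl
>>=-just f (just x) = refl

record Peeled (ε : ℤ → Bool) (m a : ℤ) (L : List Entry) (S : Cells) (P Q : List Entry) : Set where
  constructor peeled
  field
    V     : LFill
    R' P' : List Entry
    res   : SwitchRes (negPart a S) (upperPart a m S) (extract Pl V) (extract Ql V)
    rest  : Coded ε R' (extract Ql V)
    atP   : ∀ i j → at (cells empty R') i j ≡ nothing → at (extract Pl V) i j ≡ at (cells (adv empty (labels R')) P') i j
    labR  : labels R' ≡ swT (labels P) (labels Q)
    labP  : labels P' ≡ swX (labels P) (labels Q)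
    valR  : map value R' ≡ map value Q
    cohP  : Coh (λ _ → not (ε a)) none P'
    valP' : All (λ f → value f ≡ ℤ.- a) P'

module _ {ε : ℤ → Bool} {m a : ℤ} {L : List Entry} {S : Cells} (C : Coded ε L S) (least : IsMin S a)
         (le : All (λ e → value e ℤ.≤ m) L) where
  open Coded C

  private
    FB = first-block C least
  open FirstBlock FB

  private
    bound : ∀ {c x} → (c , x) ∈ S → a ℤ.≤ val x × val x ℤ.≤ m
    bound q = proj₂ least q , All.lookup le (proj₂ (code⇐ q))
    K : Keyed (pieces a m S)
    K = Keyed-image keyed (pieces-image a m S bound)
    repr-pieces : Repr (plab negBlock ++ qlab Q) (pieces a m S)
    repr-pieces i j = begin
      at (pieces a m S) i j                                           ≡⟨ at-image keyed (pieces-image a m S bound) i j ⟩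
      (at S i j >>= λ x → just (pieceLetter a (i , j) x))             ≡⟨ >>=-just _ (at S i j) ⟩
      Maybe.map (pieceLetter a (i , j)) (at S i j)                    ≡⟨ cong (Maybe.map _) (trans (repr i j) (cong (λ Z → at (cells empty Z) i j) split)) ⟩
      Maybe.map (pieceLetter a (i , j)) (at (cells empty ((0 , x₀) ∷ Pr ++ Q)) i j) ≡⟨ at-neg (pieceLetter a) h x₀ (Pr ++ Q) h-eq i j ⟩
      at (cells empty ((0 , pieceLetter a (1 , 1) x₀) ∷ map (λ e → proj₁ e , h (proj₂ e)) (Pr ++ Q))) i j
        ≡⟨ cong₂ (λ y Z → at (cells empty ((0 , y) ∷ Z)) i j) (pieceLetter-≡ a m S bound (1 , 1) x₀ valx) (trans (map-++ _ Pr Q) (cong₂ _++_ (map-P Pr valPr) (map-Q Q valQ))) ⟩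
      at (cells empty (plab negBlock ++ qlab Q)) i j                  ∎
      where
      open ≡-Reasoning
      h : Letter → Labelled
      h x = if val x ==ℤ a then (un (ℤ.- a) , Pl) else (x , Ql)
      h-eq : ∀ {c x} → c ≢ (1 , 1) → pieceLetter a c x ≡ h x
      h-eq {c} {x} n with val x ==ℤ a
      ... | true = cong (_, Pl) (negLetter-≢ a c x n)
      ... | false = refl
      map-P : ∀ P → All (λ f → value f ≡ a) P → map (λ e → proj₁ e , h (proj₂ e)) P ≡ plab (constant (ℤ.- a) P)
      map-P [] [] = refl
      map-P (f ∷ P) (v ∷ vs) = cong₂ _∷_ (cong (proj₁ f ,_) (trans (cong (λ z → if z ==ℤ a then (un (ℤ.- a) , Pl) else (proj₂ f , Ql)) v)
        (cong (if_then (un (ℤ.- a) , Pl) else (proj₂ f , Ql)) (==ℤ-refl a)))) (map-P P vs)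
      map-Q : ∀ Z → All (λ f → a ℤ.< value f) Z → map (λ e → proj₁ e , h (proj₂ e)) Z ≡ qlab Z
      map-Q [] [] = refl
      map-Q (f ∷ Z) (v ∷ vs) = cong₂ _∷_ (cong (proj₁ f ,_) (cong (if_then (un (ℤ.- a) , Pl) else (proj₂ f , Ql)) (==ℤ-false λ q → ℤP.<-irrefl (sym q) v))) (map-Q Z vs)
    labels-split : labels negBlock ++ labels Q ≡ labels L
    labels-split = trans (cong (_++ labels Q) labels-neg) (trans (sym (labels-++ ((0 , x₀) ∷ Pr) Q)) (sym (cong labels split)))
    js : List ℤ
    js = lettersAsc (upperPart a m S)
    inJs : All (λ f → value f ∈ js) Q
    inJs = All.tabulate λ {f} q → let c , s = code⇒ (subst (f ∈_) (sym split) (MP.∈-++⁺ʳ ((0 , x₀) ∷ Pr) q)) in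
      lettersAsc-∈ (upperPart a m S) (upper-∈⁺ a m S bound s (λ v → ℤP.<-irrefl (sym v) (All.lookup valQ q)))
    sw : Switched (ℤ.- a) (not (ε a)) ε [] negBlock Q [] (InnerLoop (ℤ.- a) js) (pieces a m S)
    sw = inner (ℤ.- a) (not (ε a)) ε js [] negBlock Q (pieces a m S) repr-pieces K (λ ())
      (subst (Legal empty) (sym labels-split) legal) coh-neg value-neg cohQ
      (Sorted-suffix ((0 , x₀) ∷ Pr) (subst Sorted split sorted)) (lettersAsc-asc (upperPart a m S)) inJs
    negs : lettersAsc (negPart a S) ≡ [ ℤ.- a ]
    negs = lettersAsc-const (ℤ.- a) (negPart a S) nonempty (λ {c} q → let x , _ , v , e = negPart-∈⁻ a S q in trans (cong val e) (val-negLetter a c x v))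
      where
      nonempty : negPart a S ≢ []
      nonempty e with proj₁ least
      ... | c , x , q , v with subst (_ ∈_) e (negPart-∈⁺ a S q v)
      ...   | ()

  peel : Peeled ε m a L S negBlock Q
  peel = conclude sw
    where
    conclude : Switched (ℤ.- a) (not (ε a)) ε [] negBlock Q [] (InnerLoop (ℤ.- a) js) (pieces a m S) → Peeled ε m a L S negBlock Q
    conclude (switched V R' P' proc k r lr lp cr vr cp vp) = peeled V R' P'
      (V , subst (λ is → OuterLoop js is (pieces a m S) V) (cong reverseℤ (sym negs)) (andThen proc finished) , refl , refl)
      (coded (Keyed-image k (extract-Q V)) atQ legalR cr (Sorted-values (sym vr) (Sorted-suffix ((0 , x₀) ∷ Pr) (subst Sorted split sorted))))
      atP′ lr lp vr cp vp
      where
      M : State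
      M = adv empty (labels R')
      atV : ∀ i j → at V i j ≡ (Maybe.map (_, Ql) (at (cells empty R') i j) <∣> Maybe.map (_, Pl) (at (cells M P') i j))
      atV i j = trans (r i j) (trans (cong (λ Z → at (cells empty (qlab R' ++ Z)) i j) (++-identityʳ (plab P')))
        (trans (at-cells-++ empty (qlab R') (plab P') i j) (cong₂ _<∣>_ (at-cells-map (_, Ql) empty R' i j)
          (trans (cong (λ w → at (cells (adv empty w) (plab P')) i j) (labels-qlab R')) (at-cells-map (_, Pl) M P' i j)))))
      atQ : ∀ i j → at (extract Ql V) i j ≡ at (cells empty R') i j
      atQ i j = trans (at-image k (extract-Q V) i j) (trans (cong (_>>= onlyQ) (atV i j)) (go (at (cells empty R') i j) (at (cells M P') i j)))
        where
        go : ∀ x y → ((Maybe.map (_, Ql) x <∣> Maybe.map (_, Pl) y) >>= onlyQ) ≡ x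
        go (just x) y = refl
        go nothing nothing = refl
        go nothing (just y) = refl
      atP′ : ∀ i j → at (cells empty R') i j ≡ nothing → at (extract Pl V) i j ≡ at (cells M P') i j
      atP′ i j n = trans (at-image k (extract-P V) i j) (trans (cong (_>>= onlyP) (trans (atV i j) (cong (λ z → Maybe.map (_, Ql) z <∣> Maybe.map (_, Pl) (at (cells M P') i j)) n)))
        (go (at (cells M P') i j)))
        where
        go : ∀ y → (Maybe.map (_, Pl) y >>= onlyP) ≡ y
        go nothing = refl
        go (just y) = refl
      legalR : Legal empty (labels R')
      legalR = subst (Legal empty) (sym lr) (proj₁ (Legal-++ empty (swT (labels negBlock) (labels Q))
        (~-Legal (sw-~ (labels negBlock) (labels Q)) {empty} (subst (Legal empty) (sym labels-split) legal))))

  corner : Corner11 S a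
  corner = go x₀ valx (trans (repr 1 1) (cong (λ Z → at (cells empty Z) 1 1) split))
    where
    go : ∀ x → val x ≡ a → at S 1 1 ≡ just x → Corner11 S a
    go (un k) refl e = inj₁ e
    go (pr k) refl e = inj₂ e

  at-last : Q ≡ [] → ∀ i j → at (negPart a S) i j ≡ at (cells empty negBlock) i j
  at-last q₀ i j = trans (at-image keyed (negPart-image a S all-a) i j) (trans (>>=-just _ (at S i j))
    (trans (cong (Maybe.map _) (trans (repr i j) (cong (λ Z → at (cells empty Z) i j) L≡)))
      (at-neg (negLetter a) (λ _ → un (ℤ.- a)) x₀ Pr (λ {c} {x} → negLetter-≢ a c x) i j)))
    where
    L≡ : L ≡ (0 , x₀) ∷ Pr
    L≡ = trans split (trans (cong (((0 , x₀) ∷ Pr) ++_) q₀) (++-identityʳ _))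
    all-a : ∀ {c x} → (c , x) ∈ S → val x ≡ a
    all-a {x = x} q = let k , r = code⇐ q in All.lookup valP (subst ((k , x) ∈_) L≡ r)

record Evacuated (ε : ℤ → Bool) (m : ℤ) (L : List Entry) (S acc : Cells) : Set where
  constructor evacuated
  field
    E    : Cells
    loop : EvacLoop m S acc E
    LE   : List Entry
    atE  : ∀ i j → at E i j ≡ (at (cells empty LE) i j <∣> at acc i j)
    labE : labels LE ≡ ev (labels L)
    valE : map value LE ≡ reverse (map (λ e → ℤ.- value e) L)
    cohE : Coh (mirror ε) none LE

module _ {ε : ℤ → Bool} {m : ℤ} where

  -- The smallest letters form a row `r`, for which `ev r ≡ r`; so switching the negated row with
  -- the rest is the right side of `ev-++`. The bound `n` is on the length because the rest is a new
  -- word in every round.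
  evac-sim : ∀ n L S acc → length L ≤ n → Coded ε L S → All (λ e → value e ℤ.≤ m) L → m ∈ map value L → Evacuated ε m L S acc
  evac-sim zero [] S acc _ C le ()
  evac-sim (suc n) L S acc len C le mm = go (minC S) refl
    where
    go : ∀ z → minC S ≡ z → Evacuated ε m L S acc
    go nothing e with minC-[] S e | MP.∈-map⁻ value mm
    ... | refl | e' , q , _ with Coded.code⇒ C q
    ...   | _ , ()
    go (just a) e = cases (a ℤP.≟ m)
      where
      least = minC-spec S e
      FB = first-block C least
      open FirstBlock FB
      mirror-a : All (λ f → not (ε a) ≡ mirror ε (value f)) negBlock
      mirror-a = All.map (λ {f} v → cong (λ z → not (ε z)) (sym (trans (cong (ℤ.-_) v) (ℤP.neg-involutive a)))) value-neg
      minus : List Entry → List ℤ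
      minus = map (λ f → ℤ.- value f)
      minus-P : All (_≡ ℤ.- a) (reverse (minus ((0 , x₀) ∷ Pr)))
      minus-P = All.tabulate λ q → All.lookup (AllP.map⁺ {f = λ f → ℤ.- value f} (All.map (cong (ℤ.-_)) valP)) (AnyP.reverse⁻ q)
      cases : Dec (a ≡ m) → Evacuated ε m L S acc
      cases (yes refl) = last Q refl
        where
        last : ∀ Z → Q ≡ Z → Evacuated ε a L S acc
        last (f ∷ Z) q = contradiction (All.lookup valQ (subst (f ∈_) (sym q) (here refl)))
          (ℤP.≤⇒≯ (All.lookup le (subst (f ∈_) (sym (trans split (cong (((0 , x₀) ∷ Pr) ++_) q))) (MP.∈-++⁺ʳ ((0 , x₀) ∷ Pr) (here refl)))))
        last [] q = evacuated (negPart a S ++ acc) (stop e (corner C least le) refl) negBlock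
          (λ i j → trans (at-++ (negPart a S) acc i j) (cong (_<∣> at acc i j) (at-last C least le q i j)))
          (trans labels-neg (trans labels-row (trans (sym (ev-range (suc (length Pr)))) (cong ev (trans (sym labels-row) (cong labels (sym L≡)))))))
          (trans (constant-≡ (AllP.map⁺ value-neg) minus-P
            (trans (length-map value negBlock) (trans (cong suc (trans (length-map _ Pr) (sym (length-map _ Pr)))) (sym (length-reverse (minus ((0 , x₀) ∷ Pr)))))))
            (cong (λ Z → reverse (minus Z)) (sym L≡)))
          (Coh-ε negBlock mirror-a coh-neg)
          where
          L≡ : L ≡ (0 , x₀) ∷ Pr
          L≡ = trans split (trans (cong (((0 , x₀) ∷ Pr) ++_) q) (++-identityʳ _))
      cases (no a≢m) = further (peel C least le)
        where
        further : Peeled ε m a L S negBlock Q → Evacuated ε m L S acc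
        further (peeled V R' P' res rest atP lr lp vr cp vp) = finish′ (evac-sim n R' (extract Ql V) (extract Pl V ++ acc) len' rest le' mm')
          where
          lenR : length R' ≡ length Q
          lenR = trans (sym (length-map value R')) (trans (cong length vr) (length-map value Q))
          len' : length R' ≤ n
          len' = ≤-pred (≤-trans (s≤s (≤-trans (≤-reflexive lenR) (m≤n+m (length Q) (length Pr))))
            (≤-trans (≤-reflexive (trans (cong suc (sym (length-++ Pr))) (cong length (sym split)))) len))
          ∈Q : ∀ {v} → v ∈ map value R' → v ∈ map value Q
          ∈Q = subst (_ ∈_) vr
          le' : All (λ f → value f ℤ.≤ m) R'
          le' = All.tabulate λ q → let f , r , w = MP.∈-map⁻ value (∈Q (MP.∈-map⁺ value q)) in
            subst (ℤ._≤ m) (sym w) (All.lookup le (subst (f ∈_) (sym split) (MP.∈-++⁺ʳ ((0 , x₀) ∷ Pr) r)))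
          mm' : m ∈ map value R'
          mm' with MP.∈-map⁻ value mm
          ... | f , q , w with MP.∈-++⁻ ((0 , x₀) ∷ Pr) (subst (f ∈_) split q)
          ...   | inj₁ r = contradiction (sym (trans w (All.lookup valP r))) a≢m
          ...   | inj₂ r = subst (_∈ map value R') (sym w) (subst (value f ∈_) (sym vr) (MP.∈-map⁺ value r))
          finish′ : Evacuated ε m R' (extract Ql V) (extract Pl V ++ acc) → Evacuated ε m L S acc
          finish′ (evacuated E loop LE aE lE vE cE) = evacuated E (advance e (corner C least le) a≢m res loop) (LE ++ P') aE′ lE′ vE′ cE′
            where
            same : adv empty (labels R') ≗ adv empty (labels LE)
            same k = trans (~-adv (ev-~ (labels R')) empty k) (cong (λ w → adv empty w k) (sym lE))
            aE′ : ∀ i j → at E i j ≡ (at (cells empty (LE ++ P')) i j <∣> at acc i j)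
            aE′ i j = trans (aE i j) (trans (cong (at (cells empty LE) i j <∣>_) (at-++ (extract Pl V) acc i j))
              (trans (choose (at (cells empty LE) i j) refl) (cong (_<∣> at acc i j) (sym (at-cells-++ empty LE P' i j)))))
              where
              -- `LE` and `R'` have the same counts, so they occupy the same boxes; a box outside
              -- `LE` thus satisfies the hypothesis of `atP`.
              choose : ∀ z → at (cells empty LE) i j ≡ z → (z <∣> (at (extract Pl V) i j <∣> at acc i j)) ≡
                       ((z <∣> at (cells (adv empty (labels LE)) P') i j) <∣> at acc i j)
              choose (just z) q = refl
              choose nothing q = cong (_<∣> at acc i j) (trans (atP i j (same-support LE R' (λ k → sym (same k)) i j q))
                (cong (λ T → at T i j) (cells-cong same P')))
            r : List ℕ
            r = labels negBlock
            evr : ev r ≡ r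
            evr = trans (cong ev (trans labels-neg labels-row)) (trans (ev-range _) (sym (trans labels-neg labels-row)))
            lE′ : labels (LE ++ P') ≡ ev (labels L)
            lE′ = trans (labels-++ LE P') (trans (cong₂ _++_ (trans lE (cong ev lr)) lp)
              (trans (cong (λ z → ev (swT z (labels Q)) ++ swX z (labels Q)) (sym evr))
                (trans (sym (ev-++ r (labels Q))) (cong ev (trans (cong (_++ labels Q) labels-neg) (trans (sym (labels-++ ((0 , x₀) ∷ Pr) Q)) (sym (cong labels split))))))))
            minus-values : ∀ X → minus X ≡ map (ℤ.-_) (map value X)
            minus-values [] = refl
            minus-values (f ∷ X) = cong (_ ∷_) (minus-values X)
            vE′ : map value (LE ++ P') ≡ reverse (minus L)
            vE′ = trans (map-++ value LE P') (trans (cong₂ _++_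
                (trans vE (cong reverse (trans (minus-values R') (trans (cong (map (ℤ.-_)) vr) (sym (minus-values Q))))))
                (constant-≡ (AllP.map⁺ vp) minus-P lenP))
              (trans (sym (reverse-++ (minus ((0 , x₀) ∷ Pr)) (minus Q))) (cong reverse (trans (sym (map-++ _ ((0 , x₀) ∷ Pr) Q)) (cong minus (sym split))))))
              where
              lenP : length (map value P') ≡ length (reverse (minus ((0 , x₀) ∷ Pr)))
              lenP = trans (length-map value P') (trans (sym (length-labels P')) (trans (cong length lp)
                (trans (length-swX r (labels Q)) (trans (cong length labels-neg) (trans (length-labels ((0 , x₀) ∷ Pr))
                  (trans (sym (length-map _ ((0 , x₀) ∷ Pr))) (sym (length-reverse (minus ((0 , x₀) ∷ Pr))))))))))
            cE′ : Coh (mirror ε) none (LE ++ P')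
            cE′ = Coh-append′ LE P' ne vp cE (Coh-ε P' (All.map (λ {f} v → cong (λ z → not (ε z)) (sym (trans (cong (ℤ.-_) v) (ℤP.neg-involutive a)))) vp) cp)
              where
              ne : All (λ f → value f ≢ ℤ.- a) LE
              ne = All.tabulate bad
                where
                bad : ∀ {f} → f ∈ LE → value f ≢ ℤ.- a
                bad {f} q v with MP.∈-map⁻ (λ g → ℤ.- value g) (AnyP.reverse⁻ (subst (value f ∈_) vE (MP.∈-map⁺ value q)))
                ... | g , s , w with MP.∈-map⁻ value (∈Q (MP.∈-map⁺ value s))
                ...   | g' , s' , w' = ℤP.<-irrefl (ℤP.neg-injective (trans (sym v) w)) (subst (a ℤ.<_) (sym w') (All.lookup valQ s'))

-- Determinism of the evacuation.

switch-det : ∀ {a b U V V'} → SwitchProc a b U V → SwitchProc a b U V' → V ≡ V'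
switch-det (finish e) (finish e') = refl
switch-det (finish e) (advance e' q) = contradiction (trans (sym e) e') λ ()
switch-det (advance e p) (finish e') = contradiction (trans (sym e) e') λ ()
switch-det (advance e p) (advance e' q) with trans (sym e) e'
... | refl = switch-det p q

inner-det : ∀ {i js U V V'} → InnerLoop i js U V → InnerLoop i js U V' → V ≡ V'
inner-det finished finished = refl
inner-det (andThen p q) (andThen p' q') with switch-det p p'
... | refl = inner-det q q'

outer-det : ∀ {js is U V V'} → OuterLoop js is U V → OuterLoop js is U V' → V ≡ V'
outer-det finished finished = refl
outer-det (andThen p q) (andThen p' q') with inner-det p p'
... | refl = outer-det q q'

evacLoop-det : ∀ {m S acc E E'} → EvacLoop m S acc E → EvacLoop m S acc E' → E ≡ E'
evacLoop-det (stop e _ _) (stop e' _ _) with trans (sym e) e'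
... | refl = refl
evacLoop-det (stop e _ refl) (advance e' _ n _ _) = contradiction (just-injective (trans (sym e') e)) n
evacLoop-det (advance e _ n _ _) (stop e' _ refl) = contradiction (just-injective (trans (sym e) e')) n
evacLoop-det (advance e _ _ (V , o , refl , refl) l) (advance e' _ _ (V' , o' , refl , refl) l') with trans (sym e) e'
... | refl with outer-det o o'
...   | refl = evacLoop-det l l'

-- The simulation constructs one evacuation; to speak about every `E` related to `S`, the relation
-- must be single-valued.
evac-det : ∀ {S E E'} → Evac S E → Evac S E' → E ≡ E'
evac-det evac-empty evac-empty = refl
evac-det evac-empty (evac-run () _)
evac-det (evac-run () _) evac-empty
evac-det (evac-run e l) (evac-run e' l') with trans (sym e) e'
... | refl = evacLoop-det l l'

-- Rectification

rectGo : ℕ → List ℕ → Cells → Cells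
rectGo zero μ T = T
rectGo (suc f) μ T with lastCorner μ
... | nothing = T
... | just (i , j , μ') = rectGo f μ' (slide (suc (length T)) T i j)

-- The loop in the definition of rect is local to it; after one step all of its
-- arguments are variables, and the type of loop-≡ can be inferred.

loop-≡ : ∀ (μ : List ℕ) (T : Cells) (f : ℕ) (μ' : List ℕ) (T' : Cells) → _

rect-def : ∀ μ T → rect μ T ≡ rectGo (sum μ) μ T
rect-def μ T with sum μ
... | zero = refl
... | suc f with lastCorner μ
...   | nothing = refl
...   | just (i , j , μ') with slide (suc (length T)) T i j
...     | T' = loop-≡ μ T f μ' T'

loop-≡ μ T zero μ' T' = refl
loop-≡ μ T (suc f) μ' T' with lastCorner μ'
... | nothing = refl
... | just (i , j , μ'') = loop-≡ μ T f μ'' (slide (suc (length T')) T' i j)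

-- The inner shape is filled by rows, so that the last letter of the word belongs to the corner
-- chosen by `lastCorner`, and each slide removes a letter from the end.
rowWord : List ℕ → List ℕ
rowWord [] = []
rowWord (x ∷ μ) = range 0 x ++ rowWord μ

adv-+ : ∀ m w k → adv m w k ≡ m k + adv empty w k
adv-+ m [] k = sym (+-identityʳ (m k))
adv-+ m (l ∷ w) k = trans (adv-+ (bump l m) w k) (trans (bumped (l ≡ᵇ k) refl) (cong (m k +_) (sym (adv-+ (bump l empty) w k))))
  where
  bumped : ∀ b → (l ≡ᵇ k) ≡ b → (if b then suc (m k) else m k) + adv empty w k ≡ m k + ((if b then 1 else 0) + adv empty w k)
  bumped true _ = sym (+-suc (m k) _)
  bumped false _ = refl

record Corner (μ : List ℕ) : Set where
  constructor lastBox
  field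
    i v   : ℕ
    μ'    : List ℕ
    eq    : lastCorner μ ≡ just (suc i , suc i + v , μ')
    word  : rowWord μ ≡ rowWord μ' ∷ʳ v
    rowEq : adv empty (rowWord μ') v ≡ i
    size  : sum μ ≡ suc (sum μ')
    below : ∀ {z} → All (_< z) μ → v < z × All (_< z) μ'
    strict : AllPairs (λ a b → b < a) μ'
    pos    : All (0 <_) μ'

adv-range-∉ : ∀ m a d k → k < a ⊎ a + d ≤ k → adv m (range a d) k ≡ m k
adv-range-∉ m a d k h = adv-∉ m (λ q → out (range-all {P = λ x → k ≢ x} a d apart) q)
  where
  apart : ∀ {x} → a ≤ x → x < a + d → k ≢ x
  apart {x} le lt e = out′ h
    where
    out′ : k < a ⊎ a + d ≤ k → ⊥
    out′ (inj₁ l) = <⇒≱ (subst (_< a) e l) le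
    out′ (inj₂ g) = <⇒≱ lt (subst (a + d ≤_) e g)
  out : ∀ {L} → All (λ x → k ≢ x) L → k ∉ L
  out ns q = All.lookup ns q refl

adv-range-∈ : ∀ m a d k → a ≤ k → k < a + d → adv m (range a d) k ≡ suc (m k)
adv-range-∈ m a zero k le lt = contradiction le (<⇒≱ (subst (k <_) (+-identityʳ a) lt))
adv-range-∈ m a (suc d) k le lt with a ≟ k
... | yes refl = trans (adv-range-∉ (bump a m) (suc a) d a (inj₁ (n<1+n a))) (bump-same a m)
... | no n = trans (adv-range-∈ (bump a m) (suc a) d k (≤∧≢⇒< le n) (subst (k <_) (+-suc a d) lt)) (cong suc (bump-diff a k m n))

last-corner : ∀ x μ → AllPairs (λ a b → b < a) (x ∷ μ) → All (0 <_) (x ∷ μ) → Corner (x ∷ μ)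
last-corner (suc zero) [] s (p ∷ []) = lastBox 0 0 [] refl refl refl refl (λ { (l ∷ []) → ≤-trans (s≤s z≤n) l , [] }) [] []
last-corner (suc (suc x)) [] s (p ∷ []) = lastBox 0 (suc x) (suc x ∷ []) refl
  (trans (++-identityʳ _) (trans (range-snoc 0 (suc x)) (cong (_∷ʳ suc x) (sym (++-identityʳ (range 0 (suc x)))))))
  (trans (cong (λ w → adv empty w (suc x)) (++-identityʳ (range 0 (suc x)))) (adv-range-∉ empty 0 (suc x) (suc x) (inj₂ ≤-refl)))
  refl (λ { (l ∷ []) → ≤-trans (n≤1+n _) l , ≤-trans (n≤1+n _) l ∷ [] }) ([] ∷ []) (s≤s z≤n ∷ [])
last-corner x (y ∷ μ) (l ∷ s) (p ∷ ps) with last-corner y μ s ps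
... | lastBox i v μ' eq word row size below strict pos = lastBox (suc i) v (x ∷ μ')
  (cong (Maybe.map _) eq)
  (trans (cong (range 0 x ++_) word) (sym (++-assoc (range 0 x) (rowWord μ') [ v ])))
  (trans (cong (λ g → g v) (adv-++ empty (range 0 x) (rowWord μ'))) (trans (adv-+ _ (rowWord μ') v)
    (cong₂ _+_ (adv-range-∈ empty 0 x v z≤n (proj₁ (below l))) row)))
  (trans (cong (x +_) size) (+-suc x (sum μ')))
  (λ { (lz ∷ ls) → proj₁ (below ls) , lz ∷ proj₂ (below ls) }) (proj₂ (below l) ∷ strict) (p ∷ pos)

length-del : ∀ {A : Set} i j (T : Fill A) → length (del i j T) ≤ length T
length-del i j [] = z≤n
length-del i j (((a , b) , x) ∷ T) with hit a b i j
... | true = m≤n⇒m≤1+n (length-del i j T)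
... | false = s≤s (length-del i j T)

length-del-< : ∀ {A : Set} i j (T : Fill A) → at T i j ≢ nothing → length (del i j T) < length T
length-del-< i j [] n = contradiction refl n
length-del-< i j (((a , b) , x) ∷ T) n with hit a b i j
... | true = s≤s (length-del i j T)
... | false = s≤s (length-del-< i j T n)

-- The coded boxes are distinct and all occur in `T`. Hence the fuel `suc (length T)` of a slide
-- covers the remaining word.
code-length : ∀ {A B : Set} m (L : Code A) (T : Fill B) → (∀ i j → at (cells m L) i j ≢ nothing → at T i j ≢ nothing) → length L ≤ length T
code-length m [] T h = z≤n
code-length m ((k , x) ∷ L) T h = ≤-trans (s≤s (code-length (bump k m) L (del r (r + k) T) rest))
  (length-del-< r (r + k) T (h r (r + k) λ e → here≢ (trans (sym own) e)))
  where
  r = suc (m k)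
  own : at (cells m ((k , x) ∷ L)) r (r + k) ≡ just x
  own rewrite hit-refl r (r + k) = refl
  here≢ : just x ≢ nothing
  here≢ ()
  rest : ∀ i j → at (cells (bump k m) L) i j ≢ nothing → at (del r (r + k) T) i j ≢ nothing
  rest i j n e with hit r (r + k) i j in q
  ... | true with hit-true r (r + k) i j q
  ...   | refl , refl = n (trans (at-cells (bump k m) L r k) (look-below (bump k m) L r k (≤-reflexive (sym (bump-same k m)))))
  rest i j n e | false = h i j later (trans (sym (trans (at-del r (r + k) T i j) (cong (if_then nothing else at T i j) q))) e)
    where
    later : at (cells m ((k , x) ∷ L)) i j ≢ nothing
    later rewrite q = n

hole-rep : ∀ m v (L : List Entry) T → (∀ i j → at T i j ≡ at (cells (bump v m) L) i j) → Rep m (withHole [] v L) T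
hole-rep m v L T e i j with hit (suc (m v)) (suc (m v) + v) i j in q
... | true with hit-true (suc (m v)) (suc (m v) + v) i j q
...   | refl , refl = trans (e i j) (trans (at-cells (bump v m) L i v) (look-below (bump v m) L i v (≤-reflexive (sym (bump-same v m)))))
hole-rep m v L T e i j | false = trans (e i j) (sym (trans (cong joinM (at-cells-map just (bump v m) L i j)) (join-just (at (cells (bump v m) L) i j))))
  where
  join-just : ∀ {A : Set} (z : Maybe A) → joinM (Maybe.map just z) ≡ z
  join-just nothing = refl
  join-just (just x) = refl

record Rectified (ε : ℤ → Bool) (μ : List ℕ) (L : List Entry) (T : Cells) : Set where
  constructor rectified
  field
    result   : List Entry
    isLabels : labels result ≡ swT (rowWord μ) (labels L)
    isValues : map value result ≡ map value L
    isCoh    : Coh ε none result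
    isRep    : T ≈F cells empty result

-- Each slide applies `passW` for the last letter of `rowWord μ`, and by `swT-++` removing letters
-- of the inner word from its end in this way amounts to switching with the whole of it.
rect-sim : ∀ {ε} f μ L T → sum μ ≡ f → AllPairs (λ a b → b < a) μ → All (0 <_) μ → Legal empty (rowWord μ ++ labels L) →
           Coh ε none L → Sorted L → (∀ i j → at T i j ≡ at (cells (adv empty (rowWord μ)) L) i j) → Rectified ε μ L (rectGo f μ T)
rect-sim zero [] L T q s p lg c o e = rectified L (sym (swT-[] (labels L))) refl c e
rect-sim zero (x ∷ μ) L T q s (p ∷ ps) lg c o e with x
rect-sim zero (x ∷ μ) L T () s (p ∷ ps) lg c o e | suc _
rect-sim {ε} (suc f) (x ∷ μ) L T q s p lg c o e = go (last-corner x μ s p)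
  where
  go : Corner (x ∷ μ) → Rectified ε (x ∷ μ) L (rectGo (suc f) (x ∷ μ) T)
  go (lastBox i v μ' eq word row size _ strict pos) = subst (Rectified ε (x ∷ μ) L) (sym unfold) (next sl)
    where
    m : State
    m = adv empty (rowWord μ')
    T' : Cells
    T' = slide (suc (length T)) T (suc i) (suc i + v)
    unfold : rectGo (suc f) (x ∷ μ) T ≡ rectGo f μ' T'
    unfold rewrite eq = refl
    advanced : adv empty (rowWord (x ∷ μ)) ≡ bump v m
    advanced = trans (cong (adv empty) word) (adv-++ empty (rowWord μ') [ v ])
    e' : ∀ i j → at T i j ≡ at (cells (bump v m) L) i j
    e' a b = trans (e a b) (cong (λ z → at (cells z L) a b) advanced)
    lgv : Legal empty (rowWord μ' ++ v ∷ labels L)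
    lgv = subst (Legal empty) (trans (cong (_++ labels L) word) (++-assoc (rowWord μ') [ v ] (labels L))) lg
    sl : Slid ε none m [] v L T'
    sl = slide-sim (suc (length T)) T [] v L
      (m≤n⇒m≤1+n (code-length (bump v m) L T (λ a b n z → n (trans (sym (e' a b)) z))))
      (mid (proj₂ (Legal-++ empty (rowWord μ') lgv)) c o) (hole-rep m v L T e') (suc i) (suc i + v) (cong suc (sym row)) refl
    next : Slid ε none m [] v L T' → Rectified ε (x ∷ μ) L (rectGo f μ' T')
    next (slid L' lab vals coh rep) = final (rect-sim f μ' L' T' (suc-injective (trans (sym size) q)) strict pos
        (subst (λ z → Legal empty (rowWord μ' ++ z)) (sym lab) legal') coh (Sorted-values (sym vals) o) rep)
      where
      legal' : Legal empty (rowWord μ' ++ passW v (labels L))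
      legal' = proj₁ (Legal-++ empty (rowWord μ' ++ passW v (labels L)) {[ passV v (labels L) ]}
        (subst (Legal empty) (sym (++-assoc (rowWord μ') (passW v (labels L)) _))
          (~-Legal (~++ˡ (rowWord μ') (subst (λ z → v ∷ z ~ passW v (labels L) ++ [ passV v (labels L) ]) (++-identityʳ (labels L)) (pass-~ v (labels L) []))) {empty} lgv)))
      final : Rectified ε μ' L' (rectGo f μ' T') → Rectified ε (x ∷ μ) L (rectGo f μ' T')
      final (rectified L'' lab'' vals'' coh'' rep'') = rectified L''
        (trans lab'' (trans (cong (swT (rowWord μ')) lab) (sym (trans (cong (λ w → swT w (labels L)) word)
          (trans (swT-++ (rowWord μ') [ v ] (labels L)) (cong (swT (rowWord μ')) (trans (swT-∷ v [] (labels L)) (cong (passW v) (swT-[] (labels L)))))))))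
        ) (trans vals'' vals) coh'' rep''

-- The word of a tableau

rank-bounds : ∀ x → rank x ℤ.≤ val x ℤ.+ val x × val x ℤ.+ ℤ.pred (val x) ℤ.≤ rank x
rank-bounds (un k) = ℤP.≤-refl , ℤP.+-monoʳ-≤ k (ℤP.<⇒≤ (ℤP.i≤pred[j]⇒i<j ℤP.≤-refl))
rank-bounds (pr k) = ℤP.≤-trans (ℤP.≤-reflexive (ℤP.+-comm (k ℤ.+ k) ℤ.-1ℤ)) (ℤP.<⇒≤ (ℤP.i≤pred[j]⇒i<j ℤP.≤-refl)) ,
  ℤP.≤-reflexive (trans (cong (λ z → k ℤ.+ z) (ℤP.+-comm ℤ.-1ℤ k)) (sym (ℤP.+-assoc k k ℤ.-1ℤ)))

-- A letter of value k has rank 2k or 2k - 1, so the ranks belonging to different values do not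
-- overlap.
rank-val : ∀ x y → x ≤L y → val x ℤ.≤ val y
rank-val x y le = ℤP.≮⇒≥ λ lt → ℤP.<⇒≱ (ℤP.≤-<-trans (proj₁ (rank-bounds y))
  (ℤP.<-≤-trans (ℤP.+-mono-<-≤ lt (ℤP.i<j⇒i≤pred[j] lt)) (proj₂ (rank-bounds x)))) le

un≰pr : ∀ v → ¬ (un v ≤L pr v)
un≰pr v le = ℤP.<-irrefl refl (ℤP.i≤pred[j]⇒i<j (ℤP.≤-trans le (ℤP.≤-reflexive (ℤP.+-comm (v ℤ.+ v) ℤ.-1ℤ))))

module _ {λs : List ℕ} (lk : Linked (λ a b → b < a) λs) where

  rowLen-< : ∀ {λs} → Linked (λ a b → b < a) λs → ∀ i → 0 < rowLen λs (suc (suc i)) → rowLen λs (suc (suc i)) < rowLen λs (suc i)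
  rowLen-< [-] i ()
  rowLen-< (gt ∷ l) zero p = gt
  rowLen-< (gt ∷ l) (suc i) p = rowLen-< l i p

  shape-north : ∀ {i j} → InShape λs (suc (suc i)) j → InShape λs (suc i) j
  shape-north {i} {j} (_ , p , le , lt) = s≤s z≤n , ≤-<-trans z≤n dec , <⇒≤ le ,
    <-≤-trans lt (≤-trans (≤-reflexive (+-suc _ (suc i))) (+-monoˡ-≤ (suc i) dec))
    where dec = rowLen-< lk i p

  shape-norths : ∀ d {i j} → InShape λs (d + suc i) j → InShape λs (suc i) j
  shape-norths zero s = s
  shape-norths (suc zero) s = shape-north s
  shape-norths (suc (suc d)) {i} {j} s = shape-norths (suc d) (shape-north (subst (λ z → InShape λs z j) (cong (suc ∘ suc) refl) s))

  shape-west : ∀ {i j} → InShape λs i (suc j) → i ≤ j → InShape λs i j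
  shape-west (a , p , _ , lt) le = a , p , le , <-trans (n<1+n _) lt

-- Entries are ordered by value; for equal values the primed ones come first, in
-- decreasing order of their diagonals, then the others in increasing order.

position : Entry → ℤ
position (k , un _) = ℤ.+ k
position (k , pr _) = -[1+ k ]

codeOf : Box × Letter → Entry
codeOf ((i , j) , x) = j ∸ i , x

readingOrder : DecTotalOrder 0ℓ 0ℓ 0ℓ
readingOrder = On.decTotalOrder (×-decTotalOrder ℤP.≤-decTotalOrder ℤP.≤-decTotalOrder)
  (λ (c : Box × Letter) → value (codeOf c) , position (codeOf c))

open DecTotalOrder readingOrder using () renaming (_≤_ to _⊑_; trans to ⊑-trans)

Before : Entry → Entry → Set
Before e f = value e ℤ.< value f ⊎ (value e ≡ value f × position e ℤ.< position f)

⊑⇒≯ : ∀ {c d} → c ⊑ d → ¬ Before (codeOf d) (codeOf c)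
⊑⇒≯ (inj₁ (le , ne)) (inj₁ lt) = ℤP.<⇒≱ lt le
⊑⇒≯ (inj₁ (le , ne)) (inj₂ (e , _)) = ne (sym e)
⊑⇒≯ (inj₂ (e , le)) (inj₁ lt) = ℤP.<-irrefl (sym e) lt
⊑⇒≯ (inj₂ (e , le)) (inj₂ (_ , lt)) = ℤP.<⇒≱ lt le

AllPairs-middle : ∀ {A : Set} {R : A → A → Set} P {c X} → AllPairs R (P ++ c ∷ X) → (∀ {d} → d ∈ P → R d c) × (∀ {d} → d ∈ X → R c d)
AllPairs-middle [] (r ∷ rs) = (λ ()) , All.lookup r
AllPairs-middle (p ∷ P) {c} (r ∷ rs) with AllPairs-middle P rs
... | f , g = (λ { (here refl) → All.lookup r (MP.∈-++⁺ʳ P (here refl)) ; (there q) → f q }) , g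

keys : ∀ {A : Set} → Fill A → List Box
keys = map proj₁

Unique⇒Keyed : ∀ {A : Set} (U : Fill A) → Unique (keys U) → Keyed U
Unique⇒Keyed (((i , j) , x) ∷ U) (n ∷ ns) (here refl) rewrite hit-refl i j = refl
Unique⇒Keyed (((i , j) , x) ∷ U) (n ∷ ns) {c} (there q)
  rewrite hit-false i j (proj₁ c) (proj₂ c) (λ { refl refl → All.lookup n (MP.∈-map⁺ proj₁ q) refl }) = Unique⇒Keyed U ns q

-- On every diagonal the boxes of `P` form an initial segment, and `m` gives its length.
Tracks : Cells → State → Set
Tracks P m = ∀ i k → (1 ≤ i × i ≤ m k → (i , i + k) ∈ keys P) × ((i , i + k) ∈ keys P → 1 ≤ i × i ≤ m k)

module Reading {λs : List ℕ} {S : Cells} (syt : IsSYTNormal λs S) where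
  open IsSYTNormal syt
  open Sort readingOrder using (sort; sort-↭; sort-↗)

  private
    lk = proj₁ strict
    S' = sort S

  entry-at : ∀ {i j} → InShape λs i j → ∃ λ x → ((i , j) , x) ∈ S
  entry-at s with MP.∈-map⁻ proj₁ (shape⇐ _ _ s)
  ... | (_ , x) , q , refl = x , q

  inShapeOf : ∀ {i j x} → ((i , j) , x) ∈ S → InShape λs i j
  inShapeOf q = shape⇒ _ _ (MP.∈-map⁺ proj₁ q)

  north-of : ∀ {i j i'} → 1 ≤ i' → i' ≤ i → InShape λs i j → InShape λs i' j
  north-of {j = j} {suc i'} _ le s with m≤n⇒∃[o]m+o≡n le
  ... | d , refl = shape-norths lk d (subst (λ z → InShape λs z j) (+-comm (suc i') d) s)

  -- Compare both entries with `z` at row `i'` and column `j`, which shares a row with one and a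
  -- column with the other. If all values agree, equal unprimed letters force `i'` to be `i`, equal
  -- primed letters force `j'` to be `j`, and a primed `y` before an unprimed `x` is already in
  -- order.
  northwest-earlier : ∀ {i j x i' j' y} → ((i , j) , x) ∈ S → ((i' , j') , y) ∈ S → i' ≤ i → j' ≤ j → (i' , j') ≢ (i , j) →
                      Before (j' ∸ i' , y) (j ∸ i , x)
  northwest-earlier {i} {j} {x} {i'} {j'} {y} qx qy li lj ne with entry-at (north-of (proj₁ (inShapeOf qy)) li (inShapeOf qx))
  ... | z , qz = cases (val y ℤP.≟ val x)
    where
    yz : y ≤L z
    yz = rowWeak qy qz lj
    zx : z ≤L x
    zx = colWeak qz qx li
    i≤j : i ≤ j
    i≤j = proj₁ (proj₂ (proj₂ (inShapeOf qx)))
    i'≤j' : i' ≤ j'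
    i'≤j' = proj₁ (proj₂ (proj₂ (inShapeOf qy)))
    go : ∀ x y z → val y ≡ val x → val z ≡ val x → y ≤L z → z ≤L x → ((i , j) , x) ∈ S → ((i' , j') , y) ∈ S → ((i' , j) , z) ∈ S →
         position (j' ∸ i' , y) ℤ.< position (j ∸ i , x)
    go (un v) (pr .v) z refl e yz zx qx qy qz = -<+
    go (pr v) (un .v) (un .v) refl refl yz zx qx qy qz = contradiction zx (un≰pr v)
    go (pr v) (un .v) (pr .v) refl refl yz zx qx qy qz = contradiction yz (un≰pr v)
    go (un v) (un .v) (pr .v) refl refl yz zx qx qy qz = contradiction yz (un≰pr v)
    go (pr v) (pr .v) (un .v) refl refl yz zx qx qy qz = contradiction zx (un≰pr v)
    go (un v) (un .v) (un .v) refl refl yz zx qx qy qz = subst (λ r → ℤ.+ (j' ∸ r) ℤ.< ℤ.+ (j ∸ i)) (sym i'≡i)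
        (+<+ (∸-monoˡ-< (≤∧≢⇒< lj (λ e → ne (cong₂ _,_ i'≡i e))) (subst (_≤ j') i'≡i i'≤j')))
      where i'≡i = colUnpr qz qx
    go (pr v) (pr .v) (pr .v) refl refl yz zx qx qy qz = subst (λ r → -[1+ r ∸ i' ] ℤ.< -[1+ j ∸ i ]) (sym j'≡j)
        (-<- (∸-monoʳ-< (≤∧≢⇒< li (λ e → ne (cong₂ _,_ e j'≡j))) i≤j))
      where j'≡j = rowPrim qy qz
    cases : Dec (val y ≡ val x) → Before (j' ∸ i' , y) (j ∸ i , x)
    cases (yes e) = inj₂ (e , go x y z e (ℤP.≤-antisym (rank-val z x zx) (subst (ℤ._≤ val z) e (rank-val y z yz))) yz zx qx qy qz)
    cases (no n) = inj₁ (ℤP.≤∧≢⇒< (ℤP.≤-trans (rank-val y z yz) (rank-val z x zx)) n)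

  sortedPairs : AllPairs _⊑_ S'
  sortedPairs = Linked⇒AllPairs (λ {a} {b} {c} → ⊑-trans {a} {b} {c}) (sort-↗ S)

  ∈S' : ∀ {c} → c ∈ S → c ∈ S'
  ∈S' = ∈-resp-↭ (↭-sym (sort-↭ S))

  ∈S : ∀ {c} → c ∈ S' → c ∈ S
  ∈S = ∈-resp-↭ (sort-↭ S)

  uniqueS' : Unique (keys S')
  uniqueS' = PermP.Unique-resp-↭ (setoid Box) (↭⇒↭ₛ (map⁺ proj₁ (↭-sym (sort-↭ S)))) distinct

  module _ (P : Cells) (i₀ j : ℕ) (x : Letter) (R : Cells) (eq : S' ≡ P ++ ((suc i₀ , j) , x) ∷ R) (m : State) (tr : Tracks P m) where

    private
      i = suc i₀
      c : Box × Letter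
      c = (i , j) , x
      pairs : AllPairs _⊑_ (P ++ c ∷ R)
      pairs = subst (AllPairs _⊑_) eq sortedPairs
      c∈S : c ∈ S
      c∈S = ∈S (subst (c ∈_) (sym eq) (MP.∈-++⁺ʳ P (here refl)))
      i≤j : i ≤ j
      i≤j = proj₁ (proj₂ (proj₂ (inShapeOf c∈S)))
      k = j ∸ i
      j≡ : j ≡ i + k
      j≡ = sym (m+[n∸m]≡n i≤j)

    NW-in : ∀ {i' j'} → InShape λs i' j' → i' ≤ i → j' ≤ j → (i' , j') ≢ (i , j) → (i' , j') ∈ keys P
    NW-in {i'} {j'} s li lj ne with entry-at s
    ... | y , q with MP.∈-++⁻ P (subst (((i' , j') , y) ∈_) eq (∈S' q))
    ...   | inj₁ r = MP.∈-map⁺ proj₁ r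
    ...   | inj₂ (here refl) = contradiction refl ne
    ...   | inj₂ (there r) = contradiction (northwest-earlier c∈S q li lj ne) (⊑⇒≯ {c} {(i' , j') , y} (proj₂ (AllPairs-middle P pairs) r))

    SE-out : ∀ {i' j'} → i ≤ i' → j ≤ j' → (i , j) ≢ (i' , j') → (i' , j') ∉ keys P
    SE-out {i'} {j'} li lj ne q with MP.∈-map⁻ proj₁ q
    ... | (_ , y) , r , refl = ⊑⇒≯ {(i' , j') , y} {c} (proj₁ (AllPairs-middle P pairs) r)
      (northwest-earlier (∈S (subst (_ ∈_) (sym eq) (MP.∈-++⁺ˡ r))) c∈S li lj ne)

    own-out : (i , j) ∉ keys P
    own-out q = proj₁ (AllPairs-middle (keys P) (subst Unique (trans (cong keys eq) (map-++ proj₁ P (c ∷ R))) uniqueS')) q refl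

    -- One box inside an initial segment and the next one outside determine its length. Below, the
    -- northern and western neighbours are inside because they come earlier, the eastern and
    -- southern ones outside because they come later.
    pin : ∀ k' r → (∀ r' → r ≡ suc r' → (r , r + k') ∈ keys P) → (suc r , suc r + k') ∉ keys P → m k' ≡ r
    pin k' r h out = ≤-antisym (≮⇒≥ λ lt → out (proj₁ (tr (suc r) k') (s≤s z≤n , lt))) (low r h)
      where
      low : ∀ r → (∀ r' → r ≡ suc r' → (r , r + k') ∈ keys P) → r ≤ m k'
      low zero h = z≤n
      low (suc r) h = proj₂ (proj₂ (tr (suc r) k') (h r refl))

    count : m k ≡ i₀
    count = pin k i₀ inside (subst (λ z → (i , z) ∉ keys P) j≡ own-out)
      where
      inside : ∀ r' → i₀ ≡ suc r' → (i₀ , i₀ + k) ∈ keys P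
      inside r' refl = NW-in (shape-west lk (subst (InShape λs (suc r')) j≡ (shape-north lk (inShapeOf c∈S))) (m≤m+n (suc r') k))
        (n≤1+n _) (≤-trans (n≤1+n _) (≤-reflexive (sym j≡))) (λ e → 1+n≢n (sym (cong proj₁ e)))

    count-east : m (suc k) ≡ i₀
    count-east = pin (suc k) i₀ inside (SE-out ≤-refl (≤-trans (≤-reflexive j≡) (+-monoʳ-≤ i (n≤1+n k)))
        (λ e → <⇒≢ (subst (_< i + suc k) (sym j≡) (+-monoʳ-< i (n<1+n k))) (cong proj₂ e)))
      where
      inside : ∀ r' → i₀ ≡ suc r' → (i₀ , i₀ + suc k) ∈ keys P
      inside r' refl = subst (λ z → (suc r' , z) ∈ keys P) (trans j≡ (sym (+-suc (suc r') k)))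
        (NW-in (shape-north lk (inShapeOf c∈S)) (n≤1+n _) ≤-refl (λ e → 1+n≢n (sym (cong proj₁ e))))

    count-west : ∀ k' → k ≡ suc k' → m k' ≡ suc i₀
    count-west k' e = pin k' i (λ _ _ → NW-in (shape-west lk (subst (InShape λs i) j≡′ (inShapeOf c∈S)) (m≤m+n i k')) ≤-refl
        (≤-trans (n≤1+n _) (≤-reflexive (sym j≡′))) (λ q → <⇒≢ (subst (i + k' <_) (sym j≡′) ≤-refl) (cong proj₂ q)))
      (SE-out (n≤1+n i) (≤-reflexive j≡′) (λ q → 1+n≢n (sym (cong proj₁ q))))
      where
      j≡′ : j ≡ suc (i + k')
      j≡′ = trans j≡ (trans (cong (λ z → i + z) e) (+-suc i k'))

    stepOk : Step m k
    stepOk = trans count (sym count-east) , west k refl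
      where
      west : ∀ l → k ≡ l → West m l
      west zero e = tt
      west (suc l) e = trans (count-west l e) (cong suc (trans (sym count) (cong m e)))

    box≡ : (suc (m k) , suc (m k) + k) ≡ (i , j)
    box≡ = trans (cong diag count) (cong {A = ℕ} {B = Box} (λ z → suc i₀ , z) (sym j≡))
      where
      diag : ℕ → Box
      diag z = suc z , suc z + k

    tracks-next : Tracks (P ++ c ∷ []) (bump k m)
    tracks-next r l = to , from
      where
      keys-snoc : keys (P ++ c ∷ []) ≡ keys P ++ [ (i , j) ]
      keys-snoc = map-++ proj₁ P [ c ]
      to : 1 ≤ r × r ≤ bump k m l → (r , r + l) ∈ keys (P ++ c ∷ [])
      to (p , le) with k ≟ l
      ... | no n = subst ((r , r + l) ∈_) (sym keys-snoc) (MP.∈-++⁺ˡ (proj₁ (tr r l) (p , ≤-trans le (≤-reflexive (bump-diff k l m n)))))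
      ... | yes refl with m≤n⇒m<n∨m≡n (≤-trans le (≤-reflexive (bump-same k m)))
      ...   | inj₁ (s≤s lt) = subst ((r , r + l) ∈_) (sym keys-snoc) (MP.∈-++⁺ˡ (proj₁ (tr r k) (p , lt)))
      ...   | inj₂ refl = subst (_ ∈_) (sym keys-snoc) (MP.∈-++⁺ʳ (keys P) (here box≡))
      from : (r , r + l) ∈ keys (P ++ c ∷ []) → 1 ≤ r × r ≤ bump k m l
      from q with MP.∈-++⁻ (keys P) (subst ((r , r + l) ∈_) keys-snoc q)
      ... | inj₁ s with proj₂ (tr r l) s
      ...   | a , b = a , ≤-trans b (grow k)
        where
        grow : ∀ k → m l ≤ bump k m l
        grow k with k ≡ᵇ l
        ... | true = n≤1+n _
        ... | false = ≤-refl
      from q | inj₂ (here e) = subst (λ z → 1 ≤ z × z ≤ bump k m l) (sym r≡) (s≤s z≤n , subst (λ z → i ≤ bump k m z) k≡l (≤-reflexive (sym (trans (bump-same k m) (cong suc count)))))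
        where
        r≡ : r ≡ i
        r≡ = cong proj₁ e
        k≡l : k ≡ l
        k≡l = +-cancelˡ-≡ i k l (trans (sym j≡) (trans (sym (cong proj₂ e)) (cong (_+ l) r≡)))

  reading : ∀ P R m → S' ≡ P ++ R → Tracks P m → Legal m (labels (map codeOf R)) × cells m (map codeOf R) ≡ R
  reading P [] m eq tr = tt , refl
  reading P (((zero , j) , x) ∷ R) m eq tr =
    contradiction (proj₁ (inShapeOf (∈S (subst (_ ∈_) (sym eq) (MP.∈-++⁺ʳ P (here refl)))))) λ ()
  reading P (c@((suc i , j) , x) ∷ R) m eq tr
    with reading (P ++ [ c ]) R (bump (j ∸ suc i) m) (trans eq (sym (++-assoc P [ c ] R))) (tracks-next P i j x R eq m tr)
  ... | l , e = (stepOk P i j x R eq m tr , l) , cong₂ _∷_ (cong (_, x) (box≡ P i j x R eq m tr)) e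

  word : List Entry
  word = map codeOf S'

  private
    whole = reading [] S' empty refl (λ { i k → (λ { (p , le) → contradiction (≤-trans p le) λ () }) , λ () })

  word-legal : Legal empty (labels word)
  word-legal = proj₁ whole

  word-cells : ∀ {c} → (c ∈ S → c ∈ cells empty word) × (c ∈ cells empty word → c ∈ S)
  word-cells {c} = (λ q → subst (c ∈_) (sym (proj₂ whole)) (∈S' q)) , (λ q → ∈S (subst (c ∈_) (proj₂ whole) q))

  word-repr : ∀ i j → at S i j ≡ at (cells empty word) i j
  word-repr i j = trans (at-same i j) (cong (λ T → at T i j) (sym (proj₂ whole)))
    where
    at-same : ∀ i j → at S i j ≡ at S' i j
    at-same i j = trans (at-image {g = λ _ → just} (Unique⇒Keyed S' uniqueS') (record { from = λ q → _ , ∈S' q , refl ; to = λ { q refl → ∈S q } }) i j) (id-just (at S' i j))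
      where
      id-just : ∀ (z : Maybe Letter) → (z >>= just) ≡ z
      id-just nothing = refl
      id-just (just x) = refl

  word-pairs : AllPairs (λ e f → ¬ Before f e) word
  word-pairs = AllPairsP.map⁺ (AllPairs.map (λ {c} {d} → ⊑⇒≯ {c} {d}) sortedPairs)

Ok : Dir → Entry → Set
Ok none e = ⊤
Ok desc e = ⊤
Ok asc e = primed (proj₂ e) ≡ false
Ok flat e = ⊥

ok-end : ∀ s e → Ok s e → isPrimed (primed (proj₂ e)) s none ≡ just (primed (proj₂ e))
ok-end none e _ = refl
ok-end desc e _ = refl
ok-end asc e u = cong just (sym u)

sorted-above : ∀ {e f L} → Sorted (e ∷ f ∷ L) → value f ≢ value e → All (λ g → value g ≢ value e) (f ∷ L)
sorted-above {e} ((ef ∷ _) ∷ (le ∷ _)) n = n ∷ All.map (λ fg q → ℤP.<-irrefl (sym q) (ℤP.<-≤-trans (ℤP.≤∧≢⇒< ef (n ∘ sym)) fg)) le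

-- After an ascent the rest of the block is ascending, and there `isPrimed` does not consult the
-- bit; so the bit of this value can still be chosen by an earlier entry.
Coh-asc-ε : ∀ {ε ε' : ℤ → Bool} e L → Sorted (e ∷ L) → Coh ε asc (e ∷ L) → (∀ w → w ≢ value e → ε w ≡ ε' w) → Coh ε' asc (e ∷ L)
Coh-asc-ε e [] s (o , _) h = o , tt
Coh-asc-ε {ε} {ε'} e (f ∷ L) ss@(_ ∷ s) (o , c) h = go (value f ℤP.≟ value e)
  where
  go : Dec (value f ≡ value e) → Coh ε' asc (e ∷ f ∷ L)
  go (no n) = trans (cong (isPrimed (ε' (value e)) asc) d) (trans (sym (cong (isPrimed (ε (value e)) asc) d)) o) ,
    Coh-ε (f ∷ L) (All.map (λ q → h _ q) (sorted-above ss n)) c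
    where d = dir-diff e f (n ∘ sym)
  go (yes v) with dir-view (o , c) v
  ... | isDesc _ d = contradiction d (proj₁ (proj₂ (incoming-asc (ε (value e)) (dir e f) o)))
  ... | isAsc _ d = trans (cong (isPrimed (ε' (value e)) asc) d) (trans (sym (cong (isPrimed (ε (value e)) asc) d)) o) ,
    subst (λ t → Coh ε' t (f ∷ L)) (sym d) (Coh-asc-ε f L s (subst (λ t → Coh ε t (f ∷ L)) d c) (λ w n → h w (λ q → n (trans q (sym v)))))

upd : (ℤ → Bool) → ℤ → Bool → ℤ → Bool
upd ε v b w = if w ==ℤ v then b else ε w

upd-same : ∀ ε v b → upd ε v b v ≡ b
upd-same ε v b = cong (if_then b else ε v) (==ℤ-refl v)

upd-diff : ∀ ε v b w → w ≢ v → ε w ≡ upd ε v b w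
upd-diff ε v b w n = sym (cong (if_then b else ε w) (==ℤ-false n))

-- The bits are found from right to left. An entry followed by an ascent or by the end of its block
-- may be the bottom of the valley and sets the bit to its own prime, which harms no later entry; an
-- entry followed by a descent leaves the bit to the entries after it. The quantifier over `s`
-- postpones the question from where the entry was reached.
reading-coh : ∀ m e L → Legal m (labels (e ∷ L)) → AllPairs (λ e f → ¬ Before f e) (e ∷ L) → Sorted (e ∷ L) →
              ∃ λ ε → ∀ s → Ok s e → Coh ε s (e ∷ L)
reading-coh m e [] lg ps ss = (λ _ → primed (proj₂ e)) , λ s ok → ok-end s e ok , tt
reading-coh m (k , x) ((l , y) ∷ L) lg ((p ∷ _) ∷ ps) ss@(_ ∷ ss') with reading-coh (bump k m) (l , y) L (proj₂ lg) ps ss'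
... | ε' , h = go (val y ℤP.≟ val x)
  where
  e f : Entry
  e = k , x
  f = l , y
  Goal : Set
  Goal = ∃ λ ε → ∀ s → Ok s e → Coh ε s (e ∷ f ∷ L)
  k≢l : k ≢ l
  k≢l = legal-≢ {m} {k} {l} {labels L} lg
  isDown : val x ≡ val y → l < k → dir e f ≡ desc
  isDown v lt = trans (dir-same e f v) (>⇒cmp lt)
  isUp : val x ≡ val y → k < l → dir e f ≡ asc
  isUp v lt = trans (dir-same e f v) (<⇒cmp lt)
  descending : dir e f ≡ desc → primed x ≡ true → Goal
  descending d u = ε' , λ s ok → trans (cong (isPrimed (ε' (val x)) s) d) (lemma s ok) , subst (λ t → Coh ε' t (f ∷ L)) (sym d) (h desc tt)
    where
    lemma : ∀ s → Ok s e → isPrimed (ε' (val x)) s desc ≡ just (primed x)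
    lemma none _ = cong just (sym u)
    lemma desc _ = cong just (sym u)
    lemma asc q = contradiction (trans (sym u) q) λ ()
  ascending′ : val x ≡ val y → dir e f ≡ asc → primed y ≡ false → Goal
  ascending′ v d u = ε , λ s ok → trans (cong₂ (λ b t → isPrimed b s t) (upd-same ε' (val x) (primed x)) d) (lemma s ok) ,
      subst (λ t → Coh ε t (f ∷ L)) (sym d) (Coh-asc-ε f L ss' (h asc u) (λ w n → upd-diff ε' (val x) (primed x) w (λ q → n (trans q v))))
    where
    ε = upd ε' (val x) (primed x)
    lemma : ∀ s → Ok s e → isPrimed (primed x) s asc ≡ just (primed x)
    lemma none _ = refl
    lemma desc _ = refl
    lemma asc q = cong just (sym q)
  same : ∀ x' y' → x' ≡ x → y' ≡ y → val x ≡ val y → Goal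
  same (un a) (un b) refl refl v = ascending′ v (isUp v (≤∧≢⇒< (≮⇒≥ λ lt → p (inj₂ (sym v , +<+ lt))) k≢l)) refl
  same (un a) (pr b) refl refl v = contradiction (inj₂ (sym v , -<+)) p
  same (pr a) (pr b) refl refl v = descending (isDown v (≤∧≢⇒< (≮⇒≥ λ lt → p (inj₂ (sym v , -<- lt))) (k≢l ∘ sym))) refl
  same (pr a) (un b) refl refl v with <-cmp k l
  ... | tri< lt _ _ = ascending′ v (isUp v lt) refl
  ... | tri≈ _ q _ = contradiction q k≢l
  ... | tri> _ _ lt = descending (isDown v lt) refl
  go : Dec (val y ≡ val x) → Goal
  go (yes v) = same x y refl refl (sym v)
  go (no n) = ε , λ s ok → trans (cong₂ (λ b t → isPrimed b s t) (upd-same ε' (val x) (primed x)) d) (ok-end s e ok) ,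
      subst (λ t → Coh ε t (f ∷ L)) (sym d) (Coh-ε (f ∷ L) (All.map (λ q → upd-diff ε' (val x) (primed x) _ q) (sorted-above ss n)) (h none tt))
    where
    ε = upd ε' (val x) (primed x)
    d = dir-diff e f (n ∘ sym)

-- The star operation on words.

starE : Entry → Entry
starE e = proj₁ e , star (proj₂ e)

value-star : ∀ e → value (starE e) ≡ ℤ.- value e
value-star e = val-star (proj₂ e)

opp : Dir → Dir
opp none = none
opp asc = desc
opp desc = asc
opp flat = flat

isPrimed-opp : ∀ ε s t {b} → isPrimed ε s t ≡ just b → isPrimed (not ε) (opp t) (opp s) ≡ just (not b)
isPrimed-opp ε none none refl = refl
isPrimed-opp ε none asc refl = refl
isPrimed-opp ε desc none refl = refl
isPrimed-opp ε desc asc refl = refl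
isPrimed-opp ε none desc refl = refl
isPrimed-opp ε desc desc refl = refl
isPrimed-opp ε asc none refl = refl
isPrimed-opp ε asc asc refl = refl

cmp-opp : ∀ k l → cmp l k ≡ opp (cmp k l)
cmp-opp k l with <-cmp k l
... | tri< lt _ _ = trans (>⇒cmp lt) (cong opp (sym (<⇒cmp lt)))
... | tri≈ _ refl _ = trans (≡⇒cmp k) (cong opp (sym (≡⇒cmp k)))
... | tri> _ _ lt = trans (<⇒cmp lt) (cong opp (sym (>⇒cmp lt)))

dir-star : ∀ e f → dir (starE f) (starE e) ≡ opp (dir e f)
dir-star e f = go (value e ℤP.≟ value f)
  where
  go : Dec (value e ≡ value f) → dir (starE f) (starE e) ≡ opp (dir e f)
  go (yes v) = trans (dir-same (starE f) (starE e) (trans (value-star f) (trans (cong (ℤ.-_) (sym v)) (sym (value-star e)))))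
                 (trans (cmp-opp (proj₁ e) (proj₁ f)) (cong opp (sym (dir-same e f v))))
  go (no n) = trans (dir-diff (starE f) (starE e) (λ q → n (ℤP.neg-injective (trans (sym (value-star e)) (trans (sym q) (value-star f))))))
                (cong opp (sym (dir-diff e f n)))

primed-star : ∀ x → primed (star x) ≡ not (primed x)
primed-star (un k) = refl
primed-star (pr k) = refl

mirror-star : ∀ ε e → mirror ε (value (starE e)) ≡ not (ε (value e))
mirror-star ε e = cong (λ z → not (ε z)) (trans (cong (ℤ.-_) (value-star e)) (ℤP.neg-involutive (value e)))

-- Reversal exchanges the entering and the leaving sign and inverts both. This maps the descending,
-- primed side of a valley to the ascending, unprimed one, in accordance with the flip of primes.
rev-coh : ∀ {ε} s e L acc → Coh ε s (e ∷ L) → nextDir (starE e) acc ≡ opp s → Coh (mirror ε) (opp s) acc →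
          Coh (mirror ε) none (reverseAcc acc (map starE (e ∷ L)))
rev-coh {ε} s e L acc c n a = go L c
  where
  turn : ∀ t → isPrimed (ε (value e)) s t ≡ just (primed (proj₂ e)) → Coh (mirror ε) (opp t) (starE e ∷ acc)
  turn t o = trans (cong₂ (λ b q → isPrimed b (opp t) q) (mirror-star ε e) n)
      (trans (isPrimed-opp (ε (value e)) s t o) (cong just (sym (primed-star (proj₂ e))))) ,
    subst (λ q → Coh (mirror ε) q acc) (sym n) a
  go : ∀ L → Coh ε s (e ∷ L) → Coh (mirror ε) none (reverseAcc acc (map starE (e ∷ L)))
  go [] (o , _) = turn none o
  go (f ∷ L) (o , c') = rev-coh (dir e f) f L (starE e ∷ acc) c' (dir-star e f) (turn (dir e f) o)

revStar : List Entry → List Entry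
revStar L = reverse (map starE L)

revStar-coh : ∀ {ε} L → Coh ε none L → Coh (mirror ε) none (revStar L)
revStar-coh [] c = tt
revStar-coh (e ∷ L) c = rev-coh none e L [] c refl tt

-- All signs are computed from diagonals and values, and the signs together with the bit of the
-- value give each prime.
coh-unique : ∀ {ε s} L L' → labels L ≡ labels L' → map value L ≡ map value L' → Coh ε s L → Coh ε s L' → L ≡ L'
coh-unique [] [] _ _ _ _ = refl
coh-unique {ε} {s} ((k , x) ∷ L) ((k' , x') ∷ L') lab vs (o , c) (o' , c') = cong₂ _∷_ (cong₂ _,_ k≡ x≡)
    (coh-unique L L' (tails lab) (tails vs) c (subst (λ t → Coh ε t L') (sym d) c'))
  where
  heads : ∀ {A : Set} {a b : A} {X Y : List A} → a ∷ X ≡ b ∷ Y → a ≡ b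
  heads refl = refl
  tails : ∀ {A : Set} {a b : A} {X Y : List A} → a ∷ X ≡ b ∷ Y → X ≡ Y
  tails refl = refl
  k≡ : k ≡ k'
  k≡ = heads lab
  v≡ : val x ≡ val x'
  v≡ = heads vs
  dirs : ∀ L L' → labels L ≡ labels L' → map value L ≡ map value L' → nextDir (k , x) L ≡ nextDir (k' , x') L'
  dirs [] [] _ _ = refl
  dirs ((l , y) ∷ _) ((l' , y') ∷ _) p q = trans (cong₂ (λ a b → if val x ==ℤ b then cmp k a else none) (heads p) (heads q))
    (cong₂ (λ a b → if b ==ℤ val y' then cmp a l' else none) k≡ v≡)
  d : nextDir (k , x) L ≡ nextDir (k' , x') L'
  d = dirs L L' (tails lab) (tails vs)
  letter : ∀ x x' → val x ≡ val x' → primed x ≡ primed x' → x ≡ x'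
  letter (un a) (un b) refl _ = refl
  letter (pr a) (pr b) refl _ = refl
  x≡ : x ≡ x'
  x≡ = letter x x' v≡ (just-injective (trans (sym o) (trans (cong₂ (λ v t → isPrimed (ε v) s t) v≡ d) o')))

Keyed-cells : ∀ {A : Set} m (L : Code A) → Keyed (cells m L)
Keyed-cells m ((k , x) ∷ L) (here refl) rewrite hit-refl (suc (m k)) (suc (m k) + k) = refl
Keyed-cells m ((k , x) ∷ L) {i , j} {y} (there q) with hit (suc (m k)) (suc (m k) + k) i j in e
... | false = Keyed-cells (bump k m) L q
... | true with hit-true (suc (m k)) (suc (m k) + k) i j e
...   | refl , refl = contradiction (trans (at-cells (bump k m) L i k) (look-below (bump k m) L i k (≤-reflexive (sym (bump-same k m)))))
                        (∈-at (cells (bump k m) L) q)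

module Complement (n : ℕ) where

  -- Diagonal `k` of the staircase of size `n` has `n - k` boxes, so `s` and `m` are complementary;
  -- `starBox` maps each diagonal to itself and reverses it.
  Comp : State → State → Set
  Comp s m = ∀ k → s k + m k ≡ n ∸ k

  starBox : Box × Letter → Box × Letter
  starBox c = (suc n ∸ proj₂ (proj₁ c) , suc n ∸ proj₁ (proj₁ c)) , star (proj₂ c)

  module _ (s m : State) (k : ℕ) (co : Comp s (bump k m)) where

    here≡ : s k + suc (m k) ≡ n ∸ k
    here≡ = trans (cong (s k +_) (sym (bump-same k m))) (co k)

    there≡ : ∀ l → k ≢ l → s l + m l ≡ n ∸ l
    there≡ l ne = trans (cong (s l +_) (sym (bump-diff k l m ne))) (co l)

    comp-step : Comp (bump k s) m
    comp-step l with k ≟ l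
    ... | yes refl = trans (cong (_+ m k) (bump-same k s)) (trans (sym (+-suc (s k) (m k))) here≡)
    ... | no ne = trans (cong (_+ m l) (bump-diff k l s ne)) (there≡ l ne)

    k≤n : k ≤ n
    k≤n = <⇒≤ (m∸n≢0⇒n<m λ z → 1+n≢0 (trans (sym (trans (sym here≡) (+-suc (s k) (m k)))) z))

    box-star : ∀ x → ((suc (s k) , suc (s k) + k) , star x) ≡ starBox ((suc (m k) , suc (m k) + k) , x)
    box-star x = cong₂ (λ a b → (a , b) , star x) (sym row≡) (sym col≡)
      where
      total : n ∸ k ≡ suc (s k) + m k
      total = trans (sym here≡) (+-suc (s k) (m k))
      row≡ : n ∸ (m k + k) ≡ suc (s k)
      row≡ = trans (cong (n ∸_) (+-comm (m k) k)) (trans (sym (∸-+-assoc n k (m k))) (trans (cong (_∸ m k) total) (m+n∸n≡m (suc (s k)) (m k))))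
      col≡ : n ∸ m k ≡ suc (s k) + k
      col≡ = trans (cong (_∸ m k) (trans (sym (m+[n∸m]≡n k≤n)) (trans (cong (k +_) total) (sym (+-assoc k (suc (s k)) (m k))))))
        (trans (m+n∸n≡m (k + suc (s k)) (m k)) (+-comm k (suc (s k))))

    step-star : Step m k → Step s k
    step-star (nx , w) = +-cancelʳ-≡ (m (suc k)) (s k) (s (suc k))
        (trans (cong (s k +_) (sym nx)) (suc-injective (trans (sym (+-suc (s k) (m k))) (trans here≡ (trans (n∸k (<-≤-trans (s≤s z≤n) (≤-trans (≤-reflexive (sym (+-suc (s k) (m k)))) (≤-reflexive here≡)))) (cong suc (sym (there≡ (suc k) (λ e → 1+n≢n (sym e)))))))))) , west k refl w
      where
      n∸k : ∀ {k} → 0 < n ∸ k → n ∸ k ≡ suc (n ∸ suc k)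
      n∸k {k} p = +-∸-assoc 1 {n} {suc k} (m∸n≢0⇒n<m λ z → <⇒≢ p (sym z))
      west : ∀ l → k ≡ l → West m l → West s l
      west zero e _ = tt
      west (suc l) e w = +-cancelʳ-≡ (m l) (s l) (suc (s (suc l))) (trans (there≡ l (λ q → 1+n≢n (trans (sym e) q)))
          (trans (n∸k (≤-trans pos (∸-monoʳ-≤ n (n≤1+n l)))) (cong suc (trans (sym suc≡) (cong (s (suc l) +_) (sym w))))))
        where
        suc≡ : s (suc l) + suc (m (suc l)) ≡ n ∸ suc l
        suc≡ = subst (λ z → s z + suc (m z) ≡ n ∸ z) e here≡
        pos : 0 < n ∸ suc l
        pos = ≤-trans (≤-trans (s≤s z≤n) (≤-reflexive (sym (+-suc (s (suc l)) (m (suc l)))))) (≤-reflexive suc≡)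

  record Reversed (m mm : State) (L : List Entry) : Set where
    constructor reversed
    field
      legal  : Legal mm (labels (revStar L))
      comp   : Comp (adv mm (labels (revStar L))) m
      boxes  : cells mm (revStar L) ≡ reverse (map starBox (cells m L))

  -- Taking a box off the end of `L` adds its mirror image to the complement. A corner at which one
  -- shape ends is a place at which the other can grow (`step-star`), so the reversed word is legal
  -- from the complement `mm`.
  reverse-reading : ∀ L m mm → Comp mm (adv m (labels L)) → Legal m (labels L) → Reversed m mm L
  reverse-reading [] m mm co lg = reversed tt co refl
  reverse-reading ((k , x) ∷ L) m mm co (st , lg) with reverse-reading L (bump k m) mm co lg
  ... | reversed l c b = reversed
      (subst (Legal mm) (sym lab) (++-Legal mm (labels (revStar L)) l (step-star (adv mm (labels (revStar L))) m k c st , tt)))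
      (subst (λ w → Comp (adv mm w) m) (sym lab) (subst (λ g → Comp g m) (sym (adv-++ mm (labels (revStar L)) [ k ])) (comp-step (adv mm (labels (revStar L))) m k c)))
      (trans (cong (cells mm) snoc) (trans (cells-++ mm (revStar L) [ k , star x ])
        (trans (cong₂ _++_ b (cong [_] (box-star (adv mm (labels (revStar L))) m k c x))) (sym (unfold-reverse _ (map starBox (cells (bump k m) L)))))))
    where
    snoc : revStar ((k , x) ∷ L) ≡ revStar L ∷ʳ (k , star x)
    snoc = unfold-reverse (k , star x) (map starE L)
    lab : labels (revStar ((k , x) ∷ L)) ≡ labels (revStar L) ++ [ k ]
    lab = trans (cong labels snoc) (labels-++ (revStar L) [ k , star x ])

-- The inner shape of the starred tableau.

trues : List Bool → ℕ
trues [] = 0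
trues (true ∷ bs) = suc (trues bs)
trues (false ∷ bs) = trues bs

starRow : List ℕ → ℕ → ℕ
starRow λs r = trues (map (λ c → not (inShape λs (suc (rowLen λs 1) ∸ c) (suc (rowLen λs 1) ∸ r))) (map (r +_) (upTo (suc (rowLen λs 1) ∸ r))))

keep : List ℕ → List ℕ
keep = filterᵇ (λ k → 0 <ᵇ k)

keep-singleton : ∀ a b → keep (a ∷ []) ≡ keep (b ∷ []) → a ≡ b
keep-singleton zero zero e = refl
keep-singleton zero (suc b) ()
keep-singleton (suc a) zero ()
keep-singleton (suc a) (suc .a) refl = refl

-- The row lengths in the definition of starInner are local to it.  With the two
-- uses of map replaced by variables they occur in the inferred type of rows-≡,
-- and a special choice of the variables isolates the counting function.

MapLike : ((ℕ → ℕ) → List ℕ → List ℕ) → Set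
MapLike mp = ∀ f g xs → (∀ x → f x ≡ g x) → mp f xs ≡ mp g xs

rows-≡ : ∀ (λs : List ℕ) (mp : (ℕ → ℕ) → List ℕ → List ℕ) (mb : (ℕ → Bool) → List ℕ → List Bool) (like : MapLike mp) → _

starInner-def : ∀ λs → starInner λs ≡ keep (map (starRow λs) (map suc (upTo (rowLen λs 1))))
starInner-def λs with map {A = ℕ} {B = ℕ} | map {A = ℕ} {B = Bool} | (λ (f g : ℕ → ℕ) (xs : List ℕ) (h : ∀ x → f x ≡ g x) → map-cong {A = ℕ} {B = ℕ} h xs)
... | mp | mb | like = rows-≡ λs mp mb like

trues-≡ : ∀ λs bs → TypeOf (rows-≡ λs (λ f _ → f 0 ∷ []) (λ _ _ → bs) (λ f g xs h → cong (_∷ []) (h 0)))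
trues-≡ λs [] = refl
trues-≡ λs (true ∷ bs) = cong (λ z → keep (suc z ∷ [])) (keep-singleton _ _ (trues-≡ λs bs))
trues-≡ λs (false ∷ bs) = trues-≡ λs bs

rows-≡ λs mp mb like = cong keep (like _ _ (mp suc (upTo (rowLen λs 1))) (λ r → keep-singleton _ _
  (trues-≡ λs (mb (λ c → not (inShape λs (suc (rowLen λs 1) ∸ c) (suc (rowLen λs 1) ∸ r))) (mp (r +_) (upTo (suc (rowLen λs 1) ∸ r)))))))

-- Under the hypothesis the places with value true come first, so counting them locates where they
-- end.
trues-applyUpTo : ∀ N b → (∀ k → suc k < N → b (suc k) ≡ true → b k ≡ true) → ∀ k → (k <ᵇ trues (applyUpTo b N)) ≡ (b k ∧ (k <ᵇ N))
trues-applyUpTo zero b h k = sym (∧-zeroʳ (b k))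
trues-applyUpTo (suc N) b h k = go (b 0) refl k
  where
  ih = trues-applyUpTo N (b ∘ suc) (λ k lt → h (suc k) (s≤s lt))
  all-false : b 0 ≡ false → ∀ k → k < suc N → b k ≡ false
  all-false e zero lt = e
  all-false e (suc k) lt with b (suc k) in q
  ... | false = refl
  ... | true = contradiction (trans (sym (all-false e k (<-trans (n<1+n k) lt))) (h k lt q)) λ ()
  none-at : b 0 ≡ false → ∀ k → b k ∧ (k <ᵇ suc N) ≡ false
  none-at e k with <-≤-connex k (suc N)
  ... | inj₁ lt = cong (_∧ (k <ᵇ suc N)) (all-false e k lt)
  ... | inj₂ ge = trans (cong (b k ∧_) (≤⇒<ᵇ-false ge)) (∧-zeroʳ (b k))
  none-after : b 0 ≡ false → ∀ k → b (suc k) ∧ (k <ᵇ N) ≡ false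
  none-after e k with <-≤-connex k N
  ... | inj₁ lt = cong (_∧ (k <ᵇ N)) (all-false e (suc k) (s≤s lt))
  ... | inj₂ ge = trans (cong (b (suc k) ∧_) (≤⇒<ᵇ-false ge)) (∧-zeroʳ (b (suc k)))
  go : ∀ z → b 0 ≡ z → ∀ k → (k <ᵇ trues (z ∷ applyUpTo (b ∘ suc) N)) ≡ (b k ∧ (k <ᵇ suc N))
  go true e zero = cong (_∧ true) (sym e)
  go true e (suc k) = ih k
  go false e k = trans (ih k) (trans (none-after e k) (sym (none-at e k)))

rowWord-keep : ∀ μ → rowWord (keep μ) ≡ rowWord μ
rowWord-keep [] = refl
rowWord-keep (zero ∷ μ) = rowWord-keep μ
rowWord-keep (suc x ∷ μ) = cong (range 0 (suc x) ++_) (rowWord-keep μ)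

rowWord-adv : ∀ n f k d → (∀ r → r < n → (k <ᵇ f r) ≡ (r <ᵇ d)) → d ≤ n → adv empty (rowWord (applyUpTo f n)) k ≡ d
rowWord-adv zero f k zero h le = refl
rowWord-adv (suc n) f k d h le = trans (cong (λ g → g k) (adv-++ empty (range 0 (f 0)) _)) (trans (adv-+ _ (rowWord (applyUpTo (f ∘ suc) n)) k) (go d h le))
  where
  go : ∀ d → (∀ r → r < suc n → (k <ᵇ f r) ≡ (r <ᵇ d)) → d ≤ suc n →
       adv empty (range 0 (f 0)) k + adv empty (rowWord (applyUpTo (f ∘ suc) n)) k ≡ d
  go zero h le = cong₂ _+_ (adv-range-∉ empty 0 (f 0) k (inj₂ (≮⇒≥ λ lt → contradiction (trans (sym (<⇒<ᵇ-true lt)) (h 0 (s≤s z≤n))) λ ())))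
    (rowWord-adv n (f ∘ suc) k zero (λ r lt → h (suc r) (s≤s lt)) z≤n)
  go (suc d) h (s≤s le) = cong₂ _+_ (adv-range-∈ empty 0 (f 0) k z≤n (<ᵇ-true (h 0 (s≤s z≤n))))
    (rowWord-adv n (f ∘ suc) k d (λ r lt → h (suc r) (s≤s lt)) le)

range-legal : ∀ d a m r → (∀ k → a ≤ k → k ≤ a + d → m k ≡ r) → West m a → Legal m (range a d)
range-legal zero a m r h w = tt
range-legal (suc d) a m r h w = (trans here≡ (sym next≡) , w) , range-legal d (suc a) (bump a m) r
    (λ k lo hi → trans (bump-diff a k m (<⇒≢ lo)) (h k (<⇒≤ lo) (≤-trans hi (≤-reflexive (sym (+-suc a d))))))
    (trans (bump-same a m) (cong suc (trans here≡ (trans (sym next≡) (sym (bump-diff a (suc a) m (<⇒≢ (n<1+n a))))))))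
  where
  here≡ : m a ≡ r
  here≡ = h a ≤-refl (m≤m+n a (suc d))
  next≡ : m (suc a) ≡ r
  next≡ = h (suc a) (n≤1+n a) (≤-trans (s≤s (m≤m+n a d)) (≤-reflexive (sym (+-suc a d))))

rowWord-legal : ∀ μ m r z → (∀ k → k < z → m k ≡ r) → AllPairs (λ a b → b < a) μ → All (_< z) μ → Legal m (rowWord μ)
rowWord-legal [] m r z h s b = tt
rowWord-legal (x ∷ μ) m r z h (l ∷ s) (lt ∷ _) = ++-Legal m (range 0 x) (range-legal x 0 m r (λ k _ le → h k (≤-<-trans le lt)) tt)
  (rowWord-legal μ _ (suc r) x (λ k k<x → trans (adv-range-∈ m 0 x k z≤n k<x) (cong suc (h k (<-trans k<x lt)))) s l)

module Inner {λs : List ℕ} {S : Cells} (syt : IsSYTNormal λs S) where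
  open Reading syt

  n : ℕ
  n = rowLen λs 1

  c : State
  c = adv empty (labels word)

  c-shape : Shape c
  c-shape = Shape-adv (labels word) Shape-empty word-legal

  in-shape⇒ : ∀ i k → InShape λs (suc i) (suc i + k) → i < c k
  in-shape⇒ i k s with entry-at s
  ... | x , q with <-≤-connex i (c k)
  ...   | inj₁ lt = lt
  ...   | inj₂ ge = contradiction (trans (word-repr (suc i) (suc i + k)) (trans (at-cells empty word (suc i) k)
            (trans (cong (λ Z → look empty Z (suc i) k) (sym (++-identityʳ word))) (look-skip empty word [] (suc i) k (s≤s ge))))) (∈-at S q)

  in-shape⇐ : ∀ i k → i < c k → InShape λs (suc i) (suc i + k)
  in-shape⇐ i k lt = go (at S (suc i) (suc i + k)) refl
    where
    go : ∀ z → at S (suc i) (suc i + k) ≡ z → InShape λs (suc i) (suc i + k)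
    go (just x) e = inShapeOf (at-∈ S (suc i) (suc i + k) e)
    go nothing e = contradiction (trans (sym (at-cells empty word (suc i) k)) (trans (sym (word-repr (suc i) (suc i + k))) e))
      (look-within empty word (suc i) k (s≤s z≤n) lt)

  c-bound : ∀ k → c k ≤ n ∸ k
  c-bound k = go (c k) refl
    where
    go : ∀ r → c k ≡ r → r ≤ n ∸ k
    go zero e = z≤n
    go (suc i) e with north-of (s≤s z≤n) (s≤s z≤n) (in-shape⇐ i k (≤-reflexive (sym e)))
    ... | _ , _ , _ , lt = m+n≤o⇒m≤o∸n (suc i) (≤-pred (≤-trans lt (≤-reflexive (+-comm n 1))))

  inShape-true : ∀ i j → InShape λs i j → inShape λs i j ≡ true
  inShape-true i j (p , q , le , lt) rewrite <⇒<ᵇ-true p | <⇒<ᵇ-true q | <⇒<ᵇ-true lt with m≤n⇒m<n∨m≡n le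
  ... | inj₁ l rewrite <⇒<ᵇ-true l = refl
  ... | inj₂ refl rewrite ≡ᵇ-refl i | ≤⇒<ᵇ-false (≤-refl {i}) = refl

  inShape-true⁻ : ∀ i j → inShape λs i j ≡ true → InShape λs i j
  inShape-true⁻ i j e with 0 <ᵇ i in a | 0 <ᵇ rowLen λs i in b | i <ᵇ j in d | i ≡ᵇ j in d' | j <ᵇ rowLen λs i + i in l
  ... | true | true | true | _ | true = <ᵇ-true a , <ᵇ-true b , <⇒≤ (<ᵇ-true d) , <ᵇ-true l
  ... | true | true | false | true | true = <ᵇ-true a , <ᵇ-true b , ≤-reflexive (≡ᵇ-true d') , <ᵇ-true l

  inShape-count : ∀ i k → inShape λs (suc i) (suc i + k) ≡ (i <ᵇ c k)
  inShape-count i k with <-≤-connex i (c k)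
  ... | inj₁ lt = trans (inShape-true (suc i) (suc i + k) (in-shape⇐ i k lt)) (sym (<⇒<ᵇ-true lt))
  ... | inj₂ ge with inShape λs (suc i) (suc i + k) in e
  ...   | false = sym (≤⇒<ᵇ-false ge)
  ...   | true = contradiction ge (<⇒≱ (in-shape⇒ i k (inShape-true⁻ (suc i) (suc i + k) e)))

  -- The counts of the complement of the shape in the staircase. `row-length-<` then says that row
  -- `r` of the inner shape reaches diagonal `k` exactly when `r < d k`, which identifies the
  -- computed rows with this complement.
  d : State
  d k = (n ∸ k) ∸ c k

  d-≤ : ∀ k → suc k ≤ n → d (suc k) ≤ d k
  d-≤ k lt = go (c-shape k)
    where
    sub : n ∸ k ≡ suc (n ∸ suc k)
    sub = +-∸-assoc 1 {n} {suc k} lt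
    go : (c k ≡ c (suc k)) ⊎ (c k ≡ suc (c (suc k))) → d (suc k) ≤ d k
    go (inj₁ e) = subst₂ (λ a b → (n ∸ suc k) ∸ c (suc k) ≤ a ∸ b) (sym sub) (sym e) (∸-monoˡ-≤ (c (suc k)) (n≤1+n _))
    go (inj₂ e) = subst₂ (λ a b → (n ∸ suc k) ∸ c (suc k) ≤ a ∸ b) (sym sub) (sym e) ≤-refl

  d-≥ : ∀ k → d k ≤ suc (d (suc k))
  d-≥ k = m≤n+o⇒m∸n≤o (n ∸ k) (c k) (≤-trans sub (≤-trans (s≤s (m≤n+m∸n (n ∸ suc k) (c (suc k))))
      (≤-trans (≤-reflexive (sym (+-suc (c (suc k)) (d (suc k))))) (+-monoˡ-≤ (suc (d (suc k))) mono))))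
    where
    mono : c (suc k) ≤ c k
    mono with c-shape k
    ... | inj₁ e = ≤-reflexive (sym e)
    ... | inj₂ e = ≤-trans (n≤1+n _) (≤-reflexive (sym e))
    sub : n ∸ k ≤ suc (n ∸ suc k)
    sub = m≤n+o⇒m∸n≤o n k (≤-trans (m≤n+m∸n n (suc k)) (≤-reflexive (sym (+-suc k (n ∸ suc k)))))

  outside : ℕ → ℕ → Bool
  outside r k = not (inShape λs (n ∸ (r + k)) (n ∸ r))

  outside-≡ : ∀ r k → k < n ∸ r → outside r k ≡ (r <ᵇ d k)
  outside-≡ r k lt = go (n ∸ (r + k)) refl
    where
    rk<n : r + k < n
    rk<n = ≤-trans (≤-reflexive (cong suc (+-comm r k))) (m≤o∸n⇒m+n≤o (suc k) (<⇒≤ (m∸n≢0⇒n<m λ z → n≮0 (subst (k <_) z lt))) lt)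
    go : ∀ z → n ∸ (r + k) ≡ z → outside r k ≡ (r <ᵇ d k)
    go zero e = contradiction (m∸n≡0⇒m≤n e) (<⇒≱ rk<n)
    go (suc i) e = trans (cong not (trans (cong₂ (inShape λs) e col) (inShape-count i k))) (trans (flip (<-≤-connex i (c k))) refl)
      where
      total : n ≡ suc i + (r + k)
      total = trans (sym (m∸n+n≡m (<⇒≤ rk<n))) (cong (_+ (r + k)) e)
      col : n ∸ r ≡ suc i + k
      col = trans (cong (_∸ r) (trans total (trans (cong (suc i +_) (+-comm r k)) (sym (+-assoc (suc i) k r))))) (m+n∸n≡m (suc i + k) r)
      n∸k : n ∸ k ≡ suc i + r
      n∸k = trans (cong (_∸ k) (trans total (sym (+-assoc (suc i) r k)))) (m+n∸n≡m (suc i + r) k)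
      flip : (i < c k) ⊎ (c k ≤ i) → not (i <ᵇ c k) ≡ (r <ᵇ d k)
      flip (inj₁ p) = trans (cong not (<⇒<ᵇ-true p)) (sym (≤⇒<ᵇ-false (m≤n+o⇒m∸n≤o (n ∸ k) (c k) (≤-trans (≤-reflexive n∸k) (+-monoˡ-≤ r p)))))
      flip (inj₂ p) = trans (cong not (≤⇒<ᵇ-false p)) (sym (<⇒<ᵇ-true (m+n≤o⇒m≤o∸n (suc r)
        (≤-trans (≤-reflexive (+-comm (suc r) (c k))) (≤-trans (+-monoˡ-≤ (suc r) p) (≤-trans (≤-reflexive (+-suc i r)) (≤-reflexive (sym n∸k))))))))

  row-length : ∀ r → ℕ
  row-length r = starRow λs (suc r)

  row-length-≡ : ∀ r → row-length r ≡ trues (applyUpTo (outside r) (n ∸ r))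
  row-length-≡ r = cong trues (trans (cong (map (λ z → not (inShape λs (suc n ∸ z) (n ∸ r)))) (map-applyUpTo id (suc r +_) (n ∸ r)))
    (map-applyUpTo (suc r +_) (λ z → not (inShape λs (suc n ∸ z) (n ∸ r))) (n ∸ r)))

  row-length-< : ∀ k r → (k <ᵇ row-length r) ≡ (r <ᵇ d k)
  row-length-< k r = trans (cong (k <ᵇ_) (row-length-≡ r)) (trans (trues-applyUpTo (n ∸ r) (outside r) mono k) (go (<-≤-connex k (n ∸ r))))
    where
    mono : ∀ k → suc k < n ∸ r → outside r (suc k) ≡ true → outside r k ≡ true
    mono k lt e = trans (outside-≡ r k (<-trans (n<1+n k) lt)) (<⇒<ᵇ-true (<-≤-trans (<ᵇ-true (trans (sym (outside-≡ r (suc k) lt)) e))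
      (d-≤ k (≤-trans (<⇒≤ lt) (m∸n≤m n r)))))
    go : (k < n ∸ r) ⊎ (n ∸ r ≤ k) → (outside r k ∧ (k <ᵇ n ∸ r)) ≡ (r <ᵇ d k)
    go (inj₁ lt) rewrite <⇒<ᵇ-true lt = trans (∧-true (outside r k)) (outside-≡ r k lt)
      where
      ∧-true : ∀ b → b ∧ true ≡ b
      ∧-true true = refl
      ∧-true false = refl
    go (inj₂ ge) = trans (cong (outside r k ∧_) (≤⇒<ᵇ-false ge)) (trans (∧-zeroʳ (outside r k))
      (sym (≤⇒<ᵇ-false (≤-trans (m∸n≤m (n ∸ k) (c k)) (m≤n+o⇒m∸n≤o n k (≤-trans (m≤n+m∸n n r) (≤-trans (+-monoʳ-≤ r ge) (≤-reflexive (+-comm r k)))))))))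

  inner≡ : starInner λs ≡ keep (applyUpTo row-length n)
  inner≡ = trans (starInner-def λs) (cong keep (trans (cong (map (starRow λs)) (map-applyUpTo id suc n)) (map-applyUpTo suc (starRow λs) n)))

  open Complement n

  inner-comp : Comp (adv empty (rowWord (starInner λs))) c
  inner-comp k = trans (cong (_+ c k) (trans (cong (λ w → adv empty w k) (trans (cong rowWord inner≡) (rowWord-keep (applyUpTo row-length n))))
    (rowWord-adv n row-length k (d k) (λ r _ → row-length-< k r) (≤-trans (m∸n≤m (n ∸ k) (c k)) (m∸n≤m n k))))) (m∸n+n≡m (c-bound k))

  inner-strict : AllPairs (λ a b → b < a) (starInner λs)
  inner-strict = subst (AllPairs _) (sym inner≡) (go (applyUpTo row-length n) (AllPairsP.applyUpTo⁺₁ row-length n (λ {i} {j} lt _ → dec i j lt)))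
    where
    dec : ∀ r r' → r < r' → 0 < row-length r' → row-length r' < row-length r
    dec r r' lt p = go (row-length r') refl p
      where
      go : ∀ z → row-length r' ≡ z → 0 < z → z < row-length r
      go (suc k) e _ = <ᵇ-true (trans (row-length-< (suc k) r) (<⇒<ᵇ-true (<-≤-trans lt (≤-pred (≤-trans
        (<ᵇ-true (trans (sym (row-length-< k r')) (<⇒<ᵇ-true (≤-reflexive (sym e))))) (d-≥ k))))))
    go : ∀ L → AllPairs (λ a b → 0 < b → b < a) L → AllPairs (λ a b → b < a) (keep L)
    go [] [] = []
    go (zero ∷ L) (_ ∷ s) = go L s
    go (suc x ∷ L) (l ∷ s) = All.tabulate (λ q → let q' , b = ∈-filterᵇ⁻ _ L q in All.lookup l q' (<ᵇ-true b)) ∷ go L s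

  inner-positive : All (0 <_) (starInner λs)
  inner-positive = subst (All _) (sym inner≡) (All.tabulate (λ q → <ᵇ-true (proj₂ (∈-filterᵇ⁻ _ (applyUpTo row-length n) q))))

labels-revStar : ∀ L → labels (revStar L) ≡ reverse (labels L)
labels-revStar L = trans (reverse-map proj₁ (map starE L)) (cong reverse (go L))
  where
  go : ∀ L → labels (map starE L) ≡ labels L
  go [] = refl
  go (e ∷ L) = cong (proj₁ e ∷_) (go L)

values-revStar : ∀ L → map value (revStar L) ≡ reverse (map (λ e → ℤ.- value e) L)
values-revStar L = trans (reverse-map value (map starE L)) (cong reverse (go L))
  where
  go : ∀ L → map value (map starE L) ≡ map (λ e → ℤ.- value e) L
  go [] = refl
  go (e ∷ L) = cong₂ _∷_ (value-star e) (go L)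

revStar-sorted : ∀ L → Sorted L → Sorted (revStar L)
revStar-sorted [] s = []
revStar-sorted (e ∷ L) (le ∷ s) = subst Sorted (sym (unfold-reverse (starE e) (map starE L)))
  (AllPairsP.++⁺ (revStar-sorted L s) ([] ∷ []) (All.tabulate below))
  where
  below : ∀ {f} → f ∈ revStar L → All (λ g → value f ℤ.≤ value g) [ starE e ]
  below q with MP.∈-map⁻ starE (AnyP.reverse⁻ q)
  ... | f , r , refl = subst₂ ℤ._≤_ (sym (value-star f)) (sym (value-star e)) (ℤP.neg-mono-≤ (All.lookup le r)) ∷ []

bounded : ∀ μ → ∃ λ z → All (_< z) μ
bounded [] = 0 , []
bounded (x ∷ μ) with bounded μ
... | z , b = suc x + z , s≤s (m≤m+n x z) ∷ All.map (λ lt → <-≤-trans lt (m≤n+m z (suc x))) b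

-- Comparison of evacuation and rectification.

module Main {λs : List ℕ} {S : Cells} (syt : IsSYTNormal λs S) where
  open Reading syt
  open Inner syt
  open Complement n

  word-sorted : Sorted word
  word-sorted = AllPairs.map (λ h → ℤP.≮⇒≥ (λ lt → h (inj₁ lt))) word-pairs

  word-coh : ∃ λ ε → Coh ε none word
  word-coh = go word word-legal word-pairs word-sorted
    where
    go : ∀ W → Legal empty (labels W) → AllPairs (λ e f → ¬ Before f e) W → Sorted W → ∃ λ ε → Coh ε none W
    go [] lg ps s = (λ _ → false) , tt
    go (e ∷ W) lg ps s with reading-coh empty e W lg ps s
    ... | ε , h = ε , h none tt

  ε : ℤ → Bool
  ε = proj₁ word-coh

  code : Coded ε word S
  code = coded (Unique⇒Keyed S (IsSYTNormal.distinct syt)) word-repr word-legal (proj₂ word-coh) word-sorted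

  μ : List ℕ
  μ = starInner λs

  m₀ : State
  m₀ = adv empty (rowWord μ)

  rev : Reversed empty m₀ word
  rev = reverse-reading word empty m₀ inner-comp word-legal

  star-repr : ∀ i j → at (starCells λs S) i j ≡ at (cells m₀ (revStar word)) i j
  star-repr i j = trans (at-image {g = λ _ → just} (Keyed-cells m₀ (revStar word)) (record { from = λ q → _ , from q , refl ; to = λ { q refl → to q } }) i j)
      (id-just (at (cells m₀ (revStar word)) i j))
    where
    id-just : ∀ (z : Maybe Letter) → (z >>= just) ≡ z
    id-just nothing = refl
    id-just (just x) = refl
    from : ∀ {c} → c ∈ starCells λs S → c ∈ cells m₀ (revStar word)
    from q with MP.∈-map⁻ starBox q
    ... | c , r , refl = subst (starBox c ∈_) (sym (Reversed.boxes rev)) (AnyP.reverse⁺ (MP.∈-map⁺ starBox (proj₁ word-cells r)))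
    to : ∀ {c} → c ∈ cells m₀ (revStar word) → c ∈ starCells λs S
    to {c} q with MP.∈-map⁻ starBox (AnyP.reverse⁻ {xs = map starBox (cells empty word)} (subst (c ∈_) (Reversed.boxes rev) q))
    ... | c' , r , refl = MP.∈-map⁺ starBox (proj₂ word-cells r)

  legal-all : Legal empty (rowWord μ ++ labels (revStar word))
  legal-all = ++-Legal empty (rowWord μ) (rowWord-legal μ empty 0 (proj₁ (bounded μ)) (λ _ _ → refl) inner-strict (proj₂ (bounded μ))) (Reversed.legal rev)

  rectification : Rectified (mirror ε) μ (revStar word) (tableauJ λs S)
  rectification = subst (Rectified (mirror ε) μ (revStar word)) (sym (rect-def μ (starCells λs S)))
    (rect-sim (sum μ) μ (revStar word) (starCells λs S) refl inner-strict inner-positive legal-all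
      (revStar-coh word (proj₂ word-coh)) (revStar-sorted word word-sorted) star-repr)

  open Rectified rectification

  -- The inner shape and the starred tableau together fill the staircase of size `n`, so `rect-ev`
  -- applies; the reversal caused by the star cancels the one in `rect-ev`.
  result-labels : labels result ≡ ev (labels word)
  result-labels = trans isLabels (trans (rect-ev n (rowWord μ) (labels (revStar word)) legal-all full)
      (cong ev (trans (cong reverse (labels-revStar word)) (reverse-involutive (labels word)))))
    where
    full : adv empty (rowWord μ ++ labels (revStar word)) ≗ (n ∸_)
    full k = trans (cong (λ g → g k) (adv-++ empty (rowWord μ) (labels (revStar word)))) (trans (sym (+-identityʳ _)) (Reversed.comp rev k))

  evacuation : ∃ λ E → Evac S E × (E ≈F tableauJ λs S)
  evacuation = go (maxC S) refl
    where
    go : ∀ z → maxC S ≡ z → ∃ λ E → Evac S E × (E ≈F tableauJ λs S)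
    go nothing e = [] , subst (λ T → Evac T []) (sym S≡) evac-empty , λ i j → sym (trans (isRep i j) (cong (λ L → at (cells empty L) i j) result≡))
      where
      S≡ : S ≡ []
      S≡ = maxC-[] S e
      word≡ : ∀ W → (∀ {f} → f ∈ W → f ∈ word) → W ≡ []
      word≡ [] h = refl
      word≡ (f ∷ W) h with Coded.code⇒ code (h (here refl))
      ... | _ , q = contradiction (subst (_ ∈_) S≡ q) λ ()
      empty-values : ∀ (L : List Entry) → map value L ≡ [] → L ≡ []
      empty-values [] _ = refl
      result≡ : result ≡ []
      result≡ = empty-values result (trans isValues (cong (λ W → map value (revStar W)) (word≡ word id)))
    go (just m) e = finish′ (evac-sim (length word) word S [] ≤-refl code (All.tabulate (λ q → proj₂ greatest (proj₂ (Coded.code⇒ code q)))) m∈)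
      where
      greatest = maxC-spec S e
      m∈ : m ∈ map value word
      m∈ with proj₁ greatest
      ... | c , x , q , v with Coded.code⇐ code q
      ...   | k , r = subst (_∈ map value word) v (MP.∈-map⁺ value r)
      finish′ : Evacuated ε m word S [] → ∃ λ E → Evac S E × (E ≈F tableauJ λs S)
      finish′ (evacuated E loop LE aE lE vE cE) = E , evac-run e loop , λ i j →
        trans (aE i j) (trans (right-nothing (at (cells empty LE) i j)) (trans (cong (λ L → at (cells empty L) i j) LE≡) (sym (isRep i j))))
        where
        right-nothing : ∀ (z : Maybe Letter) → (z <∣> nothing) ≡ z
        right-nothing nothing = refl
        right-nothing (just x) = refl
        LE≡ : LE ≡ result
        -- Both words have the diagonals `ev (labels word)`, the negated values in reverse order,
        -- and the bits `mirror ε`; hence they agree letter by letter.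
        LE≡ = coh-unique LE result (trans lE (sym result-labels)) (trans vE (sym (trans isValues (values-revStar word)))) cE isCoh

theorem5p5 : (λs : List ℕ) (S : Cells) → IsSYTNormal λs S →
    (∃ λ E → Evac S E) × (∀ E → Evac S E → E ≈F tableauJ λs S)
theorem5p5 λs S syt with Main.evacuation syt
... | E , ev , same = (E , ev) , λ E' ev' → subst (_≈F tableauJ λs S) (evac-det ev ev') same
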